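{- With $\omega_f(k)=\lim_{n\to\infty}\operatorname{M}(F_{n,n}\setminus \triangleleft_2(k))/\operatorname{M}(F_{n,n})$ for integers $k\ge0$, we have $$\frac{\omega_f(k+1)}{\omega_f(k)}-1\sim-\frac1k,\qquad k\to\infty.$$
   Context: Consider the tiling of the plane by unit equilateral triangles, drawn so that one family of lattice lines is vertical; a (unit) lozenge is the union of two unit triangles sharing an edge. Let $\ell$ be a fixed vertical lattice line, and choose Cartesian coordinates in which $\ell$ is the $y$-axis, the origin is a lattice point on $\ell$, and the unit is the lattice spacing. For integers $n,x\ge1$, let $H_{n,x}$ be the lattice hexagon centered at the origin with side lengths $2n,2n,2x,2n,2n,2x$ (in counterclockwise order starting with the southwestern side); it is symmetric with respect to $\ell$ and its vertical sides have length $2x$. For an integer $k\ge0$, let $\triangleleft_2(k)$ be the left-pointing lattice triangle of side length $2$ with vertices $(-k\sqrt3,\pm1)$ and $(-(k+1)\sqrt3,0)$. Let $F_{n,x}$ be the left half of $H_{n,x}$ with its boundary along $\ell$ free (lozenges may protrude halfway across $\ell$). Equivalently, $\operatorname{M}(F_{n,x})$ is the number of lozenge tilings of $H_{n,x}$ invariant under reflection in $\ell$, and, for $0\le k\le n-1$, $\operatorname{M}(F_{n,x}\setminus\triangleleft_2(k))$ is the number of reflection-invariant lozenge tilings of $H_{n,x}$ with $\triangleleft_2(k)$ and its mirror image in $\ell$ removed. -}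

module Defs where

open import Data.Nat as ℕ using (ℕ; zero; suc; _≡ᵇ_; _≤ᵇ_)
open import Data.Integer as ℤ using (ℤ; +_; ∣_∣)
open import Data.Bool using (Bool; true; false; not; _∧_; _∨_; if_then_else_)
open import Data.List using (List; []; _∷_; _++_; map; concatMap; filter; length; upTo; foldr)
open import Data.Bool.ListAction using (any)
open import Data.Product using (Σ; ∃; _×_; _,_; proj₁; proj₂)
open import Relation.Nullary using (does)
open import Relation.Nullary.Decidable using (T?)
open import Data.Rational as ℚ using (ℚ)

-- Coordinates.
-- Points of the triangular lattice are written (a·√3/2 , b/2) with a+b even.
-- Vertical lattice lines are x = a·√3/2; ℓ is a = 0.
-- The unit triangles between the vertical lines a = i and a = i+1 are
-- indexed by an integer j:
--   * if i+j is odd  : right-pointing, vertices (i,j-1),(i,j+1),(i+1,j);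
--   * if i+j is even : left-pointing,  vertices (i+1,j-1),(i+1,j+1),(i,j).
-- For the left half of H_{n,x} (which lies in -2n ≤ a ≤ 0) we use the strip
-- index p = i + 2n ∈ {0,…,2n-1}; since 2n is even, parity of i+j = parity of p+j.

record Tri : Set where
  constructor tri
  field
    strip : ℕ
    row   : ℤ
open Tri public

evenℕ : ℕ → Bool
evenℕ zero    = true
evenℕ (suc n) = not (evenℕ n)

evenℤ : ℤ → Bool
evenℤ z = evenℕ ∣ z ∣

leftPointing : Tri → Bool
leftPointing (tri p j) = evenℤ (+ p ℤ.+ j)

eqTri : Tri → Tri → Bool
eqTri (tri p j) (tri q k) = (p ≡ᵇ q) ∧ does (j ℤ.≟ k)

-- The left half of H_{n,x}: -2n ≤ a ≤ 0 and |b| ≤ 2x + 2n + a.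
-- A unit triangle (p , j) lies in it iff p < 2n and
--   |j| + (1 if right-pointing else 0) ≤ 2x + p.
inHalfHex : ℕ → ℕ → Tri → Bool
inHalfHex n x (tri p j) =
  (suc p ≤ᵇ 2 ℕ.* n) ∧
  ((∣ j ∣ ℕ.+ (if evenℤ (+ p ℤ.+ j) then 0 else 1)) ≤ᵇ (2 ℕ.* x ℕ.+ p))

-- Unit triangles of F_{n,x} whose vertical edge lies on ℓ (the free boundary):
-- left-pointing triangles in the last strip p = 2n-1.
freeTri : ℕ → Tri → Bool
freeTri n t = (suc (strip t) ≡ᵇ 2 ℕ.* n) ∧ leftPointing t

-- The four unit triangles of ◁₂(k) (vertices (-2k,±2), (-2k-2,0) in our
-- coordinates): in strip i = -2k-1 (p = 2n-2k-1) rows -1,0,1, and in strip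
-- i = -2k-2 (p = 2n-2k-2) row 0.
inHole : ℕ → ℕ → Tri → Bool
inHole n k (tri p j) =
  ((p ℕ.+ 2 ℕ.* k ℕ.+ 1 ≡ᵇ 2 ℕ.* n) ∧ (∣ j ∣ ≤ᵇ 1)) ∨
  ((p ℕ.+ 2 ℕ.* k ℕ.+ 2 ≡ᵇ 2 ℕ.* n) ∧ does (j ℤ.≟ + 0))

symRange : ℕ → List ℤ
symRange m = map (λ t → + t ℤ.- + m) (upTo (suc (2 ℕ.* m)))

cells : ℕ → ℕ → (Tri → Bool) → List Tri
cells n x hole =
  filter (λ t → T? (inHalfHex n x t ∧ not (hole t)))
    (concatMap (λ p → map (tri p) (symRange (2 ℕ.* x ℕ.+ p))) (upTo (2 ℕ.* n)))

memTri : Tri → List Tri → Bool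
memTri t ts = any (eqTri t) ts

-- Unit lozenges inside the region: pairs of unit triangles sharing an edge.
--   * slanted shared edge : (p , j) and (p , j+1);
--   * vertical shared edge: left-pointing (p , j) and (p+1 , j).
Lozenge : Set
Lozenge = Tri × Tri

lozenges : List Tri → List Lozenge
lozenges cs = concatMap nbrs cs
  where
  up : Tri → Tri
  up (tri p j) = tri p (j ℤ.+ + 1)
  right : Tri → Tri
  right (tri p j) = tri (suc p) j
  nbrs : Tri → List Lozenge
  nbrs t =
    (if memTri (up t) cs then (t , up t) ∷ [] else []) ++
    (if leftPointing t ∧ memTri (right t) cs then (t , right t) ∷ [] else [])

subsets : {A : Set} → List A → List (List A)
subsets []       = [] ∷ []
subsets (a ∷ as) = subsets as ++ map (a ∷_) (subsets as)

coverCount : Tri → List Lozenge → ℕ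
coverCount t ls = length (filter (λ l → T? (eqTri t (proj₁ l) ∨ eqTri t (proj₂ l))) ls)

-- A (free-boundary) tiling of the region: a set of lozenges covering every
-- non-free triangle exactly once and every free triangle (along ℓ) at most
-- once (an uncovered free triangle = a lozenge protruding across ℓ).
isTiling : ℕ → List Tri → List Lozenge → Bool
isTiling n cs ls =
  foldr (λ t b → b ∧ (if freeTri n t then coverCount t ls ≤ᵇ 1
                                      else coverCount t ls ≡ᵇ 1)) true cs

tilingCount : ℕ → ℕ → (Tri → Bool) → ℕ
tilingCount n x hole =
  length (filter (λ ls → T? (isTiling n cs ls)) (subsets (lozenges cs)))
  where cs = cells n x hole

MF : ℕ → ℕ → ℕ
MF n x = tilingCount n x (λ _ → false)

MFhole : ℕ → ℕ → ℕ → ℕ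
MFhole n x k = tilingCount n x (inHole n k)

fracℕ : ℕ → ℕ → ℚ
fracℕ a zero    = ℚ.0ℚ
fracℕ a (suc b) = + a ℚ./ suc b

ℕtoℚ : ℕ → ℚ
ℕtoℚ m = + m ℚ./ 1

-- Cauchy sequence of rationals (= convergent sequence of reals)
CauchyQ : (ℕ → ℚ) → Set
CauchyQ s = (ε : ℚ) → ℚ.0ℚ ℚ.< ε →
  ∃ λ N → (n m : ℕ) → N ℕ.≤ n → N ℕ.≤ m → ℚ.∣ s n ℚ.- s m ∣ ℚ.< ε

-- eventually bounded below by a positive rational (limit is > 0)
EventuallyPositive : (ℕ → ℚ) → Set
EventuallyPositive s =
  Σ ℚ λ δ → (ℚ.0ℚ ℚ.< δ) × ∃ λ N → (n : ℕ) → N ℕ.≤ n → δ ℚ.< s n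

{-# OPTIONS --safe #-}
module Submission where

-- Read along the vertical strips, a tiling of the free half hexagon is a family of 2x
-- non-colliding ±1 walks with free ends. The families are counted by a Pfaffian of the
-- antisymmetric form that counts pairs of walks signed by the order in which they end; the
-- hole adds two walks, started at (2k , -1) and (2k , 1). Pascal's rule trades the starting
-- points on the left side for the points (2l , ±1) with n ≤ l < n + x, and on all these points
-- the only non-zero values of the form are ± h (l + j), h N = (2N+1 choose N+1), between
-- (2l , -1) and (2j , 1). Hence M(F∖◁₂(k)) / M(F) is the squared distance from y^k to the span
-- of y^n, …, y^(n+x-1) for the functional with moments h. Explicit (Jacobi) orthogonal
-- polynomials make it a sum over x of hypergeometric terms, and telescoping turns it into
-- h (2k) Σ γ_j over 2k ≤ j < 2n, where n = x. As n grows, the ratios γ_(j+1) / γ_j tend to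
-- (j+2) / (2(2j+5)), close to 1/4 for large j, so that the sums from j = 2k and from
-- j = 2k + 2, measured by their first terms, differ by O(k⁻²). Since h (j+2) / h j is also
-- rational in j, this leaves ω(k+1) / ω(k) = (4k+3) / (4k+7) + O(k⁻²).

-- No involution on families of walks is used. A function of lists of points that is additive under
-- Pascal's rule and alternating passes through a strip exactly: expanding every point into its two
-- successors produces all moves of the particles, and the moves with a collision repeat an argument
-- and vanish. The hole is treated in the same way: its two points are arguments from the start, so
-- a walk that runs into the hole repeats one of them. Free ends cost nothing, because at `ℓ` the
-- form is a sign and every sorted configuration has Pfaffian 1. For the telescoping the normalised
-- distance is given a second index: `β x k l` is that distance for `k = l`, and it changes by a
-- single hypergeometric term when `l` grows by one. A staircase of such steps, using the symmetry
-- in `k` and `l`, leads from `(k , k)` to `(n , n)`, where `β` is zero because y^n lies in the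
-- span. Only rationals occur, so each passage to the limit in `n` is an estimate with an explicit
-- error of the form constant / n, the constant depending on `k`.

-- Rational arithmetic: embeddings of integers, inverses, signs.

module Rat where

  open import Data.Empty using (⊥-elim)
  open import Data.Maybe using (Maybe; just; nothing)
  open import Data.Rational
  open import Data.Rational.Properties
  open import Data.Sum using (inj₁; inj₂)
  open import Level using (0ℓ)
  open import Relation.Binary.Definitions using (tri<; tri≈; tri>)
  open import Relation.Binary.PropositionalEquality
  open import Relation.Nullary using (yes; no)
  open import Tactic.RingSolver.Core.AlmostCommutativeRing using (AlmostCommutativeRing; fromCommutativeRing)

  private
    isZero? : ∀ q → Maybe (0ℚ ≡ q)
    isZero? q with 0ℚ ≟ q
    ... | yes p = just p
    ... | no _  = nothing

  ℚ-ring : AlmostCommutativeRing 0ℓ 0ℓ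
  ℚ-ring = fromCommutativeRing +-*-commutativeRing isZero?

  open import Data.Integer as ℤ using (ℤ)
  import Data.Integer.Properties as ℤ
  import Data.Rational.Unnormalised as ℚᵘ
  import Data.Rational.Unnormalised.Properties as ℚᵘ
  open import Data.Nat as ℕ using (ℕ)

  ι : ℤ → ℚ
  ι z = z / 1

  ι-toℚᵘ : ∀ z → toℚᵘ (ι z) ℚᵘ.≃ (z ℚᵘ./ 1)
  ι-toℚᵘ z = toℚᵘ-fromℚᵘ (z ℚᵘ./ 1)

  ι-+ : ∀ a b → ι (a ℤ.+ b) ≡ ι a + ι b
  ι-+ a b = toℚᵘ-injective (ℚᵘ.≃-trans (ι-toℚᵘ (a ℤ.+ b)) (ℚᵘ.≃-trans lem
    (ℚᵘ.≃-trans (ℚᵘ.+-cong (ℚᵘ.≃-sym (ι-toℚᵘ a)) (ℚᵘ.≃-sym (ι-toℚᵘ b))) (ℚᵘ.≃-sym (toℚᵘ-homo-+ (ι a) (ι b))))))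
    where
    lem : ((a ℤ.+ b) ℚᵘ./ 1) ℚᵘ.≃ (a ℚᵘ./ 1) ℚᵘ.+ (b ℚᵘ./ 1)
    lem = ℚᵘ.*≡* (cong (ℤ._* ℤ.1ℤ) (cong₂ ℤ._+_ (sym (ℤ.*-identityʳ a)) (sym (ℤ.*-identityʳ b))))

  ι-* : ∀ a b → ι (a ℤ.* b) ≡ ι a * ι b
  ι-* a b = toℚᵘ-injective (ℚᵘ.≃-trans (ι-toℚᵘ (a ℤ.* b)) (ℚᵘ.≃-trans (ℚᵘ.*≡* refl)
    (ℚᵘ.≃-trans (ℚᵘ.*-cong (ℚᵘ.≃-sym (ι-toℚᵘ a)) (ℚᵘ.≃-sym (ι-toℚᵘ b))) (ℚᵘ.≃-sym (toℚᵘ-homo-* (ι a) (ι b))))))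

  ι-neg : ∀ a → ι (ℤ.- a) ≡ - ι a
  ι-neg a = toℚᵘ-injective (ℚᵘ.≃-trans (ι-toℚᵘ (ℤ.- a)) (ℚᵘ.≃-trans (ℚᵘ.*≡* refl)
    (ℚᵘ.≃-trans (ℚᵘ.-‿cong (ℚᵘ.≃-sym (ι-toℚᵘ a))) (ℚᵘ.≃-sym (toℚᵘ-homo‿- (ι a))))))

  ν : ℕ → ℚ
  ν m = ι (ℤ.+ m)

  ν-+ : ∀ a b → ν (a ℕ.+ b) ≡ ν a + ν b
  ν-+ a b = ι-+ (ℤ.+ a) (ℤ.+ b)

  ν-suc : ∀ a → ν (ℕ.suc a) ≡ 1ℚ + ν a
  ν-suc a = ν-+ 1 a

  0≤ν : ∀ a → 0ℚ ≤ ν a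
  0≤ν a = toℚᵘ-cancel-≤ (ℚᵘ.≤-respʳ-≃ (ℚᵘ.≃-sym (ι-toℚᵘ (ℤ.+ a))) (ℚᵘ.*≤* (ℤ.≤-trans (ℤ.+≤+ ℕ.z≤n) (ℤ.≤-reflexive (sym (ℤ.*-identityʳ (ℤ.+ a)))))))

  opaque

    -- The value 0 at 0 makes the inverse total, so that quotients can be formed before their
    -- denominators are known to be non-zero. It is opaque in order to remain an atom in later
    -- identities.
    inv : ℚ → ℚ
    inv q with q ≟ 0ℚ
    ... | yes _ = 0ℚ
    ... | no  h = 1/_ q {{≢-nonZero h}}

    inv-ʳ : ∀ {q} → q ≢ 0ℚ → q * inv q ≡ 1ℚ
    inv-ʳ {q} h with q ≟ 0ℚ
    ... | yes e = ⊥-elim (h e)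
    ... | no h′ = *-inverseʳ q {{≢-nonZero h′}}

  -- The standard way to an identity between quotients below: both sides are multiplied by a
  -- non-zero `q` that clears the denominators, and the ring solver does the rest.
  cancel : ∀ q {a b} → q ≢ 0ℚ → q * a ≡ q * b → a ≡ b
  cancel q {a} {b} h e = trans (sym (lem a)) (trans (cong (inv q *_) e) (lem b))
    where
    lem : ∀ a → inv q * (q * a) ≡ a
    lem a = trans (sym (*-assoc (inv q) q a)) (trans (cong (_* a) (trans (*-comm (inv q) q) (inv-ʳ h))) (*-identityˡ a))

  >0⇒≢0 : ∀ {q} → 0ℚ < q → q ≢ 0ℚ
  >0⇒≢0 h e = <-irrefl (sym e) h

  ≢0-* : ∀ {a b} → a ≢ 0ℚ → b ≢ 0ℚ → a * b ≢ 0ℚ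
  ≢0-* {a} {b} ha hb e = hb (cancel a ha (trans e (sym (*-zeroʳ a))))

  0<1 : 0ℚ < 1ℚ
  0<1 = *<* (ℤ.+<+ (ℕ.s≤s ℕ.z≤n))

  *-pos : ∀ {a b} → 0ℚ < a → 0ℚ < b → 0ℚ < a * b
  *-pos {a} {b} ha hb = subst (_< a * b) (*-zeroʳ a) (*-monoʳ-<-pos a {{positive ha}} hb)

  *-nonneg : ∀ {a b} → 0ℚ ≤ a → 0ℚ ≤ b → 0ℚ ≤ a * b
  *-nonneg {a} {b} ha hb = subst (_≤ a * b) (*-zeroʳ a) (*-monoˡ-≤-nonNeg a {{nonNegative ha}} hb)

  +-pos : ∀ {a b} → 0ℚ ≤ a → 0ℚ < b → 0ℚ < a + b
  +-pos {a} {b} ha hb = ≤-<-trans ha (subst (_< a + b) (+-identityʳ a) (+-monoʳ-< a hb))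

  +-nonneg : ∀ {a b} → 0ℚ ≤ a → 0ℚ ≤ b → 0ℚ ≤ a + b
  +-nonneg {a} {b} ha hb = ≤-trans ha (subst (_≤ a + b) (+-identityʳ a) (+-monoʳ-≤ a hb))

  ν-pos : ∀ a → 0ℚ < ν (ℕ.suc a)
  ν-pos a = subst (0ℚ <_) (trans (+-comm (ν a) 1ℚ) (sym (ν-suc a))) (+-pos (0≤ν a) 0<1)

  inv-pos : ∀ {q} → 0ℚ < q → 0ℚ < inv q
  inv-pos {q} h with <-cmp 0ℚ (inv q)
  ... | tri< p _ _ = p
  ... | tri≈ _ e _ = ⊥-elim (<-irrefl (trans (sym (*-zeroʳ q)) (trans (cong (q *_) e) (inv-ʳ (>0⇒≢0 h)))) 0<1)
  ... | tri> _ _ p = ⊥-elim (<-asym 0<1 (subst₂ _<_ (inv-ʳ (>0⇒≢0 h)) (*-zeroʳ q) (*-monoʳ-<-pos q {{positive h}} p)))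

  inv-ν : ∀ m → ν (ℕ.suc m) * inv (ν (ℕ.suc m)) ≡ 1ℚ
  inv-ν m = inv-ʳ (>0⇒≢0 (ν-pos m))

  -- Polynomial estimates are proved in this form: the slack `p` is exhibited as a sum of products
  -- of non-negative quantities, and what remains is an equation.
  ≤-by : ∀ {a b} p → 0ℚ ≤ p → a + p ≡ b → a ≤ b
  ≤-by {a} {b} p h e = subst₂ _≤_ (+-identityʳ a) e (+-monoʳ-≤ a h)

  ∣∣≤ : ∀ {a b} → a ≤ b → - a ≤ b → ∣ a ∣ ≤ b
  ∣∣≤ {a} {b} h h′ with ∣p∣≡p∨∣p∣≡-p a
  ... | inj₁ e = subst (_≤ b) (sym e) h
  ... | inj₂ e = subst (_≤ b) (sym e) h′

-- Pfaffians as iterated interior products.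

module Pfaffian where

  open Rat
  open import Data.List using (List; []; _∷_; _++_)
  open import Data.List.Relation.Unary.All using (All; []; _∷_)
  open import Data.Nat using (ℕ; zero; suc)
  open import Data.Product using (_,_)
  open import Data.Rational
  open import Data.Rational.Properties
  open import Relation.Binary.PropositionalEquality
  open import Tactic.RingSolver using (solve-∀)
  open ≡-Reasoning

  neg-self : ∀ x → x ≡ - x → x ≡ 0ℚ
  neg-self x e = begin
    x               ≡⟨ lem x ⟩
    ½ * (x + x)     ≡⟨ cong (λ y → ½ * (x + y)) e ⟩
    ½ * (x + - x)   ≡⟨ cong (½ *_) (+-inverseʳ x) ⟩
    ½ * 0ℚ          ≡⟨ *-zeroʳ ½ ⟩
    0ℚ              ∎
    where
    lem : ∀ x → x ≡ ½ * (x + x)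
    lem = solve-∀ ℚ-ring

  -- contr φ F is the interior product Σᵢ (-1)ⁱ φ(xᵢ) F(xs without xᵢ).
  contr : {A : Set} → (A → ℚ) → (List A → ℚ) → List A → ℚ
  contr φ F []       = 0ℚ
  contr φ F (x ∷ xs) = φ x * F xs - contr φ (λ ys → F (x ∷ ys)) xs

  module _ {A : Set} where

    contr-cong : ∀ {φ ψ : A → ℚ} {F G : List A → ℚ} → (∀ x → φ x ≡ ψ x) → (∀ ys → F ys ≡ G ys) →
                 ∀ xs → contr φ F xs ≡ contr ψ G xs
    contr-cong e f []       = refl
    contr-cong e f (x ∷ xs) =
      cong₂ _-_ (cong₂ _*_ (e x) (f xs)) (contr-cong e (λ ys → f (x ∷ ys)) xs)

    contr-+ˡ : ∀ (φ ψ : A → ℚ) F xs →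
               contr (λ x → φ x + ψ x) F xs ≡ contr φ F xs + contr ψ F xs
    contr-+ˡ φ ψ F []       = refl
    contr-+ˡ φ ψ F (x ∷ xs) =
      trans (cong (λ c → (φ x + ψ x) * F xs - c) (contr-+ˡ φ ψ (λ ys → F (x ∷ ys)) xs))
            (lem (φ x) (ψ x) (F xs) _ _)
      where
      lem : ∀ a b f c d → (a + b) * f - (c + d) ≡ (a * f - c) + (b * f - d)
      lem = solve-∀ ℚ-ring

    contr-*ˡ : ∀ c (φ : A → ℚ) F xs → contr (λ x → c * φ x) F xs ≡ c * contr φ F xs
    contr-*ˡ c φ F []       = sym (*-zeroʳ c)
    contr-*ˡ c φ F (x ∷ xs) =
      trans (cong (λ d → c * φ x * F xs - d) (contr-*ˡ c φ (λ ys → F (x ∷ ys)) xs))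
            (lem c (φ x) (F xs) _)
      where
      lem : ∀ c a f d → c * a * f - c * d ≡ c * (a * f - d)
      lem = solve-∀ ℚ-ring

    contr-zeroʳ : ∀ (φ : A → ℚ) xs → contr φ (λ _ → 0ℚ) xs ≡ 0ℚ
    contr-zeroʳ φ []       = refl
    contr-zeroʳ φ (x ∷ xs) =
      trans (cong (λ c → φ x * 0ℚ - c) (contr-zeroʳ φ xs)) (lem (φ x))
      where
      lem : ∀ a → a * 0ℚ - 0ℚ ≡ 0ℚ
      lem = solve-∀ ℚ-ring

    contr-zeroˡ : ∀ {φ : A → ℚ} F {xs} → All (λ x → φ x ≡ 0ℚ) xs → contr φ F xs ≡ 0ℚ
    contr-zeroˡ F []                 = refl
    contr-zeroˡ F (_∷_ {x} {xs} e es) =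
      trans (cong₂ (λ a c → a * F xs - c) e (contr-zeroˡ (λ ys → F (x ∷ ys)) es)) (lem (F xs))
      where
      lem : ∀ a → 0ℚ * a - 0ℚ ≡ 0ℚ
      lem = solve-∀ ℚ-ring

    contr-+ʳ : ∀ (φ : A → ℚ) F G xs →
               contr φ (λ ys → F ys + G ys) xs ≡ contr φ F xs + contr φ G xs
    contr-+ʳ φ F G []       = refl
    contr-+ʳ φ F G (x ∷ xs) =
      trans (cong (λ c → φ x * (F xs + G xs) - c) (contr-+ʳ φ (λ ys → F (x ∷ ys)) (λ ys → G (x ∷ ys)) xs))
            (lem (φ x) (F xs) (G xs) _ _)
      where
      lem : ∀ a f g c d → a * (f + g) - (c + d) ≡ (a * f - c) + (a * g - d)
      lem = solve-∀ ℚ-ring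

    contr-*ʳ : ∀ c (φ : A → ℚ) F xs → contr φ (λ ys → c * F ys) xs ≡ c * contr φ F xs
    contr-*ʳ c φ F []       = sym (*-zeroʳ c)
    contr-*ʳ c φ F (x ∷ xs) =
      trans (cong (λ d → φ x * (c * F xs) - d) (contr-*ʳ c φ (λ ys → F (x ∷ ys)) xs))
            (lem c (φ x) (F xs) _)
      where
      lem : ∀ c a f d → a * (c * f) - c * d ≡ c * (a * f - d)
      lem = solve-∀ ℚ-ring

    contr--ʳ : ∀ (φ : A → ℚ) F G xs →
               contr φ (λ ys → F ys - G ys) xs ≡ contr φ F xs - contr φ G xs
    contr--ʳ φ F G xs = begin
      contr φ (λ ys → F ys - G ys) xs                ≡⟨ contr-cong (λ _ → refl) (λ ys → lem (F ys) (G ys)) xs ⟩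
      contr φ (λ ys → F ys + (- 1ℚ) * G ys) xs       ≡⟨ contr-+ʳ φ F _ xs ⟩
      contr φ F xs + contr φ (λ ys → - 1ℚ * G ys) xs ≡⟨ cong (contr φ F xs +_) (contr-*ʳ (- 1ℚ) φ G xs) ⟩
      contr φ F xs + (- 1ℚ) * contr φ G xs           ≡⟨ sym (lem (contr φ F xs) (contr φ G xs)) ⟩
      contr φ F xs - contr φ G xs                    ∎
      where
      lem : ∀ a b → a - b ≡ a + (- 1ℚ) * b
      lem = solve-∀ ℚ-ring

    contr-neg : ∀ (φ : A → ℚ) {F G} → (∀ ys → F ys ≡ - G ys) → ∀ xs → contr φ F xs ≡ - contr φ G xs
    contr-neg φ {F} {G} e xs = begin
      contr φ F xs                       ≡⟨ contr-cong (λ _ → refl) (λ ys → trans (e ys) (lem (G ys))) xs ⟩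
      contr φ (λ ys → (- 1ℚ) * G ys) xs  ≡⟨ contr-*ʳ (- 1ℚ) φ G xs ⟩
      (- 1ℚ) * contr φ G xs              ≡⟨ sym (lem _) ⟩
      - contr φ G xs                     ∎
      where
      lem : ∀ a → - a ≡ (- 1ℚ) * a
      lem = solve-∀ ℚ-ring

    contr-∷ : ∀ (φ ψ : A → ℚ) F x xs → contr φ (λ ys → contr ψ F (x ∷ ys)) xs ≡
              ψ x * contr φ F xs - contr φ (contr ψ (λ ys → F (x ∷ ys))) xs
    contr-∷ φ ψ F x xs =
      trans (contr--ʳ φ (λ ys → ψ x * F ys) _ xs)
            (cong (λ c → c - contr φ (contr ψ (λ ys → F (x ∷ ys))) xs) (contr-*ʳ (ψ x) φ F xs))

    -- The exterior-algebra rule for two interior products. In `pf-Alternating` it gives the sign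
    -- for the exchange of the two leading points, the one exchange that the recursion does not pass
    -- on to smaller Pfaffians.
    contr-anticomm : ∀ (φ ψ : A → ℚ) F xs → contr φ (contr ψ F) xs ≡ - contr ψ (contr φ F) xs
    contr-anticomm φ ψ F []       = refl
    contr-anticomm φ ψ F (x ∷ xs) = begin
      φ x * contr ψ F xs - contr φ (λ ys → contr ψ F (x ∷ ys)) xs
        ≡⟨ cong (λ c → φ x * contr ψ F xs - c) (contr-∷ φ ψ F x xs) ⟩
      φ x * contr ψ F xs - (ψ x * contr φ F xs - contr φ (contr ψ F') xs)
        ≡⟨ cong (λ c → φ x * contr ψ F xs - (ψ x * contr φ F xs - c)) (contr-anticomm φ ψ F' xs) ⟩
      φ x * contr ψ F xs - (ψ x * contr φ F xs - - contr ψ (contr φ F') xs)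
        ≡⟨ lem (φ x * contr ψ F xs) (ψ x * contr φ F xs) (contr ψ (contr φ F') xs) ⟩
      - (ψ x * contr φ F xs - (φ x * contr ψ F xs - contr ψ (contr φ F') xs))
        ≡⟨ cong (λ c → - (ψ x * contr φ F xs - c)) (sym (contr-∷ ψ φ F x xs)) ⟩
      - (ψ x * contr φ F xs - contr ψ (λ ys → contr φ F (x ∷ ys)) xs) ∎
      where
      F' = λ ys → F (x ∷ ys)
      lem : ∀ a b c → a - (b - - c) ≡ - (b - (a - c))
      lem = solve-∀ ℚ-ring

  module Form {A : Set} (⟨_,_⟩ : A → A → ℚ) (antisym : ∀ a b → ⟨ a , b ⟩ ≡ - ⟨ b , a ⟩) where

    -- Expansion along the first row. The index is half the expected length: it makes the recursion
    -- through `contr` structural, and a list of any other length gets the value 0.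
    pf : ℕ → List A → ℚ
    pf zero    []       = 1ℚ
    pf zero    (_ ∷ _)  = 0ℚ
    pf (suc m) []       = 0ℚ
    pf (suc m) (v ∷ vs) = contr ⟨ v ,_⟩ (pf m) vs

    -- Points are not vectors; this says that `p` is `a + b` as far as the form can see. `Additive`
    -- functions respect just these relations.
    Sum : A → A → A → Set
    Sum p a b = ∀ z → ⟨ p , z ⟩ ≡ ⟨ a , z ⟩ + ⟨ b , z ⟩

    Additive : (List A → ℚ) → Set
    Additive F = ∀ {p a b} → Sum p a b → ∀ pre post →
                 F (pre ++ p ∷ post) ≡ F (pre ++ a ∷ post) + F (pre ++ b ∷ post)

    Alternating : (List A → ℚ) → Set
    Alternating F = ∀ pre a b post → F (pre ++ a ∷ b ∷ post) ≡ - F (pre ++ b ∷ a ∷ post)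

    Additive-∷ : ∀ F x → Additive F → Additive (λ ys → F (x ∷ ys))
    Additive-∷ F x lin s pre post = lin s (x ∷ pre) post

    Alternating-∷ : ∀ F x → Alternating F → Alternating (λ ys → F (x ∷ ys))
    Alternating-∷ F x alt pre a b post = alt (x ∷ pre) a b post

    contr-Additive : ∀ φ F → (∀ {p a b} → Sum p a b → φ p ≡ φ a + φ b) → Additive F → Additive (contr φ F)
    contr-Additive φ F φ+ lin {p} {a} {b} s [] post = begin
      φ p * F post - contr φ (λ ys → F (p ∷ ys)) post
        ≡⟨ cong₂ (λ u c → u * F post - c) (φ+ s)
             (trans (contr-cong (λ _ → refl) (λ ys → lin s [] ys) post) (contr-+ʳ φ _ _ post)) ⟩
      (φ a + φ b) * F post - (contr φ (λ ys → F (a ∷ ys)) post + contr φ (λ ys → F (b ∷ ys)) post)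
        ≡⟨ lem (φ a) (φ b) (F post) _ _ ⟩
      (φ a * F post - contr φ (λ ys → F (a ∷ ys)) post) + (φ b * F post - contr φ (λ ys → F (b ∷ ys)) post) ∎
      where
      lem : ∀ a b f c d → (a + b) * f - (c + d) ≡ (a * f - c) + (b * f - d)
      lem = solve-∀ ℚ-ring
    contr-Additive φ F φ+ lin {p} {a} {b} s (x ∷ pre) post =
      trans (cong₂ (λ u c → φ x * u - c) (lin s pre post)
               (contr-Additive φ (λ ys → F (x ∷ ys)) φ+ (Additive-∷ F x lin) s pre post))
            (lem (φ x) (F (pre ++ a ∷ post)) (F (pre ++ b ∷ post)) _ _)
      where
      lem : ∀ f a b c d → f * (a + b) - (c + d) ≡ (f * a - c) + (f * b - d)
      lem = solve-∀ ℚ-ring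

    contr-Alternating : ∀ φ F → Alternating F → Alternating (contr φ F)
    contr-Alternating φ F alt [] a b post =
      trans (cong (λ c → φ a * F (b ∷ post) - (φ b * F (a ∷ post) - c)) (contr-neg φ (λ ys → alt [] a b ys) post))
            (lem (φ a * F (b ∷ post)) (φ b * F (a ∷ post)) (contr φ (λ ys → F (b ∷ a ∷ ys)) post))
      where
      lem : ∀ x y z → x - (y - - z) ≡ - (y - (x - z))
      lem = solve-∀ ℚ-ring
    contr-Alternating φ F alt (x ∷ pre) a b post =
      trans (cong₂ (λ u c → φ x * u - c) (alt pre a b post) (contr-Alternating φ (λ ys → F (x ∷ ys)) (Alternating-∷ F x alt) pre a b post))
            (lem (φ x) (F (pre ++ b ∷ a ∷ post)) (contr φ (λ ys → F (x ∷ ys)) (pre ++ b ∷ a ∷ post)))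
      where
      lem : ∀ x y z → x * - y - - z ≡ - (x * y - z)
      lem = solve-∀ ℚ-ring

    Sum-flip : ∀ {p a b} v → Sum p a b → ⟨ v , p ⟩ ≡ ⟨ v , a ⟩ + ⟨ v , b ⟩
    Sum-flip {p} {a} {b} v s = begin
      ⟨ v , p ⟩                   ≡⟨ antisym v p ⟩
      - ⟨ p , v ⟩                 ≡⟨ cong -_ (s v) ⟩
      - (⟨ a , v ⟩ + ⟨ b , v ⟩)   ≡⟨ neg-distrib-+ ⟨ a , v ⟩ ⟨ b , v ⟩ ⟩
      - ⟨ a , v ⟩ + - ⟨ b , v ⟩   ≡⟨ cong₂ _+_ (sym (antisym v a)) (sym (antisym v b)) ⟩
      ⟨ v , a ⟩ + ⟨ v , b ⟩       ∎

    pf-Additive : ∀ m → Additive (pf m)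
    pf-Additive zero    s []        post = refl
    pf-Additive zero    s (x ∷ pre) post = refl
    pf-Additive (suc m) s [] post =
      trans (contr-cong s (λ _ → refl) post) (contr-+ˡ _ _ (pf m) post)
    pf-Additive (suc m) s (x ∷ pre) post = contr-Additive ⟨ x ,_⟩ (pf m) (Sum-flip x) (pf-Additive m) s pre post

    pf-Alternating : ∀ m → Alternating (pf m)
    pf-Alternating zero    []        a b post = refl
    pf-Alternating zero    (x ∷ pre) a b post = refl
    pf-Alternating (suc m) [] a b post =
      trans (cong₂ (λ u c → u * pf m post - c) (antisym a b) (swap m))
            (lem ⟨ b , a ⟩ (pf m post) (contr ⟨ b ,_⟩ (λ ys → pf m (a ∷ ys)) post))
      where
      swap : ∀ m → contr ⟨ a ,_⟩ (λ ys → pf m (b ∷ ys)) post ≡ - contr ⟨ b ,_⟩ (λ ys → pf m (a ∷ ys)) post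
      swap zero    = trans (contr-zeroʳ ⟨ a ,_⟩ post) (sym (cong -_ (contr-zeroʳ ⟨ b ,_⟩ post)))
      swap (suc m) = contr-anticomm ⟨ a ,_⟩ ⟨ b ,_⟩ (pf m) post
      lem : ∀ x y z → - x * y - - z ≡ - (x * y - z)
      lem = solve-∀ ℚ-ring
    pf-Alternating (suc m) (x ∷ pre) a b post = contr-Alternating ⟨ x ,_⟩ (pf m) (pf-Alternating m) pre a b post

    adjacent-equal : ∀ F → Alternating F → ∀ pre a post → F (pre ++ a ∷ a ∷ post) ≡ 0ℚ
    adjacent-equal F alt pre a post = neg-self _ (alt pre a a post)

    repeated : ∀ F → Alternating F → ∀ a pre post → F (a ∷ pre ++ a ∷ post) ≡ 0ℚ
    repeated F alt a []        post = adjacent-equal F alt [] a post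
    repeated F alt a (x ∷ pre) post =
      trans (alt [] a x (pre ++ a ∷ post))
            (cong -_ (repeated (λ ys → F (x ∷ ys)) (Alternating-∷ F x alt) a pre post))

    -- Passing one entry takes two exchanges, hence costs no sign. This brings the two points of the
    -- hole, carried in front, to their place among the particles.
    move-pair : ∀ F → Alternating F → ∀ a b pre post → F (a ∷ b ∷ pre ++ post) ≡ F (pre ++ a ∷ b ∷ post)
    move-pair F alt a b []        post = refl
    move-pair F alt a b (x ∷ pre) post = begin
      F (a ∷ b ∷ x ∷ pre ++ post)       ≡⟨ alt (a ∷ []) b x (pre ++ post) ⟩
      - F (a ∷ x ∷ b ∷ pre ++ post)     ≡⟨ cong -_ (alt [] a x (b ∷ pre ++ post)) ⟩
      - - F (x ∷ a ∷ b ∷ pre ++ post)   ≡⟨ neg-involutive _ ⟩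
      F (x ∷ a ∷ b ∷ pre ++ post)       ≡⟨ move-pair (λ ys → F (x ∷ ys)) (Alternating-∷ F x alt) a b pre post ⟩
      F (x ∷ pre ++ a ∷ b ∷ post)       ∎
      where
      neg-involutive : ∀ x → - - x ≡ x
      neg-involutive = solve-∀ ℚ-ring

    -- φ stands for a vector w ≡ u modulo span vs; if w is orthogonal to vs, only one term of the
    -- expansion along w survives.
    contr-orthogonal : ∀ φ m v {vs} → All (λ x → φ x ≡ 0ℚ) vs → contr φ (pf m) (v ∷ vs) ≡ φ v * pf m vs
    contr-orthogonal φ m v {vs} es =
      trans (cong (λ c → φ v * pf m vs - c) (contr-zeroˡ (λ ys → pf m (v ∷ ys)) es)) (lem _)
      where
      lem : ∀ a → a - 0ℚ ≡ a
      lem = solve-∀ ℚ-ring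

-- Pairs of walks, and the transfer of particles through one strip.

module Strip where

  open Rat
  open Pfaffian
  open import Data.Bool using (Bool; true; false)
  open import Data.Integer as ℤ using (ℤ)
  import Data.Integer.Properties as ℤ
  import Data.Integer.Tactic.RingSolver as ℤ-Solver
  open import Data.List using (List; []; _∷_)
  open import Data.Nat as ℕ using (ℕ; zero; suc)
  import Data.Nat.Properties as ℕ
  open import Data.Product using (_×_; _,_)
  open import Data.Rational
  open import Data.Rational.Properties
  open import Relation.Binary.PropositionalEquality
  open import Tactic.RingSolver using (solve-∀)
  open ≡-Reasoning

  sgn : ℤ → ℤ
  sgn ℤ.+0       = ℤ.0ℤ
  sgn ℤ.+[1+ _ ] = ℤ.1ℤ
  sgn ℤ.-[1+ _ ] = ℤ.-1ℤ

  -- Number of pairs of M-step ±1 walks, started d apart, that end in the order of their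
  -- starting points, minus the number of those that end in the opposite order.
  q : ℕ → ℤ → ℤ
  q zero    d = sgn d
  q (suc M) d = q M (ℤ.suc d) ℤ.+ q M (ℤ.pred d)

  q-odd : ∀ M d → q M (ℤ.- d) ≡ ℤ.- q M d
  q-odd zero    ℤ.+0       = refl
  q-odd zero    ℤ.+[1+ _ ] = refl
  q-odd zero    ℤ.-[1+ _ ] = refl
  q-odd (suc M) d = begin
    q M (ℤ.suc (ℤ.- d)) ℤ.+ q M (ℤ.pred (ℤ.- d))
      ≡⟨ cong₂ (λ u v → q M u ℤ.+ q M v) (l1 d) (l2 d) ⟩
    q M (ℤ.- ℤ.pred d) ℤ.+ q M (ℤ.- ℤ.suc d)
      ≡⟨ cong₂ ℤ._+_ (q-odd M _) (q-odd M _) ⟩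
    ℤ.- q M (ℤ.pred d) ℤ.+ ℤ.- q M (ℤ.suc d)
      ≡⟨ l3 (q M (ℤ.pred d)) (q M (ℤ.suc d)) ⟩
    ℤ.- (q M (ℤ.suc d) ℤ.+ q M (ℤ.pred d)) ∎
    where
    l1 : ∀ d → ℤ.1ℤ ℤ.+ ℤ.- d ≡ ℤ.- (ℤ.-1ℤ ℤ.+ d)
    l1 = ℤ-Solver.solve-∀
    l2 : ∀ d → ℤ.-1ℤ ℤ.+ ℤ.- d ≡ ℤ.- (ℤ.1ℤ ℤ.+ d)
    l2 = ℤ-Solver.solve-∀
    l3 : ∀ a b → ℤ.- a ℤ.+ ℤ.- b ≡ ℤ.- (b ℤ.+ a)
    l3 = ℤ-Solver.solve-∀

  -- (m , j) is a path at height j with m steps still to go.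
  Point : Set
  Point = ℕ × ℤ

  -- The difference of two independent ±1 walks is itself a ±1 walk, of length `m + m′`. So `q`
  -- needs only the distance, and points with different numbers of steps left can be paired, as
  -- those of the hole and of the left side must be.
  ⟨_,_⟩ : Point → Point → ℚ
  ⟨ (m , i) , (m′ , j) ⟩ = ι (q (m ℕ.+ m′) (j ℤ.- i))

  ⟨⟩-antisym : ∀ a b → ⟨ a , b ⟩ ≡ - ⟨ b , a ⟩
  ⟨⟩-antisym (m , i) (m′ , j) = begin
    ι (q (m ℕ.+ m′) (j ℤ.- i))            ≡⟨ cong₂ (λ M d → ι (q M d)) (ℕ.+-comm m m′) (lem i j) ⟩
    ι (q (m′ ℕ.+ m) (ℤ.- (i ℤ.- j)))      ≡⟨ cong ι (q-odd (m′ ℕ.+ m) _) ⟩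
    ι (ℤ.- q (m′ ℕ.+ m) (i ℤ.- j))        ≡⟨ ι-neg (q (m′ ℕ.+ m) (i ℤ.- j)) ⟩
    - ι (q (m′ ℕ.+ m) (i ℤ.- j))          ∎
    where
    lem : ∀ i j → j ℤ.- i ≡ ℤ.- (i ℤ.- j)
    lem = ℤ-Solver.solve-∀

  open Form ⟨_,_⟩ ⟨⟩-antisym public

  step-Sum : ∀ m s → Sum (suc m , ℤ.suc s) (m , s) (m , ℤ.suc (ℤ.suc s))
  step-Sum m s (m′ , j) = begin
    ι (q M (ℤ.suc (j ℤ.- ℤ.suc s)) ℤ.+ q M (ℤ.pred (j ℤ.- ℤ.suc s)))
      ≡⟨ cong₂ (λ u v → ι (q M u ℤ.+ q M v)) (l1 s j) (l2 s j) ⟩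
    ι (q M (j ℤ.- s) ℤ.+ q M (j ℤ.- ℤ.suc (ℤ.suc s)))
      ≡⟨ ι-+ (q M (j ℤ.- s)) _ ⟩
    ι (q M (j ℤ.- s)) + ι (q M (j ℤ.- ℤ.suc (ℤ.suc s))) ∎
    where
    M = m ℕ.+ m′
    l1 : ∀ s j → ℤ.1ℤ ℤ.+ (j ℤ.- (ℤ.1ℤ ℤ.+ s)) ≡ j ℤ.- s
    l1 = ℤ-Solver.solve-∀
    l2 : ∀ s j → ℤ.-1ℤ ℤ.+ (j ℤ.- (ℤ.1ℤ ℤ.+ s)) ≡ j ℤ.- (ℤ.1ℤ ℤ.+ (ℤ.1ℤ ℤ.+ s))
    l2 = ℤ-Solver.solve-∀

  points : ℕ → ℤ → List Bool → List Point
  points m r []           = []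
  points m r (true  ∷ as) = (m , r) ∷ points m (ℤ.suc (ℤ.suc r)) as
  points m r (false ∷ as) = points m (ℤ.suc (ℤ.suc r)) as

  -- Sum of K over the configurations reached from as when every particle moves one half-step
  -- down or up and no two collide; the flag says that the lowest target is already taken.
  advance : Bool → List Bool → (List Bool → ℚ) → ℚ
  advance c     []           K = K (c ∷ [])
  advance true  (a ∷ as)     K = advance a as (λ bs → K (true ∷ bs))
  advance false (true ∷ as)  K = advance false as (λ bs → K (true ∷ bs)) + advance true as (λ bs → K (false ∷ bs))
  advance false (false ∷ as) K = advance false as (λ bs → K (false ∷ bs))

  -- Every particle is expanded by `step-Sum`, from the lowest one up. `advance` enumerates the
  -- terms without collision, and the others have two equal neighbouring arguments. The companion
  -- statement treats the situation in which the lowest target `(m , s)` has just been occupied from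
  -- below.
  advance-points : ∀ F → Additive F → Alternating F → ∀ m s as →
    advance false as (λ bs → F (points m s bs)) ≡ F (points (suc m) (ℤ.suc s) as)
  advance-points-taken : ∀ F → Additive F → Alternating F → ∀ m s as →
    advance true as (λ bs → F (points m s bs)) ≡ F ((m , s) ∷ points (suc m) (ℤ.suc s) as)

  advance-points F add alt m s []           = refl
  advance-points F add alt m s (true ∷ as)  = begin
    advance false as (λ bs → F ((m , s) ∷ points m s″ bs)) + advance true as (λ bs → F (points m s″ bs))
      ≡⟨ cong₂ _+_ (advance-points (λ ys → F ((m , s) ∷ ys)) (Additive-∷ F _ add) (Alternating-∷ F _ alt) m s″ as)
                   (advance-points-taken F add alt m s″ as) ⟩
    F ((m , s) ∷ points (suc m) (ℤ.suc s″) as) + F ((m , s″) ∷ points (suc m) (ℤ.suc s″) as)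
      ≡⟨ sym (add (step-Sum m s) [] (points (suc m) (ℤ.suc s″) as)) ⟩
    F ((suc m , ℤ.suc s) ∷ points (suc m) (ℤ.suc s″) as) ∎
    where s″ = ℤ.suc (ℤ.suc s)
  advance-points F add alt m s (false ∷ as) = advance-points F add alt m (ℤ.suc (ℤ.suc s)) as

  advance-points-taken F add alt m s []           = refl
  advance-points-taken F add alt m s (true ∷ as)  = begin
    advance true as (λ bs → F ((m , s) ∷ points m s″ bs))
      ≡⟨ advance-points-taken (λ ys → F ((m , s) ∷ ys)) (Additive-∷ F _ add) (Alternating-∷ F _ alt) m s″ as ⟩
    F ((m , s) ∷ (m , s″) ∷ rest)
      ≡⟨ sym (+-identityˡ _) ⟩
    -- The next particle could also step down onto `(m , s)`. That term vanishes by repetition; it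
    -- is added so that the two-term rule applies.
    0ℚ + F ((m , s) ∷ (m , s″) ∷ rest)
      ≡⟨ cong (_+ F ((m , s) ∷ (m , s″) ∷ rest)) (sym (adjacent-equal F alt [] (m , s) rest)) ⟩
    F ((m , s) ∷ (m , s) ∷ rest) + F ((m , s) ∷ (m , s″) ∷ rest)
      ≡⟨ sym (add (step-Sum m s) ((m , s) ∷ []) rest) ⟩
    F ((m , s) ∷ (suc m , ℤ.suc s) ∷ rest) ∎
    where
    s″   = ℤ.suc (ℤ.suc s)
    rest = points (suc m) (ℤ.suc s″) as
  advance-points-taken F add alt m s (false ∷ as) =
    advance-points (λ ys → F ((m , s) ∷ ys)) (Additive-∷ F _ add) (Alternating-∷ F _ alt) m (ℤ.suc (ℤ.suc s)) as

  bit : Bool → ℕ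
  bit true  = 1
  bit false = 0

  trues : List Bool → ℕ
  trues []       = 0
  trues (b ∷ bs) = bit b ℕ.+ trues bs

  1≤+ : ∀ {a b} → 1ℚ ≤ a → 1ℚ ≤ b → 1ℚ ≤ a + b
  1≤+ {a} {b} p q = ≤-trans p (≤-trans (≤-reflexive (sym (+-identityʳ a))) (+-monoʳ-≤ a (≤-trans 0≤1 q)))
    where
    0≤1 : 0ℚ ≤ 1ℚ
    0≤1 = *≤* (ℤ.+≤+ ℕ.z≤n)

  -- A move without collision always exists, so a lower bound 1 is handed back from strip to strip.
  -- Through `1≤pf` this shows that `MF n x` is not zero, and keeps `fracℕ` away from its default
  -- value.
  advance-1≤ : ∀ c as {K} → (∀ bs → trues bs ≡ bit c ℕ.+ trues as → 1ℚ ≤ K bs) → 1ℚ ≤ advance c as K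
  advance-1≤ true  []           e = e _ refl
  advance-1≤ false []           e = e _ refl
  advance-1≤ true  (a ∷ as)     e = advance-1≤ a as (λ bs t → e _ (cong suc t))
  advance-1≤ false (true ∷ as)  e =
    1≤+ (advance-1≤ false as (λ bs t → e _ (cong suc t))) (advance-1≤ true as (λ bs t → e _ t))
  advance-1≤ false (false ∷ as) e = advance-1≤ false as (λ bs t → e _ t)

  alternate : ℕ → ℚ
  alternate zero    = 0ℚ
  alternate (suc n) = 1ℚ - alternate n

  alternate-odd : ∀ m → alternate (suc (m ℕ.+ m)) ≡ 1ℚ
  alternate-odd zero    = refl
  alternate-odd (suc m) rewrite ℕ.+-suc m m = trans (lem (alternate (suc (m ℕ.+ m)))) (alternate-odd m)
    where
    lem : ∀ a → 1ℚ - (1ℚ - a) ≡ a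
    lem = solve-∀ ℚ-ring

  r≤r+2 : ∀ r → r ℤ.≤ ℤ.suc (ℤ.suc r)
  r≤r+2 r = ℤ.≤-trans (ℤ.i≤suc[i] r) (ℤ.i≤suc[i] (ℤ.suc r))

  -- All entries of the row and all smaller Pfaffians are 1, so the expansion is the sum 1 - 1 + 1 -
  -- ..., which equals 1 over an odd number of points.
  contr-sorted : ∀ φ F r bs → (∀ s → r ℤ.≤ s → φ (0 , s) ≡ 1ℚ) →
                 (∀ bs′ → suc (trues bs′) ≡ trues bs → F (points 0 r bs′) ≡ 1ℚ) →
                 contr φ F (points 0 r bs) ≡ alternate (trues bs)
  contr-sorted φ F r []           p e = refl
  contr-sorted φ F r (false ∷ bs) p e =
    contr-sorted φ F _ bs (λ s le → p s (ℤ.≤-trans (r≤r+2 r) le)) (λ bs′ → e (false ∷ bs′))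
  contr-sorted φ F r (true ∷ bs)  p e = trans
    (cong₂ (λ u c → u - c) (cong₂ _*_ (p r ℤ.≤-refl) (e (false ∷ bs) refl))
      (contr-sorted φ (λ ys → F ((0 , r) ∷ ys)) _ bs (λ s le → p s (ℤ.≤-trans (r≤r+2 r) le))
        (λ bs′ t → e (true ∷ bs′) (cong suc t))))
    (lem (alternate (trues bs)))
    where
    lem : ∀ a → 1ℚ * 1ℚ - a ≡ 1ℚ - a
    lem = solve-∀ ℚ-ring

  sgn-pos : ∀ r s → ℤ.suc (ℤ.suc r) ℤ.≤ s → sgn (s ℤ.- r) ≡ ℤ.1ℤ
  sgn-pos r s le = lem (s ℤ.- r) (ℤ.≤-trans (ℤ.≤-reflexive (l1 r)) (ℤ.+-monoˡ-≤ (ℤ.- r) le))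
    where
    l1 : ∀ r → ℤ.1ℤ ℤ.+ ℤ.1ℤ ≡ ℤ.1ℤ ℤ.+ (ℤ.1ℤ ℤ.+ r) ℤ.+ ℤ.- r
    l1 = ℤ-Solver.solve-∀
    lem : ∀ d → ℤ.+ 2 ℤ.≤ d → sgn d ≡ ℤ.1ℤ
    lem ℤ.+[1+ n ] _         = refl
    lem ℤ.+0 (ℤ.+≤+ ())

  -- With no steps left the form is the sign of the height difference, and for sorted points its
  -- matrix has 1 everywhere above the diagonal. The value 1 means that every configuration on the
  -- free boundary counts once.
  pf-sorted : ∀ m r bs → trues bs ≡ m ℕ.+ m → pf m (points 0 r bs) ≡ 1ℚ
  pf-sorted zero    r []           t = refl
  pf-sorted m       r (false ∷ bs) t = pf-sorted m _ bs t
  pf-sorted (suc m) r (true ∷ bs)  t = begin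
    contr ⟨ (0 , r) ,_⟩ (pf m) (points 0 _ bs)
      ≡⟨ contr-sorted ⟨ (0 , r) ,_⟩ (pf m) _ bs (λ s le → cong ι (sgn-pos r s le))
           (λ bs′ t′ → pf-sorted m _ bs′ (ℕ.suc-injective (trans t′ t″))) ⟩
    alternate (trues bs)         ≡⟨ cong alternate t″ ⟩
    alternate (suc (m ℕ.+ m))    ≡⟨ alternate-odd m ⟩
    1ℚ                           ∎
    where
    t″ : trues bs ≡ suc (m ℕ.+ m)
    t″ = trans (ℕ.suc-injective t) (ℕ.+-suc m m)

  1≤pf : ∀ k m r bs → trues bs ≡ k ℕ.+ k → 1ℚ ≤ pf k (points m r bs)
  1≤pf k zero    r bs t = ≤-reflexive (sym (pf-sorted k r bs t))
  1≤pf k (suc m) r bs t =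
    subst (λ r → 1ℚ ≤ pf k (points (suc m) r bs)) (ℤ.suc-pred r)
      (subst (1ℚ ≤_) (advance-points (pf k) (pf-Additive k) (pf-Alternating k) m (ℤ.pred r) bs)
        (advance-1≤ false bs (λ cs e → 1≤pf k m (ℤ.pred r) cs (trans e t))))

-- The unit triangles of the region in a linear order.

module Cells where

  open import Defs
  open import Data.Bool using (Bool; true; false; not; _∧_; _∨_; if_then_else_; T)
  open import Data.Bool.Properties using (not-involutive; ∨-zeroʳ; T-≡; T?)
  open import Data.Empty using (⊥-elim)
  open import Data.Integer as ℤ using (ℤ; +_; ∣_∣)
  import Data.Integer.Properties as ℤ
  import Data.Integer.Tactic.RingSolver as ℤ-Solver
  open import Data.List using (List; []; _∷_; _++_; map; concatMap; filter; applyUpTo)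
  open import Data.List.Properties using (filter-accept)
  open import Data.List.Relation.Unary.All using ([]; _∷_)
  open import Data.Nat as ℕ using (ℕ; zero; suc; _≤_; _<_; s≤s; z≤n)
  import Data.Nat.Properties as ℕ
  open import Data.Product using (_×_; _,_; proj₁; proj₂)
  open import Data.Sum using (_⊎_; inj₁; inj₂)
  open import Function using (id; _∘_; Equivalence)
  open import Relation.Nullary using (¬_; yes; no)
  open import Relation.Binary.PropositionalEquality

  dbl : ℕ → ℕ
  dbl zero    = 0
  dbl (suc k) = suc (suc (dbl k))

  2*≡dbl : ∀ k → 2 ℕ.* k ≡ dbl k
  2*≡dbl zero    = refl
  2*≡dbl (suc k) = cong suc (trans (ℕ.+-suc k (k ℕ.+ 0)) (cong suc (2*≡dbl k)))

  even-dbl : ∀ k → evenℕ (dbl k) ≡ true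
  even-dbl zero    = refl
  even-dbl (suc k) = trans (not-involutive _) (even-dbl k)

  dbl≡+ : ∀ k → dbl k ≡ k ℕ.+ k
  dbl≡+ zero    = refl
  dbl≡+ (suc k) = cong suc (trans (cong suc (dbl≡+ k)) (sym (ℕ.+-suc k k)))

  T⇒≡ : ∀ {b} → T b → b ≡ true
  T⇒≡ = Equivalence.to T-≡

  ≡⇒T : ∀ {b} → b ≡ true → T b
  ≡⇒T = Equivalence.from T-≡

  ≡false : ∀ b → ¬ (b ≡ true) → b ≡ false
  ≡false true  h = ⊥-elim (h refl)
  ≡false false h = refl

  ∧-falseˡ : ∀ {a} b → a ≡ false → a ∧ b ≡ false
  ∧-falseˡ b refl = refl

  ∨-trueˡ : ∀ {a} b → a ≡ true → a ∨ b ≡ true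
  ∨-trueˡ b refl = refl

  eqTri-sound : ∀ t u → eqTri t u ≡ true → t ≡ u
  eqTri-sound (tri p j) (tri q k) e with p ℕ.≡ᵇ q in e₁ | j ℤ.≟ k
  ... | true  | yes refl = cong (λ p → tri p j) (ℕ.≡ᵇ⇒≡ p q (≡⇒T e₁))
  eqTri-sound (tri p j) (tri q k) () | true | no _
  eqTri-sound (tri p j) (tri q k) () | false | _

  eqTri-refl : ∀ t → eqTri t t ≡ true
  eqTri-refl (tri p j) with p ℕ.≡ᵇ p in e₁ | j ℤ.≟ j
  ... | true  | yes _ = refl
  ... | true  | no ¬e = ⊥-elim (¬e refl)
  ... | false | _     = trans (sym e₁) (T⇒≡ (ℕ.≡⇒≡ᵇ p p refl))

  eqTri-≢ : ∀ {t u} → ¬ (t ≡ u) → eqTri t u ≡ false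
  eqTri-≢ {t} {u} ne = ≡false _ (λ e → ne (eqTri-sound t u e))

  up right : Tri → Tri
  up    (tri p j) = tri p (j ℤ.+ + 1)
  right (tri p j) = tri (suc p) j

  module Region (n x : ℕ) (hole : Tri → Bool) where

    M : ℕ → ℕ
    M p = 2 ℕ.* x ℕ.+ p

    -- The s-th unit triangle of strip p counted from below, 0 ≤ s ≤ 2 M p; it is left-pointing iff s is even.
    cell : ℕ → ℕ → Tri
    cell p s = tri p (+ s ℤ.- + M p)

    dead : ℕ → ℕ → Bool
    dead p s = hole (cell p s)

    inside : Tri → Bool
    inside t = inHalfHex n x t ∧ not (hole t)

    cs : List Tri
    cs = cells n x hole

    up-cell : ∀ p s → up (cell p s) ≡ cell p (suc s)
    up-cell p s = cong (tri p) (lem (+ s) (+ M p))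
      where
      lem : ∀ a b → a ℤ.- b ℤ.+ + 1 ≡ (+ 1 ℤ.+ a) ℤ.- b
      lem = ℤ-Solver.solve-∀

    M-suc : ∀ p → M (suc p) ≡ suc (M p)
    M-suc p = ℕ.+-suc (2 ℕ.* x) p

    right-cell : ∀ p s → right (cell p s) ≡ cell (suc p) (suc s)
    right-cell p s = cong (tri (suc p)) (sym (trans
      (cong (λ k → + suc s ℤ.- + k) (M-suc p)) (lem (+ s) (+ M p))))
      where
      lem : ∀ a b → (+ 1 ℤ.+ a) ℤ.- (+ 1 ℤ.+ b) ≡ a ℤ.- b
      lem = ℤ-Solver.solve-∀

    cell-injective : ∀ {p s q t} → cell p s ≡ cell q t → p ≡ q × s ≡ t
    cell-injective {p} {s} {q} {t} e with cong strip e
    ... | refl = refl , ℤ.+-injective (trans (lem (+ s) (+ M p)) (trans (cong (ℤ._+ + M p) (cong row e)) (sym (lem (+ t) (+ M p)))))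
      where
      lem : ∀ a b → a ≡ (a ℤ.- b) ℤ.+ b
      lem = ℤ-Solver.solve-∀

    cell-≢ : ∀ {p s q t} → ¬ (p ≡ q) ⊎ ¬ (s ≡ t) → ¬ (cell p s ≡ cell q t)
    cell-≢ (inj₁ h) e = h (proj₁ (cell-injective e))
    cell-≢ (inj₂ h) e = h (proj₂ (cell-injective e))

    evenℤ-suc : ∀ z → evenℤ (ℤ.suc z) ≡ not (evenℤ z)
    evenℤ-suc (+ m)              = refl
    evenℤ-suc ℤ.-[1+ zero ]      = refl
    evenℤ-suc ℤ.-[1+ suc m ]     = sym (not-involutive _)

    leftPointing-cell : ∀ p s → leftPointing (cell p s) ≡ evenℕ s
    leftPointing-cell p s = trans (cong evenℤ (lem (+ p) (+ s) (+ (2 ℕ.* x)))) (go s)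
      where
      lem : ∀ p s y → p ℤ.+ (s ℤ.- (y ℤ.+ p)) ≡ s ℤ.+ ℤ.- y
      lem = ℤ-Solver.solve-∀
      go : ∀ s → evenℤ (+ s ℤ.+ ℤ.- (+ (2 ℕ.* x))) ≡ evenℕ s
      go zero    = trans (cong evenℤ (ℤ.+-identityˡ (ℤ.- (+ (2 ℕ.* x)))))
                     (trans (cong evenℕ (trans (ℤ.∣-i∣≡∣i∣ (+ (2 ℕ.* x))) (2*≡dbl x))) (even-dbl x))
      go (suc s) = trans (cong evenℤ (ℤ.+-assoc (+ 1) (+ s) (ℤ.- (+ (2 ℕ.* x)))))
                     (trans (evenℤ-suc (+ s ℤ.+ ℤ.- (+ (2 ℕ.* x)))) (cong not (go s)))

    height : ℕ → ℕ → ℕ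
    height p s = ∣ + s ℤ.- + M p ∣

    height-≤ : ∀ {p s} → s ≤ M p → height p s ≡ M p ℕ.∸ s
    height-≤ {p} {s} le = trans (cong ∣_∣ (ℤ.m-n≡m⊖n s (M p))) (ℤ.∣⊖∣-≤ le)

    height-≥ : ∀ {p s} → M p ≤ s → height p s ≡ s ℕ.∸ M p
    height-≥ {p} {s} le = trans (cong ∣_∣ (trans (ℤ.m-n≡m⊖n s (M p)) (ℤ.⊖-≥ le))) refl

    -- Right-pointing triangles cost an extra 1. Below the middle the cell `s = 0` is left-pointing
    -- and every other cell has room to spare; above it an odd `s` cannot equal the even number
    -- `dbl (M p)`, which leaves the missing unit.
    height-bound : ∀ p s → s ≤ dbl (M p) → height p s ℕ.+ (if evenℕ s then 0 else 1) ≤ M p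
    height-bound p s le with ℕ.≤-total s (M p)
    height-bound p zero le | inj₁ s≤M = ℕ.≤-reflexive (trans (ℕ.+-identityʳ _) (height-≤ {p} s≤M))
    height-bound p (suc s) le | inj₁ s≤M = begin
        height p (suc s) ℕ.+ (if evenℕ (suc s) then 0 else 1) ≤⟨ ℕ.+-monoʳ-≤ (height p (suc s)) (≤1 (evenℕ (suc s))) ⟩
        height p (suc s) ℕ.+ 1      ≡⟨ cong (ℕ._+ 1) (height-≤ {p} s≤M) ⟩
        M p ℕ.∸ suc s ℕ.+ 1         ≤⟨ ℕ.+-monoʳ-≤ (M p ℕ.∸ suc s) (s≤s z≤n) ⟩
        M p ℕ.∸ suc s ℕ.+ suc s     ≡⟨ ℕ.m∸n+n≡m s≤M ⟩
        M p                         ∎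
      where
      open ℕ.≤-Reasoning
      ≤1 : ∀ b → (if b then 0 else 1) ≤ 1
      ≤1 true  = z≤n
      ≤1 false = s≤s z≤n
    height-bound p s le | inj₂ M≤s = ℕ.+-cancelʳ-≤ (M p) _ _ (begin
        height p s ℕ.+ e ℕ.+ M p       ≡⟨ cong (λ h → h ℕ.+ e ℕ.+ M p) (height-≥ {p} M≤s) ⟩
        s ℕ.∸ M p ℕ.+ e ℕ.+ M p        ≡⟨ ℕ.+-assoc (s ℕ.∸ M p) e (M p) ⟩
        s ℕ.∸ M p ℕ.+ (e ℕ.+ M p)      ≡⟨ cong (s ℕ.∸ M p ℕ.+_) (ℕ.+-comm e (M p)) ⟩
        s ℕ.∸ M p ℕ.+ (M p ℕ.+ e)      ≡⟨ sym (ℕ.+-assoc (s ℕ.∸ M p) (M p) e) ⟩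
        s ℕ.∸ M p ℕ.+ M p ℕ.+ e        ≡⟨ cong (ℕ._+ e) (ℕ.m∸n+n≡m M≤s) ⟩
        s ℕ.+ e                        ≤⟨ parity (evenℕ s) refl ⟩
        dbl (M p)                      ≡⟨ dbl≡+ (M p) ⟩
        M p ℕ.+ M p                    ∎)
      where
      open ℕ.≤-Reasoning
      e = if evenℕ s then 0 else 1
      parity : ∀ b → evenℕ s ≡ b → s ℕ.+ (if b then 0 else 1) ≤ dbl (M p)
      parity true  _  = ℕ.≤-trans (ℕ.≤-reflexive (ℕ.+-identityʳ s)) le
      parity false ev = ℕ.≤-trans (ℕ.≤-reflexive (ℕ.+-comm s 1)) (ℕ.≤∧≢⇒< le λ { refl → case (trans (sym ev) (even-dbl (M p))) })
        where
        case : ¬ (false ≡ true)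
        case ()

    inHalfHex-cell : ∀ p s → p < 2 ℕ.* n → s ≤ dbl (M p) → inHalfHex n x (cell p s) ≡ true
    inHalfHex-cell p s p< s≤ = cong₂ _∧_ (T⇒≡ (ℕ.≤⇒≤ᵇ p<))
      (T⇒≡ (ℕ.≤⇒≤ᵇ (subst (λ b → height p s ℕ.+ (if b then 0 else 1) ≤ M p) (sym (leftPointing-cell p s)) (height-bound p s s≤))))

    above-top : ∀ p → inHalfHex n x (cell p (suc (dbl (M p)))) ≡ false
    above-top p = ≡false _ λ e → ℕ.<⇒≱ {M p} {M p ℕ.+ 1} (ℕ.≤-reflexive (ℕ.+-comm 1 (M p)))
      (ℕ.≤-trans (ℕ.≤-reflexive (sym h)) (ℕ.≤-trans (ℕ.m≤m+n _ _) (ℕ.≤ᵇ⇒≤ _ _ (≡⇒T (∧-right (suc p ℕ.≤ᵇ 2 ℕ.* n) e)))))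
      where
      ∧-right : ∀ a {b} → a ∧ b ≡ true → b ≡ true
      ∧-right true e = e
      h : height p (suc (dbl (M p))) ≡ M p ℕ.+ 1
      h = trans (height-≥ {p} (ℕ.≤-trans (ℕ.m≤m+n (M p) (M p)) (ℕ.≤-trans (ℕ.≤-reflexive (sym (dbl≡+ (M p)))) (ℕ.n≤1+n _))))
            (trans (cong (λ d → suc d ℕ.∸ M p) (dbl≡+ (M p)))
              (trans (cong (ℕ._∸ M p) (sym (ℕ.+-suc (M p) (M p)))) (trans (ℕ.m+n∸m≡n (M p) (suc (M p))) (ℕ.+-comm 1 (M p)))))

    beyond : ∀ j → inHalfHex n x (tri (2 ℕ.* n) j) ≡ false
    beyond j = ∧-falseˡ _ (≡false (suc (2 ℕ.* n) ℕ.≤ᵇ 2 ℕ.* n) (λ e → ℕ.<-irrefl {2 ℕ.* n} refl (ℕ.≤ᵇ⇒≤ (suc (2 ℕ.* n)) (2 ℕ.* n) (≡⇒T e))))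

    cellsFrom : ℕ → ℕ → ℕ → List Tri
    cellsFrom p s zero    = []
    cellsFrom p s (suc r) = cell p s ∷ cellsFrom p (suc s) r

    strips : ℕ → ℕ → List Tri
    strips zero    p = []
    strips (suc f) p = cellsFrom p 0 (suc (dbl (M p))) ++ strips f (suc p)

    alive : List Tri → List Tri
    alive = filter (λ t → T? (inside t))

    -- The order is what matters: with strips from left to right and cells upward, both partners
    -- `up` and `right` of a triangle stand behind it, so a scan can decide each lozenge at its
    -- first triangle.
    cs≡ : cs ≡ alive (strips (2 ℕ.* n) 0)
    cs≡ = cong alive (go id (2 ℕ.* n) 0 (λ _ → refl))
      where
      symRow : ∀ p (f : ℕ → ℕ) r s → (∀ i → f i ≡ s ℕ.+ i) →
               map (tri p) (map (λ t → + t ℤ.- + M p) (applyUpTo f r)) ≡ cellsFrom p s r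
      symRow p f zero    s e = refl
      symRow p f (suc r) s e = cong₂ _∷_ (cong (λ t → tri p (+ t ℤ.- + M p)) (trans (e 0) (ℕ.+-identityʳ s)))
        (symRow p (f ∘ suc) r (suc s) (λ i → trans (e (suc i)) (ℕ.+-suc s i)))
      go : ∀ (f : ℕ → ℕ) r p → (∀ i → f i ≡ p ℕ.+ i) →
           concatMap (λ p → map (tri p) (symRange (M p))) (applyUpTo f r) ≡ strips r p
      go f zero    p e = refl
      go f (suc r) p e rewrite trans (e 0) (ℕ.+-identityʳ p) = cong₂ _++_
        (trans (symRow p id (suc (2 ℕ.* M p)) 0 (λ _ → refl)) (cong (λ d → cellsFrom p 0 (suc d)) (2*≡dbl (M p))))
        (go (f ∘ suc) r (suc p) (λ i → trans (e (suc i)) (ℕ.+-suc p i)))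

    mem-++ʳ : ∀ t us {vs} → memTri t vs ≡ true → memTri t (us ++ vs) ≡ true
    mem-++ʳ t []       e = e
    mem-++ʳ t (u ∷ us) e = trans (cong (eqTri t u ∨_) (mem-++ʳ t us e)) (∨-zeroʳ _)

    mem-++ˡ : ∀ t us {vs} → memTri t us ≡ true → memTri t (us ++ vs) ≡ true
    mem-++ˡ t (u ∷ us) e with eqTri t u
    ... | true  = refl
    ... | false = mem-++ˡ t us e

    mem-cellsFrom : ∀ p d s r → d < r → memTri (cell p (d ℕ.+ s)) (cellsFrom p s r) ≡ true
    mem-cellsFrom p zero    s (suc r) _       = ∨-trueˡ _ (eqTri-refl (cell p s))
    mem-cellsFrom p (suc d) s (suc r) (s≤s h) =
      trans (cong (eqTri (cell p (suc d ℕ.+ s)) (cell p s) ∨_)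
              (trans (cong (λ k → memTri (cell p k) (cellsFrom p (suc s) r)) (sym (ℕ.+-suc d s))) (mem-cellsFrom p d (suc s) r h)))
            (∨-zeroʳ _)

    mem-strips : ∀ d f p s → d < f → s ≤ dbl (M (d ℕ.+ p)) → memTri (cell (d ℕ.+ p) s) (strips f p) ≡ true
    mem-strips zero    (suc f) p s h le = mem-++ˡ (cell p s) (cellsFrom p 0 (suc (dbl (M p))))
      (subst (λ k → memTri (cell p k) (cellsFrom p 0 (suc (dbl (M p)))) ≡ true) (ℕ.+-identityʳ s) (mem-cellsFrom p s 0 (suc (dbl (M p))) (s≤s le)))
    mem-strips (suc d) (suc f) p s (s≤s h) le = mem-++ʳ (cell (suc d ℕ.+ p) s) (cellsFrom p 0 (suc (dbl (M p))))
      (subst (λ k → memTri (cell k s) (strips f (suc p)) ≡ true) (ℕ.+-suc d p)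
        (mem-strips d f (suc p) s h (subst (λ k → s ≤ dbl (M k)) (sym (ℕ.+-suc d p)) le)))

    mem-alive : ∀ t us → memTri t us ≡ true → inside t ≡ true → memTri t (alive us) ≡ true
    mem-alive t (u ∷ us) m i with eqTri t u in e
    ... | true  = trans (cong (memTri t) (filter-accept (λ t → T? (inside t)) {u} {us} (≡⇒T (subst (λ t → inside t ≡ true) (eqTri-sound t u e) i))))
                        (∨-trueˡ _ e)
    ... | false with inside u
    ...   | true  = trans (cong (eqTri t u ∨_) (mem-alive t us m i)) (∨-zeroʳ _)
    ...   | false = mem-alive t us m i

    not-mem-alive : ∀ t us → inside t ≡ false → memTri t (alive us) ≡ false
    not-mem-alive t []       i = refl
    not-mem-alive t (u ∷ us) i with inside u in j
    ... | false = not-mem-alive t us i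
    ... | true  = cong₂ _∨_ (≡false _ (λ e → case (trans (sym i) (trans (cong inside (eqTri-sound t u e)) j)))) (not-mem-alive t us i)
      where
      case : ¬ (false ≡ true)
      case ()

    mem-cell : ∀ p s → p < 2 ℕ.* n → s ≤ dbl (M p) → memTri (cell p s) cs ≡ not (dead p s)
    mem-cell p s p< s≤ = trans (cong (memTri (cell p s)) cs≡) (go (not (dead p s)) refl)
      where
      ins : inside (cell p s) ≡ not (dead p s)
      ins = cong (_∧ not (dead p s)) (inHalfHex-cell p s p< s≤)
      go : ∀ b → not (dead p s) ≡ b → memTri (cell p s) (alive (strips (2 ℕ.* n) 0)) ≡ not (dead p s)
      go true  e = trans (mem-alive (cell p s) (strips (2 ℕ.* n) 0)
        (subst (λ k → memTri (cell k s) (strips (2 ℕ.* n) 0) ≡ true) (ℕ.+-identityʳ p)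
          (mem-strips p (2 ℕ.* n) 0 s p< (subst (λ k → s ≤ dbl (M k)) (sym (ℕ.+-identityʳ p)) s≤))) (trans ins e)) (sym e)
      go false e = trans (not-mem-alive (cell p s) (strips (2 ℕ.* n) 0) (trans ins e)) (sym e)

    mem-above : ∀ p → memTri (cell p (suc (dbl (M p)))) cs ≡ false
    mem-above p = trans (cong (memTri (cell p (suc (dbl (M p))))) cs≡)
      (not-mem-alive (cell p (suc (dbl (M p)))) (strips (2 ℕ.* n) 0) (∧-falseˡ _ (above-top p)))

    mem-beyond : ∀ s → memTri (cell (2 ℕ.* n) s) cs ≡ false
    mem-beyond s = trans (cong (memTri (cell (2 ℕ.* n) s)) cs≡)
      (not-mem-alive (cell (2 ℕ.* n) s) (strips (2 ℕ.* n) 0) (∧-falseˡ _ (beyond (row (cell (2 ℕ.* n) s)))))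

-- Counting tilings by a scan, one triangle at a time.

module Counting where

  open import Defs
  open Cells
  open import Data.Bool using (Bool; true; false; not; _∧_; _∨_; if_then_else_)
  open import Data.Bool.Properties using (T?)
  open import Data.List using (List; []; _∷_; _++_; map; concatMap; filter; length; foldr)
  open import Data.List.Properties using (filter-++; length-++)
  open import Data.List.Relation.Unary.All as All using (All; []; _∷_)
  import Data.List.Relation.Unary.All.Properties as All
  open import Data.Nat as ℕ using (ℕ; zero; suc; _+_; _≤_; _<_; _≡ᵇ_; _≤ᵇ_; s≤s)
  import Data.Nat.Properties as ℕ
  open import Data.Product using (_,_; proj₁; proj₂)
  open import Data.Sum using (inj₁; inj₂)
  open import Function using (_∘_)
  open import Relation.Nullary using (¬_)
  open import Relation.Binary.PropositionalEquality

  count : {A : Set} → (A → Bool) → List A → ℕ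
  count p xs = length (filter (λ a → T? (p a)) xs)

  ind : Bool → ℕ
  ind b = if b then 1 else 0

  gate : Bool → ℕ → ℕ
  gate b m = if b then m else 0

  sumSubsets : {A : Set} → (List A → ℕ) → List A → ℕ
  sumSubsets f []       = f []
  sumSubsets f (a ∷ as) = sumSubsets f as + sumSubsets (f ∘ (a ∷_)) as

  count-++ : {A : Set} (p : A → Bool) (xs ys : List A) → count p (xs ++ ys) ≡ count p xs + count p ys
  count-++ p xs ys = trans (cong length (filter-++ (λ a → T? (p a)) xs ys)) (length-++ (filter (λ a → T? (p a)) xs))

  count-map : {A B : Set} (p : B → Bool) (f : A → B) (xs : List A) → count p (map f xs) ≡ count (p ∘ f) xs
  count-map p f []       = refl
  count-map p f (x ∷ xs) with p (f x)
  ... | true  = cong suc (count-map p f xs)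
  ... | false = count-map p f xs

  count-singleton : {A : Set} (p : A → Bool) (a : A) → count p (a ∷ []) ≡ ind (p a)
  count-singleton p a with p a
  ... | true  = refl
  ... | false = refl

  count-subsets : {A : Set} (p : List A → Bool) (as : List A) → count p (subsets as) ≡ sumSubsets (ind ∘ p) as
  count-subsets p []       = count-singleton p []
  count-subsets p (a ∷ as) = trans (count-++ p (subsets as) (map (a ∷_) (subsets as)))
    (cong₂ _+_ (count-subsets p as) (trans (count-map p (a ∷_) (subsets as)) (count-subsets (p ∘ (a ∷_)) as)))

  sumSubsets-cong : {A : Set} {Q : A → Set} {f g : List A → ℕ} → (∀ ls → All Q ls → f ls ≡ g ls) →
                    ∀ {as} → All Q as → sumSubsets f as ≡ sumSubsets g as
  sumSubsets-cong e []       = e [] []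
  sumSubsets-cong e (q ∷ qs) = cong₂ _+_ (sumSubsets-cong e qs) (sumSubsets-cong (λ ls h → e _ (q ∷ h)) qs)

  sumSubsets-≗ : {A : Set} {f g : List A → ℕ} → (∀ ls → f ls ≡ g ls) → ∀ as → sumSubsets f as ≡ sumSubsets g as
  sumSubsets-≗ e []       = e []
  sumSubsets-≗ e (a ∷ as) = cong₂ _+_ (sumSubsets-≗ e as) (sumSubsets-≗ (λ ls → e (a ∷ ls)) as)

  sumSubsets-++ : {A : Set} (f : List A → ℕ) (as bs : List A) →
                  sumSubsets f (as ++ bs) ≡ sumSubsets (λ ch → sumSubsets (λ ls → f (ch ++ ls)) bs) as
  sumSubsets-++ f []       bs = refl
  sumSubsets-++ f (a ∷ as) bs = cong₂ _+_ (sumSubsets-++ f as bs) (sumSubsets-++ (f ∘ (a ∷_)) as bs)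

  sumSubsets-zero : {A : Set} (as : List A) → sumSubsets (λ _ → 0) as ≡ 0
  sumSubsets-zero []       = refl
  sumSubsets-zero (a ∷ as) = cong₂ _+_ (sumSubsets-zero as) (sumSubsets-zero as)

  sumSubsets-gate : {A : Set} (b : Bool) (f : List A → ℕ) (as : List A) →
                    sumSubsets (λ ls → gate b (f ls)) as ≡ gate b (sumSubsets f as)
  sumSubsets-gate true  f as = refl
  sumSubsets-gate false f as = sumSubsets-zero as

  okv : Bool → ℕ → Bool
  okv fr v = if fr then v ≤ᵇ 1 else v ≡ᵇ 1

  -- The effect of the (at most two) lozenges starting at a triangle that is already covered v times.
  choices : {A : Set} (bu br fr : Bool) (v : ℕ) (l₁ l₂ : A) (cv G : List A → ℕ) →
    cv [] ≡ 0 → cv (l₁ ∷ []) ≡ 1 → cv (l₂ ∷ []) ≡ 1 → cv (l₁ ∷ l₂ ∷ []) ≡ 2 →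
    sumSubsets (λ ch → gate (okv fr (v + cv ch)) (G ch)) ((if bu then l₁ ∷ [] else []) ++ (if br then l₂ ∷ [] else []))
      ≡ gate (okv fr v) (G []) + (gate (bu ∧ okv fr (v + 1)) (G (l₁ ∷ [])) + gate (br ∧ okv fr (v + 1)) (G (l₂ ∷ [])))
  choices bu br fr v l₁ l₂ cv G e₀ e₁ e₂ e₃ = go bu br
    where
    open ≡-Reasoning
    g0 : gate (okv fr (v + cv [])) (G []) ≡ gate (okv fr v) (G [])
    g0 = cong (λ w → gate (okv fr w) (G [])) (trans (cong (v +_) e₀) (ℕ.+-identityʳ v))
    g1 : gate (okv fr (v + cv (l₁ ∷ []))) (G (l₁ ∷ [])) ≡ gate (okv fr (v + 1)) (G (l₁ ∷ []))
    g1 = cong (λ w → gate (okv fr (v + w)) (G (l₁ ∷ []))) e₁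
    g2 : gate (okv fr (v + cv (l₂ ∷ []))) (G (l₂ ∷ [])) ≡ gate (okv fr (v + 1)) (G (l₂ ∷ []))
    g2 = cong (λ w → gate (okv fr (v + w)) (G (l₂ ∷ []))) e₂
    ok2 : ∀ fr → okv fr (v + 2) ≡ false
    ok2 fr rewrite ℕ.+-comm v 2 with fr
    ... | true  = refl
    ... | false = refl
    g3 : gate (okv fr (v + cv (l₁ ∷ l₂ ∷ []))) (G (l₁ ∷ l₂ ∷ [])) ≡ 0
    g3 = trans (cong (λ w → gate (okv fr (v + w)) (G (l₁ ∷ l₂ ∷ []))) e₃) (cong (λ b → gate b (G (l₁ ∷ l₂ ∷ []))) (ok2 fr))
    go : ∀ bu br → sumSubsets (λ ch → gate (okv fr (v + cv ch)) (G ch)) ((if bu then l₁ ∷ [] else []) ++ (if br then l₂ ∷ [] else []))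
      ≡ gate (okv fr v) (G []) + (gate (bu ∧ okv fr (v + 1)) (G (l₁ ∷ [])) + gate (br ∧ okv fr (v + 1)) (G (l₂ ∷ [])))
    go false false = trans g0 (sym (ℕ.+-identityʳ _))
    go false true  = cong₂ _+_ g0 g2
    go true  false = cong₂ _+_ g0 (trans g1 (sym (ℕ.+-identityʳ _)))
    go true  true  = begin
      (a + b) + (c + d)  ≡⟨ cong₂ _+_ (cong₂ _+_ g0 g2) (cong₂ _+_ g1 g3) ⟩
      (a′ + b′) + (c′ + 0) ≡⟨ cong (a′ + b′ +_) (ℕ.+-identityʳ c′) ⟩
      (a′ + b′) + c′     ≡⟨ ℕ.+-assoc a′ b′ c′ ⟩
      a′ + (b′ + c′)     ≡⟨ cong (a′ +_) (ℕ.+-comm b′ c′) ⟩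
      a′ + (c′ + b′)     ∎
      where
      a = gate (okv fr (v + cv [])) (G [])
      b = gate (okv fr (v + cv (l₂ ∷ []))) (G (l₂ ∷ []))
      c = gate (okv fr (v + cv (l₁ ∷ []))) (G (l₁ ∷ []))
      d = gate (okv fr (v + cv (l₁ ∷ l₂ ∷ []))) (G (l₁ ∷ l₂ ∷ []))
      a′ = gate (okv fr v) (G [])
      b′ = gate (okv fr (v + 1)) (G (l₂ ∷ []))
      c′ = gate (okv fr (v + 1)) (G (l₁ ∷ []))

  touches : Tri → Lozenge → Bool
  touches t l = eqTri t (proj₁ l) ∨ eqTri t (proj₂ l)

  cover-++ : ∀ t as bs → coverCount t (as ++ bs) ≡ coverCount t as + coverCount t bs
  cover-++ t = count-++ (touches t)

  cover-none : ∀ t {ls} → All (λ l → touches t l ≡ false) ls → coverCount t ls ≡ 0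
  cover-none t []                = refl
  cover-none t (_∷_ {l} e es) with touches t l
  ... | false = cover-none t es

  cover-hit : ∀ t l → touches t l ≡ true → coverCount t (l ∷ []) ≡ 1
  cover-hit t l e = trans (count-singleton (touches t) l) (cong ind e)

  cover-miss : ∀ t l → touches t l ≡ false → coverCount t (l ∷ []) ≡ 0
  cover-miss t l e = trans (count-singleton (touches t) l) (cong ind e)

  _⊕_ : (Tri → ℕ) → List Lozenge → (Tri → ℕ)
  (c ⊕ ls) t = c t + coverCount t ls

  nbrs : List Tri → Tri → List Lozenge
  nbrs cs t =
    (if memTri (up t) cs then (t , up t) ∷ [] else []) ++
    (if leftPointing t ∧ memTri (right t) cs then (t , right t) ∷ [] else [])

  module _ (n : ℕ) (cs : List Tri) where

    ok : Tri → ℕ → Bool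
    ok t v = okv (freeTri n t) v

    tiled : List Tri → (Tri → ℕ) → List Lozenge → Bool
    tiled ts c ls = foldr (λ t b → b ∧ ok t (c t + coverCount t ls)) true ts

    -- Ways to complete a partial tiling with lozenges starting at triangles of ts, c counting
    -- how often each triangle is covered already.
    completions : List Tri → (Tri → ℕ) → ℕ
    completions ts c = sumSubsets (λ ls → ind (tiled ts c ls)) (concatMap (nbrs cs) ts)

    tiled-cong : ∀ ts c c′ ls ls′ → (∀ t → c t + coverCount t ls ≡ c′ t + coverCount t ls′) → tiled ts c ls ≡ tiled ts c′ ls′
    tiled-cong []       c c′ ls ls′ e = refl
    tiled-cong (t ∷ ts) c c′ ls ls′ e = cong₂ (λ a v → a ∧ ok t v) (tiled-cong ts c c′ ls ls′ e) (e t)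

    completions-cong : ∀ ts c c′ → (∀ t → c t ≡ c′ t) → completions ts c ≡ completions ts c′
    completions-cong ts c c′ e = sumSubsets-≗ (λ ls → cong ind (tiled-cong ts c c′ ls ls (λ t → cong (_+ coverCount t ls) (e t)))) (concatMap (nbrs cs) ts)

    -- Lozenges that start at later triangles do not touch `t`, so its cover count is final once the
    -- choice `ch` at `t` is made. Its test becomes a `gate` in front, and the choice affects the
    -- rest only through the counts `c ⊕ ch`.
    completions-∷ : ∀ t ts c → All (λ l → touches t l ≡ false) (concatMap (nbrs cs) ts) →
      completions (t ∷ ts) c ≡
      sumSubsets (λ ch → gate (ok t (c t + coverCount t ch)) (completions ts (c ⊕ ch))) (nbrs cs t)
    completions-∷ t ts c h = trans (sumSubsets-++ (λ ls → ind (tiled (t ∷ ts) c ls)) (nbrs cs t) (concatMap (nbrs cs) ts))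
      (sumSubsets-≗ (λ ch → trans (sumSubsets-cong (λ ls a → step ch ls a) h)
         (sumSubsets-gate (ok t (c t + coverCount t ch)) (λ ls → ind (tiled ts (c ⊕ ch) ls)) (concatMap (nbrs cs) ts))) (nbrs cs t))
      where
      ind-∧ : ∀ a b → ind (a ∧ b) ≡ gate b (ind a)
      ind-∧ true  true  = refl
      ind-∧ true  false = refl
      ind-∧ false true  = refl
      ind-∧ false false = refl
      step : ∀ ch ls → All (λ l → touches t l ≡ false) ls →
             ind (tiled (t ∷ ts) c (ch ++ ls)) ≡ gate (ok t (c t + coverCount t ch)) (ind (tiled ts (c ⊕ ch) ls))
      step ch ls a = trans (cong ind (cong₂ (λ u v → u ∧ ok t v)
          (tiled-cong ts c (c ⊕ ch) (ch ++ ls) ls (λ s → trans (cong (c s +_) (cover-++ s ch ls)) (sym (ℕ.+-assoc (c s) (coverCount s ch) (coverCount s ls)))))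
          (cong (c t +_) (trans (cover-++ t ch ls) (trans (cong (coverCount t ch +_) (cover-none t a)) (ℕ.+-identityʳ _))))))
        (ind-∧ (tiled ts (c ⊕ ch) ls) (ok t (c t + coverCount t ch)))

  tilingCount≡ : ∀ n x hole → tilingCount n x hole ≡ completions n (cells n x hole) (cells n x hole) (λ _ → 0)
  tilingCount≡ n x hole = count-subsets (isTiling n (cells n x hole)) (lozenges (cells n x hole))

  module Steps (n x : ℕ) (hole : Tri → Bool) where

    open Region n x hole

    opaque

      -- Opaque: outside the step lemmas that follow, the enumeration of subsets is never unfolded.
      N : List Tri → (Tri → ℕ) → ℕ
      N us c = completions n cs (alive us) c

      N-[] : ∀ c → N [] c ≡ 1
      N-[] c = refl

      tilingCount≡N : tilingCount n x hole ≡ N (strips (2 ℕ.* n) 0) (λ _ → 0)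
      tilingCount≡N = trans (tilingCount≡ n x hole) (cong (λ us → completions n cs us (λ _ → 0)) cs≡)

    data Later (p s : ℕ) : Tri → Set where
      same  : ∀ {u} → s < u → Later p s (cell p u)
      above : ∀ {q u} → p < q → Later p s (cell q u)

    later-cellsFrom : ∀ p s u r → s < u → All (Later p s) (cellsFrom p u r)
    later-cellsFrom p s u zero    h = []
    later-cellsFrom p s u (suc r) h = same h ∷ later-cellsFrom p s (suc u) r (ℕ.m≤n⇒m≤1+n h)

    later-above : ∀ p s q u r → p < q → All (Later p s) (cellsFrom q u r)
    later-above p s q u zero    h = []
    later-above p s q u (suc r) h = above h ∷ later-above p s q (suc u) r h

    later-strips : ∀ p s f q → p < q → All (Later p s) (strips f q)
    later-strips p s zero    q h = []
    later-strips p s (suc f) q h = All.++⁺ (later-above p s q 0 _ h) (later-strips p s f (suc q) (ℕ.m≤n⇒m≤1+n h))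

    cell-≢-later : ∀ {p s t} → Later p s t → ¬ (cell p s ≡ t)
    cell-≢-later (same h)  = cell-≢ (inj₂ (ℕ.<⇒≢ h))
    cell-≢-later (above h) = cell-≢ (inj₁ (ℕ.<⇒≢ h))

    later-up : ∀ {p s t} → Later p s t → Later p s (up t)
    later-up {p} {s} (same {u} h)      = subst (Later p s) (sym (up-cell p u)) (same (ℕ.m≤n⇒m≤1+n h))
    later-up {p} {s} (above {q} {u} h) = subst (Later p s) (sym (up-cell q u)) (above h)

    later-right : ∀ {p s t} → Later p s t → Later p s (right t)
    later-right {p} {s} (same {u} h)      = subst (Later p s) (sym (right-cell p u)) (above ℕ.≤-refl)
    later-right {p} {s} (above {q} {u} h) = subst (Later p s) (sym (right-cell q u)) (above (ℕ.m≤n⇒m≤1+n h))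

    later-untouched : ∀ {p s ts} → All (Later p s) ts → All (λ l → touches (cell p s) l ≡ false) (concatMap (nbrs cs) ts)
    later-untouched []                          = []
    later-untouched {p} {s} (_∷_ {t} l ls) = All.++⁺ (All.++⁺ (opt (memTri (up t) cs) (up t) (later-up l))
        (opt (leftPointing t ∧ memTri (right t) cs) (right t) (later-right l))) (later-untouched ls)
      where
      opt : ∀ b u → Later p s u → All (λ l → touches (cell p s) l ≡ false) (if b then (t , u) ∷ [] else [])
      opt true  u lu = cong₂ _∨_ (eqTri-≢ (cell-≢-later l)) (eqTri-≢ (cell-≢-later lu)) ∷ []
      opt false u lu = []

    rest : ℕ → ℕ → ℕ → ℕ → List Tri
    rest p s r f = cellsFrom p (suc s) r ++ strips f (suc p)

    later-alive : ∀ p s r f → All (Later p s) (alive (rest p s r f))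
    later-alive p s r f = All.filter⁺ (λ t → T? (inside t)) (All.++⁺ (later-cellsFrom p s (suc s) r ℕ.≤-refl) (later-strips p s f (suc p) ℕ.≤-refl))

    upLoz rightLoz : ℕ → ℕ → Lozenge
    upLoz    p s = cell p s , cell p (suc s)
    rightLoz p s = cell p s , cell (suc p) (suc s)

    inside-cell : ∀ p s → p < 2 ℕ.* n → s ≤ dbl (M p) → inside (cell p s) ≡ not (dead p s)
    inside-cell p s p< s≤ = cong (_∧ not (dead p s)) (inHalfHex-cell p s p< s≤)

    module At (p s r f : ℕ) (p< : p < 2 ℕ.* n) (s≤ : s ≤ dbl (M p)) where

      R = rest p s r f
      bu = memTri (cell p (suc s)) cs
      br = evenℕ s ∧ memTri (cell (suc p) (suc s)) cs
      fr = (suc p ≡ᵇ 2 ℕ.* n) ∧ evenℕ s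

      opaque
        unfolding N

        step-dead : dead p s ≡ true → ∀ c → N (cell p s ∷ R) c ≡ N R c
        step-dead d c with inside (cell p s) | inside-cell p s p< s≤
        ... | true  | e with trans e (cong not d)
        ...   | ()
        step-dead d c | false | e = refl

        step-alive : dead p s ≡ false → ∀ c → N (cell p s ∷ R) c ≡
          gate (okv fr (c (cell p s))) (N R c) +
          (gate (bu ∧ okv fr (c (cell p s) + 1)) (N R (c ⊕ (upLoz p s ∷ []))) +
           gate (br ∧ okv fr (c (cell p s) + 1)) (N R (c ⊕ (rightLoz p s ∷ []))))
        step-alive d c with inside (cell p s) | inside-cell p s p< s≤
        ... | false | e with trans e (cong not d)
        ...   | ()
        step-alive d c | true  | e = trans (completions-∷ n cs t (alive R) c (later-untouched (later-alive p s r f)))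
          (trans (cong₂ (λ b l → sumSubsets (λ ch → gate (okv b (c t + coverCount t ch)) (completions n cs (alive R) (c ⊕ ch))) l)
                    (cong ((suc p ≡ᵇ 2 ℕ.* n) ∧_) (leftPointing-cell p s)) nb)
            (trans (choices bu br fr (c t) (upLoz p s) (rightLoz p s) (coverCount t) (λ ch → completions n cs (alive R) (c ⊕ ch))
               refl (cover-hit t (upLoz p s) hit) (cover-hit t (rightLoz p s) hit)
               (trans (cover-++ t (upLoz p s ∷ []) (rightLoz p s ∷ [])) (cong₂ _+_ (cover-hit t (upLoz p s) hit) (cover-hit t (rightLoz p s) hit))))
             (cong₂ _+_ (cong (gate (okv fr (c t))) (completions-cong n cs (alive R) (c ⊕ []) c (λ u → ℕ.+-identityʳ (c u)))) refl)))
          where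
          t : Tri
          t = cell p s
          hit : ∀ {u} → eqTri t t ∨ u ≡ true
          hit = ∨-trueˡ _ (eqTri-refl t)
          nb : nbrs cs t ≡ (if bu then upLoz p s ∷ [] else []) ++ (if br then rightLoz p s ∷ [] else [])
          nb = cong₂ _++_ (cong (λ u → if memTri u cs then (t , u) ∷ [] else []) (up-cell p s))
                          (cong₂ (λ b u → if b ∧ memTri u cs then (t , u) ∷ [] else []) (leftPointing-cell p s) (right-cell p s))

      step-covered : dead p s ≡ false → ∀ c → c (cell p s) ≡ 1 → N (cell p s ∷ R) c ≡ N R c
      step-covered d c e rewrite step-alive d c | e with fr | bu | br
      ... | true  | true  | true  = ℕ.+-identityʳ _
      ... | true  | true  | false = ℕ.+-identityʳ _
      ... | true  | false | true  = ℕ.+-identityʳ _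
      ... | true  | false | false = ℕ.+-identityʳ _
      ... | false | true  | true  = ℕ.+-identityʳ _
      ... | false | true  | false = ℕ.+-identityʳ _
      ... | false | false | true  = ℕ.+-identityʳ _
      ... | false | false | false = ℕ.+-identityʳ _

      step-overfull : dead p s ≡ false → ∀ c → c (cell p s) ≡ 2 → N (cell p s ∷ R) c ≡ 0
      step-overfull d c e rewrite step-alive d c | e with fr | bu | br
      ... | true  | true  | true  = refl
      ... | true  | true  | false = refl
      ... | true  | false | true  = refl
      ... | true  | false | false = refl
      ... | false | true  | true  = refl
      ... | false | true  | false = refl
      ... | false | false | true  = refl
      ... | false | false | false = refl

      -- A right-pointing triangle does not touch `ℓ` with its vertical edge, and its partners below
      -- and on the left come earlier in the scan. If it is still uncovered, it can only be paired
      -- upward.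
      step-odd : dead p s ≡ false → evenℕ s ≡ false → ∀ c → c (cell p s) ≡ 0 →
                 N (cell p s ∷ R) c ≡ gate bu (N R (c ⊕ (upLoz p s ∷ [])))
      step-odd d o c e rewrite step-alive d c | e | o with suc p ≡ᵇ 2 ℕ.* n | bu
      ... | true  | true  = ℕ.+-identityʳ _
      ... | true  | false = refl
      ... | false | true  = ℕ.+-identityʳ _
      ... | false | false = refl

      not-last : (suc p ≡ᵇ 2 ℕ.* n) ≡ false → suc p < 2 ℕ.* n
      not-last eq = ℕ.≤∧≢⇒< p< λ h → case (trans (sym eq) (T⇒≡ (ℕ.≡⇒≡ᵇ (suc p) (2 ℕ.* n) h)))
        where
        case : ¬ (false ≡ true)
        case ()

      s′≤ : suc s ≤ dbl (M (suc p))
      s′≤ = subst (λ m → suc s ≤ dbl m) (sym (M-suc p)) (s≤s (ℕ.m≤n⇒m≤1+n s≤))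

      -- Inside the region the second summand is the lozenge across the vertical edge. In the last
      -- strip there is no partner, but the triangle is free and may stay uncovered: a protruding
      -- lozenge is thus a lozenge to the right that leaves the counts unchanged.
      step-even : dead p s ≡ false → (suc p < 2 ℕ.* n → dead (suc p) (suc s) ≡ false) → evenℕ s ≡ true → ∀ c → c (cell p s) ≡ 0 →
        N (cell p s ∷ R) c ≡ gate bu (N R (c ⊕ (upLoz p s ∷ []))) +
          N R (if suc p ≡ᵇ 2 ℕ.* n then c else c ⊕ (rightLoz p s ∷ []))
      step-even d d′ o c e rewrite step-alive d c | e | o with suc p ≡ᵇ 2 ℕ.* n in eq
      ... | true  rewrite trans (cong (λ q → memTri (cell q (suc s)) cs) (ℕ.≡ᵇ⇒≡ (suc p) (2 ℕ.* n) (≡⇒T eq))) (mem-beyond (suc s)) with bu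
      ...   | true  = trans (cong (N R c +_) (ℕ.+-identityʳ _)) (ℕ.+-comm (N R c) _)
      ...   | false = ℕ.+-identityʳ _
      step-even d d′ o c e | false
        rewrite mem-cell (suc p) (suc s) (not-last eq) s′≤ | d′ (not-last eq) with bu
      ... | true  = refl
      ... | false = refl

-- One strip of a tiling as one move of the particles.

module Rows where

  open import Defs
  open Rat
  open Strip
  open Cells
  open Counting
  open import Data.Bool using (Bool; true; false; not; _∨_; if_then_else_)
  open import Data.Bool.Properties using (∨-zeroʳ)
  open import Data.Integer using (+_)
  open import Data.List using (List; []; _∷_; _++_; length)
  open import Data.Nat as ℕ using (ℕ; suc; _≤_; _<_; _≡ᵇ_; s≤s; z≤n)
  import Data.Nat.Properties as ℕ
  open import Data.Product using (_×_; _,_; proj₁; proj₂)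
  open import Data.Rational using (ℚ; 0ℚ; _+_)
  open import Data.Rational.Properties using (+-identityˡ; +-identityʳ)
  open import Data.Sum using (_⊎_; inj₁; inj₂)
  open import Data.Unit using (⊤; tt)
  open import Function using (_∘_)
  open import Relation.Nullary using (¬_)
  open import Relation.Binary.PropositionalEquality

  dbl-mono : ∀ {a b} → a ≤ b → dbl a ≤ dbl b
  dbl-mono z≤n     = z≤n
  dbl-mono (s≤s h) = s≤s (s≤s (dbl-mono h))

  odd-dbl : ∀ k → evenℕ (suc (dbl k)) ≡ false
  odd-dbl k = cong not (even-dbl k)

  absurd-Bool : ∀ {b} {A : Set} → b ≡ true → b ≡ false → A
  absurd-Bool refl ()

  advance-zero : ∀ v as {K} → (∀ bs → trues bs ≡ bit v ℕ.+ trues as → length bs ≡ suc (length as) → K bs ≡ 0ℚ) → advance v as K ≡ 0ℚ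
  advance-zero true  []           e = e _ refl refl
  advance-zero false []           e = e _ refl refl
  advance-zero true  (a ∷ as)     e = advance-zero a as (λ bs t l → e _ (cong suc t) (cong suc l))
  advance-zero false (true ∷ as)  e =
    cong₂ _+_ (advance-zero false as (λ bs t l → e _ (cong suc t) (cong suc l))) (advance-zero true as (λ bs t l → e _ t (cong suc l)))
  advance-zero false (false ∷ as) e = advance-zero false as (λ bs t l → e _ t (cong suc l))

  advance-zero-true : ∀ as {K} → (∀ bs → trues (true ∷ bs) ≡ suc (trues as) → length bs ≡ length as → K (true ∷ bs) ≡ 0ℚ) → advance true as K ≡ 0ℚ
  advance-zero-true []       e = e [] refl refl
  advance-zero-true (a ∷ as) e = advance-zero a as (λ bs t l → e bs (cong suc t) l)

  -- The condition `hole-right` says that a removed right-pointing triangle has a removed neighbour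
  -- across its vertical edge. Hence a live left-pointing triangle before the last strip always has
  -- a live partner on its right.
  module Row-by-row (n x : ℕ) (hole : Tri → Bool)
    (hole-right : ∀ p i → Region.dead n x hole (suc p) (suc (dbl i)) ≡ true → Region.dead n x hole p (dbl i) ≡ true)
    where

    open Region n x hole
    open Steps n x hole

    hit : ∀ {q u} p s p′ s′ → (q ≡ p × u ≡ s) ⊎ (q ≡ p′ × u ≡ s′) →
          coverCount (cell q u) ((cell p s , cell p′ s′) ∷ []) ≡ 1
    hit p s p′ s′ (inj₁ (refl , refl)) = cover-hit (cell p s) (cell p s , cell p′ s′) (∨-trueˡ _ (eqTri-refl (cell p s)))
    hit p s p′ s′ (inj₂ (refl , refl)) = cover-hit (cell p′ s′) (cell p s , cell p′ s′)
      (trans (cong (eqTri (cell p′ s′) (cell p s) ∨_) (eqTri-refl (cell p′ s′))) (∨-zeroʳ _))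

    miss : ∀ {q u} p s p′ s′ → ¬ (q ≡ p) ⊎ ¬ (u ≡ s) → ¬ (q ≡ p′) ⊎ ¬ (u ≡ s′) →
           coverCount (cell q u) ((cell p s , cell p′ s′) ∷ []) ≡ 0
    miss {q} {u} p s p′ s′ h h′ = cover-miss (cell q u) (cell p s , cell p′ s′) (cong₂ _∨_ (eqTri-≢ (cell-≢ h)) (eqTri-≢ (cell-≢ h′)))

    goUp goRight : ℕ → ℕ → (Tri → ℕ) → (Tri → ℕ)
    goUp    p s c = c ⊕ (upLoz p s ∷ [])
    goRight p s c = if suc p ≡ᵇ 2 ℕ.* n then c else c ⊕ (rightLoz p s ∷ [])

    goUp-miss : ∀ {q u} p s c → ¬ (q ≡ p) ⊎ (¬ (u ≡ s) × ¬ (u ≡ suc s)) → goUp p s c (cell q u) ≡ c (cell q u)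
    goUp-miss {q} {u} p s c h = trans (cong (c (cell q u) ℕ.+_) (miss p s p (suc s) (l h) (r h))) (ℕ.+-identityʳ _)
      where
      l : ¬ (q ≡ p) ⊎ (¬ (u ≡ s) × ¬ (u ≡ suc s)) → ¬ (q ≡ p) ⊎ ¬ (u ≡ s)
      l (inj₁ e)       = inj₁ e
      l (inj₂ (e , _)) = inj₂ e
      r : ¬ (q ≡ p) ⊎ (¬ (u ≡ s) × ¬ (u ≡ suc s)) → ¬ (q ≡ p) ⊎ ¬ (u ≡ suc s)
      r (inj₁ e)       = inj₁ e
      r (inj₂ (_ , e)) = inj₂ e

    goUp-head : ∀ p s c → goUp p s c (cell p (suc s)) ≡ suc (c (cell p (suc s)))
    goUp-head p s c = trans (cong (c (cell p (suc s)) ℕ.+_) (hit p s p (suc s) (inj₂ (refl , refl)))) (ℕ.+-comm _ 1)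

    goRight-miss : ∀ {q u} p s c → ¬ (q ≡ p) ⊎ ¬ (u ≡ s) → ¬ (q ≡ suc p) ⊎ ¬ (u ≡ suc s) → goRight p s c (cell q u) ≡ c (cell q u)
    goRight-miss {q} {u} p s c h h′ with suc p ≡ᵇ 2 ℕ.* n
    ... | true  = refl
    ... | false = trans (cong (c (cell q u) ℕ.+_) (miss p s (suc p) (suc s) h h′)) (ℕ.+-identityʳ _)

    -- A live left-pointing triangle that is covered by no lozenge of its own strip is paired to the
    -- right. So the particles of a strip are its right-pointing triangles not covered from the
    -- left; each must form a lozenge with the left-pointing triangle below or above, and this is
    -- its half-step down or up.
    out : ℕ → ℕ → Bool → (Tri → ℕ) → (Tri → ℕ)
    out p i b c = if b ∨ dead p (dbl i) then c else goRight p (dbl i) c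

    outs : ℕ → ℕ → List Bool → (Tri → ℕ) → (Tri → ℕ)
    outs p i []       c = c
    outs p i (b ∷ bs) c = outs p (suc i) bs (out p i b c)

    Agree : ℕ → (Tri → ℕ) → (Tri → ℕ) → Set
    Agree p c c′ = ∀ q u → p < q → c′ (cell q u) ≡ c (cell q u)

    Agree-refl : ∀ {p c} → Agree p c c
    Agree-refl q u h = refl

    out-Agree : ∀ p i b {c c′} → Agree p c c′ → Agree p (out p i b c) (out p i b c′)
    out-Agree p i b {c} {c′} a q u h with b ∨ dead p (dbl i) | suc p ≡ᵇ 2 ℕ.* n
    ... | true  | _     = a q u h
    ... | false | true  = a q u h
    ... | false | false = cong (ℕ._+ _) (a q u h)

    outs-Agree : ∀ p i bs {c c′} → Agree p c c′ → Agree p (outs p i bs c) (outs p i bs c′)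
    outs-Agree p i []       a = a
    outs-Agree p i (b ∷ bs) a = outs-Agree p (suc i) bs (out-Agree p i b a)

    goUp-Agree : ∀ p s c → Agree p c (goUp p s c)
    goUp-Agree p s c q u h = goUp-miss p s c (inj₁ (λ e → ℕ.<⇒≢ h (sym e)))

    Good : ℕ → ℕ → List Bool → Set
    Good p i []       = ⊤
    Good p i (b ∷ bs) = (dead p (dbl i) ≡ true → b ≡ false) × Good p (suc i) bs

    LeftVal RightVal : (Tri → ℕ) → ℕ → ℕ → Bool → Set
    LeftVal  c p s v = (dead p s ≡ true × v ≡ false) ⊎ (dead p s ≡ false × c (cell p s) ≡ bit v)
    RightVal c p s a = (dead p s ≡ true × a ≡ false) ⊎ (dead p s ≡ false × c (cell p s) ≡ bit (not a))

    -- The cover c of strip p, from its 2i-th triangle on: v tells whether that triangle is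
    -- covered from below, and as which of the right-pointing triangles are not covered.
    data Row (c : Tri → ℕ) (p : ℕ) : ℕ → Bool → List Bool → Set where
      top  : ∀ {i v} → LeftVal c p (dbl i) v → Row c p i v []
      pair : ∀ {i v a as} → LeftVal c p (dbl i) v → RightVal c p (suc (dbl i)) a → Row c p (suc i) false as → Row c p i v (a ∷ as)

    Row-head : ∀ {c p i v as} → Row c p i v as → LeftVal c p (dbl i) v
    Row-head (top l)      = l
    Row-head (pair l _ _) = l

    Row-map : ∀ {c c′ p i v v′ as} → (∀ u → dbl i < u → c′ (cell p u) ≡ c (cell p u)) → LeftVal c′ p (dbl i) v′ →
              Row c p i v as → Row c′ p i v′ as
    Row-map e l (top _) = top l
    Row-map {c} {c′} {p} {i} e l (pair _ r w) = pair l (right′ r)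
        (Row-map (λ u h → e u (ℕ.<-trans (ℕ.<-trans (ℕ.n<1+n _) (ℕ.n<1+n _)) h)) (left′ (Row-head w)) w)
      where
      right′ : ∀ {a} → RightVal c p (suc (dbl i)) a → RightVal c′ p (suc (dbl i)) a
      right′ (inj₁ h)       = inj₁ h
      right′ (inj₂ (h , k)) = inj₂ (h , trans (e _ (ℕ.n<1+n _)) k)
      left′ : ∀ {v} → LeftVal c p (dbl (suc i)) v → LeftVal c′ p (dbl (suc i)) v
      left′ (inj₁ h)       = inj₁ h
      left′ (inj₂ (h , k)) = inj₂ (h , trans (e _ (ℕ.<-trans (ℕ.n<1+n _) (ℕ.n<1+n _))) k)

    Fits : Bool → List Bool → List Bool → Set
    Fits v as bs = trues bs ≡ bit v ℕ.+ trues as × length bs ≡ suc (length as)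

    -- `advance` knows nothing of the hole and also moves particles onto removed triangles. A
    -- continuation `K` is therefore required to count the remaining tilings for admissible
    -- configurations and to vanish for all others; for the hole, this vanishing is later supplied
    -- by the Pfaffian.
    record Next (p f i : ℕ) (c : Tri → ℕ) (v : Bool) (as : List Bool) (K : List Bool → ℚ) : Set where
      field
        good : ∀ bs → Fits v as bs → Good p i bs → ∀ c′ → Agree p (outs p i bs c) c′ → K bs ≡ ι (+ N (strips f (suc p)) c′)
        bad  : ∀ bs → Fits v as bs → ¬ Good p i bs → K bs ≡ 0ℚ
    open Next

    Next-∷ : ∀ {p f i c c₁ v a as a′ K} b → bit b ℕ.+ bit a′ ≡ bit v ℕ.+ bit a → (dead p (dbl i) ≡ true → b ≡ false) →
             Agree p (out p i b c) c₁ → Next p f i c v (a ∷ as) K → Next p f (suc i) c₁ a′ as (K ∘ (b ∷_))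
    Next-∷ {p} {f} {i} {c} {c₁} {v} {a} {as} {a′} b e d ag k = record
      { good = λ bs ft g c′ ag′ → good k (b ∷ bs) (fits {bs} ft) (d , g) c′
                 (λ q u h → trans (ag′ q u h) (outs-Agree p (suc i) bs ag q u h))
      ; bad  = λ bs ft ng → bad k (b ∷ bs) (fits {bs} ft) (ng ∘ proj₂) }
      where
      fits : ∀ {bs} → Fits a′ as bs → Fits v (a ∷ as) (b ∷ bs)
      fits (t , l) = trans (cong (bit b ℕ.+_) t) (trans (sym (ℕ.+-assoc (bit b) (bit a′) (trues as)))
        (trans (cong (ℕ._+ trues as) e) (ℕ.+-assoc (bit v) (bit a) (trues as)))) , cong suc l

    module _ (p f : ℕ) (p< : p < 2 ℕ.* n) where

      alive-right : ∀ i → dead p (dbl i) ≡ false → suc p < 2 ℕ.* n → dead (suc p) (suc (dbl i)) ≡ false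
      alive-right i d _ = ≡false _ (λ e → absurd-Bool (hole-right p i e) d)

      below : ∀ i l → i ℕ.+ l ≡ M p → dbl i ≤ dbl (M p)
      below i l e = dbl-mono (ℕ.≤-trans (ℕ.m≤m+n i l) (ℕ.≤-reflexive e))

      below′ : ∀ i l → i ℕ.+ suc l ≡ M p → suc (dbl i) ≤ dbl (M p)
      below′ i l e = ℕ.≤-trans (ℕ.n≤1+n _) (below (suc i) l (trans (sym (ℕ.+-suc i l)) e))

      -- The scan branches exactly where `advance` does. A left-pointing triangle covered from below
      -- is a target already taken; an uncovered one next to a particle is either its lower target
      -- or is paired to the right; with no particle above it, it must be paired to the right.
      row-right : ∀ as a i c K → suc i ℕ.+ length as ≡ M p → RightVal c p (suc (dbl i)) a → Row c p (suc i) false as →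
        Next p f (suc i) c a as K →
        ι (+ N (cellsFrom p (suc (dbl i)) (suc (suc (dbl (length as)))) ++ strips f (suc p)) c) ≡ advance a as K
      row-left : ∀ as v i c K → i ℕ.+ length as ≡ M p → Row c p i v as → Next p f i c v as K →
        ι (+ N (cellsFrom p (dbl i) (suc (dbl (length as))) ++ strips f (suc p)) c) ≡ advance v as K

      row-right as false i c K e (inj₁ (d , _)) w k =
        trans (cong (ι ∘ +_) (At.step-dead p (suc (dbl i)) _ f p< (below′ i _ (trans (ℕ.+-suc i _) e)) d c)) (row-left as false (suc i) c K e w k)
      row-right as false i c K e (inj₂ (d , h)) w k =
        trans (cong (ι ∘ +_) (At.step-covered p (suc (dbl i)) _ f p< (below′ i _ (trans (ℕ.+-suc i _) e)) d c h)) (row-left as false (suc i) c K e w k)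
      row-right as true i c K e (inj₁ (_ , ())) w k
      row-right as true i c K e (inj₂ (d , h)) w k =
        trans (cong (ι ∘ +_) (trans (At.step-odd p (suc (dbl i)) (suc (dbl (length as))) f p< (below′ i _ (trans (ℕ.+-suc i _) e)) d (odd-dbl i) c h)
                (cong (λ b → gate b (N R (goUp p (suc (dbl i)) c))) (mem-cell p (suc (suc (dbl i))) p< (below (suc i) _ e)))))
              (go (dead p (dbl (suc i))) refl)
        where
        R = rest p (suc (dbl i)) (suc (dbl (length as))) f
        zero-head : dead p (dbl (suc i)) ≡ false → LeftVal c p (dbl (suc i)) false → c (cell p (dbl (suc i))) ≡ 0
        zero-head d′ (inj₁ (d″ , _)) = absurd-Bool d″ d′
        zero-head d′ (inj₂ (_ , z))  = z
        go : ∀ b → dead p (dbl (suc i)) ≡ b → ι (+ gate (not b) (N R (goUp p (suc (dbl i)) c))) ≡ advance true as K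
        -- The only partner of this triangle is removed, so no tiling is left. `advance true` still
        -- places the particle there, and `bad` gives this the value 0.
        go true  d′ = sym (advance-zero-true as (λ bs t l → bad k (true ∷ bs) (t , cong suc l) (λ g → absurd-Bool refl (proj₁ g d′))))
        go false d′ = row-left as true (suc i) (goUp p (suc (dbl i)) c) K e
          (Row-map (λ u h → goUp-miss p (suc (dbl i)) c (inj₂ ((λ { refl → ℕ.<-asym h (ℕ.n<1+n _) }) , (λ { refl → ℕ.<-irrefl refl h }))))
            (inj₂ (d′ , trans (goUp-head p (suc (dbl i)) c) (cong suc (zero-head d′ (Row-head w))))) w)
          (record { good = λ bs ft g c′ ag → good k bs ft g c′
                             (λ q u h → trans (ag q u h) (outs-Agree p (suc i) bs (goUp-Agree p (suc (dbl i)) c) q u h))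
                  ; bad = bad k })
      row-left [] v i c K e (top (inj₁ (d , refl))) k =
        trans (cong (ι ∘ +_) (At.step-dead p (dbl i) 0 f p< (below i 0 e) d c))
          (sym (good k (false ∷ []) (refl , refl) ((λ _ → refl) , tt) c
            (λ q u h → cong (λ b → (if b then c else goRight p (dbl i) c) (cell q u)) (sym d) )))
      row-left [] true i c K e (top (inj₂ (d , h))) k =
        trans (cong (ι ∘ +_) (At.step-covered p (dbl i) 0 f p< (below i 0 e) d c h))
          (sym (good k (true ∷ []) (refl , refl) ((λ d′ → absurd-Bool d′ d) , tt) c (Agree-refl {p} {c})))
      row-left [] false i c K e (top (inj₂ (d , h))) k =
        trans (cong (ι ∘ +_) (trans (At.step-even p (dbl i) 0 f p< (below i 0 e) d (alive-right i d) (even-dbl i) c h)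
            (cong (λ b → gate b (N (strips f (suc p)) (goUp p (dbl i) c)) ℕ.+ N (strips f (suc p)) (goRight p (dbl i) c))
              (subst (λ m → memTri (cell p (suc (dbl m))) cs ≡ false) (trans (sym e) (ℕ.+-identityʳ i)) (mem-above p)))))
          (sym (good k (false ∷ []) (refl , refl) ((λ d′ → absurd-Bool d′ d) , tt) (goRight p (dbl i) c)
            (λ q u h → cong (λ b → (if b then c else goRight p (dbl i) c) (cell q u)) (sym d))))
      row-left (a ∷ as) v i c K e (pair (inj₁ (d , refl)) r w) k =
        trans (cong (ι ∘ +_) (At.step-dead p (dbl i) _ f p< (below i _ e) d c))
          (trans (row-right as a i c (K ∘ (false ∷_)) (trans (sym (ℕ.+-suc i _)) e) r w
                   (Next-∷ false refl (λ _ → refl) (λ q u h → cong (λ b → (if b then c else goRight p (dbl i) c) (cell q u)) (sym d)) k))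
                 (onlyDown a k))
        where
        onlyDown : ∀ a → Next p f i c false (a ∷ as) K → advance a as (K ∘ (false ∷_)) ≡ advance false (a ∷ as) K
        onlyDown false k = refl
        onlyDown true  k = trans (sym (+-identityˡ _)) (cong (_+ advance true as (K ∘ (false ∷_)))
          (sym (advance-zero false as (λ bs t l → bad k (true ∷ bs) (cong suc t , cong suc l) (λ g → absurd-Bool refl (proj₁ g d))))))
      row-left (a ∷ as) true i c K e (pair (inj₂ (d , h)) r w) k =
        trans (cong (ι ∘ +_) (At.step-covered p (dbl i) _ f p< (below i _ e) d c h))
          (row-right as a i c (K ∘ (true ∷_)) (trans (sym (ℕ.+-suc i _)) e) r w (Next-∷ true refl (λ d′ → absurd-Bool d′ d) (Agree-refl {p} {c}) k))
      row-left (a ∷ as) false i c K e (pair (inj₂ (d , h)) r w) k =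
        trans (cong (ι ∘ +_) (At.step-even p (dbl i) (suc (suc (dbl (length as)))) f p< (below i _ e) d (alive-right i d) (even-dbl i) c h))
          (trans (ι-+ (+ gate mem (N R (goUp p (dbl i) c))) (+ N R (goRight p (dbl i) c))) (finish a r k))
        where
        R = rest p (dbl i) (suc (suc (dbl (length as)))) f
        e′ = trans (sym (ℕ.+-suc i (length as))) e
        s≤ = below′ i (length as) e
        mem = memTri (cell p (suc (dbl i))) cs
        right-Row : Row (goRight p (dbl i) c) p (suc i) false as
        right-Row = Row-map (λ u h → goRight-miss p (dbl i) c (inj₂ (λ { refl → ℕ.<-asym h (ℕ.<-trans (ℕ.n<1+n _) (ℕ.n<1+n _)) })) (inj₁ (λ ())))
          (left′ (Row-head w)) w
          where
          left′ : LeftVal c p (dbl (suc i)) false → LeftVal (goRight p (dbl i) c) p (dbl (suc i)) false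
          left′ (inj₁ z)       = inj₁ z
          left′ (inj₂ (z , y)) = inj₂ (z , trans (goRight-miss p (dbl i) c (inj₂ (λ q → ℕ.<⇒≢ (ℕ.<-trans (ℕ.n<1+n _) (ℕ.n<1+n _)) (sym q))) (inj₁ (λ ()))) y)
        right-RightVal : ∀ {a} → RightVal c p (suc (dbl i)) a → RightVal (goRight p (dbl i) c) p (suc (dbl i)) a
        right-RightVal (inj₁ z)       = inj₁ z
        right-RightVal (inj₂ (z , y)) = inj₂ (z , trans (goRight-miss p (dbl i) c (inj₂ (λ q → ℕ.<⇒≢ (ℕ.n<1+n _) (sym q))) (inj₁ (λ ()))) y)
        up-Row : Row (goUp p (dbl i) c) p (suc i) false as
        up-Row = Row-map (λ u h → goUp-miss p (dbl i) c (inj₂ ((λ { refl → ℕ.<-asym h (ℕ.<-trans (ℕ.n<1+n _) (ℕ.n<1+n _)) }) , (λ { refl → ℕ.<-asym h (ℕ.n<1+n _) }))))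
          (left′ (Row-head w)) w
          where
          left′ : LeftVal c p (dbl (suc i)) false → LeftVal (goUp p (dbl i) c) p (dbl (suc i)) false
          left′ (inj₁ z)       = inj₁ z
          left′ (inj₂ (z , y)) = inj₂ (z , trans (goUp-miss p (dbl i) c (inj₂ ((λ q → ℕ.<⇒≢ (ℕ.<-trans (ℕ.n<1+n _) (ℕ.n<1+n _)) (sym q)) , (λ q → ℕ.<⇒≢ (ℕ.n<1+n _) (sym q))))) y)
        agree-right : Agree p (out p i false c) (goRight p (dbl i) c)
        agree-right q u h = cong (λ b → (if b then c else goRight p (dbl i) c) (cell q u)) (sym d)
        down : ∀ a → RightVal c p (suc (dbl i)) a → Next p f i c false (a ∷ as) K →
               ι (+ N R (goRight p (dbl i) c)) ≡ advance a as (K ∘ (false ∷_))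
        down a r k = row-right as a i (goRight p (dbl i) c) (K ∘ (false ∷_)) e′ (right-RightVal r) right-Row
          (Next-∷ false refl (λ _ → refl) agree-right k)
        gated : ∀ b {m} → m ≡ 0 → ι (+ gate b m) ≡ 0ℚ
        gated true  refl = refl
        gated false refl = refl
        noUp : mem ≡ false → ι (+ gate mem (N R (goUp p (dbl i) c))) ≡ 0ℚ
        noUp m = cong (λ b → ι (+ gate b (N R (goUp p (dbl i) c)))) m
        finish : ∀ a → RightVal c p (suc (dbl i)) a → Next p f i c false (a ∷ as) K →
          ι (+ gate mem (N R (goUp p (dbl i) c))) + ι (+ N R (goRight p (dbl i) c)) ≡ advance false (a ∷ as) K
        finish false (inj₁ (d′ , z)) k = trans (cong₂ _+_ (noUp (trans (mem-cell p (suc (dbl i)) p< s≤) (cong not d′))) (down false (inj₁ (d′ , z)) k)) (+-identityˡ _)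
        -- The slanted lozenge would cover a triangle that is already covered from the left. Its
        -- contribution is 0, and `advance` has no branch for it.
        finish false (inj₂ (d′ , z)) k = trans (cong₂ _+_ over (down false (inj₂ (d′ , z)) k)) (+-identityˡ _)
          where
          over : ι (+ gate mem (N R (goUp p (dbl i) c))) ≡ 0ℚ
          over = gated mem
            (At.step-overfull p (suc (dbl i)) (suc (dbl (length as))) f p< s≤ d′ (goUp p (dbl i) c) (trans (goUp-head p (dbl i) c) (cong suc z)))
        finish true (inj₁ (_ , ())) k
        finish true (inj₂ (d′ , z)) k = cong₂ _+_
          (trans (cong (λ b → ι (+ gate b (N R (goUp p (dbl i) c)))) (trans (mem-cell p (suc (dbl i)) p< s≤) (cong not d′)))
            (row-right as false i (goUp p (dbl i) c) (K ∘ (true ∷_)) e′ (inj₂ (d′ , trans (goUp-head p (dbl i) c) (cong suc z))) up-Row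
              (Next-∷ true refl (λ d″ → absurd-Bool d″ d) (goUp-Agree p (dbl i) c) k)))
          (down true (inj₂ (d′ , z)) k)

-- Composing the strips; the region without a hole.

module Regions where

  open import Defs
  open Rat
  open Strip
  open Cells
  open Counting
  open Rows
  open import Data.Bool using (Bool; true; false; not; _∨_; if_then_else_)
  open import Data.Empty using (⊥-elim)
  open import Data.Integer as ℤ using (+_)
  import Data.Integer.Properties as ℤ
  open import Data.List using (List; []; _∷_; _++_; length; replicate)
  open import Data.List.Properties using (length-replicate)
  open import Data.Nat as ℕ using (ℕ; zero; suc; _≤_; _<_; _≡ᵇ_; _∸_; s≤s; z≤n)
  import Data.Nat.Properties as ℕ
  open import Data.Product using (_×_; _,_)
  open import Data.Rational using (ℚ; 0ℚ; 1ℚ; _+_)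
  open import Data.Sum using (_⊎_; inj₁; inj₂)
  open import Data.Unit using (tt)
  open import Function using (_∘_)
  open import Relation.Nullary using (¬_)
  open import Relation.Binary.PropositionalEquality

  if-false : ∀ {A : Set} {e} {a b : A} → e ≡ false → (if e then a else b) ≡ b
  if-false refl = refl

  trues-replicate : ∀ m → trues (replicate m true) ≡ m
  trues-replicate zero    = refl
  trues-replicate (suc m) = cong suc (trues-replicate m)

  module Transfer (n x : ℕ) (hole : Tri → Bool)
    (hole-right : ∀ p i → Region.dead n x hole (suc p) (suc (dbl i)) ≡ true → Region.dead n x hole p (dbl i) ≡ true)
    where

    open Region n x hole
    open Steps n x hole
    open Row-by-row n x hole hole-right

    -- A removed left-pointing triangle covers nothing to its right. If the triangle across its
    -- vertical edge is live, that triangle is not covered from the left, so a particle is born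
    -- there; if it is removed as well, no particle enters.
    merge : ℕ → ℕ → List Bool → List Bool
    merge p i []       = []
    merge p i (b ∷ bs) = (if dead p (dbl i) then not (dead (suc p) (suc (dbl i))) else b) ∷ merge p (suc i) bs

    length-merge : ∀ p i bs → length (merge p i bs) ≡ length bs
    length-merge p i []       = refl
    length-merge p i (b ∷ bs) = cong suc (length-merge p (suc i) bs)

    merge-good : ∀ p → (∀ i → dead p (dbl i) ≡ true → dead (suc p) (suc (dbl i)) ≡ true) →
                 ∀ i bs → Good p i bs → merge p i bs ≡ bs
    merge-good p h i []       g       = refl
    merge-good p h i (b ∷ bs) (d , g) = cong₂ _∷_ (go (dead p (dbl i)) refl) (merge-good p h (suc i) bs g)
      where
      go : ∀ e → dead p (dbl i) ≡ e → (if e then not (dead (suc p) (suc (dbl i))) else b) ≡ b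
      go true  e = trans (cong not (h i e)) (sym (d e))
      go false e = refl

    merge-++ : ∀ p i as bs → (∀ j → j < length as → dead p (dbl (j ℕ.+ i)) ≡ false) →
               merge p i (as ++ bs) ≡ as ++ merge p (length as ℕ.+ i) bs
    merge-++ p i []       bs h = refl
    merge-++ p i (a ∷ as) bs h = cong₂ _∷_ (if-false (h 0 (s≤s z≤n)))
      (trans (merge-++ p (suc i) as bs (λ j l → trans (cong (λ m → dead p (dbl m)) (ℕ.+-suc j i)) (h (suc j) (s≤s l))))
        (cong (λ m → as ++ merge p m bs) (ℕ.+-suc (length as) i)))

    Good-++ : ∀ p i as bs → (∀ j → j < length as → dead p (dbl (j ℕ.+ i)) ≡ false) → Good p (length as ℕ.+ i) bs → Good p i (as ++ bs)
    Good-++ p i []       bs h g = g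
    Good-++ p i (a ∷ as) bs h g = (λ d → absurd-Bool d (h 0 (s≤s z≤n))) ,
      Good-++ p (suc i) as bs (λ j l → trans (cong (λ m → dead p (dbl m)) (ℕ.+-suc j i)) (h (suc j) (s≤s l)))
        (subst (λ m → Good p m bs) (sym (ℕ.+-suc (length as) i)) g)

    Good-all : ∀ p i bs → (∀ j → i ≤ j → dead p (dbl j) ≡ false) → Good p i bs
    Good-all p i []       h = tt
    Good-all p i (b ∷ bs) h = (λ d → absurd-Bool d (h i ℕ.≤-refl)) , Good-all p (suc i) bs (λ j l → h j (ℕ.<⇒≤ l))

    out-other : ∀ p i b c {q u} → p < q → ¬ (q ≡ suc p) ⊎ ¬ (u ≡ suc (dbl i)) → out p i b c (cell q u) ≡ c (cell q u)
    out-other p i b c h h′ with b ∨ dead p (dbl i)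
    ... | true  = refl
    ... | false = goRight-miss p (dbl i) c (inj₁ (λ e → ℕ.<⇒≢ h (sym e))) h′

    outs-above : ∀ p i bs c {q u} → suc p < q → outs p i bs c (cell q u) ≡ c (cell q u)
    outs-above p i []       c h = refl
    outs-above p i (b ∷ bs) c h = trans (outs-above p (suc i) bs (out p i b c) h)
      (out-other p i b c (ℕ.<-trans (ℕ.n<1+n p) h) (inj₁ (λ e → ℕ.<⇒≢ h (sym e))))

    outs-low : ∀ p i bs c {u} → u ≤ dbl i → outs p i bs c (cell (suc p) u) ≡ c (cell (suc p) u)
    outs-low p i []       c h = refl
    outs-low p i (b ∷ bs) c h = trans (outs-low p (suc i) bs (out p i b c) (ℕ.≤-trans h (ℕ.≤-trans (ℕ.n≤1+n _) (ℕ.n≤1+n _))))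
      (out-other p i b c (ℕ.n<1+n p) (inj₂ (λ { refl → ℕ.<-irrefl refl h })))

    out-value : ∀ p i b c → suc p < 2 ℕ.* n → c (cell (suc p) (suc (dbl i))) ≡ 0 →
                out p i b c (cell (suc p) (suc (dbl i))) ≡ bit (not (b ∨ dead p (dbl i)))
    out-value p i b c h z with b ∨ dead p (dbl i)
    ... | true  = z
    ... | false with suc p ≡ᵇ 2 ℕ.* n in e
    ...   | true  = ⊥-elim (ℕ.<⇒≢ h (ℕ.≡ᵇ⇒≡ (suc p) (2 ℕ.* n) (≡⇒T e)))
    ...   | false = cong₂ ℕ._+_ z (hit p (dbl i) (suc p) (suc (dbl i)) (inj₂ (refl , refl)))

    Row-merge : ∀ p → suc p < 2 ℕ.* n → ∀ bs i c c′ → (∀ u → dbl i ≤ u → c (cell (suc p) u) ≡ 0) →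
                (∀ u → dbl i ≤ u → c′ (cell (suc p) u) ≡ outs p i bs c (cell (suc p) u)) → Row c′ (suc p) i false (merge p i bs)
    Row-merge p h bs i c c′ z a = build bs z a
      where
      left : ∀ bs → (∀ u → dbl i ≤ u → c (cell (suc p) u) ≡ 0) →
             (∀ u → dbl i ≤ u → c′ (cell (suc p) u) ≡ outs p i bs c (cell (suc p) u)) → LeftVal c′ (suc p) (dbl i) false
      left bs z a with dead (suc p) (dbl i) in d
      ... | true  = inj₁ (refl , refl)
      ... | false = inj₂ (refl , trans (a _ ℕ.≤-refl) (trans (outs-low p i bs c ℕ.≤-refl) (z _ ℕ.≤-refl)))
      build : ∀ bs → (∀ u → dbl i ≤ u → c (cell (suc p) u) ≡ 0) →
             (∀ u → dbl i ≤ u → c′ (cell (suc p) u) ≡ outs p i bs c (cell (suc p) u)) → Row c′ (suc p) i false (merge p i bs)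
      build []       z a = top (left [] z a)
      build (b ∷ bs) z a = pair (left (b ∷ bs) z a) (right-val (dead (suc p) (suc (dbl i))) refl (dead p (dbl i)) refl)
        (Row-merge p h bs (suc i) (out p i b c) c′
          (λ u l → trans (out-other p i b c (ℕ.n<1+n p) (inj₂ (λ { refl → ℕ.<-irrefl refl l }))) (z u (ℕ.≤-trans (ℕ.≤-trans (ℕ.n≤1+n _) (ℕ.n≤1+n _)) l)))
          (λ u l → a u (ℕ.≤-trans (ℕ.≤-trans (ℕ.n≤1+n _) (ℕ.n≤1+n _)) l)))
        where
        value : c′ (cell (suc p) (suc (dbl i))) ≡ bit (not (b ∨ dead p (dbl i)))
        value = trans (a _ (ℕ.n≤1+n _)) (trans (outs-low p (suc i) bs (out p i b c) (ℕ.n≤1+n _)) (out-value p i b c h (z _ (ℕ.n≤1+n _))))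
        ∨-tr : ∀ b → b ∨ true ≡ true
        ∨-tr true  = refl
        ∨-tr false = refl
        ∨-fa : ∀ b → b ∨ false ≡ b
        ∨-fa true  = refl
        ∨-fa false = refl
        right-val : ∀ e → dead (suc p) (suc (dbl i)) ≡ e → ∀ e′ → dead p (dbl i) ≡ e′ →
                    RightVal c′ (suc p) (suc (dbl i)) (if e′ then not (dead (suc p) (suc (dbl i))) else b)
        right-val true  d e′    d′ rewrite trans (sym d′) (hole-right p i d) = inj₁ (d , cong not d)
        right-val false d true  d′ = inj₂ (d , trans value (trans (cong (λ t → bit (not (b ∨ t))) d′)
          (trans (cong (bit ∘ not) (∨-tr b)) (cong (λ e → bit (not (not e))) (sym d)))))
        right-val false d false d′ = inj₂ (d , trans value (trans (cong (λ t → bit (not (b ∨ t))) d′) (cong (bit ∘ not) (∨-fa b))))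

    -- V p as is the claimed number of ways to tile strips p, p+1, …, 2n-1 when the particles
    -- entering strip p are as; T p is their number.
    record Model : Set where
      field
        V K     : ℕ → List Bool → ℚ
        T       : ℕ → ℕ
        final   : ∀ as → length as ≡ M (2 ℕ.* n) → trues as ≡ T (2 ℕ.* n) → V (2 ℕ.* n) as ≡ 1ℚ
        step    : ∀ p → p < 2 ℕ.* n → ∀ as → advance false as (K p) ≡ V p as
        next    : ∀ p → p < 2 ℕ.* n → ∀ bs → length bs ≡ suc (M p) → trues bs ≡ T p → Good p 0 bs →
                  K p bs ≡ V (suc p) (merge p 0 bs) × trues (merge p 0 bs) ≡ T (suc p)
        discard : ∀ p → p < 2 ℕ.* n → ∀ bs → length bs ≡ suc (M p) → trues bs ≡ T p → ¬ Good p 0 bs → K p bs ≡ 0ℚ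

    module _ (mod : Model) where
      open Model mod

      -- Induction on the number `f` of strips left. Beyond `ℓ` no cells remain and protruding
      -- lozenges are not recorded in the counts, so the description of the cover by `Row` can be
      -- demanded only for `0 < f`.
      N≡V : ∀ f p c as → p ℕ.+ f ≡ 2 ℕ.* n → (0 < f → Row c p 0 false as) → (∀ q u → p < q → c (cell q u) ≡ 0) →
            length as ≡ M p → trues as ≡ T p → ι (+ N (strips f p) c) ≡ V p as
      N≡V zero    p c as e r z l t = trans (cong (ι ∘ +_) (N-[] c)) (sym (subst (λ q → V q as ≡ 1ℚ) p≡
          (final as (trans l (cong M (sym p≡))) (trans t (cong T (sym p≡))))))
        where
        p≡ : 2 ℕ.* n ≡ p
        p≡ = trans (sym e) (ℕ.+-identityʳ p)
      N≡V (suc f) p c as e r z l t = trans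
          (subst (λ m → ι (+ N (cellsFrom p 0 (suc (dbl m)) ++ strips f (suc p)) c) ≡ advance false as (K p)) l
            (row-left p f p< as false 0 c (K p) l (r (s≤s z≤n)) nxt))
          (step p p< as)
        where
        e′ : suc p ℕ.+ f ≡ 2 ℕ.* n
        e′ = trans (sym (ℕ.+-suc p f)) e
        p< : p < 2 ℕ.* n
        p< = ℕ.≤-trans (ℕ.m≤m+n (suc p) f) (ℕ.≤-reflexive e′)
        nxt : Next p f 0 c false as (K p)
        nxt = record
          { good = λ bs (tb , lb) g c′ ag → let (k , t′) = next p p< bs (trans lb (cong suc l)) (trans tb t) g in
              trans k (sym (N≡V f (suc p) c′ (merge p 0 bs) e′
                (λ f> → Row-merge p (ℕ.≤-trans (ℕ.≤-trans (ℕ.≤-reflexive (ℕ.+-comm 1 (suc p))) (ℕ.+-monoʳ-≤ (suc p) f>)) (ℕ.≤-reflexive e′)) bs 0 c c′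
                          (λ u _ → z (suc p) u (ℕ.n<1+n p)) (λ u _ → ag (suc p) u (ℕ.n<1+n p)))
                (λ q u h → trans (ag q u (ℕ.<-trans (ℕ.n<1+n p) h)) (trans (outs-above p 0 bs c h) (z q u (ℕ.<-trans (ℕ.n<1+n p) h))))
                (trans (length-merge p 0 bs) (trans lb (trans (cong suc l) (sym (M-suc p))))) t′))
          ; bad = λ bs (tb , lb) ng → discard p p< bs (trans lb (cong suc l)) (trans tb t) ng }

      Row-start : (∀ i → dead 0 (suc (dbl i)) ≡ false) → ∀ m i → Row (λ _ → 0) 0 i false (replicate m true)
      Row-start h zero    i = top (left i)
        where
        left : ∀ i → LeftVal (λ _ → 0) 0 (dbl i) false
        left i with dead 0 (dbl i)
        ... | true  = inj₁ (refl , refl)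
        ... | false = inj₂ (refl , refl)
      Row-start h (suc m) i = pair (left i) (inj₂ (h i , refl)) (Row-start h m (suc i))
        where
        left : ∀ i → LeftVal (λ _ → 0) 0 (dbl i) false
        left i with dead 0 (dbl i)
        ... | true  = inj₁ (refl , refl)
        ... | false = inj₂ (refl , refl)

      -- The right-pointing triangles of strip 0 stand on the left side of the hexagon, where
      -- nothing covers them from the left. So a particle starts at each of the `2x` unit edges of
      -- that side.
      tilingCount≡V : (∀ i → dead 0 (suc (dbl i)) ≡ false) → T 0 ≡ x ℕ.+ x →
                      ι (+ tilingCount n x hole) ≡ V 0 (replicate (M 0) true)
      tilingCount≡V h t = trans (cong (ι ∘ +_) tilingCount≡N)
        (N≡V (2 ℕ.* n) 0 (λ _ → 0) (replicate (M 0) true) refl (λ _ → Row-start h (M 0) 0) (λ _ _ _ → refl) (length-replicate (M 0))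
          (trans (trues-replicate (M 0)) (trans (trans (ℕ.+-identityʳ (2 ℕ.* x)) (cong (x ℕ.+_) (ℕ.+-identityʳ x))) (sym t))))

  starts : ℕ → ℕ → List Point
  starts n x = points (2 ℕ.* n) (ℤ.suc (ℤ.- + (2 ℕ.* x))) (replicate (2 ℕ.* x) true)

  suc-neg : ∀ m → ℤ.suc (ℤ.- + suc m) ≡ ℤ.- + m
  suc-neg zero    = refl
  suc-neg (suc m) = refl

  MF≡pf : ∀ n x → ι (+ MF n x) ≡ pf x (starts n x)
  MF≡pf n x = trans (tilingCount≡V model (λ _ → refl) refl)
      (cong (λ m → pf x (points (2 ℕ.* n) (ℤ.suc (ℤ.- + m)) (replicate m true))) (ℕ.+-identityʳ (2 ℕ.* x)))
    where
    open Region n x (λ _ → false)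
    open Transfer n x (λ _ → false) (λ _ _ ())
    model : Model
    model = record
      { V       = λ p as → pf x (points (2 ℕ.* n ∸ p) (ℤ.suc (ℤ.- + M p)) as)
      ; K       = λ p bs → pf x (points (2 ℕ.* n ∸ suc p) (ℤ.- + M p) bs)
      ; T       = λ _ → x ℕ.+ x
      ; final   = λ as l t → trans (cong (λ m → pf x (points m (ℤ.suc (ℤ.- + M (2 ℕ.* n))) as)) (ℕ.n∸n≡0 (2 ℕ.* n))) (pf-sorted x _ as t)
      ; step    = λ p p< as → trans (advance-points (pf x) (pf-Additive x) (pf-Alternating x) (2 ℕ.* n ∸ suc p) (ℤ.- + M p) as)
                    (cong (λ m → pf x (points m (ℤ.suc (ℤ.- + M p)) as)) (sym (ℕ.+-∸-assoc 1 p<)))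
      ; next    = λ p p< bs l t g → let e = merge-good p (λ _ ()) 0 bs g in
                    trans (cong (λ r → pf x (points (2 ℕ.* n ∸ suc p) r bs)) (sym (trans (cong (λ m → ℤ.suc (ℤ.- + m)) (M-suc p)) (suc-neg (M p)))))
                          (cong (λ cs → pf x (points (2 ℕ.* n ∸ suc p) (ℤ.suc (ℤ.- + M (suc p))) cs)) (sym e)) ,
                    trans (cong trues e) t
      ; discard = λ p p< bs l t ng → ⊥-elim (ng (Good-all p 0 bs (λ _ _ → refl)))
      }
      where open Row-by-row n x (λ _ → false) (λ _ _ ())

-- The hole as a pair of additional points.

module Hole where

  open import Defs
  open Rat
  open Strip
  open Cells
  open Counting
  open Rows
  open Regions
  open import Data.Bool using (Bool; true; false; not; _∧_; _∨_; if_then_else_)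
  open import Data.Empty using (⊥; ⊥-elim)
  open import Data.Integer as ℤ using (ℤ; +_; ∣_∣)
  import Data.Integer.Properties as ℤ
  import Data.Integer.Tactic.RingSolver as ℤ-Solver
  open import Data.List using (List; []; _∷_; _++_; length; replicate)
  open import Data.Nat as ℕ using (ℕ; zero; suc; _≤_; _<_; _≡ᵇ_; _≤ᵇ_; _∸_)
  import Data.Nat.Properties as ℕ
  import Data.Nat.Tactic.RingSolver as ℕ-Solver
  open import Data.Product using (_×_; _,_; Σ; ∃₂)
  open import Data.Rational using (ℚ; 0ℚ; _+_)
  open import Data.Sum using (inj₁; inj₂)
  open import Function using (_∘_)
  open import Relation.Nullary using (¬_; yes; no; does)
  open import Relation.Binary.Definitions using (tri<; tri≈; tri>)
  open import Relation.Binary.PropositionalEquality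

  split-at : ∀ k l (bs : List Bool) → length bs ≡ k ℕ.+ suc l → Σ (List Bool) λ pre → ∃₂ λ b post →
             bs ≡ pre ++ b ∷ post × length pre ≡ k × length post ≡ l
  split-at zero    l (b ∷ bs) e = [] , b , bs , refl , refl , ℕ.suc-injective e
  split-at (suc k) l (b ∷ bs) e with split-at k l bs (ℕ.suc-injective e)
  ... | pre , b′ , post , refl , e₁ , e₂ = b ∷ pre , b′ , post , refl , cong suc e₁ , e₂

  points-++ : ∀ m r as bs → points m r (as ++ bs) ≡ points m r as ++ points m (+ dbl (length as) ℤ.+ r) bs
  points-++ m r []           bs = cong (λ r → points m r bs) (sym (ℤ.+-identityˡ r))
  points-++ m r (true ∷ as)  bs = cong ((m , r) ∷_) (trans (points-++ m _ as bs)
    (cong (λ s → points m _ as ++ points m s bs) (lem (+ dbl (length as)) r)))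
    where
    lem : ∀ a r → a ℤ.+ (+ 1 ℤ.+ (+ 1 ℤ.+ r)) ≡ (+ 1 ℤ.+ (+ 1 ℤ.+ a)) ℤ.+ r
    lem = ℤ-Solver.solve-∀
  points-++ m r (false ∷ as) bs = trans (points-++ m _ as bs)
    (cong (λ s → points m _ as ++ points m s bs) (lem (+ dbl (length as)) r))
    where
    lem : ∀ a r → a ℤ.+ (+ 1 ℤ.+ (+ 1 ℤ.+ r)) ≡ (+ 1 ℤ.+ (+ 1 ℤ.+ a)) ℤ.+ r
    lem = ℤ-Solver.solve-∀

  trues-++ : ∀ as bs → trues (as ++ bs) ≡ trues as ℕ.+ trues bs
  trues-++ []       bs = refl
  trues-++ (a ∷ as) bs = trans (cong (bit a ℕ.+_) (trues-++ as bs)) (sym (ℕ.+-assoc (bit a) (trues as) (trues bs)))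

  dbl-injective : ∀ {a b} → dbl a ≡ dbl b → a ≡ b
  dbl-injective {zero}  {zero}  e = refl
  dbl-injective {suc a} {suc b} e = cong suc (dbl-injective (ℕ.suc-injective (ℕ.suc-injective e)))

  dbl-≢-odd : ∀ a b → ¬ (dbl a ≡ suc (dbl b))
  dbl-≢-odd a b e = absurd-Bool (even-dbl a) (trans (cong evenℕ e) (odd-dbl b))

  -- The midpoints of the two unit edges that make up the vertical side of the hole, `2k` strips
  -- before `ℓ`. The two walks born at the hole start here.
  lowerPt upperPt : ℕ → Point
  lowerPt k = dbl k , ℤ.- + 1
  upperPt k = dbl k , + 1

  -- The hole of side two with k + 1 + d = n; its apex is in strip 2d.
  module _ (d k x : ℕ) where

    n : ℕ
    n = suc (d ℕ.+ k)

    mid : ℕ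
    mid = x ℕ.+ d

    open Region n x (inHole n k)

    M-even : M (dbl d) ≡ dbl mid
    M-even = trans (cong₂ ℕ._+_ (2*≡dbl x) refl) (sym (dbl-+ x d))
      where
      dbl-+ : ∀ a b → dbl (a ℕ.+ b) ≡ dbl a ℕ.+ dbl b
      dbl-+ zero    b = refl
      dbl-+ (suc a) b = cong (suc ∘ suc) (dbl-+ a b)

    M-odd : M (suc (dbl d)) ≡ suc (dbl mid)
    M-odd = trans (M-suc (dbl d)) (cong suc M-even)

    apex-eq : dbl d ℕ.+ 2 ℕ.* k ℕ.+ 2 ≡ 2 ℕ.* n
    apex-eq = trans (cong (λ m → m ℕ.+ 2 ℕ.* k ℕ.+ 2) (sym (2*≡dbl d))) (lem d k)
      where
      lem : ∀ d k → 2 ℕ.* d ℕ.+ 2 ℕ.* k ℕ.+ 2 ≡ 2 ℕ.* (1 ℕ.+ (d ℕ.+ k))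
      lem = ℕ-Solver.solve-∀

    base-eq : suc (dbl d) ℕ.+ 2 ℕ.* k ℕ.+ 1 ≡ 2 ℕ.* n
    base-eq = trans (cong (λ m → suc m ℕ.+ 2 ℕ.* k ℕ.+ 1) (sym (2*≡dbl d))) (lem d k)
      where
      lem : ∀ d k → (1 ℕ.+ 2 ℕ.* d) ℕ.+ 2 ℕ.* k ℕ.+ 1 ≡ 2 ℕ.* (1 ℕ.+ (d ℕ.+ k))
      lem = ℕ-Solver.solve-∀

    at-apex : ∀ p → (p ℕ.+ 2 ℕ.* k ℕ.+ 2 ≡ᵇ 2 ℕ.* n) ≡ true → p ≡ dbl d
    at-apex p e = ℕ.+-cancelʳ-≡ (2 ℕ.* k) _ _ (ℕ.+-cancelʳ-≡ 2 _ _ (trans (ℕ.≡ᵇ⇒≡ (p ℕ.+ 2 ℕ.* k ℕ.+ 2) (2 ℕ.* n) (≡⇒T e)) (sym apex-eq)))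

    at-base : ∀ p → (p ℕ.+ 2 ℕ.* k ℕ.+ 1 ≡ᵇ 2 ℕ.* n) ≡ true → p ≡ suc (dbl d)
    at-base p e = ℕ.+-cancelʳ-≡ (2 ℕ.* k) _ _ (ℕ.+-cancelʳ-≡ 1 _ _ (trans (ℕ.≡ᵇ⇒≡ (p ℕ.+ 2 ℕ.* k ℕ.+ 1) (2 ℕ.* n) (≡⇒T e)) (sym base-eq)))

    dead-off : ∀ p s → ¬ (p ≡ dbl d) → ¬ (p ≡ suc (dbl d)) → dead p s ≡ false
    dead-off p s h h′ = cong₂ _∨_ (∧-falseˡ _ (≡false _ (h′ ∘ at-base p))) (∧-falseˡ _ (≡false _ (h ∘ at-apex p)))

    dead-apex : ∀ s → dead (dbl d) s ≡ does (+ s ℤ.- + M (dbl d) ℤ.≟ + 0)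
    dead-apex s = trans (cong₂ _∨_ (∧-falseˡ _ (≡false _ (λ e → ℕ.<⇒≢ (ℕ.n<1+n _) (at-base (dbl d) e))))
      (cong (_∧ does (+ s ℤ.- + M (dbl d) ℤ.≟ + 0)) (T⇒≡ (ℕ.≡⇒≡ᵇ _ _ apex-eq)))) refl

    dead-base : ∀ s → dead (suc (dbl d)) s ≡ (∣ + s ℤ.- + M (suc (dbl d)) ∣ ≤ᵇ 1)
    dead-base s = trans (cong₂ _∨_ (cong (_∧ (∣ + s ℤ.- + M (suc (dbl d)) ∣ ≤ᵇ 1)) (T⇒≡ (ℕ.≡⇒≡ᵇ _ _ base-eq)))
        (∧-falseˡ _ (≡false _ (λ e → ℕ.<⇒≢ (ℕ.n<1+n (dbl d)) (sym (at-apex (suc (dbl d)) e)))))) (∨-fa _)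
      where
      ∨-fa : ∀ b → b ∨ false ≡ b
      ∨-fa true  = refl
      ∨-fa false = refl

    apex-≡ : ∀ s → dead (dbl d) s ≡ true → s ≡ dbl mid
    apex-≡ s e with + s ℤ.- + M (dbl d) ℤ.≟ + 0 | trans (sym e) (dead-apex s)
    ... | yes z | _ = trans (ℤ.+-injective (trans (lem (+ s) (+ M (dbl d))) (cong (ℤ._+ + M (dbl d)) z))) M-even
      where
      lem : ∀ a b → a ≡ (a ℤ.- b) ℤ.+ b
      lem = ℤ-Solver.solve-∀
    ... | no _  | ()

    apex-dead : dead (dbl d) (dbl mid) ≡ true
    apex-dead = trans (dead-apex (dbl mid)) (subst (λ m → does (+ dbl mid ℤ.- + m ℤ.≟ + 0) ≡ true) (sym M-even) (go (+ dbl mid)))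
      where
      go : ∀ z → does (z ℤ.- z ℤ.≟ + 0) ≡ true
      go z rewrite ℤ.+-inverseʳ z = refl

    base-height : ∀ s → dead (suc (dbl d)) s ≡ (∣ s ℤ.⊖ suc (dbl mid) ∣ ≤ᵇ 1)
    base-height s = trans (dead-base s) (cong (λ z → ∣ z ∣ ≤ᵇ 1) (trans (cong (λ m → + s ℤ.- + m) M-odd) (ℤ.m-n≡m⊖n s (suc (dbl mid)))))

    ∣⊖∣-shift : ∀ a b → ∣ (b ℕ.+ a) ℤ.⊖ b ∣ ≡ a
    ∣⊖∣-shift a b = trans (cong ∣_∣ (ℤ.⊖-≥ (ℕ.m≤m+n b a))) (ℕ.m+n∸m≡n b a)

    base-below : ∀ s → s < dbl mid → dead (suc (dbl d)) s ≡ false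
    base-below s h = trans (base-height s) (≡false _ (λ e → ℕ.<⇒≱ h (ℕ.≤-pred (bound (ℕ.≤ᵇ⇒≤ _ 1 (≡⇒T e))))))
      where
      bound : ∣ s ℤ.⊖ suc (dbl mid) ∣ ≤ 1 → suc (dbl mid) ≤ suc s
      bound b = begin
        suc (dbl mid)              ≡⟨ sym (ℕ.m∸n+n≡m (ℕ.≤-trans (ℕ.<⇒≤ h) (ℕ.n≤1+n _))) ⟩
        (suc (dbl mid) ∸ s) ℕ.+ s  ≡⟨ cong (ℕ._+ s) (sym (ℤ.∣⊖∣-≤ (ℕ.≤-trans (ℕ.<⇒≤ h) (ℕ.n≤1+n _)))) ⟩
        ∣ s ℤ.⊖ suc (dbl mid) ∣ ℕ.+ s ≤⟨ ℕ.+-monoˡ-≤ s b ⟩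
        suc s                      ∎
        where open ℕ.≤-Reasoning

    base-above : ∀ a → dead (suc (dbl d)) (suc (dbl mid) ℕ.+ suc (suc a)) ≡ false
    base-above a = trans (base-height _) (cong (_≤ᵇ 1) (∣⊖∣-shift (suc (suc a)) (suc (dbl mid))))

    base-lower : dead (suc (dbl d)) (dbl mid) ≡ true
    base-lower = trans (base-height _) (cong (_≤ᵇ 1) (trans (ℤ.∣⊖∣-≤ (ℕ.n≤1+n (dbl mid))) (ℕ.m+n∸n≡m 1 (dbl mid))))

    base-upper : dead (suc (dbl d)) (dbl (suc mid)) ≡ true
    base-upper = trans (base-height _) (cong (_≤ᵇ 1) (trans (cong (λ m → ∣ m ℤ.⊖ suc (dbl mid) ∣) (ℕ.+-comm 1 (suc (dbl mid)))) (∣⊖∣-shift 1 (suc (dbl mid)))))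

    base-middle : dead (suc (dbl d)) (suc (dbl mid)) ≡ true
    base-middle = trans (base-height _) (cong (λ z → ∣ z ∣ ≤ᵇ 1) (ℤ.n⊖n≡0 (suc (dbl mid))))

    base-right : ∀ i → dead (suc (dbl d)) (suc (dbl i)) ≡ true → i ≡ mid
    base-right i e with ℕ.<-cmp i mid
    ... | tri≈ _ z _ = z
    ... | tri< h _ _ = absurd-Bool e (base-below (suc (dbl i)) (dbl-mono h))
    ... | tri> _ _ h with ℕ.m≤n⇒∃[o]m+o≡n h
    ...   | o , refl = absurd-Bool e (subst (λ s → dead (suc (dbl d)) s ≡ false) (shape mid o) (base-above (dbl o)))
      where
      shape : ∀ a o → suc (dbl a) ℕ.+ suc (suc (dbl o)) ≡ suc (dbl (suc a ℕ.+ o))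
      shape zero    o = refl
      shape (suc a) o = cong (suc ∘ suc) (shape a o)

    hole-right : ∀ p i → dead (suc p) (suc (dbl i)) ≡ true → dead p (dbl i) ≡ true
    hole-right p i e with suc p ℕ.≟ dbl d | suc p ℕ.≟ suc (dbl d)
    ... | no h  | no h′ = absurd-Bool e (dead-off (suc p) _ h h′)
    ... | yes h | _ = ⊥-elim (dbl-≢-odd mid i (sym (apex-≡ _ (subst (λ q → dead q (suc (dbl i)) ≡ true) h e))))
    ... | no _  | yes refl rewrite base-right i e = apex-dead

    open Transfer n x (inHole n k) hole-right
    open Row-by-row n x (inHole n k) hole-right using (Good)

    -- The flag `true` means that the base of the hole is still ahead. The two points then stand in
    -- front of the particles although their walks start only later, so that the size `suc x` of the
    -- Pfaffian is the same before and after the hole.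
    F : Bool → List Point → ℚ
    F true  ys = pf (suc x) (lowerPt k ∷ upperPt k ∷ ys)
    F false ys = pf (suc x) ys

    F-Additive : ∀ b → Additive (F b)
    F-Additive true  = Additive-∷ (λ ys → pf (suc x) (lowerPt k ∷ ys)) (upperPt k) (Additive-∷ (pf (suc x)) (lowerPt k) (pf-Additive (suc x)))
    F-Additive false = pf-Additive (suc x)

    F-Alternating : ∀ b → Alternating (F b)
    F-Alternating true  = Alternating-∷ (λ ys → pf (suc x) (lowerPt k ∷ ys)) (upperPt k) (Alternating-∷ (pf (suc x)) (lowerPt k) (pf-Alternating (suc x)))
    F-Alternating false = pf-Alternating (suc x)

    lower-again : ∀ pre post → F true (pre ++ lowerPt k ∷ post) ≡ 0ℚ
    lower-again pre post = repeated (pf (suc x)) (pf-Alternating (suc x)) (lowerPt k) (upperPt k ∷ pre) post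

    upper-again : ∀ pre post → F true (pre ++ upperPt k ∷ post) ≡ 0ℚ
    upper-again pre post = repeated (λ ys → pf (suc x) (lowerPt k ∷ ys)) (Alternating-∷ (pf (suc x)) (lowerPt k) (pf-Alternating (suc x))) (upperPt k) pre post

    -- By Pascal's rule a particle at the removed apex is the sum of the two points of the hole, and
    -- each of them is already an argument.
    centre-again : ∀ pre post → F true (pre ++ (suc (dbl k) , + 0) ∷ post) ≡ 0ℚ
    centre-again pre post = trans (F-Additive true (step-Sum (dbl k) (ℤ.- + 1)) pre post)
      (cong₂ _+_ (lower-again pre post) (upper-again pre post))

    V K : ℕ → List Bool → ℚ
    V p as = F (p ≤ᵇ suc (dbl d)) (points (2 ℕ.* n ∸ p) (ℤ.suc (ℤ.- + M p)) as)
    K p bs = F (p ≤ᵇ suc (dbl d)) (points (2 ℕ.* n ∸ suc p) (ℤ.- + M p) bs)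

    T : ℕ → ℕ
    T p = if p ≤ᵇ suc (dbl d) then x ℕ.+ x else suc x ℕ.+ suc x

    level-apex : 2 ℕ.* n ∸ suc (dbl d) ≡ suc (dbl k)
    level-apex = trans (cong (_∸ suc (dbl d)) (trans (sym base-eq) (trans (ℕ.+-comm _ 1) (trans (sym (ℕ.+-suc (suc (dbl d)) (2 ℕ.* k))) (cong (λ m → suc (dbl d) ℕ.+ suc m) (2*≡dbl k))))))
      (ℕ.m+n∸m≡n (suc (dbl d)) (suc (dbl k)))

    level-base : 2 ℕ.* n ∸ suc (suc (dbl d)) ≡ dbl k
    level-base = trans (sym (ℕ.pred[m∸n]≡m∸[1+n] (2 ℕ.* n) (suc (dbl d)))) (cong ℕ.pred level-apex)

    Result : ℕ → List Bool → Set
    Result p bs = K p bs ≡ V (suc p) (merge p 0 bs) × trues (merge p 0 bs) ≡ T (suc p)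

    unmerged : ∀ p bs → (p ≤ᵇ suc (dbl d)) ≡ (suc p ≤ᵇ suc (dbl d)) → trues bs ≡ T p → merge p 0 bs ≡ bs → Result p bs
    unmerged p bs b t m =
      trans (cong₂ (λ b r → F b (points (2 ℕ.* n ∸ suc p) r bs)) b (sym (trans (cong (λ m → ℤ.suc (ℤ.- + m)) (M-suc p)) (suc-neg (M p)))))
            (cong (V (suc p)) (sym m)) ,
      trans (cong trues m) (trans t (cong (λ b → if b then x ℕ.+ x else suc x ℕ.+ suc x) b))

    ≤ᵇ-yes : ∀ {a b} → a ≤ b → (a ≤ᵇ b) ≡ true
    ≤ᵇ-yes h = T⇒≡ (ℕ.≤⇒≤ᵇ h)

    ≤ᵇ-no : ∀ {a b} → b < a → (a ≤ᵇ b) ≡ false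
    ≤ᵇ-no {a} {b} h = ≡false _ (λ e → ℕ.<⇒≱ h (ℕ.≤ᵇ⇒≤ a b (≡⇒T e)))

    -- What happens at the apex strip (p = 2d), at the base strip (p = 2d+1) and elsewhere.
    data Place (p : ℕ) : Set where
      before : p < dbl d → Place p
      apex   : p ≡ dbl d → Place p
      base   : p ≡ suc (dbl d) → Place p
      after  : suc (dbl d) < p → Place p

    place : ∀ p → Place p
    place p with ℕ.<-cmp p (dbl d)
    ... | tri< h _ _ = before h
    ... | tri≈ _ h _ = apex h
    ... | tri> _ _ h with ℕ.m≤n⇒m<n∨m≡n h
    ...   | inj₁ h′ = after h′
    ...   | inj₂ h′ = base (sym h′)

    none : ∀ p → ¬ (p ≡ dbl d) → ¬ (p ≡ suc (dbl d)) → ∀ s → dead p s ≡ false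
    none p h h′ s = dead-off p s h h′

    apex-split : ∀ bs → length bs ≡ suc (M (dbl d)) → Σ (List Bool) λ pre → ∃₂ λ b post → bs ≡ pre ++ b ∷ post × length pre ≡ mid
    apex-split bs l with split-at mid mid bs (trans l (trans (cong suc (trans M-even (dbl≡+ mid))) (sym (ℕ.+-suc mid mid))))
    ... | pre , b , post , e , e′ , _ = pre , b , post , e , e′

    base-split : ∀ bs → length bs ≡ suc (M (suc (dbl d))) →
                 Σ (List Bool) λ pre → ∃₂ λ b b′ → Σ (List Bool) λ post → bs ≡ pre ++ b ∷ b′ ∷ post × length pre ≡ mid
    base-split bs l with split-at mid (suc mid) bs (trans l (trans (cong suc (trans M-odd (cong suc (dbl≡+ mid)))) (sym (trans (ℕ.+-suc mid (suc mid)) (cong suc (ℕ.+-suc mid mid))))))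
    ... | pre , b , []        , e , e′ , ()
    ... | pre , b , b′ ∷ post , e , e′ , _ = pre , b , b′ , post , e , e′

    left-free : ∀ p (pre : List Bool) → length pre ≡ mid → (∀ s → s < dbl mid → dead p s ≡ false) →
                ∀ j → j < length pre → dead p (dbl (j ℕ.+ 0)) ≡ false
    left-free p pre e h j l = h _ (dbl-< (subst₂ _<_ (sym (ℕ.+-identityʳ j)) e l))
      where
      dbl-< : ∀ {a b} → a < b → dbl a < dbl b
      dbl-< h = ℕ.<-≤-trans (ℕ.<-trans (ℕ.n<1+n _) (ℕ.n<1+n _)) (dbl-mono h)

    apex-left : ∀ s → s < dbl mid → dead (dbl d) s ≡ false
    apex-left s h = ≡false _ (λ e → ℕ.<⇒≢ h (apex-≡ s e))

    apex-right : ∀ j → suc mid ≤ j → dead (dbl d) (dbl j) ≡ false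
    apex-right j h = ≡false _ (λ e → ℕ.<⇒≢ h (sym (dbl-injective (apex-≡ _ e))))

    base-right-free : ∀ j → suc (suc mid) ≤ j → dead (suc (dbl d)) (dbl j) ≡ false
    base-right-free j h with ℕ.m≤n⇒∃[o]m+o≡n h
    ... | o , refl = subst (λ s → dead (suc (dbl d)) s ≡ false) (shape mid o) (base-above (suc (dbl o)))
      where
      shape : ∀ a o → suc (dbl a) ℕ.+ suc (suc (suc (dbl o))) ≡ dbl (suc (suc a) ℕ.+ o)
      shape zero    o = refl
      shape (suc a) o = cong (suc ∘ suc) (shape a o)

    row-at : ∀ p (pre : List Bool) {r} → length pre ≡ mid → + dbl mid ℤ.- + M p ≡ r → + dbl (length pre) ℤ.+ ℤ.- + M p ≡ r
    row-at p pre e h = trans (cong (λ m → + dbl m ℤ.+ ℤ.- + M p) e) h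

    row-apex : + dbl mid ℤ.- + M (dbl d) ≡ + 0
    row-apex = trans (cong (λ m → + dbl mid ℤ.- + m) M-even) (ℤ.+-inverseʳ (+ dbl mid))

    row-base : + dbl mid ℤ.- + M (suc (dbl d)) ≡ ℤ.- + 1
    row-base = trans (cong (λ m → + dbl mid ℤ.- + m) M-odd) (lem (+ dbl mid))
      where
      lem : ∀ a → a ℤ.- (+ 1 ℤ.+ a) ≡ ℤ.- + 1
      lem = ℤ-Solver.solve-∀

    Good-apex : ∀ pre post → length pre ≡ mid → Good (dbl d) 0 (pre ++ false ∷ post)
    Good-apex pre post e = Good-++ (dbl d) 0 pre (false ∷ post) (left-free (dbl d) pre e apex-left)
      ((λ _ → refl) , Good-all (dbl d) _ post (λ j h → apex-right j (subst (λ m → suc m ≤ j) (trans (ℕ.+-identityʳ (length pre)) e) h)))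

    Good-base : ∀ pre post → length pre ≡ mid → Good (suc (dbl d)) 0 (pre ++ false ∷ false ∷ post)
    Good-base pre post e = Good-++ (suc (dbl d)) 0 pre (false ∷ false ∷ post) (left-free (suc (dbl d)) pre e base-below)
      ((λ _ → refl) , (λ _ → refl) , Good-all (suc (dbl d)) _ post (λ j h → base-right-free j (subst (λ m → suc (suc m) ≤ j) (trans (ℕ.+-identityʳ (length pre)) e) h)))

    -- Behind the base two live triangles face removed ones, so `merge` turns their two bits on. On
    -- the side of the Pfaffian `move-pair` carries the two front points to the same place, between
    -- the particles below and above the hole.
    next-base : ∀ bs → length bs ≡ suc (M (suc (dbl d))) → trues bs ≡ x ℕ.+ x → Good (suc (dbl d)) 0 bs →
      K (suc (dbl d)) bs ≡ V (suc (suc (dbl d))) (merge (suc (dbl d)) 0 bs) × trues (merge (suc (dbl d)) 0 bs) ≡ suc x ℕ.+ suc x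
    next-base bs l t g with base-split bs l
    ... | pre , b , b′ , post , refl , e = go b b′ t (heads pre _ g)
      where
      P = suc (dbl d)
      heads : ∀ pre′ j → Good P j (pre′ ++ b ∷ b′ ∷ post) → (dead P (dbl (length pre′ ℕ.+ j)) ≡ true → b ≡ false) × (dead P (dbl (suc (length pre′ ℕ.+ j))) ≡ true → b′ ≡ false) × Good P (suc (suc (length pre′ ℕ.+ j))) post
      heads []        j (h , h′ , g) = h , h′ , g
      heads (_ ∷ pre) j (_ , g) = subst (λ m → (dead P (dbl m) ≡ true → b ≡ false) × (dead P (dbl (suc m)) ≡ true → b′ ≡ false) × Good P (suc (suc m)) post) (ℕ.+-suc (length pre) j) (heads pre (suc j) g)
      at : length pre ℕ.+ 0 ≡ mid
      at = trans (ℕ.+-identityʳ (length pre)) e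
      post-merge : ∀ j → suc (suc mid) ≤ j → ∀ post → merge P j post ≡ post
      post-merge j h []       = refl
      post-merge j h (c ∷ cs) = cong₂ _∷_ (if-false (base-right-free j h)) (post-merge (suc j) (ℕ.m≤n⇒m≤1+n h) cs)
      mid-merge : ∀ b b′ → merge P (length pre ℕ.+ 0) (b ∷ b′ ∷ post) ≡ true ∷ true ∷ post
      mid-merge b b′ rewrite at | base-lower | base-upper = cong₂ _∷_ (kept mid) (cong₂ _∷_ (kept (suc mid)) (post-merge (suc (suc mid)) ℕ.≤-refl post))
        where
        kept : ∀ i → not (dead (suc P) (suc (dbl i))) ≡ true
        kept i = cong not (dead-off (suc P) _ (λ q → ℕ.<⇒≢ (ℕ.<-trans (ℕ.n<1+n _) (ℕ.n<1+n _)) (sym q)) (λ q → ℕ.<⇒≢ (ℕ.n<1+n _) (sym q)))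
      merged : ∀ b b′ → merge P 0 (pre ++ b ∷ b′ ∷ post) ≡ pre ++ true ∷ true ∷ post
      merged b b′ = trans (merge-++ P 0 pre (b ∷ b′ ∷ post) (left-free P pre e base-below)) (cong (pre ++_) (mid-merge b b′))
      go : ∀ b b′ → trues (pre ++ b ∷ b′ ∷ post) ≡ x ℕ.+ x →
           (dead P (dbl (length pre ℕ.+ 0)) ≡ true → b ≡ false) × (dead P (dbl (suc (length pre ℕ.+ 0))) ≡ true → b′ ≡ false) × Good P (suc (suc (length pre ℕ.+ 0))) post →
           K P (pre ++ b ∷ b′ ∷ post) ≡ V (suc P) (merge P 0 (pre ++ b ∷ b′ ∷ post)) × trues (merge P 0 (pre ++ b ∷ b′ ∷ post)) ≡ suc x ℕ.+ suc x
      go true b′ t (h , _) = absurd-Bool refl (h (trans (cong (λ m → dead P (dbl m)) at) base-lower))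
      go false true t (_ , h , _) = absurd-Bool refl (h (trans (cong (λ m → dead P (dbl (suc m))) at) base-upper))
      go false false t _ = (begin
          F (P ≤ᵇ P) (points (2 ℕ.* n ∸ suc P) (ℤ.- + M P) (pre ++ false ∷ false ∷ post))
            ≡⟨ cong (λ b → F b (points (2 ℕ.* n ∸ suc P) (ℤ.- + M P) (pre ++ false ∷ false ∷ post))) (≤ᵇ-yes {P} ℕ.≤-refl) ⟩
          F true (points (2 ℕ.* n ∸ suc P) (ℤ.- + M P) (pre ++ false ∷ false ∷ post))
            ≡⟨ cong (λ m → F true (points m (ℤ.- + M P) (pre ++ false ∷ false ∷ post))) level-base ⟩
          F true (points (dbl k) (ℤ.- + M P) (pre ++ false ∷ false ∷ post))
            ≡⟨ cong (F true) (points-at (false ∷ false ∷ post)) ⟩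
          pf (suc x) (lowerPt k ∷ upperPt k ∷ points (dbl k) (ℤ.- + M P) pre ++ points (dbl k) (+ 3) post)
            ≡⟨ move-pair (pf (suc x)) (pf-Alternating (suc x)) (lowerPt k) (upperPt k) (points (dbl k) (ℤ.- + M P) pre) (points (dbl k) (+ 3) post) ⟩
          F false (points (dbl k) (ℤ.- + M P) pre ++ points (dbl k) (ℤ.- + 1) (true ∷ true ∷ post))
            ≡⟨ cong (F false) (sym (points-at (true ∷ true ∷ post))) ⟩
          F false (points (dbl k) (ℤ.- + M P) (pre ++ true ∷ true ∷ post))
            ≡⟨ cong₂ (λ m r → F false (points m r (pre ++ true ∷ true ∷ post))) (sym level-base) (sym (trans (cong (λ m → ℤ.suc (ℤ.- + m)) (M-suc P)) (suc-neg (M P)))) ⟩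
          F false (points (2 ℕ.* n ∸ suc P) (ℤ.suc (ℤ.- + M (suc P))) (pre ++ true ∷ true ∷ post))
            ≡⟨ cong₂ (λ b cs → F b (points (2 ℕ.* n ∸ suc P) (ℤ.suc (ℤ.- + M (suc P))) cs)) (sym (≤ᵇ-no (ℕ.n<1+n P))) (sym (merged false false)) ⟩
          V (suc P) (merge P 0 (pre ++ false ∷ false ∷ post)) ∎) ,
        trans (cong trues (merged false false)) (trans (trues-++ pre (true ∷ true ∷ post))
          (trans (two (trues pre) (trues post)) (cong suc (trans (cong suc (trans (sym (trues-++ pre (false ∷ false ∷ post))) t)) (sym (ℕ.+-suc x x))))))
        where
        open ≡-Reasoning
        two : ∀ a b → a ℕ.+ suc (suc b) ≡ suc (suc (a ℕ.+ b))
        two a b = trans (ℕ.+-suc a (suc b)) (cong suc (ℕ.+-suc a b))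
        points-at : ∀ cs → points (dbl k) (ℤ.- + M P) (pre ++ cs) ≡ points (dbl k) (ℤ.- + M P) pre ++ points (dbl k) (ℤ.- + 1) cs
        points-at cs = trans (points-++ (dbl k) (ℤ.- + M P) pre cs)
          (cong (λ r → points (dbl k) (ℤ.- + M P) pre ++ points (dbl k) r cs) (row-at P pre e row-base))

    model : Model
    model = record
      { V = V ; K = K ; T = T
      ; final   = λ as l t → trans (cong₂ (λ b m → F b (points m (ℤ.suc (ℤ.- + M (2 ℕ.* n))) as)) last (ℕ.n∸n≡0 (2 ℕ.* n)))
                    (pf-sorted (suc x) _ as (trans t (cong (λ b → if b then x ℕ.+ x else suc x ℕ.+ suc x) last)))
      ; step    = λ p p< as → trans (advance-points (F (p ≤ᵇ suc (dbl d))) (F-Additive (p ≤ᵇ suc (dbl d))) (F-Alternating (p ≤ᵇ suc (dbl d))) (2 ℕ.* n ∸ suc p) (ℤ.- + M p) as)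
                    (cong (λ m → F (p ≤ᵇ suc (dbl d)) (points m (ℤ.suc (ℤ.- + M p)) as)) (sym (ℕ.+-∸-assoc 1 p<)))
      ; next    = λ p p< bs l t g → nxt p (place p) bs l t g
      ; discard = λ p p< bs l t ng → dis p (place p) bs l ng
      }
      where
      last : (2 ℕ.* n ≤ᵇ suc (dbl d)) ≡ false
      last = ≤ᵇ-no (subst (suc (dbl d) <_) base-eq (ℕ.≤-trans (ℕ.≤-reflexive (ℕ.+-comm 1 (suc (dbl d)))) (ℕ.+-monoˡ-≤ 1 (ℕ.m≤m+n (suc (dbl d)) (2 ℕ.* k)))))
      nxt : ∀ p → Place p → ∀ bs → length bs ≡ suc (M p) → trues bs ≡ T p → Good p 0 bs → Result p bs
      nxt p (before h) bs l t g = unmerged p bs (trans (≤ᵇ-yes (ℕ.≤-trans (ℕ.<⇒≤ h) (ℕ.n≤1+n _))) (sym (≤ᵇ-yes (ℕ.≤-trans h (ℕ.n≤1+n _))))) t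
        (merge-good p (λ i e → absurd-Bool e (none p (ℕ.<⇒≢ h) (ℕ.<⇒≢ (ℕ.<-trans h (ℕ.n<1+n _))) (dbl i))) 0 bs g)
      -- The triangle to the right of the apex is the removed middle of the base strip, so no
      -- particle is born here and the bits stay as they are.
      nxt p (apex refl) bs l t g = unmerged p bs (trans (≤ᵇ-yes (ℕ.n≤1+n p)) (sym (≤ᵇ-yes {suc p} ℕ.≤-refl))) t
        (merge-good p (λ i e → subst (λ m → dead (suc p) (suc (dbl m)) ≡ true) (sym (dbl-injective (apex-≡ _ e))) base-middle) 0 bs g)
      nxt p (base refl) bs l t g with next-base bs l (trans t (cong (λ b → if b then x ℕ.+ x else suc x ℕ.+ suc x) (≤ᵇ-yes {p} ℕ.≤-refl))) g
      ... | r , r′ = r , trans r′ (sym (cong (λ b → if b then x ℕ.+ x else suc x ℕ.+ suc x) (≤ᵇ-no (ℕ.n<1+n p))))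
      nxt p (after h) bs l t g = unmerged p bs (trans (≤ᵇ-no h) (sym (≤ᵇ-no (ℕ.<-trans h (ℕ.n<1+n p))))) t
        (merge-good p (λ i e → absurd-Bool e (none p (λ q → ℕ.<⇒≢ (ℕ.<-trans (ℕ.n<1+n _) h) (sym q)) (λ q → ℕ.<⇒≢ h (sym q)) (dbl i))) 0 bs g)
      dis : ∀ p → Place p → ∀ bs → length bs ≡ suc (M p) → ¬ Good p 0 bs → K p bs ≡ 0ℚ
      dis p (before h) bs l ng = ⊥-elim (ng (Good-all p 0 bs (λ j _ → none p (ℕ.<⇒≢ h) (ℕ.<⇒≢ (ℕ.<-trans h (ℕ.n<1+n _))) (dbl j))))
      dis p (after h) bs l ng = ⊥-elim (ng (Good-all p 0 bs (λ j _ → none p (λ q → ℕ.<⇒≢ (ℕ.<-trans (ℕ.n<1+n _) h) (sym q)) (λ q → ℕ.<⇒≢ h (sym q)) (dbl j))))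
      dis p (apex refl) bs l ng with apex-split bs l
      ... | pre , false , post , refl , e = ⊥-elim (ng (Good-apex pre post e))
      ... | pre , true  , post , refl , e = trans (cong₂ (λ b m → F b (points m (ℤ.- + M p) (pre ++ true ∷ post))) (≤ᵇ-yes (ℕ.n≤1+n p)) level-apex)
        (trans (cong (F true) (trans (points-++ (suc (dbl k)) (ℤ.- + M p) pre (true ∷ post))
            (cong (λ r → points (suc (dbl k)) (ℤ.- + M p) pre ++ points (suc (dbl k)) r (true ∷ post)) (row-at p pre e row-apex))))
          (centre-again (points (suc (dbl k)) (ℤ.- + M p) pre) _))
      dis p (base refl) bs l ng with base-split bs l
      ... | pre , false , false , post , refl , e = ⊥-elim (ng (Good-base pre post e))
      ... | pre , true  , b′    , post , refl , e = trans (cong₂ (λ b m → F b (points m (ℤ.- + M p) (pre ++ true ∷ b′ ∷ post))) (≤ᵇ-yes {p} ℕ.≤-refl) level-base)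
        (trans (cong (F true) (trans (points-++ (dbl k) (ℤ.- + M p) pre (true ∷ b′ ∷ post))
            (cong (λ r → points (dbl k) (ℤ.- + M p) pre ++ points (dbl k) r (true ∷ b′ ∷ post)) (row-at p pre e row-base))))
          (lower-again (points (dbl k) (ℤ.- + M p) pre) _))
      ... | pre , false , true  , post , refl , e = trans (cong₂ (λ b m → F b (points m (ℤ.- + M p) (pre ++ false ∷ true ∷ post))) (≤ᵇ-yes {p} ℕ.≤-refl) level-base)
        (trans (cong (F true) (trans (points-++ (dbl k) (ℤ.- + M p) pre (false ∷ true ∷ post))
            (cong (λ r → points (dbl k) (ℤ.- + M p) pre ++ points (dbl k) r (false ∷ true ∷ post)) (row-at p pre e row-base))))
          (upper-again (points (dbl k) (ℤ.- + M p) pre) _))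

    hole-count : ι (+ MFhole n x k) ≡ pf (suc x) (lowerPt k ∷ upperPt k ∷ starts n x)
    hole-count = trans (tilingCount≡V model start refl)
      (cong (λ m → F true (points (2 ℕ.* n) (ℤ.suc (ℤ.- + m)) (replicate m true))) (ℕ.+-identityʳ (2 ℕ.* x)))
      where
      start : ∀ i → dead 0 (suc (dbl i)) ≡ false
      start i = ≡false _ (λ e → case (zero-place e))
        where
        zero-place : dead 0 (suc (dbl i)) ≡ true → 0 ≡ dbl d × suc (dbl i) ≡ dbl mid
        zero-place e with 0 ℕ.≟ dbl d
        ... | yes z = z , apex-≡ _ (subst (λ q → dead q (suc (dbl i)) ≡ true) z e)
        ... | no z  = absurd-Bool e (dead-off 0 _ z (λ ()))
        case : 0 ≡ dbl d × suc (dbl i) ≡ dbl mid → ⊥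
        case (_ , z) = dbl-≢-odd mid i (sym z)

  MFhole≡pf : ∀ d k x n′ → n′ ≡ suc (d ℕ.+ k) → ι (+ MFhole n′ x k) ≡ pf (suc x) (lowerPt k ∷ upperPt k ∷ starts n′ x)
  MFhole≡pf d k x _ refl = hole-count d k x

-- Central binomial coefficients as values of the form.

module Moments where

  open Rat
  open Strip
  open Cells using (dbl; dbl≡+)
  open import Data.Integer as ℤ using (ℤ; +_; _+_; _*_; _-_; -_)
  import Data.Integer.Properties as ℤ
  import Data.Integer.Tactic.RingSolver as ℤ-Solver
  open import Data.Nat as ℕ using (ℕ; zero; suc)
  import Data.Nat.Properties as ℕ
  import Data.Rational as ℚ
  import Data.Rational.Properties as ℚ
  open import Relation.Binary.PropositionalEquality
  open ≡-Reasoning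

  δ : ℕ → ℤ → ℤ
  δ M d = q M (+ 1 + d) - q M (ℤ.-1ℤ + d)

  δ-suc : ∀ M d → δ (suc M) d ≡ δ M (+ 1 + d) + δ M (ℤ.-1ℤ + d)
  δ-suc M d = begin
    (q M a + q M b) - (q M c + q M e)
      ≡⟨ cong₂ (λ u v → (q M a + q M u) - (q M v + q M e)) (l1 d) (l2 d) ⟩
    (q M a + q M d) - (q M d + q M e)
      ≡⟨ l3 (q M a) (q M d) (q M e) ⟩
    (q M a - q M d) + (q M d - q M e)
      ≡⟨ cong₂ (λ u v → (q M a - q M u) + (q M v - q M e)) (sym (l1 d)) (sym (l2 d)) ⟩
    (q M a - q M b) + (q M c - q M e) ∎
    where
    a = + 1 + (+ 1 + d)
    b = ℤ.-1ℤ + (+ 1 + d)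
    c = + 1 + (ℤ.-1ℤ + d)
    e = ℤ.-1ℤ + (ℤ.-1ℤ + d)
    l1 : ∀ d → ℤ.-1ℤ + (+ 1 + d) ≡ d
    l1 = ℤ-Solver.solve-∀
    l2 : ∀ d → + 1 + (ℤ.-1ℤ + d) ≡ d
    l2 = ℤ-Solver.solve-∀
    l3 : ∀ a d e → (a + d) - (d + e) ≡ (a - d) + (d - e)
    l3 = ℤ-Solver.solve-∀

  -- δ M d is the binomial coefficient (M+1 choose (M+1+d)/2); this is the relation between neighbours.
  ladder : ∀ M e → (e + + 2) * δ M (e + e + + 3 - + M) ≡ (+ M - e) * δ M (e + e + + 1 - + M)
  ladder zero ℤ.+0                    = refl
  ladder zero ℤ.+[1+ n ]              rewrite ℕ.+-comm n (suc n) =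
    trans (ℤ.*-zeroʳ (ℤ.+[1+ n ] + + 2)) (sym (ℤ.*-zeroʳ (+ 0 - ℤ.+[1+ n ])))
  ladder zero ℤ.-[1+ 0 ]              = refl
  ladder zero ℤ.-[1+ 1 ]              = refl
  ladder zero ℤ.-[1+ suc (suc n) ]    rewrite ℕ.+-comm n (suc (suc n)) =
    trans (ℤ.*-zeroʳ (ℤ.-[1+ suc (suc n) ] + + 2)) (sym (ℤ.*-zeroʳ (+ 0 - ℤ.-[1+ suc (suc n) ])))
  ladder (suc M) e = begin
    (e + + 2) * δ (suc M) (e + e + + 3 - + suc M)
      ≡⟨ cong ((e + + 2) *_) (trans (δ-suc M (e + e + + 3 - + suc M)) (cong₂ (λ u v → δ M u + δ M v) (i1 e (+ M)) (i2 e (+ M)))) ⟩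
    (e + + 2) * (δ M d₃ + δ M d₁)
      ≡⟨ ℤ.*-distribˡ-+ (e + + 2) (δ M d₃) (δ M d₁) ⟩
    (e + + 2) * δ M d₃ + (e + + 2) * δ M d₁
      ≡⟨ cong (_+ (e + + 2) * δ M d₁) (ladder M e) ⟩
    (+ M - e) * δ M d₁ + (e + + 2) * δ M d₁
      ≡⟨ i5 e (+ M) (δ M d₁) ⟩
    -- The sum of the two coefficients is kept but split differently, so that the second term fits
    -- the induction hypothesis at `e - 1`.
    (+ 1 + + M - e) * δ M d₁ + ((ℤ.-1ℤ + e) + + 2) * δ M d₁
      ≡⟨ cong (λ u → (+ 1 + + M - e) * δ M d₁ + ((ℤ.-1ℤ + e) + + 2) * δ M u) (sym (i6 e (+ M))) ⟩
    (+ 1 + + M - e) * δ M d₁ + ((ℤ.-1ℤ + e) + + 2) * δ M ((ℤ.-1ℤ + e) + (ℤ.-1ℤ + e) + + 3 - + M)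
      ≡⟨ cong (λ u → (+ 1 + + M - e) * δ M d₁ + u) (ladder M (ℤ.-1ℤ + e)) ⟩
    (+ 1 + + M - e) * δ M d₁ + (+ M - (ℤ.-1ℤ + e)) * δ M d₋
      ≡⟨ i7 e (+ M) (δ M d₁) (δ M d₋) ⟩
    (+ 1 + + M - e) * (δ M d₁ + δ M d₋)
      ≡⟨ cong ((+ 1 + + M - e) *_) (sym (trans (δ-suc M (e + e + + 1 - + suc M)) (cong₂ (λ u v → δ M u + δ M v) (i3 e (+ M)) (i4 e (+ M))))) ⟩
    (+ suc M - e) * δ (suc M) (e + e + + 1 - + suc M) ∎
    where
    d₃ = e + e + + 3 - + M
    d₁ = e + e + + 1 - + M
    d₋ = (ℤ.-1ℤ + e) + (ℤ.-1ℤ + e) + + 1 - + M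
    i1 : ∀ e m → + 1 + (e + e + + 3 - (+ 1 + m)) ≡ e + e + + 3 - m
    i1 = ℤ-Solver.solve-∀
    i2 : ∀ e m → ℤ.-1ℤ + (e + e + + 3 - (+ 1 + m)) ≡ e + e + + 1 - m
    i2 = ℤ-Solver.solve-∀
    i3 : ∀ e m → + 1 + (e + e + + 1 - (+ 1 + m)) ≡ e + e + + 1 - m
    i3 = ℤ-Solver.solve-∀
    i4 : ∀ e m → ℤ.-1ℤ + (e + e + + 1 - (+ 1 + m)) ≡ (ℤ.-1ℤ + e) + (ℤ.-1ℤ + e) + + 1 - m
    i4 = ℤ-Solver.solve-∀
    i5 : ∀ e m y → (m - e) * y + (e + + 2) * y ≡ (+ 1 + m - e) * y + ((ℤ.-1ℤ + e) + + 2) * y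
    i5 = ℤ-Solver.solve-∀
    i6 : ∀ e m → (ℤ.-1ℤ + e) + (ℤ.-1ℤ + e) + + 3 - m ≡ e + e + + 1 - m
    i6 = ℤ-Solver.solve-∀
    i7 : ∀ e m y z → (+ 1 + m - e) * y + (m - (ℤ.-1ℤ + e)) * z ≡ (+ 1 + m - e) * (y + z)
    i7 = ℤ-Solver.solve-∀

  -- The central binomial coefficient (2N+1 choose N+1).
  H : ℕ → ℤ
  H N = q (dbl N) (+ 2)

  q-zero : ∀ M → q M (+ 0) ≡ + 0
  q-zero M = self (q M (+ 0)) (q-odd M (+ 0))
    where
    self : ∀ z → z ≡ - z → z ≡ + 0
    self ℤ.+0       e = refl
    self ℤ.+[1+ _ ] ()
    self ℤ.-[1+ _ ] ()

  -- Two steps of the recursion give `q M 4 + 2 q M 2 + q M 0`. The last value is 0 by oddness, and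
  -- `ladder` at `e = N` expresses `q M 4 - q M 2` through `q M 2`.
  H-suc : ∀ N → (+ 2 + + N) * H (suc N) ≡ (+ 6 + + 4 * + N) * H N
  H-suc N = begin
    (+ 2 + + N) * ((q M (+ 4) + q M (+ 2)) + (q M (+ 2) + q M (+ 0)))
      ≡⟨ cong (λ z → (+ 2 + + N) * ((q M (+ 4) + q M (+ 2)) + (q M (+ 2) + z))) (q-zero M) ⟩
    (+ 2 + + N) * ((q M (+ 4) + q M (+ 2)) + (q M (+ 2) + + 0))
      ≡⟨ l1 (+ N) (q M (+ 4)) (q M (+ 2)) ⟩
    (+ N + + 2) * (q M (+ 4) - q M (+ 2)) + (+ 6 + + 3 * + N) * q M (+ 2)
      ≡⟨ cong (_+ (+ 6 + + 3 * + N) * q M (+ 2)) step ⟩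
    + N * q M (+ 2) + (+ 6 + + 3 * + N) * q M (+ 2)
      ≡⟨ l2 (+ N) (q M (+ 2)) ⟩
    (+ 6 + + 4 * + N) * q M (+ 2) ∎
    where
    M = dbl N
    M≡ : + M ≡ + N + + N
    M≡ = cong +_ (dbl≡+ N)
    l1 : ∀ n a b → (+ 2 + n) * ((a + b) + (b + + 0)) ≡ (n + + 2) * (a - b) + (+ 6 + + 3 * n) * b
    l1 = ℤ-Solver.solve-∀
    l2 : ∀ n b → n * b + (+ 6 + + 3 * n) * b ≡ (+ 6 + + 4 * n) * b
    l2 = ℤ-Solver.solve-∀
    d3 : ∀ n → n + n + + 3 - (n + n) ≡ + 3
    d3 = ℤ-Solver.solve-∀
    d1 : ∀ n → n + n + + 1 - (n + n) ≡ + 1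
    d1 = ℤ-Solver.solve-∀
    mn : ∀ n → (n + n) - n ≡ n
    mn = ℤ-Solver.solve-∀
    sub0 : ∀ a → a - + 0 ≡ a
    sub0 = ℤ-Solver.solve-∀
    step : (+ N + + 2) * (q M (+ 4) - q M (+ 2)) ≡ + N * q M (+ 2)
    step = begin
      (+ N + + 2) * δ M (+ 3)
        ≡⟨ cong (λ d → (+ N + + 2) * δ M d) (sym (trans (cong (λ m → + N + + N + + 3 - m) M≡) (d3 (+ N)))) ⟩
      (+ N + + 2) * δ M (+ N + + N + + 3 - + M)
        ≡⟨ ladder M (+ N) ⟩
      (+ M - + N) * δ M (+ N + + N + + 1 - + M)
        ≡⟨ cong₂ (λ a d → a * δ M d) (trans (cong (_- + N) M≡) (mn (+ N))) (trans (cong (λ m → + N + + N + + 1 - m) M≡) (d1 (+ N))) ⟩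
      + N * (q M (+ 2) - q M (+ 0))
        ≡⟨ cong (+ N *_) (trans (cong (λ u → q M (+ 2) - u) (q-zero M)) (sub0 (q M (+ 2)))) ⟩
      + N * q M (+ 2) ∎

  opaque

    h : ℕ → ℚ.ℚ
    h N = ι (H N)

    h≡ : ∀ N → h N ≡ ι (q (dbl N) (+ 2))
    h≡ N = refl

    h-zero : h 0 ≡ ℚ.1ℚ
    h-zero = refl

    h-suc : ∀ N → (ν 2 ℚ.+ ν N) ℚ.* h (suc N) ≡ (ν 6 ℚ.+ ν 4 ℚ.* ν N) ℚ.* h N
    h-suc N = begin
      (ν 2 ℚ.+ ν N) ℚ.* h (suc N)               ≡⟨ cong (ℚ._* h (suc N)) (sym (ν-+ 2 N)) ⟩
      ν (2 ℕ.+ N) ℚ.* h (suc N)                 ≡⟨ sym (ι-* (+ 2 + + N) (H (suc N))) ⟩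
      ι ((+ 2 + + N) * H (suc N))               ≡⟨ cong ι (H-suc N) ⟩
      ι ((+ 6 + + 4 * + N) * H N)               ≡⟨ ι-* (+ 6 + + 4 * + N) (H N) ⟩
      ι (+ 6 + + 4 * + N) ℚ.* h N               ≡⟨ cong (ℚ._* h N) (trans (ι-+ (+ 6) (+ 4 * + N)) (cong (ν 6 ℚ.+_) (ι-* (+ 4) (+ N)))) ⟩
      (ν 6 ℚ.+ ν 4 ℚ.* ν N) ℚ.* h N             ∎

    h-pos : ∀ N → ℚ.0ℚ ℚ.< h N
    h-pos zero    = 0<1
    h-pos (suc N) = subst (ℚ.0ℚ ℚ.<_) eq (*-pos (inv-pos a>0) (*-pos b>0 (h-pos N)))
      where
      a b : ℚ.ℚ
      a = ν 2 ℚ.+ ν N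
      b = ν 6 ℚ.+ ν 4 ℚ.* ν N
      a>0 : ℚ.0ℚ ℚ.< a
      a>0 = subst (ℚ.0ℚ ℚ.<_) (ν-+ 2 N) (ν-pos (suc N))
      b>0 : ℚ.0ℚ ℚ.< b
      b>0 = subst (ℚ.0ℚ ℚ.<_) (ℚ.+-comm (ν 4 ℚ.* ν N) (ν 6)) (+-pos (*-nonneg (0≤ν 4) (0≤ν N)) (ν-pos 5))
      eq : inv a ℚ.* (b ℚ.* h N) ≡ h (suc N)
      eq = cancel a (>0⇒≢0 a>0) (trans (sym (ℚ.*-assoc a (inv a) (b ℚ.* h N)))
        (trans (cong (ℚ._* (b ℚ.* h N)) (inv-ʳ (>0⇒≢0 a>0))) (trans (ℚ.*-identityˡ (b ℚ.* h N)) (sym (h-suc N)))))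

-- Exchanging the starting points, and splitting off the pair of the hole.

module Orthogonal where

  open import Defs
  open Rat
  open Pfaffian
  open Strip
  open Cells using (dbl; dbl≡+; 2*≡dbl)
  open Regions using (starts)
  open Hole using (lowerPt; upperPt)
  open Moments
  open import Data.Bool using (true)
  open import Data.Integer as ℤ using (ℤ; +_)
  import Data.Integer.Properties as ℤ
  import Data.Integer.Tactic.RingSolver as ℤ-Solver
  open import Data.List using ([]; _∷_; _++_; replicate)
  open import Data.List.Properties using (++-assoc)
  open import Data.List.Relation.Unary.All using (All; []; _∷_)
  open import Data.Nat as ℕ using (ℕ; zero; suc; s≤s; z≤n)
  import Data.Nat.Properties as ℕ
  open import Data.Product using (_×_; _,_; proj₁; proj₂)
  open import Data.Rational
  open import Data.Rational.Properties
  open import Relation.Binary.PropositionalEquality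
  open import Tactic.RingSolver using (solve-∀)
  open ≡-Reasoning

  ss : ℤ → ℤ
  ss r = ℤ.suc (ℤ.suc r)

  Pascal : (Point → ℚ) → Set
  Pascal g = ∀ m s → g (suc m , ℤ.suc s) ≡ g (m , s) + g (m , ss s)

  Zero : (Point → ℚ) → ℕ → ℤ → ℕ → Set
  Zero g m r c = All (λ p → g p ≡ 0ℚ) (points m r (replicate c true))

  module _ {g : Point → ℚ} (rec : Pascal g) where

    shrink : ∀ {m r} c → Zero g m r (suc c) → Zero g (suc m) (ℤ.suc r) c
    shrink zero    _             = []
    shrink (suc c) (z ∷ z′ ∷ zs) = trans (rec _ _) (cong₂ _+_ z z′) ∷ shrink c (z′ ∷ zs)

    lookup-Zero : ∀ {m} r c t → t ℕ.< c → Zero g m r c → g (m , + dbl t ℤ.+ r) ≡ 0ℚ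
    lookup-Zero {m} r (suc c) zero    _       (z ∷ zs) = trans (cong (λ s → g (m , s)) (ℤ.+-identityˡ r)) z
    lookup-Zero {m} r (suc c) (suc t) (s≤s h) (z ∷ zs) =
      trans (cong (λ s → g (m , s)) (lem (+ dbl t) r)) (lookup-Zero (ss r) c t h zs)
      where
      lem : ∀ a r → (+ 2 ℤ.+ a) ℤ.+ r ≡ a ℤ.+ (+ 1 ℤ.+ (+ 1 ℤ.+ r))
      lem = ℤ-Solver.solve-∀

    append-Zero : ∀ {m} r c → Zero g m r c → g (m , + dbl c ℤ.+ r) ≡ 0ℚ → Zero g m r (suc c)
    append-Zero {m} r zero    []       e = trans (cong (λ s → g (m , s)) (sym (ℤ.+-identityˡ r))) e ∷ []
    append-Zero {m} r (suc c) (z ∷ zs) e = z ∷ append-Zero (ss r) c zs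
      (trans (cong (λ s → g (m , s)) (lem (+ dbl c) r)) e)
      where
      lem : ∀ a r → a ℤ.+ (+ 1 ℤ.+ (+ 1 ℤ.+ r)) ≡ (+ 2 ℤ.+ a) ℤ.+ r
      lem = ℤ-Solver.solve-∀

    -- Pascal's rule turns a column of zeros into a column one level up that is shorter by one and
    -- still centred at height 0. After `2i` levels `2(y + 1)` zeros are left, and height -1 is
    -- among them.
    Zero⇒lower : ∀ i y m → Zero g m (ℤ.- + suc (dbl (i ℕ.+ y))) (dbl (suc (i ℕ.+ y))) → g (dbl i ℕ.+ m , ℤ.- + 1) ≡ 0ℚ
    Zero⇒lower zero y m zs = trans (cong (λ s → g (m , s)) (sym (lem (+ dbl y))))
        (lookup-Zero (ℤ.- + suc (dbl y)) (dbl (suc y)) y (s≤s (ℕ.m≤n⇒m≤1+n (le y))) zs)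
      where
      le : ∀ y → y ℕ.≤ dbl y
      le y = ℕ.≤-trans (ℕ.m≤m+n y y) (ℕ.≤-reflexive (sym (dbl≡+ y)))
      lem : ∀ a → a ℤ.+ ℤ.- (+ 1 ℤ.+ a) ≡ ℤ.- + 1
      lem = ℤ-Solver.solve-∀
    Zero⇒lower (suc i) y m zs = trans (cong (λ M → g (M , ℤ.- + 1)) (sym (trans (ℕ.+-suc (dbl i) (suc m)) (cong suc (ℕ.+-suc (dbl i) m)))))
      (Zero⇒lower i y (suc (suc m)) (shrink (dbl (suc (i ℕ.+ y))) (shrink (suc (dbl (suc (i ℕ.+ y)))) zs)))

    two-steps : ∀ m s → g (suc (suc m) , ss s) ≡ (g (m , s) + g (m , ss s)) + (g (m , ss s) + g (m , ss (ss s)))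
    two-steps m s = trans (rec (suc m) (ℤ.suc s)) (cong₂ _+_ (rec m s) (rec m (ss s)))

    -- Pascal's rule solved backwards. The columns at the levels `m` and `m + 2` are zero by
    -- induction; in `two-steps` taken at either end of the column all values but the new outermost
    -- one are then known to be 0.
    extend : ∀ t m → (∀ i → i ℕ.≤ t → g (dbl i ℕ.+ m , ℤ.- + 1) ≡ 0ℚ × g (dbl i ℕ.+ m , + 1) ≡ 0ℚ) →
             Zero g m (ℤ.- + suc (dbl t)) (dbl (suc t))
    extend zero    m hyp = proj₁ (hyp 0 z≤n) ∷ proj₂ (hyp 0 z≤n) ∷ []
    extend (suc t) m hyp with extend t m (λ i h → hyp i (ℕ.m≤n⇒m≤1+n h)) | extend t (suc (suc m)) hyp₂
      where
      hyp₂ : ∀ i → i ℕ.≤ t → g (dbl i ℕ.+ suc (suc m) , ℤ.- + 1) ≡ 0ℚ × g (dbl i ℕ.+ suc (suc m) , + 1) ≡ 0ℚ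
      hyp₂ i h = subst (λ M → g (M , ℤ.- + 1) ≡ 0ℚ × g (M , + 1) ≡ 0ℚ)
                   (sym (trans (ℕ.+-suc (dbl i) (suc m)) (cong suc (ℕ.+-suc (dbl i) m)))) (hyp (suc i) (s≤s h))
    ... | a ∷ a′ ∷ as | b ∷ b′ ∷ bs = lower ∷ append-Zero r (dbl (suc t)) (a ∷ a′ ∷ as) upper
      where
      s r w : ℤ
      s = ℤ.- + suc (dbl (suc t))
      r = ℤ.- + suc (dbl t)
      w = + dbl (dbl t) ℤ.+ r
      l1 : ∀ x → x ≡ (x + 0ℚ) + (0ℚ + 0ℚ)
      l1 = solve-∀ ℚ-ring
      lower : g (m , s) ≡ 0ℚ
      lower = begin
        g (m , s)                              ≡⟨ l1 (g (m , s)) ⟩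
        (g (m , s) + 0ℚ) + (0ℚ + 0ℚ)           ≡⟨ cong₂ (λ u v → (g (m , s) + u) + (u + v)) (sym a) (sym a′) ⟩
        (g (m , s) + g (m , ss s)) + (g (m , ss s) + g (m , ss (ss s))) ≡⟨ sym (two-steps m s) ⟩
        g (suc (suc m) , ss s)                 ≡⟨ b ⟩
        0ℚ                                     ∎
      l2 : ∀ x → x ≡ (0ℚ + 0ℚ) + (0ℚ + x)
      l2 = solve-∀ ℚ-ring
      sh : ∀ a r → (+ 2 ℤ.+ a) ℤ.+ r ≡ + 1 ℤ.+ (+ 1 ℤ.+ (a ℤ.+ r))
      sh = ℤ-Solver.solve-∀
      w₁ : g (m , w) ≡ 0ℚ
      w₁ = lookup-Zero r (dbl (suc t)) (dbl t) (ℕ.n≤1+n _) (a ∷ a′ ∷ as)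
      w₂ : ∀ {M} → Zero g M r (dbl (suc t)) → g (M , ss w) ≡ 0ℚ
      w₂ {M} zs = trans (cong (λ z → g (M , z)) (sym (sh (+ dbl (dbl t)) r))) (lookup-Zero r (dbl (suc t)) (suc (dbl t)) ℕ.≤-refl zs)
      upper : g (m , + dbl (dbl (suc t)) ℤ.+ r) ≡ 0ℚ
      upper = trans (cong (λ z → g (m , z)) (trans (sh (+ suc (suc (dbl (dbl t)))) r) (cong ss (sh (+ dbl (dbl t)) r)))) (begin
        g (m , ss (ss w))                      ≡⟨ l2 (g (m , ss (ss w))) ⟩
        (0ℚ + 0ℚ) + (0ℚ + g (m , ss (ss w)))
          ≡⟨ cong₂ (λ u v → (u + v) + (v + g (m , ss (ss w)))) (sym w₁) (sym (w₂ (a ∷ a′ ∷ as))) ⟩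
        (g (m , w) + g (m , ss w)) + (g (m , ss w) + g (m , ss (ss w))) ≡⟨ sym (two-steps m w) ⟩
        g (suc (suc m) , ss w)                 ≡⟨ w₂ (b ∷ b′ ∷ bs) ⟩
        0ℚ                                     ∎)

  -- Formal polynomials Σ cᵢ yˡ⁽ⁱ⁾, evaluated through the values f l of a functional at yˡ.
  data Poly : Set where
    mono : ℕ → Poly
    _⊞_  : Poly → Poly → Poly
    _·_  : ℚ → Poly → Poly

  ev : (ℕ → ℚ) → Poly → ℚ
  ev f (mono l) = f l
  ev f (c ⊞ d)  = ev f c + ev f d
  ev f (a · c)  = a * ev f c

  ev-cong : ∀ {f f′} → (∀ l → f l ≡ f′ l) → ∀ c → ev f c ≡ ev f′ c
  ev-cong e (mono l) = e l
  ev-cong e (c ⊞ d)  = cong₂ _+_ (ev-cong e c) (ev-cong e d)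
  ev-cong e (a · c)  = cong (a *_) (ev-cong e c)

  ev-zero : ∀ {f} → (∀ l → f l ≡ 0ℚ) → ∀ c → ev f c ≡ 0ℚ
  ev-zero e (mono l) = e l
  ev-zero e (c ⊞ d)  = cong₂ _+_ (ev-zero e c) (ev-zero e d)
  ev-zero e (a · c)  = trans (cong (a *_) (ev-zero e c)) (*-zeroʳ a)

  ev-+ : ∀ f f′ c → ev (λ l → f l + f′ l) c ≡ ev f c + ev f′ c
  ev-+ f f′ (mono l) = refl
  ev-+ f f′ (c ⊞ d)  = trans (cong₂ _+_ (ev-+ f f′ c) (ev-+ f f′ d)) (lem (ev f c) (ev f′ c) (ev f d) (ev f′ d))
    where
    lem : ∀ a b c d → (a + b) + (c + d) ≡ (a + c) + (b + d)
    lem = solve-∀ ℚ-ring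
  ev-+ f f′ (a · c)  = trans (cong (a *_) (ev-+ f f′ c)) (*-distribˡ-+ a (ev f c) (ev f′ c))

  ev-* : ∀ b f c → ev (λ l → b * f l) c ≡ b * ev f c
  ev-* b f (mono l) = refl
  ev-* b f (c ⊞ d)  = trans (cong₂ _+_ (ev-* b f c) (ev-* b f d)) (sym (*-distribˡ-+ b (ev f c) (ev f d)))
  ev-* b f (a · c)  = trans (cong (a *_) (ev-* b f c)) (lem a b (ev f c))
    where
    lem : ∀ a b c → a * (b * c) ≡ b * (a * c)
    lem = solve-∀ ℚ-ring

  ev-swap : ∀ (B : ℕ → ℕ → ℚ) c d → ev (λ l → ev (B l) d) c ≡ ev (λ l′ → ev (λ l → B l l′) c) d
  ev-swap B (mono l)  d = refl
  ev-swap B (c ⊞ c′)  d = trans (cong₂ _+_ (ev-swap B c d) (ev-swap B c′ d)) (sym (ev-+ _ _ d))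
  ev-swap B (a · c)   d = trans (cong (a *_) (ev-swap B c d)) (sym (ev-* a _ d))

  contr-ev : ∀ {A : Set} (ψ : ℕ → A → ℚ) F xs c → contr (λ z → ev (λ l → ψ l z) c) F xs ≡ ev (λ l → contr (ψ l) F xs) c
  contr-ev ψ F xs (mono l) = refl
  contr-ev ψ F xs (c ⊞ d)  = trans (contr-+ˡ _ _ F xs) (cong₂ _+_ (contr-ev ψ F xs c) (contr-ev ψ F xs d))
  contr-ev ψ F xs (a · c)  = trans (contr-*ˡ a _ F xs) (cong (a *_) (contr-ev ψ F xs c))

  ⟨lower,lower⟩ : ∀ l j → ⟨ lowerPt l , lowerPt j ⟩ ≡ 0ℚ
  ⟨lower,lower⟩ l j = cong ι (q-zero (dbl l ℕ.+ dbl j))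

  dbl-+ : ∀ a b → dbl (a ℕ.+ b) ≡ dbl a ℕ.+ dbl b
  dbl-+ zero    b = refl
  dbl-+ (suc a) b = cong (λ m → suc (suc m)) (dbl-+ a b)

  ⟨lower,upper⟩ : ∀ l j → ⟨ lowerPt l , upperPt j ⟩ ≡ h (l ℕ.+ j)
  ⟨lower,upper⟩ l j = trans (cong (λ M → ι (q M (+ 2))) (sym (dbl-+ l j))) (sym (h≡ (l ℕ.+ j)))

  Zero-repeated : ∀ {F} → Alternating F → ∀ pre xs → All (λ a → F (a ∷ pre ++ xs) ≡ 0ℚ) xs
  Zero-repeated {F} alt pre []       = []
  Zero-repeated {F} alt pre (a ∷ xs) = repeated F alt a pre xs ∷
    subst (λ ys → All (λ b → F (b ∷ ys) ≡ 0ℚ) xs) (++-assoc pre (a ∷ []) xs) (Zero-repeated {F} alt (pre ++ a ∷ []) xs)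

  module _ (n : ℕ) where

    starts≡ : ∀ x → starts n x ≡ points (dbl n) (ℤ.suc (ℤ.- + dbl x)) (replicate (dbl x) true)
    starts≡ x = cong₂ (λ N X → points N (ℤ.suc (ℤ.- + X)) (replicate X true)) (2*≡dbl n) (2*≡dbl x)

    level : ∀ i → dbl i ℕ.+ dbl n ≡ dbl (n ℕ.+ i)
    level i = trans (ℕ.+-comm (dbl i) (dbl n)) (sym (dbl-+ n i))

    -- w is y^k modulo y^n, …, y^(n+x-1) and orthogonal to these.
    record Residual (x k : ℕ) (w : Poly) : Set where
      field
        modulo     : ∀ f → (∀ i → i ℕ.< x → f (n ℕ.+ i) ≡ 0ℚ) → ev f w ≡ f k
        orthogonal : ∀ i → i ℕ.< x → ev (λ l → h (l ℕ.+ (n ℕ.+ i))) w ≡ 0ℚ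

    -- The exchange of points is used in both directions. The Pfaffian `g` vanishes when its first
    -- point is a starting point, hence at every `lowerPt (n + i)`, so `w` may replace `lowerPt k`.
    -- Conversely `φ`, the pairing with `w`, vanishes at the points `(2(n + i) , ±1)`, hence at the
    -- starting points, and only the pairing with `upperPt k` survives.
    insert-pair : ∀ x k w → Residual x k w →
      pf (suc x) (lowerPt k ∷ upperPt k ∷ starts n x) ≡ ev (λ l → h (l ℕ.+ k)) w * pf x (starts n x)
    insert-pair x k w res = begin
      g (lowerPt k)                                 ≡⟨ sym (modulo (λ l → g (lowerPt l)) lower-zero) ⟩
      ev (λ l → g (lowerPt l)) w                    ≡⟨ sym (contr-ev (λ l → ⟨ lowerPt l ,_⟩) (pf x) (upperPt k ∷ A) w) ⟩
      contr φ (pf x) (upperPt k ∷ A)                ≡⟨ contr-orthogonal φ x (upperPt k) φ-zero ⟩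
      φ (upperPt k) * pf x A                        ≡⟨ cong (_* pf x A) (ev-cong (λ l → ⟨lower,upper⟩ l k) w) ⟩
      ev (λ l → h (l ℕ.+ k)) w * pf x A             ∎
      where
      open Residual res
      A = starts n x
      g φ : Point → ℚ
      g p = contr ⟨ p ,_⟩ (pf x) (upperPt k ∷ A)
      φ z = ev (λ l → ⟨ lowerPt l , z ⟩) w
      g-Pascal : Pascal g
      g-Pascal m s = trans (contr-cong {F = pf x} {G = pf x} (step-Sum m s) (λ _ → refl) (upperPt k ∷ A)) (contr-+ˡ ⟨ (m , s) ,_⟩ ⟨ (m , ss s) ,_⟩ (pf x) (upperPt k ∷ A))
      g-zero : All (λ p → g p ≡ 0ℚ) (points (dbl n) (ℤ.suc (ℤ.- + dbl x)) (replicate (dbl x) true))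
      g-zero = subst (All (λ p → g p ≡ 0ℚ)) (starts≡ x) (Zero-repeated {pf (suc x)} (pf-Alternating (suc x)) (upperPt k ∷ []) A)
      lower-zero : ∀ i → i ℕ.< x → g (lowerPt (n ℕ.+ i)) ≡ 0ℚ
      lower-zero i i<x with ℕ.m≤n⇒∃[o]m+o≡n i<x
      ... | y , refl = trans (cong (λ M → g (M , ℤ.- + 1)) (sym (level i))) (Zero⇒lower g-Pascal i y (dbl n) g-zero)
      φ-Pascal : Pascal φ
      φ-Pascal m s = trans (ev-cong (λ l → Sum-flip (lowerPt l) (step-Sum m s)) w) (ev-+ _ _ w)
      φ-zero′ : ∀ y → y ≡ x → Zero φ (dbl n) (ℤ.suc (ℤ.- + dbl y)) (dbl y)
      φ-zero′ zero    _ = []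
      φ-zero′ (suc t) e = extend φ-Pascal t (dbl n) (λ i h →
        trans (cong (λ M → φ (M , ℤ.- + 1)) (level i)) (ev-zero (λ l → ⟨lower,lower⟩ l (n ℕ.+ i)) w) ,
        trans (cong (λ M → φ (M , + 1)) (level i)) (trans (ev-cong (λ l → ⟨lower,upper⟩ l (n ℕ.+ i)) w)
          (orthogonal i (subst (i ℕ.<_) e (s≤s h)))))
      φ-zero : All (λ p → φ p ≡ 0ℚ) A
      φ-zero = subst (All (λ p → φ p ≡ 0ℚ)) (sym (starts≡ x)) (φ-zero′ x refl)

-- Explicit orthogonal polynomials and the distance to their span.

module Gram where

  open Rat
  open Moments
  open Orthogonal
  open import Data.Nat as ℕ using (ℕ; zero; suc; s≤s)
  import Data.Nat.Properties as ℕ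
  open import Data.Rational
  open import Data.Rational.Properties
  open import Data.Sum using (_⊎_; inj₁; inj₂)
  open import Relation.Binary.PropositionalEquality hiding (J)
  open import Tactic.RingSolver using (solve-∀)
  open ≡-Reasoning

  rising : ℕ → ℕ → ℚ
  rising a zero    = 1ℚ
  rising a (suc x) = ν a * rising (suc a) x

  rising-last : ∀ a x → rising a (suc x) ≡ rising a x * ν (a ℕ.+ x)
  rising-last a zero    = trans (*-comm (ν a) 1ℚ) (cong (λ m → 1ℚ * ν m) (sym (ℕ.+-identityʳ a)))
  rising-last a (suc x) = trans (cong (ν a *_) (rising-last (suc a) x))
    (trans (sym (*-assoc (ν a) (rising (suc a) x) (ν (suc a ℕ.+ x)))) (cong (λ m → ν a * rising (suc a) x * ν m) (sym (ℕ.+-suc a x))))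

  rising-pos : ∀ a x → 0ℚ < rising (suc a) x
  rising-pos a zero    = 0<1
  rising-pos a (suc x) = *-pos (ν-pos a) (rising-pos (suc a) x)

  module _ (n : ℕ) where

    -- A falling factorial of `s - n`: as a polynomial in `s` it has the roots `n`, ...,
    -- `n + x - 1`, which express orthogonality to the corresponding powers.
    falling : ℕ → ℕ → ℚ
    falling s zero    = 1ℚ
    falling s (suc x) = falling s x * (ν s - ν n - ν x)

    falling-shift : ∀ s x → falling (suc s) (suc x) ≡ (1ℚ + ν s - ν n) * falling s x
    falling-shift s zero    = trans (cong (λ u → 1ℚ * (u - ν n - ν 0)) (ν-suc s)) (lem (ν s) (ν n))
      where
      lem : ∀ s n → 1ℚ * (1ℚ + s - n - 0ℚ) ≡ (1ℚ + s - n) * 1ℚ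
      lem = solve-∀ ℚ-ring
    falling-shift s (suc x) = trans (cong₂ (λ u v → u * (ν (suc s) - ν n - v)) (falling-shift s x) (ν-suc x))
      (trans (cong (λ u → (1ℚ + ν s - ν n) * falling s x * (u - ν n - (1ℚ + ν x))) (ν-suc s)) (lem (ν s) (ν n) (ν x) (falling s x)))
      where
      lem : ∀ s n x f → (1ℚ + s - n) * f * (1ℚ + s - n - (1ℚ + x)) ≡ (1ℚ + s - n) * (f * (s - n - x))
      lem = solve-∀ ℚ-ring

    falling-zero : ∀ i x → i ℕ.< x → falling (n ℕ.+ i) x ≡ 0ℚ
    falling-zero i (suc x) (s≤s h) with ℕ.m≤n⇒m<n∨m≡n h
    ... | inj₁ l    = trans (cong (_* (ν (n ℕ.+ i) - ν n - ν x)) (falling-zero i x l)) (*-zeroˡ (ν (n ℕ.+ i) - ν n - ν x))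
    ... | inj₂ refl = trans (cong (λ u → falling (n ℕ.+ i) i * (u - ν n - ν i)) (ν-+ n i)) (lem (falling (n ℕ.+ i) i) (ν n) (ν i))
      where
      lem : ∀ f n i → f * (n + i - n - i) ≡ 0ℚ
      lem = solve-∀ ℚ-ring

    falling-diag : ∀ x → falling (n ℕ.+ suc x) (suc x) ≡ (1ℚ + ν x) * falling (n ℕ.+ x) x
    falling-diag x = trans (cong (λ s → falling s (suc x)) (ℕ.+-suc n x))
      (trans (falling-shift (n ℕ.+ x) x) (cong (_* falling (n ℕ.+ x) x) (trans (cong (λ u → 1ℚ + u - ν n) (ν-+ n x)) (lem (ν n) (ν x)))))
      where
      lem : ∀ n x → 1ℚ + (n + x) - n ≡ 1ℚ + x
      lem = solve-∀ ℚ-ring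

    falling-pos : ∀ x → 0ℚ < falling (n ℕ.+ x) x
    falling-pos zero    = 0<1
    falling-pos (suc x) = subst (0ℚ <_) (sym (trans (falling-diag x) (cong (_* falling (n ℕ.+ x) x) (sym (ν-suc x))))) (*-pos (ν-pos x) (falling-pos x))

    D : ℕ → ℚ
    D zero    = 1ℚ
    D (suc x) = D x * (ν 2 + ν 4 * ν x)

    D-pos : ∀ x → 0ℚ < D x
    D-pos zero    = 0<1
    D-pos (suc x) = *-pos (D-pos x) (subst (0ℚ <_) (+-comm (ν 4 * ν x) (ν 2)) (+-pos (*-nonneg (0≤ν 4) (0≤ν x)) (ν-pos 1)))

    -- jacobi t x lies in the span of y^t, …, y^(t+x) and is orthogonal to y^n, …, y^(n+x-1): by
    -- jacobi-moment its moments are a fixed hypergeometric factor times a polynomial of degree x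
    -- with the prescribed roots, and the recurrence below produces one root after another.
    jacobi : ℕ → ℕ → Poly
    jacobi t zero    = mono t
    jacobi t (suc x) = ((- (ν 6 + ν 4 * (ν t + ν n + ν x))) · jacobi t x) ⊞ ((ν t + ν n + ν 2 * ν x + ν 2) · jacobi (suc t) x)

    moment : ℕ → ℕ → ℕ → ℚ
    moment t x s = ev (λ l → h (s ℕ.+ l)) (jacobi t x)

    jacobi-moment : ∀ x t s → moment t x s * rising (2 ℕ.+ (s ℕ.+ t)) x ≡ D x * h (s ℕ.+ t) * falling s x
    jacobi-moment zero    t s = lem (h (s ℕ.+ t))
      where
      lem : ∀ a → a * 1ℚ ≡ 1ℚ * a * 1ℚ
      lem = solve-∀ ℚ-ring
    jacobi-moment (suc x) t s = begin
      (c₁ * A + c₂ * B) * rising (2 ℕ.+ σ) (suc x)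
        ≡⟨ l1 c₁ c₂ A B (rising (2 ℕ.+ σ) (suc x)) ⟩
      c₁ * (A * rising (2 ℕ.+ σ) (suc x)) + c₂ * (B * rising (2 ℕ.+ σ) (suc x))
        ≡⟨ cong₂ (λ u v → c₁ * (A * u) + c₂ * (B * v)) (rising-last (2 ℕ.+ σ) x) refl ⟩
      c₁ * (A * (p * ν (2 ℕ.+ σ ℕ.+ x))) + c₂ * (B * (ν (2 ℕ.+ σ) * p′))
        ≡⟨ cong₂ (λ u v → c₁ * (A * (p * u)) + c₂ * (B * (v * p′))) (trans (ν-+ (2 ℕ.+ σ) x) (cong (_+ ν x) ν2σ)) ν2σ ⟩
      c₁ * (A * (p * (ν 2 + S + ν x))) + c₂ * (B * ((ν 2 + S) * p′))
        ≡⟨ l2 c₁ c₂ A B p p′ (ν 2 + S) (ν x) ⟩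
      c₁ * (A * p) * (ν 2 + S + ν x) + c₂ * (B * p′) * (ν 2 + S)
        ≡⟨ cong₂ (λ u v → c₁ * u * (ν 2 + S + ν x) + c₂ * v * (ν 2 + S)) (jacobi-moment x t s) IH₂ ⟩
      c₁ * (D x * h σ * fl) * (ν 2 + S + ν x) + c₂ * (D x * h (suc σ) * fl) * (ν 2 + S)
        ≡⟨ l3 c₁ c₂ (D x) (h σ) fl (h (suc σ)) (ν 2 + S) (ν x) ⟩
      c₁ * (D x * h σ * fl) * (ν 2 + S + ν x) + c₂ * (D x * fl) * ((ν 2 + S) * h (suc σ))
        ≡⟨ cong (λ u → c₁ * (D x * h σ * fl) * (ν 2 + S + ν x) + c₂ * (D x * fl) * u)
             (trans (cong (λ u → (ν 2 + u) * h (suc σ)) (sym (ν-+ s t))) (trans (h-suc σ) (cong (λ u → (ν 6 + ν 4 * u) * h σ) (ν-+ s t)))) ⟩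
      -- Apart from common factors this is linear in `ν s`. The coefficients `c₁` and `c₂` are those
      -- for which it vanishes at `s = n + x`, the next root.
      c₁ * (D x * h σ * fl) * (ν 2 + S + ν x) + c₂ * (D x * fl) * ((ν 6 + ν 4 * S) * h σ)
        ≡⟨ l4 (ν s) (ν t) (ν n) (ν x) (D x) (h σ) fl ⟩
      D x * (ν 2 + ν 4 * ν x) * h σ * (fl * (ν s - ν n - ν x)) ∎
      where
      σ = s ℕ.+ t
      S = ν s + ν t
      c₁ = - (ν 6 + ν 4 * (ν t + ν n + ν x))
      c₂ = ν t + ν n + ν 2 * ν x + ν 2
      A = moment t x s
      B = moment (suc t) x s
      p = rising (2 ℕ.+ σ) x
      p′ = rising (3 ℕ.+ σ) x
      fl = falling s x
      ν2σ : ν (2 ℕ.+ σ) ≡ ν 2 + S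
      ν2σ = trans (ν-+ 2 σ) (cong (ν 2 +_) (ν-+ s t))
      IH₂ : B * p′ ≡ D x * h (suc σ) * fl
      IH₂ = subst (λ m → B * rising (2 ℕ.+ m) x ≡ D x * h m * fl) (ℕ.+-suc s t) (jacobi-moment x (suc t) s)
      l1 : ∀ c d a b r → (c * a + d * b) * r ≡ c * (a * r) + d * (b * r)
      l1 = solve-∀ ℚ-ring
      l2 : ∀ c d a b p p′ u x → c * (a * (p * (u + x))) + d * (b * (u * p′)) ≡ c * (a * p) * (u + x) + d * (b * p′) * u
      l2 = solve-∀ ℚ-ring
      l3 : ∀ c d D h f h′ u x → c * (D * h * f) * (u + x) + d * (D * h′ * f) * u ≡ c * (D * h * f) * (u + x) + d * (D * f) * (u * h′)
      l3 = solve-∀ ℚ-ring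
      l4 : ∀ s t n x D h f → (- (ν 6 + ν 4 * (t + n + x))) * (D * h * f) * (ν 2 + (s + t) + x) + (t + n + ν 2 * x + ν 2) * (D * f) * ((ν 6 + ν 4 * (s + t)) * h)
           ≡ D * (ν 2 + ν 4 * x) * h * (f * (s - n - x))
      l4 = solve-∀ ℚ-ring

    -- A functional that kills the lower powers sees only the leading coefficient. In the recurrence
    -- that coefficient comes from the second summand alone, so it is a product of the factors `c₂`.
    ev-jacobi : ∀ x t f → (∀ i → i ℕ.< x → f (t ℕ.+ i) ≡ 0ℚ) → ev f (jacobi t x) ≡ rising (suc (t ℕ.+ n ℕ.+ x)) x * f (t ℕ.+ x)
    ev-jacobi zero    t f z = trans (sym (*-identityˡ (f t))) (cong (λ m → 1ℚ * f m) (sym (ℕ.+-identityʳ t)))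
    ev-jacobi (suc x) t f z = begin
      c₁ * ev f (jacobi t x) + c₂ * ev f (jacobi (suc t) x)
        ≡⟨ cong₂ (λ u v → c₁ * u + c₂ * v)
             (trans (ev-jacobi x t f (λ i l → z i (ℕ.m≤n⇒m≤1+n l))) (trans (cong (rising (suc (t ℕ.+ n ℕ.+ x)) x *_) (z x ℕ.≤-refl)) (*-zeroʳ (rising (suc (t ℕ.+ n ℕ.+ x)) x))))
             (ev-jacobi x (suc t) f (λ i l → subst (λ m → f m ≡ 0ℚ) (ℕ.+-suc t i) (z (suc i) (s≤s l)))) ⟩
      c₁ * 0ℚ + c₂ * (rising (suc (suc t ℕ.+ n ℕ.+ x)) x * f (suc t ℕ.+ x))
        ≡⟨ lem c₁ c₂ (rising (suc (suc t ℕ.+ n ℕ.+ x)) x) (f (suc t ℕ.+ x)) ⟩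
      rising (suc (suc t ℕ.+ n ℕ.+ x)) x * c₂ * f (suc t ℕ.+ x)
        ≡⟨ cong₂ (λ u v → rising (suc (suc t ℕ.+ n ℕ.+ x)) x * u * f v) c₂≡ (sym (ℕ.+-suc t x)) ⟩
      rising (suc (suc t ℕ.+ n ℕ.+ x)) x * ν (suc (suc t ℕ.+ n ℕ.+ x) ℕ.+ x) * f (t ℕ.+ suc x)
        ≡⟨ cong (_* f (t ℕ.+ suc x)) (sym (rising-last (suc (suc t ℕ.+ n ℕ.+ x)) x)) ⟩
      rising (suc (suc t ℕ.+ n ℕ.+ x)) (suc x) * f (t ℕ.+ suc x)
        ≡⟨ cong (λ m → rising (suc m) (suc x) * f (t ℕ.+ suc x)) (sym (ℕ.+-suc (t ℕ.+ n) x)) ⟩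
      rising (suc (t ℕ.+ n ℕ.+ suc x)) (suc x) * f (t ℕ.+ suc x) ∎
      where
      c₁ = - (ν 6 + ν 4 * (ν t + ν n + ν x))
      c₂ = ν t + ν n + ν 2 * ν x + ν 2
      lem : ∀ c d r f → c * 0ℚ + d * (r * f) ≡ r * d * f
      lem = solve-∀ ℚ-ring
      l2 : ∀ t n x → t + n + ν 2 * x + ν 2 ≡ ν 2 + (t + n + x) + x
      l2 = solve-∀ ℚ-ring
      c₂≡ : c₂ ≡ ν (2 ℕ.+ (t ℕ.+ n ℕ.+ x) ℕ.+ x)
      c₂≡ = trans (l2 (ν t) (ν n) (ν x)) (sym (trans (ν-+ (2 ℕ.+ (t ℕ.+ n ℕ.+ x)) x) (cong (_+ ν x) (trans (ν-+ 2 (t ℕ.+ n ℕ.+ x))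
        (cong (ν 2 +_) (trans (ν-+ (t ℕ.+ n) x) (cong (_+ ν x) (ν-+ t n))))))))

    J : ℕ → ℕ → ℚ
    J x s = moment n x s

    -- `norm x` is the squared norm of the `x`-th orthogonal polynomial: being orthogonal to the
    -- lower powers, the polynomial pairs only with its own leading term.
    lead norm : ℕ → ℚ
    lead x = rising (suc (n ℕ.+ n ℕ.+ x)) x
    norm x = lead x * J x (n ℕ.+ x)

    rising≢0 : ∀ a x → rising (suc a) x ≢ 0ℚ
    rising≢0 a x = >0⇒≢0 (rising-pos a x)

    J-zero : ∀ x i → i ℕ.< x → J x (n ℕ.+ i) ≡ 0ℚ
    J-zero x i l = cancel (rising (2 ℕ.+ (n ℕ.+ i ℕ.+ n)) x) (rising≢0 _ x) (begin
      rising (2 ℕ.+ (n ℕ.+ i ℕ.+ n)) x * J x (n ℕ.+ i)  ≡⟨ *-comm (rising (2 ℕ.+ (n ℕ.+ i ℕ.+ n)) x) (J x (n ℕ.+ i)) ⟩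
      J x (n ℕ.+ i) * rising (2 ℕ.+ (n ℕ.+ i ℕ.+ n)) x  ≡⟨ jacobi-moment x n (n ℕ.+ i) ⟩
      D x * h (n ℕ.+ i ℕ.+ n) * falling (n ℕ.+ i) x     ≡⟨ cong (D x * h (n ℕ.+ i ℕ.+ n) *_) (falling-zero i x l) ⟩
      D x * h (n ℕ.+ i ℕ.+ n) * 0ℚ                      ≡⟨ *-zeroʳ (D x * h (n ℕ.+ i ℕ.+ n)) ⟩
      0ℚ                                                ≡⟨ sym (*-zeroʳ (rising (2 ℕ.+ (n ℕ.+ i ℕ.+ n)) x)) ⟩
      rising (2 ℕ.+ (n ℕ.+ i ℕ.+ n)) x * 0ℚ             ∎)

    J-pos : ∀ x → 0ℚ < J x (n ℕ.+ x)
    J-pos x = subst (0ℚ <_) eq (*-pos (inv-pos r>0) (*-pos (*-pos (D-pos x) (h-pos (n ℕ.+ x ℕ.+ n))) (falling-pos x)))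
      where
      r = rising (2 ℕ.+ (n ℕ.+ x ℕ.+ n)) x
      r>0 : 0ℚ < r
      r>0 = rising-pos _ x
      eq : inv r * (D x * h (n ℕ.+ x ℕ.+ n) * falling (n ℕ.+ x) x) ≡ J x (n ℕ.+ x)
      eq = trans (cong (inv r *_) (sym (jacobi-moment x n (n ℕ.+ x)))) (trans (lem (inv r) (J x (n ℕ.+ x)) r)
        (trans (cong (J x (n ℕ.+ x) *_) (inv-ʳ (>0⇒≢0 r>0))) (*-identityʳ (J x (n ℕ.+ x)))))
        where
        lem : ∀ i j r → i * (j * r) ≡ j * (r * i)
        lem = solve-∀ ℚ-ring

    norm-pos : ∀ x → 0ℚ < norm x
    norm-pos x = *-pos (rising-pos _ x) (J-pos x)

    residual : ℕ → ℕ → Poly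
    residual k zero    = mono k
    residual k (suc x) = residual k x ⊞ ((- (J x k * inv (norm x))) · jacobi n x)

    dist : ℕ → ℕ → ℚ
    dist k x = ev (λ l → h (l ℕ.+ k)) (residual k x)

    residual-correct : ∀ k x → Residual n x k (residual k x)
    residual-correct k zero    = record { modulo = λ f _ → refl ; orthogonal = λ _ () }
    residual-correct k (suc x) = record { modulo = md ; orthogonal = λ i l → orth i (ℕ.m≤n⇒m<n∨m≡n (ℕ.≤-pred l)) }
      where
      open Residual (residual-correct k x)
      a = - (J x k * inv (norm x))
      R = residual k x
      e : ℕ → ℚ
      e j = ev (λ l → h (l ℕ.+ j)) R
      md : ∀ f → (∀ i → i ℕ.< suc x → f (n ℕ.+ i) ≡ 0ℚ) → ev f (residual k (suc x)) ≡ f k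
      md f z = trans (cong₂ (λ u v → u + a * v) (modulo f (λ i l → z i (ℕ.m≤n⇒m≤1+n l)))
          (trans (ev-jacobi x n f (λ i l → z i (ℕ.m≤n⇒m≤1+n l))) (trans (cong (lead x *_) (z x ℕ.≤-refl)) (*-zeroʳ (lead x)))))
        (lem (f k) a)
        where
        lem : ∀ f a → f + a * 0ℚ ≡ f
        lem = solve-∀ ℚ-ring
      jac : ∀ j → ev (λ l → h (l ℕ.+ j)) (jacobi n x) ≡ J x j
      jac j = ev-cong (λ l → cong h (ℕ.+-comm l j)) (jacobi n x)
      -- Both sides are the pairing of the residual with the orthogonal polynomial. Expanded along
      -- the polynomial only its leading power survives; expanded along the residual only y^k does.
      top : lead x * e (n ℕ.+ x) ≡ J x k
      top = begin
        lead x * e (n ℕ.+ x)          ≡⟨ sym (ev-jacobi x n e orthogonal) ⟩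
        ev e (jacobi n x)             ≡⟨ ev-swap (λ j l → h (l ℕ.+ j)) (jacobi n x) R ⟩
        ev (J x) R                    ≡⟨ modulo (J x) (J-zero x) ⟩
        J x k                         ∎
      orth : ∀ i → (i ℕ.< x) ⊎ (i ≡ x) → ev (λ l → h (l ℕ.+ (n ℕ.+ i))) (residual k (suc x)) ≡ 0ℚ
      orth i (inj₁ l) = trans (cong₂ (λ u v → u + a * v) (orthogonal i l) (trans (jac (n ℕ.+ i)) (J-zero x i l))) (lem a)
        where
        lem : ∀ a → 0ℚ + a * 0ℚ ≡ 0ℚ
        lem = solve-∀ ℚ-ring
      orth i (inj₂ refl) = cancel (lead i) (rising≢0 _ i) (begin
        lead i * (e (n ℕ.+ i) + a * ev (λ l → h (l ℕ.+ (n ℕ.+ i))) (jacobi n i))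
          ≡⟨ cong (λ v → lead i * (e (n ℕ.+ i) + a * v)) (jac (n ℕ.+ i)) ⟩
        lead i * (e (n ℕ.+ i) + (- (J i k * inv (norm i))) * J i (n ℕ.+ i))
          ≡⟨ l1 (lead i) (e (n ℕ.+ i)) (J i k) (inv (norm i)) (J i (n ℕ.+ i)) ⟩
        lead i * e (n ℕ.+ i) + (- J i k) * (norm i * inv (norm i))
          ≡⟨ cong₂ (λ u v → u + (- J i k) * v) top (inv-ʳ (>0⇒≢0 (norm-pos i))) ⟩
        J i k + (- J i k) * 1ℚ
          ≡⟨ l2 (J i k) (lead i) ⟩
        lead i * 0ℚ ∎)
        where
        l1 : ∀ l e j v d → l * (e + (- (j * v)) * d) ≡ l * e + (- j) * (l * d * v)
        l1 = solve-∀ ℚ-ring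
        l2 : ∀ j l → j + (- j) * 1ℚ ≡ l * 0ℚ
        l2 = solve-∀ ℚ-ring

    dist-suc : ∀ k x → dist k (suc x) ≡ dist k x - J x k * J x k * inv (norm x)
    dist-suc k x = trans (cong (λ u → dist k x + (- (J x k * inv (norm x))) * u) (ev-cong (λ l → cong h (ℕ.+-comm l k)) (jacobi n x)))
      (lem (dist k x) (J x k) (inv (norm x)))
      where
      lem : ∀ d j v → d + (- (j * v)) * j ≡ d - j * j * v
      lem = solve-∀ ℚ-ring

-- First-order recurrences for the terms of the distance.

module Telescope where

  open Rat
  open Moments
  open Orthogonal
  open Gram
  open import Data.Nat as ℕ using (ℕ; suc)
  import Data.Nat.Properties as ℕ
  open import Data.Rational
  open import Data.Rational.Properties
  open import Relation.Binary.PropositionalEquality hiding (J)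
  open import Tactic.RingSolver using (solve-∀)
  open ≡-Reasoning

  module _ (n : ℕ) where

    private
      N = ν n

    J-suc : ∀ x s → J n (suc x) s * (ν 2 + (ν s + N) + ν x) ≡ J n x s * ((ν 2 + ν 4 * ν x) * (ν s - N - ν x))
    J-suc x s = cancel r (rising≢0 n _ x) (begin
      r * (J n (suc x) s * (ν 2 + (ν s + N) + ν x))   ≡⟨ l1 r (J n (suc x) s) _ ⟩
      J n (suc x) s * (r * (ν 2 + (ν s + N) + ν x))   ≡⟨ cong (λ u → J n (suc x) s * (r * u)) (sym (trans (ν-+ (2 ℕ.+ (s ℕ.+ n)) x) (cong (_+ ν x) (trans (ν-+ 2 (s ℕ.+ n)) (cong (ν 2 +_) (ν-+ s n)))))) ⟩
      J n (suc x) s * (r * ν (2 ℕ.+ (s ℕ.+ n) ℕ.+ x)) ≡⟨ cong (J n (suc x) s *_) (sym (rising-last (2 ℕ.+ (s ℕ.+ n)) x)) ⟩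
      J n (suc x) s * rising (2 ℕ.+ (s ℕ.+ n)) (suc x) ≡⟨ jacobi-moment n (suc x) n s ⟩
      D n x * (ν 2 + ν 4 * ν x) * h (s ℕ.+ n) * (falling n s x * (ν s - N - ν x))
        ≡⟨ l2 (D n x) (ν 2 + ν 4 * ν x) (h (s ℕ.+ n)) (falling n s x) (ν s - N - ν x) ⟩
      D n x * h (s ℕ.+ n) * falling n s x * ((ν 2 + ν 4 * ν x) * (ν s - N - ν x))
        ≡⟨ cong (_* ((ν 2 + ν 4 * ν x) * (ν s - N - ν x))) (sym (jacobi-moment n x n s)) ⟩
      J n x s * r * ((ν 2 + ν 4 * ν x) * (ν s - N - ν x)) ≡⟨ l3 (J n x s) r _ ⟩
      r * (J n x s * ((ν 2 + ν 4 * ν x) * (ν s - N - ν x))) ∎)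
      where
      r = rising (2 ℕ.+ (s ℕ.+ n)) x
      l1 : ∀ r j u → r * (j * u) ≡ j * (r * u)
      l1 = solve-∀ ℚ-ring
      l2 : ∀ d c h f u → d * c * h * (f * u) ≡ d * h * f * (c * u)
      l2 = solve-∀ ℚ-ring
      l3 : ∀ j r u → j * r * u ≡ r * (j * u)
      l3 = solve-∀ ℚ-ring

    J-shift : ∀ x s → J n x (suc s) * ((ν 2 + (ν s + N) + ν x) * (1ℚ + ν s - N - ν x)) ≡ J n x s * ((ν 6 + ν 4 * (ν s + N)) * (1ℚ + ν s - N))
    J-shift x s = cancel r (rising≢0 n _ x) (begin
      r * (J′ * ((ν 2 + (ν s + N) + ν x) * w))        ≡⟨ l1 r J′ _ w ⟩
      J′ * (r * (ν 2 + (ν s + N) + ν x)) * w          ≡⟨ cong (λ u → J′ * u * w) both ⟩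
      J′ * ((ν 2 + (ν s + N)) * r′) * w               ≡⟨ l2 J′ (ν 2 + (ν s + N)) r′ w ⟩
      (ν 2 + (ν s + N)) * (J′ * r′) * w               ≡⟨ cong (λ u → (ν 2 + (ν s + N)) * u * w) (jacobi-moment n x n (suc s)) ⟩
      (ν 2 + (ν s + N)) * (D n x * h (suc (s ℕ.+ n)) * falling n (suc s) x) * w
        ≡⟨ l3 (ν 2 + (ν s + N)) (D n x) (h (suc (s ℕ.+ n))) (falling n (suc s) x) w ⟩
      D n x * ((ν 2 + (ν s + N)) * h (suc (s ℕ.+ n))) * (falling n (suc s) x * w)
        ≡⟨ cong₂ (λ u v → D n x * u * v) hs fs ⟩
      D n x * ((ν 6 + ν 4 * (ν s + N)) * h (s ℕ.+ n)) * ((1ℚ + ν s - N) * falling n s x)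
        ≡⟨ l4 (D n x) (ν 6 + ν 4 * (ν s + N)) (h (s ℕ.+ n)) (1ℚ + ν s - N) (falling n s x) ⟩
      D n x * h (s ℕ.+ n) * falling n s x * ((ν 6 + ν 4 * (ν s + N)) * (1ℚ + ν s - N))
        ≡⟨ cong (_* ((ν 6 + ν 4 * (ν s + N)) * (1ℚ + ν s - N))) (sym (jacobi-moment n x n s)) ⟩
      J n x s * r * ((ν 6 + ν 4 * (ν s + N)) * (1ℚ + ν s - N)) ≡⟨ l5 (J n x s) r _ ⟩
      r * (J n x s * ((ν 6 + ν 4 * (ν s + N)) * (1ℚ + ν s - N))) ∎)
      where
      J′ = J n x (suc s)
      r = rising (2 ℕ.+ (s ℕ.+ n)) x
      r′ = rising (3 ℕ.+ (s ℕ.+ n)) x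
      w = 1ℚ + ν s - N - ν x
      ν2 : ν (2 ℕ.+ (s ℕ.+ n)) ≡ ν 2 + (ν s + N)
      ν2 = trans (ν-+ 2 (s ℕ.+ n)) (cong (ν 2 +_) (ν-+ s n))
      both : r * (ν 2 + (ν s + N) + ν x) ≡ (ν 2 + (ν s + N)) * r′
      both = trans (cong (r *_) (sym (trans (ν-+ (2 ℕ.+ (s ℕ.+ n)) x) (cong (_+ ν x) ν2))))
        (trans (sym (rising-last (2 ℕ.+ (s ℕ.+ n)) x)) (cong (_* r′) ν2))
      hs : (ν 2 + (ν s + N)) * h (suc (s ℕ.+ n)) ≡ (ν 6 + ν 4 * (ν s + N)) * h (s ℕ.+ n)
      hs = subst (λ u → (ν 2 + u) * h (suc (s ℕ.+ n)) ≡ (ν 6 + ν 4 * u) * h (s ℕ.+ n)) (ν-+ s n) (h-suc (s ℕ.+ n))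
      fs : falling n (suc s) x * w ≡ (1ℚ + ν s - N) * falling n s x
      fs = trans (cong (λ u → falling n (suc s) x * (u - N - ν x)) (sym (ν-suc s))) (falling-shift n s x)
      l1 : ∀ r j u w → r * (j * (u * w)) ≡ j * (r * u) * w
      l1 = solve-∀ ℚ-ring
      l2 : ∀ j u r w → j * (u * r) * w ≡ u * (j * r) * w
      l2 = solve-∀ ℚ-ring
      l3 : ∀ u d h f w → u * (d * h * f) * w ≡ d * (u * h) * (f * w)
      l3 = solve-∀ ℚ-ring
      l4 : ∀ d c h u f → d * (c * h) * (u * f) ≡ d * h * f * (c * u)
      l4 = solve-∀ ℚ-ring
      l5 : ∀ j r u → j * r * u ≡ r * (j * u)
      l5 = solve-∀ ℚ-ring

    norm-closed : ∀ x → norm n x * (1ℚ + (N + N + ν x) + ν x) ≡ (1ℚ + (N + N + ν x)) * (D n x * h (n ℕ.+ n ℕ.+ x) * falling n (n ℕ.+ x) x)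
    norm-closed x = begin
      lead n x * j * (1ℚ + (N + N + ν x) + ν x)           ≡⟨ l1 (lead n x) j _ ⟩
      lead n x * (1ℚ + (N + N + ν x) + ν x) * j           ≡⟨ cong (λ u → lead n x * u * j) (sym (trans (ν-+ (suc a) x) (cong (_+ ν x) ν1))) ⟩
      lead n x * ν (suc a ℕ.+ x) * j                      ≡⟨ cong (_* j) (sym (rising-last (suc a) x)) ⟩
      ν (suc a) * rising (suc (suc a)) x * j              ≡⟨ l2 (ν (suc a)) (rising (suc (suc a)) x) j ⟩
      ν (suc a) * (j * rising (suc (suc a)) x)            ≡⟨ cong₂ _*_ ν1 jm ⟩
      (1ℚ + (N + N + ν x)) * (D n x * h a * falling n (n ℕ.+ x) x) ∎
      where
      a = n ℕ.+ n ℕ.+ x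
      j = J n x (n ℕ.+ x)
      ν1 : ν (suc a) ≡ 1ℚ + (N + N + ν x)
      ν1 = trans (ν-suc a) (cong (1ℚ +_) (trans (ν-+ (n ℕ.+ n) x) (cong (_+ ν x) (ν-+ n n))))
      a≡ : n ℕ.+ x ℕ.+ n ≡ a
      a≡ = trans (ℕ.+-assoc n x n) (trans (cong (n ℕ.+_) (ℕ.+-comm x n)) (sym (ℕ.+-assoc n n x)))
      jm : j * rising (suc (suc a)) x ≡ D n x * h a * falling n (n ℕ.+ x) x
      jm = subst (λ b → j * rising (suc (suc b)) x ≡ D n x * h b * falling n (n ℕ.+ x) x) a≡ (jacobi-moment n x n (n ℕ.+ x))
      l1 : ∀ l j u → l * j * u ≡ l * u * j
      l1 = solve-∀ ℚ-ring
      l2 : ∀ a r j → a * r * j ≡ a * (j * r)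
      l2 = solve-∀ ℚ-ring

    norm-suc : ∀ x → norm n (suc x) * ((ν 3 + (N + N) + (ν x + ν x)) * (1ℚ + (N + N + ν x))) ≡
                     norm n x * ((1ℚ + (N + N + ν x) + ν x) * (ν 2 + ν 4 * ν x) * (ν 6 + ν 4 * (N + N + ν x)) * (1ℚ + ν x))
    norm-suc x = begin
      norm n (suc x) * ((ν 3 + (N + N) + (ν x + ν x)) * A)
        ≡⟨ l1 (norm n (suc x)) N (ν x) ⟩
      norm n (suc x) * (1ℚ + (N + N + (1ℚ + ν x)) + (1ℚ + ν x)) * A
        ≡⟨ cong (λ u → norm n (suc x) * (1ℚ + (N + N + u) + u) * A) (sym (ν-suc x)) ⟩
      norm n (suc x) * (1ℚ + (N + N + ν (suc x)) + ν (suc x)) * A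
        ≡⟨ cong (_* A) (norm-closed (suc x)) ⟩
      (1ℚ + (N + N + ν (suc x))) * (D n x * c * h (n ℕ.+ n ℕ.+ suc x) * falling n (n ℕ.+ suc x) (suc x)) * A
        ≡⟨ cong₂ (λ u v → (1ℚ + (N + N + u)) * (D n x * c * h v * falling n (n ℕ.+ suc x) (suc x)) * A) (ν-suc x) (ℕ.+-suc (n ℕ.+ n) x) ⟩
      (1ℚ + (N + N + (1ℚ + ν x))) * (D n x * c * h (suc a) * falling n (n ℕ.+ suc x) (suc x)) * A
        ≡⟨ cong (λ u → (1ℚ + (N + N + (1ℚ + ν x))) * (D n x * c * h (suc a) * u) * A) (falling-diag n x) ⟩
      (1ℚ + (N + N + (1ℚ + ν x))) * (D n x * c * h (suc a) * ((1ℚ + ν x) * fl)) * A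
        ≡⟨ l2 N (ν x) (D n x) c (h (suc a)) fl ⟩
      (ν 2 + (N + N + ν x)) * h (suc a) * (D n x * c * ((1ℚ + ν x) * fl)) * A
        ≡⟨ cong (λ u → u * (D n x * c * ((1ℚ + ν x) * fl)) * A) hs ⟩
      (ν 6 + ν 4 * (N + N + ν x)) * h a * (D n x * c * ((1ℚ + ν x) * fl)) * A
        ≡⟨ l3 (ν 6 + ν 4 * (N + N + ν x)) (h a) (D n x) c (1ℚ + ν x) fl A ⟩
      A * (D n x * h a * fl) * (c * (ν 6 + ν 4 * (N + N + ν x)) * (1ℚ + ν x))
        ≡⟨ cong (_* (c * (ν 6 + ν 4 * (N + N + ν x)) * (1ℚ + ν x))) (sym (norm-closed x)) ⟩
      norm n x * (A + ν x) * (c * (ν 6 + ν 4 * (N + N + ν x)) * (1ℚ + ν x))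
        ≡⟨ l4 (norm n x) (A + ν x) c (ν 6 + ν 4 * (N + N + ν x)) (1ℚ + ν x) ⟩
      norm n x * ((A + ν x) * c * (ν 6 + ν 4 * (N + N + ν x)) * (1ℚ + ν x)) ∎
      where
      a = n ℕ.+ n ℕ.+ x
      A = 1ℚ + (N + N + ν x)
      c = ν 2 + ν 4 * ν x
      fl = falling n (n ℕ.+ x) x
      νa : ν a ≡ N + N + ν x
      νa = trans (ν-+ (n ℕ.+ n) x) (cong (_+ ν x) (ν-+ n n))
      hs : (ν 2 + (N + N + ν x)) * h (suc a) ≡ (ν 6 + ν 4 * (N + N + ν x)) * h a
      hs = subst (λ u → (ν 2 + u) * h (suc a) ≡ (ν 6 + ν 4 * u) * h a) νa (h-suc a)
      l1 : ∀ m n x → m * ((ν 3 + (n + n) + (x + x)) * (1ℚ + (n + n + x))) ≡ m * (1ℚ + (n + n + (1ℚ + x)) + (1ℚ + x)) * (1ℚ + (n + n + x))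
      l1 = solve-∀ ℚ-ring
      l2 : ∀ n x d c h f → (1ℚ + (n + n + (1ℚ + x))) * (d * c * h * ((1ℚ + x) * f)) * (1ℚ + (n + n + x)) ≡
           (ν 2 + (n + n + x)) * h * (d * c * ((1ℚ + x) * f)) * (1ℚ + (n + n + x))
      l2 = solve-∀ ℚ-ring
      l3 : ∀ s h d c y f A → s * h * (d * c * (y * f)) * A ≡ A * (d * h * f) * (c * s * y)
      l3 = solve-∀ ℚ-ring
      l4 : ∀ m a c s y → m * a * (c * s * y) ≡ m * (a * c * s * y)
      l4 = solve-∀ ℚ-ring

    norm*h≢0 : ∀ x k l → norm n x * h (k ℕ.+ l) ≢ 0ℚ
    norm*h≢0 x k l = >0⇒≢0 (*-pos (norm-pos n x) (h-pos (k ℕ.+ l)))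

    opaque

      -- For `k = l` this is the part of the squared length `h (2k)` of y^k that lies along the
      -- `x`-th orthogonal polynomial. With two indices it becomes hypergeometric in each variable
      -- separately, which the telescoping uses.
      τ : ℕ → ℕ → ℕ → ℚ
      τ x k l = J n x k * J n x l * inv (norm n x * h (k ℕ.+ l))

      τ-unfold : ∀ x k l → norm n x * h (k ℕ.+ l) * τ x k l ≡ J n x k * J n x l
      τ-unfold x k l = trans (lem (norm n x * h (k ℕ.+ l)) (J n x k * J n x l) (inv (norm n x * h (k ℕ.+ l))))
        (trans (cong (J n x k * J n x l *_) (inv-ʳ (norm*h≢0 x k l))) (*-identityʳ (J n x k * J n x l)))
        where
        lem : ∀ a b c → a * (b * c) ≡ b * (a * c)
        lem = solve-∀ ℚ-ring

      τ-sym : ∀ x k l → τ x k l ≡ τ x l k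
      τ-sym x k l = cong₂ (λ u m → u * inv (norm n x * h m)) (*-comm (J n x k) (J n x l)) (ℕ.+-comm k l)

      τ-zero : ∀ x k l → J n x k ≡ 0ℚ → τ x k l ≡ 0ℚ
      τ-zero x k l e = trans (cong (λ j → j * J n x l * inv (norm n x * h (k ℕ.+ l))) e) (lem (J n x l) (inv (norm n x * h (k ℕ.+ l))))
        where
        lem : ∀ a b → 0ℚ * a * b ≡ 0ℚ
        lem = solve-∀ ℚ-ring

    τ-shift-with : ∀ {a b} x k l → J n x (suc l) * a ≡ J n x l * b →
                   τ x k (suc l) * (a * (ν 6 + ν 4 * (ν k + ν l))) ≡ τ x k l * (b * (ν 2 + (ν k + ν l)))
    τ-shift-with {a} {b} x k l e = cancel (m * h₀) (norm*h≢0 x k l) (begin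
      m * h₀ * (τ′ * (a * (ν 6 + ν 4 * (ν k + ν l))))      ≡⟨ l1 m h₀ τ′ a (ν 6 + ν 4 * (ν k + ν l)) ⟩
      m * ((ν 6 + ν 4 * (ν k + ν l)) * h₀) * τ′ * a        ≡⟨ cong (λ u → m * u * τ′ * a) (sym hs) ⟩
      m * ((ν 2 + (ν k + ν l)) * h₁) * τ′ * a              ≡⟨ l2 m (ν 2 + (ν k + ν l)) h₁ τ′ a ⟩
      m * h₁ * τ′ * (a * (ν 2 + (ν k + ν l)))              ≡⟨ cong (_* (a * (ν 2 + (ν k + ν l)))) unf ⟩
      J n x k * J n x (suc l) * (a * (ν 2 + (ν k + ν l)))  ≡⟨ l3 (J n x k) (J n x (suc l)) a (ν 2 + (ν k + ν l)) ⟩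
      J n x k * (J n x (suc l) * a) * (ν 2 + (ν k + ν l))  ≡⟨ cong (λ u → J n x k * u * (ν 2 + (ν k + ν l))) e ⟩
      J n x k * (J n x l * b) * (ν 2 + (ν k + ν l))        ≡⟨ sym (l3 (J n x k) (J n x l) b (ν 2 + (ν k + ν l))) ⟩
      J n x k * J n x l * (b * (ν 2 + (ν k + ν l)))        ≡⟨ cong (_* (b * (ν 2 + (ν k + ν l)))) (sym (τ-unfold x k l)) ⟩
      m * h₀ * τ x k l * (b * (ν 2 + (ν k + ν l)))         ≡⟨ *-assoc (m * h₀) (τ x k l) (b * (ν 2 + (ν k + ν l))) ⟩
      m * h₀ * (τ x k l * (b * (ν 2 + (ν k + ν l))))       ∎)
      where
      m = norm n x
      h₀ = h (k ℕ.+ l)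
      h₁ = h (suc (k ℕ.+ l))
      τ′ = τ x k (suc l)
      hs : (ν 2 + (ν k + ν l)) * h₁ ≡ (ν 6 + ν 4 * (ν k + ν l)) * h₀
      hs = subst (λ u → (ν 2 + u) * h₁ ≡ (ν 6 + ν 4 * u) * h₀) (ν-+ k l) (h-suc (k ℕ.+ l))
      unf : m * h₁ * τ′ ≡ J n x k * J n x (suc l)
      unf = subst (λ j → m * h j * τ′ ≡ J n x k * J n x (suc l)) (ℕ.+-suc k l) (τ-unfold x k (suc l))
      l1 : ∀ m h t a s → m * h * (t * (a * s)) ≡ m * (s * h) * t * a
      l1 = solve-∀ ℚ-ring
      l2 : ∀ m s h t a → m * (s * h) * t * a ≡ m * h * t * (a * s)
      l2 = solve-∀ ℚ-ring
      l3 : ∀ j j′ a s → j * j′ * (a * s) ≡ j * (j′ * a) * s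
      l3 = solve-∀ ℚ-ring

    τ-shift : ∀ x k l → τ x k (suc l) * ((ν 2 + (ν l + N) + ν x) * (1ℚ + ν l - N - ν x) * (ν 6 + ν 4 * (ν k + ν l))) ≡
                        τ x k l * ((ν 6 + ν 4 * (ν l + N)) * (1ℚ + ν l - N) * (ν 2 + (ν k + ν l)))
    τ-shift x k l = τ-shift-with x k l (J-shift x l)

    -- At `x = 0` the relation `τ-shift` has the factor `1 + l - n` on both sides, and it is zero
    -- for `l + 1 = n`. Since `J n 0` is just a moment, `h-suc` gives the relation without this
    -- factor.
    τ-shift₀ : ∀ k l → τ 0 k (suc l) * ((ν 2 + (ν l + N)) * (ν 6 + ν 4 * (ν k + ν l))) ≡ τ 0 k l * ((ν 6 + ν 4 * (ν l + N)) * (ν 2 + (ν k + ν l)))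
    τ-shift₀ k l = τ-shift-with 0 k l (trans (*-comm (h (suc (l ℕ.+ n))) (ν 2 + (ν l + N)))
      (trans (subst (λ u → (ν 2 + u) * h (suc (l ℕ.+ n)) ≡ (ν 6 + ν 4 * u) * h (l ℕ.+ n)) (ν-+ l n) (h-suc (l ℕ.+ n)))
             (*-comm (ν 6 + ν 4 * (ν l + N)) (h (l ℕ.+ n)))))

    τ-suc : ∀ x k l →
      τ (suc x) k l * ((1ℚ + (N + N + ν x) + ν x) * (ν 6 + ν 4 * (N + N + ν x)) * (1ℚ + ν x) * (ν 2 + (ν k + N) + ν x) * (ν 2 + (ν l + N) + ν x)) ≡
      τ x k l * ((ν 2 + ν 4 * ν x) * (ν k - N - ν x) * (ν l - N - ν x) * (ν 3 + (N + N) + (ν x + ν x)) * (1ℚ + (N + N + ν x)))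
    τ-suc x k l = cancel (m * h₀ * c) (≢0-* (norm*h≢0 x k l) c≢0) (begin
      m * h₀ * c * (τ′ * (a₁ * a₂ * a₃ * K₂ * L₂))          ≡⟨ l1 m h₀ c τ′ a₁ a₂ a₃ K₂ L₂ ⟩
      m * (a₁ * c * a₂ * a₃) * (h₀ * τ′ * K₂ * L₂)          ≡⟨ cong (_* (h₀ * τ′ * K₂ * L₂)) (sym (norm-suc x)) ⟩
      m′ * (b₁ * b₂) * (h₀ * τ′ * K₂ * L₂)                  ≡⟨ l2 m′ b₁ b₂ h₀ τ′ K₂ L₂ ⟩
      m′ * h₀ * τ′ * K₂ * L₂ * (b₁ * b₂)                    ≡⟨ cong (λ u → u * K₂ * L₂ * (b₁ * b₂)) (τ-unfold (suc x) k l) ⟩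
      J n (suc x) k * J n (suc x) l * K₂ * L₂ * (b₁ * b₂)   ≡⟨ l3 (J n (suc x) k) (J n (suc x) l) K₂ L₂ b₁ b₂ ⟩
      (J n (suc x) k * K₂) * (J n (suc x) l * L₂) * (b₁ * b₂) ≡⟨ cong₂ (λ u v → u * v * (b₁ * b₂)) (J-suc x k) (J-suc x l) ⟩
      (J n x k * (c * K₀)) * (J n x l * (c * L₀)) * (b₁ * b₂) ≡⟨ l4 (J n x k) c K₀ (J n x l) L₀ b₁ b₂ ⟩
      J n x k * J n x l * c * (c * K₀ * L₀ * b₁ * b₂)       ≡⟨ cong (λ u → u * c * (c * K₀ * L₀ * b₁ * b₂)) (sym (τ-unfold x k l)) ⟩
      m * h₀ * τ x k l * c * (c * K₀ * L₀ * b₁ * b₂)        ≡⟨ l5 (m * h₀) (τ x k l) c (c * K₀ * L₀ * b₁ * b₂) ⟩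
      m * h₀ * c * (τ x k l * (c * K₀ * L₀ * b₁ * b₂))      ∎)
      where
      m = norm n x
      m′ = norm n (suc x)
      h₀ = h (k ℕ.+ l)
      τ′ = τ (suc x) k l
      c = ν 2 + ν 4 * ν x
      c≢0 : c ≢ 0ℚ
      c≢0 = >0⇒≢0 (subst (0ℚ <_) (+-comm (ν 4 * ν x) (ν 2)) (+-pos (*-nonneg (0≤ν 4) (0≤ν x)) (ν-pos 1)))
      a₁ = 1ℚ + (N + N + ν x) + ν x
      a₂ = ν 6 + ν 4 * (N + N + ν x)
      a₃ = 1ℚ + ν x
      b₁ = ν 3 + (N + N) + (ν x + ν x)
      b₂ = 1ℚ + (N + N + ν x)
      K₂ = ν 2 + (ν k + N) + ν x
      L₂ = ν 2 + (ν l + N) + ν x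
      K₀ = ν k - N - ν x
      L₀ = ν l - N - ν x
      l1 : ∀ m h c t a b d K L → m * h * c * (t * (a * b * d * K * L)) ≡ m * (a * c * b * d) * (h * t * K * L)
      l1 = solve-∀ ℚ-ring
      l2 : ∀ m a b h t K L → m * (a * b) * (h * t * K * L) ≡ m * h * t * K * L * (a * b)
      l2 = solve-∀ ℚ-ring
      l3 : ∀ i j K L a b → i * j * K * L * (a * b) ≡ (i * K) * (j * L) * (a * b)
      l3 = solve-∀ ℚ-ring
      l4 : ∀ i c K j L a b → (i * (c * K)) * (j * (c * L)) * (a * b) ≡ i * j * c * (c * K * L * a * b)
      l4 = solve-∀ ℚ-ring
      l5 : ∀ a t c d → a * t * c * d ≡ a * c * (t * d)
      l5 = solve-∀ ℚ-ring

-- Telescoping the distance.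

module Series where

  open Rat
  open Moments
  open Orthogonal
  open Gram
  open Telescope
  open import Data.Nat as ℕ using (ℕ; zero; suc; s≤s; z≤n)
  import Data.Nat.Properties as ℕ
  open import Data.Rational
  open import Data.Rational.Properties
  open import Relation.Binary.PropositionalEquality hiding (J)
  open import Tactic.RingSolver using (solve-∀)
  open ≡-Reasoning

  module Algebra where

    2≢0 : ν 2 ≢ 0ℚ
    2≢0 = >0⇒≢0 (ν-pos 1)

    -- All four quantities in the conclusion are multiples of `u`, the term `τX` divided by the
    -- common denominator. With the linear factors kept as variables, finding the multiples needs
    -- only monomial identities, and the actual polynomial identity is isolated in the last
    -- hypothesis.
    step-atoms : ∀ {u τX τ′ τx d dX a b s f E w t b₀ c X k₂ l₂ g nk m g′ nk′ m′} →
      a ≢ 0ℚ → b ≢ 0ℚ → s ≢ 0ℚ → f ≢ 0ℚ → b₀ ≢ 0ℚ → l₂ ≢ 0ℚ →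
      τX ≡ u * (b * s * f * a) →
      τ′ * (a * (- f) * (ν 2 * s)) ≡ τX * (ν 2 * t * (- E) * w) →
      τX * (b₀ * (ν 2 * c) * X * k₂ * l₂) ≡ τx * (ν 2 * g * (- nk) * (- f) * b * m) →
      s * l₂ * b₀ * d ≡ τx * (g * nk * m) →
      s * a * b * dX ≡ τX * (g′ * nk′ * m′) →
      X * c * k₂ * a + (b * t * E * w - b * s * f * a) ≡ f * g′ * nk′ * m′ →
      d + (τ′ - τX) ≡ dX
    step-atoms {u} {τX} {τ′} {τx} {d} {dX} {a} {b} {s} {f} {E} {w} {t} {b₀} {c} {X} {k₂} {l₂} {g} {nk} {m} {g′} {nk′} {m′}
      a≢ b≢ s≢ f≢ b₀≢ l₂≢ refl h₁ h₂ h₃ h₄ fin = begin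
        d + (τ′ - U)                                       ≡⟨ cong₂ (λ y z → y + (z - U)) c₂ c₁ ⟩
        u * (X * c * k₂ * a) + (u * (b * t * E * w) - U)   ≡⟨ l1 u (X * c * k₂ * a) (b * t * E * w) (b * s * f * a) ⟩
        u * (X * c * k₂ * a + (b * t * E * w - b * s * f * a)) ≡⟨ cong (u *_) fin ⟩
        u * (f * g′ * nk′ * m′)                            ≡⟨ sym c₃ ⟩
        dX                                                 ∎
      where
      U = u * (b * s * f * a)
      l1 : ∀ u p q r → u * p + (u * q - u * r) ≡ u * (p + (q - r))
      l1 = solve-∀ ℚ-ring
      c₁ : τ′ ≡ u * (b * t * E * w)
      c₁ = cancel (a * f * (ν 2 * s)) (≢0-* (≢0-* a≢ f≢) (≢0-* 2≢0 s≢)) (begin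
        a * f * (ν 2 * s) * τ′                   ≡⟨ e₁ a f s τ′ ⟩
        - (τ′ * (a * (- f) * (ν 2 * s)))         ≡⟨ cong -_ h₁ ⟩
        - (U * (ν 2 * t * (- E) * w))            ≡⟨ e₂ u b s f a t E w ⟩
        a * f * (ν 2 * s) * (u * (b * t * E * w)) ∎)
        where
        e₁ : ∀ a f s y → a * f * (ν 2 * s) * y ≡ - (y * (a * (- f) * (ν 2 * s)))
        e₁ = solve-∀ ℚ-ring
        e₂ : ∀ u b s f a t E w → - (u * (b * s * f * a) * (ν 2 * t * (- E) * w)) ≡ a * f * (ν 2 * s) * (u * (b * t * E * w))
        e₂ = solve-∀ ℚ-ring
      c₂ : d ≡ u * (X * c * k₂ * a)
      c₂ = cancel (s * l₂ * b₀ * (ν 2 * f * b)) (≢0-* (≢0-* (≢0-* s≢ l₂≢) b₀≢) (≢0-* (≢0-* 2≢0 f≢) b≢)) (begin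
        s * l₂ * b₀ * (ν 2 * f * b) * d                 ≡⟨ e₁ (s * l₂ * b₀) (ν 2 * f * b) d ⟩
        s * l₂ * b₀ * d * (ν 2 * f * b)                 ≡⟨ cong (_* (ν 2 * f * b)) h₃ ⟩
        τx * (g * nk * m) * (ν 2 * f * b)               ≡⟨ e₂ τx g nk m f b ⟩
        τx * (ν 2 * g * (- nk) * (- f) * b * m)         ≡⟨ sym h₂ ⟩
        U * (b₀ * (ν 2 * c) * X * k₂ * l₂)              ≡⟨ e₃ u b s f a b₀ c X k₂ l₂ ⟩
        s * l₂ * b₀ * (ν 2 * f * b) * (u * (X * c * k₂ * a)) ∎)
        where
        e₁ : ∀ p q d → p * q * d ≡ p * d * q
        e₁ = solve-∀ ℚ-ring
        e₂ : ∀ y g n m f b → y * (g * n * m) * (ν 2 * f * b) ≡ y * (ν 2 * g * (- n) * (- f) * b * m)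
        e₂ = solve-∀ ℚ-ring
        e₃ : ∀ u b s f a b₀ c X k l → u * (b * s * f * a) * (b₀ * (ν 2 * c) * X * k * l) ≡ s * l * b₀ * (ν 2 * f * b) * (u * (X * c * k * a))
        e₃ = solve-∀ ℚ-ring
      c₃ : dX ≡ u * (f * g′ * nk′ * m′)
      c₃ = cancel (s * a * b) (≢0-* (≢0-* s≢ a≢) b≢) (trans h₄ (e₁ u b s f a g′ nk′ m′))
        where
        e₁ : ∀ u b s f a g n m → u * (b * s * f * a) * (g * n * m) ≡ s * a * b * (u * (f * g * n * m))
        e₁ = solve-∀ ℚ-ring

    -- The polynomial core of the telescoping. `E` stands for `n - 1 - l`; as a separate variable it
    -- keeps the sign of this difference visible.
    telescope-identity : ∀ K L E Y → let N = 1ℚ + L + E; X = 1ℚ + Y in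
      X * (ν 3 + ν 4 * N + ν 2 * Y) * (ν 2 + (K + N) + Y) * (ν 2 + (L + N) + X)
        + ((1ℚ + (N + N + X) + X) * (ν 3 + ν 2 * (L + N)) * E * (ν 2 + (K + L))
           - (1ℚ + (N + N + X) + X) * (ν 3 + ν 2 * (K + L)) * (E + X) * (ν 2 + (L + N) + X))
      ≡ (E + X) * (1ℚ + ν 2 * X) * (N - K + X) * (1ℚ + (N + N + X))
    telescope-identity = solve-∀ ℚ-ring

    ratio-atoms : ∀ {τ τ′ d₀ d₁ a b s s₁ a₁ f t E w g n₀ m} → a ≢ 0ℚ → b ≢ 0ℚ → s ≢ 0ℚ →
      τ′ * (a * (- f) * (ν 2 * s)) ≡ τ * (ν 2 * t * (- E) * w) →
      s * a * b * d₀ ≡ τ * (g * n₀ * m) →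
      s₁ * a₁ * b * d₁ ≡ τ′ * (g * f * m) →
      d₁ * (s₁ * a₁ * n₀) ≡ d₀ * (t * E * w)
    ratio-atoms {τ} {τ′} {d₀} {d₁} {a} {b} {s} {s₁} {a₁} {f} {t} {E} {w} {g} {n₀} {m} a≢ b≢ s≢ h₁ h₂ h₃ =
      cancel (b * (a * (ν 2 * s))) (≢0-* b≢ (≢0-* a≢ (≢0-* 2≢0 s≢))) (begin
        b * (a * (ν 2 * s)) * (d₁ * (s₁ * a₁ * n₀))     ≡⟨ e₁ a b s d₁ s₁ a₁ n₀ ⟩
        s₁ * a₁ * b * d₁ * (a * (ν 2 * s) * n₀)         ≡⟨ cong (_* (a * (ν 2 * s) * n₀)) h₃ ⟩
        τ′ * (g * f * m) * (a * (ν 2 * s) * n₀)         ≡⟨ e₂ τ′ g f m a s n₀ ⟩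
        - (τ′ * (a * (- f) * (ν 2 * s))) * (g * n₀ * m) ≡⟨ cong (λ y → - y * (g * n₀ * m)) h₁ ⟩
        - (τ * (ν 2 * t * (- E) * w)) * (g * n₀ * m)    ≡⟨ e₃ τ t E w g n₀ m ⟩
        τ * (g * n₀ * m) * (ν 2 * t * E * w)            ≡⟨ cong (_* (ν 2 * t * E * w)) (sym h₂) ⟩
        s * a * b * d₀ * (ν 2 * t * E * w)              ≡⟨ e₄ s a b d₀ t E w ⟩
        b * (a * (ν 2 * s)) * (d₀ * (t * E * w))        ∎)
      where
      e₁ : ∀ a b s d s₁ a₁ n → b * (a * (ν 2 * s)) * (d * (s₁ * a₁ * n)) ≡ s₁ * a₁ * b * d * (a * (ν 2 * s) * n)
      e₁ = solve-∀ ℚ-ring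
      e₂ : ∀ y g f m a s n → y * (g * f * m) * (a * (ν 2 * s) * n) ≡ - (y * (a * (- f) * (ν 2 * s))) * (g * n * m)
      e₂ = solve-∀ ℚ-ring
      e₃ : ∀ y t E w g n m → - (y * (ν 2 * t * (- E) * w)) * (g * n * m) ≡ y * (g * n * m) * (ν 2 * t * E * w)
      e₃ = solve-∀ ℚ-ring
      e₄ : ∀ s a b d t E w → s * a * b * d * (ν 2 * t * E * w) ≡ b * (a * (ν 2 * s)) * (d * (t * E * w))
      e₄ = solve-∀ ℚ-ring

    -- The rational certificate of the telescoping: the difference of `β` at `l` and at `l + 1` is
    -- its last term `τ` times `numer / denom`.
    denom numer : ℚ → ℚ → ℚ → ℚ → ℚ
    denom N X K L = (ν 3 + ν 2 * (K + L)) * (ν 2 + (L + N) + X) * (1ℚ + (N + N + X) + X)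
    numer N X K L = (1ℚ + ν 2 * X) * (N - K + X) * (1ℚ + (N + N + X))

    0≤⇒pos : ∀ {a b} → 0ℚ < a → 0ℚ ≤ b → 0ℚ < a + b
    0≤⇒pos {a} {b} p q = subst (0ℚ <_) (+-comm b a) (+-pos q p)

    denom-pos : ∀ {N X K L} → 0ℚ ≤ N → 0ℚ ≤ X → 0ℚ ≤ K → 0ℚ ≤ L → 0ℚ < denom N X K L
    denom-pos pN pX pK pL = *-pos (*-pos (0≤⇒pos (ν-pos 2) (*-nonneg (0≤ν 2) (+-nonneg pK pL)))
      (0≤⇒pos (0≤⇒pos (ν-pos 1) (+-nonneg pL pN)) pX)) (0≤⇒pos (0≤⇒pos 0<1 (+-nonneg (+-nonneg pN pN) pX)) pX)

    step-algebra : ∀ {N K L E X Y τX τ′ τx d dX} → N ≡ 1ℚ + L + E → X ≡ 1ℚ + Y → 0ℚ ≤ K → 0ℚ ≤ L → 0ℚ ≤ E → 0ℚ ≤ Y →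
      τ′ * ((ν 2 + (L + N) + X) * (1ℚ + L - N - X) * (ν 6 + ν 4 * (K + L))) ≡ τX * ((ν 6 + ν 4 * (L + N)) * (1ℚ + L - N) * (ν 2 + (K + L))) →
      τX * ((1ℚ + (N + N + Y) + Y) * (ν 6 + ν 4 * (N + N + Y)) * (1ℚ + Y) * (ν 2 + (K + N) + Y) * (ν 2 + (L + N) + Y)) ≡
        τx * ((ν 2 + ν 4 * Y) * (K - N - Y) * (L - N - Y) * (ν 3 + (N + N) + (Y + Y)) * (1ℚ + (N + N + Y))) →
      denom N Y K L * d ≡ τx * numer N Y K L → denom N X K L * dX ≡ τX * numer N X K L →
      d + (τ′ - τX) ≡ dX
    step-algebra {_} {K} {L} {E} {_} {Y} {τX} {τ′} {τx} {d} {dX} refl refl pK pL pE pY h₁ h₂ h₃ h₄ =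
      step-atoms {u = τX * inv (b * s * f * a)} {τX} {τ′} {τx} {d} {dX} {a} {b} {s} {f} {E} {w = ν 2 + (K + L)} {t = ν 3 + ν 2 * (L + N)} {b₀ = 1ℚ + (N + N + Y) + Y}
        {c = ν 3 + ν 4 * N + ν 2 * Y} {X = X} {k₂ = ν 2 + (K + N) + Y} {l₂ = ν 2 + (L + N) + Y} {g = 1ℚ + ν 2 * Y} {nk = N - K + Y} {m = 1ℚ + (N + N + Y)}
        {g′ = 1ℚ + ν 2 * X} {nk′ = N - K + X} {m′ = 1ℚ + (N + N + X)}
        a≢ b≢ s≢ f≢ (>0⇒≢0 (0≤⇒pos (0≤⇒pos 0<1 (+-nonneg (+-nonneg pN pN) pY)) pY)) (>0⇒≢0 (0≤⇒pos (0≤⇒pos (ν-pos 1) (+-nonneg pL pN)) pY))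
        (trans (trans (sym (*-identityʳ τX)) (cong (τX *_) (sym (inv-ʳ (≢0-* (≢0-* (≢0-* b≢ s≢) f≢) a≢))))) (comm3 τX (b * s * f * a) (inv (b * s * f * a))))
        (trans (cong (τ′ *_) (r₁ K L E X)) (trans h₁ (cong (τX *_) (r₂ K L E))))
        (trans (cong (τX *_) (r₃ K L E Y)) (trans h₂ (cong (τx *_) (r₄ K L E Y))))
        h₃ h₄ (telescope-identity K L E Y)
      where
      N = 1ℚ + L + E
      X = 1ℚ + Y
      pN = +-nonneg (+-nonneg (<⇒≤ 0<1) pL) pE
      pX = +-nonneg (<⇒≤ 0<1) pY
      a = ν 2 + (L + N) + X
      b = 1ℚ + (N + N + X) + X
      s = ν 3 + ν 2 * (K + L)
      f = E + X
      a≢ : a ≢ 0ℚ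
      a≢ = >0⇒≢0 (0≤⇒pos (0≤⇒pos (ν-pos 1) (+-nonneg pL pN)) pX)
      b≢ : b ≢ 0ℚ
      b≢ = >0⇒≢0 (0≤⇒pos (0≤⇒pos 0<1 (+-nonneg (+-nonneg pN pN) pX)) pX)
      s≢ : s ≢ 0ℚ
      s≢ = >0⇒≢0 (0≤⇒pos (ν-pos 2) (*-nonneg (0≤ν 2) (+-nonneg pK pL)))
      f≢ : f ≢ 0ℚ
      f≢ = >0⇒≢0 (+-pos pE (0≤⇒pos 0<1 pY))
      comm3 : ∀ t b i → t * (b * i) ≡ t * i * b
      comm3 = solve-∀ ℚ-ring
      r₁ : ∀ K L E X → (ν 2 + (L + (1ℚ + L + E)) + X) * (- (E + X)) * (ν 2 * (ν 3 + ν 2 * (K + L))) ≡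
                       (ν 2 + (L + (1ℚ + L + E)) + X) * (1ℚ + L - (1ℚ + L + E) - X) * (ν 6 + ν 4 * (K + L))
      r₁ = solve-∀ ℚ-ring
      r₂ : ∀ K L E → (ν 6 + ν 4 * (L + (1ℚ + L + E))) * (1ℚ + L - (1ℚ + L + E)) * (ν 2 + (K + L)) ≡
                     ν 2 * (ν 3 + ν 2 * (L + (1ℚ + L + E))) * (- E) * (ν 2 + (K + L))
      r₂ = solve-∀ ℚ-ring
      r₃ : ∀ K L E Y → let N = 1ℚ + L + E in
        (1ℚ + (N + N + Y) + Y) * (ν 2 * (ν 3 + ν 4 * N + ν 2 * Y)) * (1ℚ + Y) * (ν 2 + (K + N) + Y) * (ν 2 + (L + N) + Y) ≡
        (1ℚ + (N + N + Y) + Y) * (ν 6 + ν 4 * (N + N + Y)) * (1ℚ + Y) * (ν 2 + (K + N) + Y) * (ν 2 + (L + N) + Y)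
      r₃ K L E Y = cong (λ z → (1ℚ + ((1ℚ + L + E) + (1ℚ + L + E) + Y) + Y) * z * (1ℚ + Y) * (ν 2 + (K + (1ℚ + L + E)) + Y) * (ν 2 + (L + (1ℚ + L + E)) + Y)) (q (1ℚ + L + E) Y)
        where
        q : ∀ N Y → ν 2 * (ν 3 + ν 4 * N + ν 2 * Y) ≡ ν 6 + ν 4 * (N + N + Y)
        q = solve-∀ ℚ-ring
      r₄ : ∀ K L E Y → let N = 1ℚ + L + E in
        (ν 2 + ν 4 * Y) * (K - N - Y) * (L - N - Y) * (ν 3 + (N + N) + (Y + Y)) * (1ℚ + (N + N + Y)) ≡
        ν 2 * (1ℚ + ν 2 * Y) * (- (N - K + Y)) * (- (E + (1ℚ + Y))) * (1ℚ + (N + N + (1ℚ + Y)) + (1ℚ + Y)) * (1ℚ + (N + N + Y))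
      r₄ K L E Y = cong (_* (1ℚ + ((1ℚ + L + E) + (1ℚ + L + E) + Y))) (cong₂ _*_ (cong₂ _*_ (cong₂ _*_ (q₁ Y) (q₂ K (1ℚ + L + E) Y)) (q₃ L E Y)) (q₄ (1ℚ + L + E) Y))
        where
        q₁ : ∀ Y → ν 2 + ν 4 * Y ≡ ν 2 * (1ℚ + ν 2 * Y)
        q₁ = solve-∀ ℚ-ring
        q₂ : ∀ K N Y → K - N - Y ≡ - (N - K + Y)
        q₂ = solve-∀ ℚ-ring
        q₃ : ∀ L E Y → L - (1ℚ + L + E) - Y ≡ - (E + (1ℚ + Y))
        q₃ = solve-∀ ℚ-ring
        q₄ : ∀ N Y → ν 3 + (N + N) + (Y + Y) ≡ 1ℚ + (N + N + (1ℚ + Y)) + (1ℚ + Y)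
        q₄ = solve-∀ ℚ-ring

    base-algebra : ∀ {N K L τ τ′ d} → 0ℚ ≤ N → 0ℚ ≤ K → 0ℚ ≤ L →
      τ′ * ((ν 2 + (L + N)) * (ν 6 + ν 4 * (K + L))) ≡ τ * ((ν 6 + ν 4 * (L + N)) * (ν 2 + (K + L))) →
      denom N 0ℚ K L * d ≡ τ * numer N 0ℚ K L → τ′ - τ ≡ d
    base-algebra {N} {K} {L} {τ} {τ′} {d} pN pK pL h₁ h₂ = cancel (ν 2 * denom N 0ℚ K L) (≢0-* 2≢0 (>0⇒≢0 (denom-pos pN ≤-refl pK pL))) (begin
      ν 2 * denom N 0ℚ K L * (τ′ - τ)
        ≡⟨ e₁ N K L τ τ′ ⟩
      (τ′ * ((ν 2 + (L + N)) * (ν 6 + ν 4 * (K + L))) - τ * ((ν 2 + (L + N)) * (ν 6 + ν 4 * (K + L)))) * (1ℚ + (N + N))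
        ≡⟨ cong (λ y → (y - τ * ((ν 2 + (L + N)) * (ν 6 + ν 4 * (K + L)))) * (1ℚ + (N + N))) h₁ ⟩
      (τ * ((ν 6 + ν 4 * (L + N)) * (ν 2 + (K + L))) - τ * ((ν 2 + (L + N)) * (ν 6 + ν 4 * (K + L)))) * (1ℚ + (N + N))
        ≡⟨ e₂ N K L τ ⟩
      ν 2 * (τ * numer N 0ℚ K L)   ≡⟨ cong (ν 2 *_) (sym h₂) ⟩
      ν 2 * (denom N 0ℚ K L * d)   ≡⟨ sym (*-assoc (ν 2) (denom N 0ℚ K L) d) ⟩
      ν 2 * denom N 0ℚ K L * d     ∎)
      where
      e₁ : ∀ N K L t t′ → ν 2 * ((ν 3 + ν 2 * (K + L)) * (ν 2 + (L + N) + 0ℚ) * (1ℚ + (N + N + 0ℚ) + 0ℚ)) * (t′ - t) ≡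
        (t′ * ((ν 2 + (L + N)) * (ν 6 + ν 4 * (K + L))) - t * ((ν 2 + (L + N)) * (ν 6 + ν 4 * (K + L)))) * (1ℚ + (N + N))
      e₁ = solve-∀ ℚ-ring
      e₂ : ∀ N K L t → (t * ((ν 6 + ν 4 * (L + N)) * (ν 2 + (K + L))) - t * ((ν 2 + (L + N)) * (ν 6 + ν 4 * (K + L)))) * (1ℚ + (N + N)) ≡
        ν 2 * (t * ((1ℚ + ν 2 * 0ℚ) * (N - K + 0ℚ) * (1ℚ + (N + N + 0ℚ))))
      e₂ = solve-∀ ℚ-ring

  open Algebra

  module _ (n : ℕ) where

    β : ℕ → ℕ → ℕ → ℚ
    β zero    k l = 1ℚ
    β (suc x) k l = β x k l - τ n x k l

    β-sym : ∀ x k l → β x k l ≡ β x l k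
    β-sym zero    k l = refl
    β-sym (suc x) k l = cong₂ _-_ (β-sym x k l) (τ-sym n x k l)

    dist≡β : ∀ k x → dist n k x ≡ h (k ℕ.+ k) * β x k k
    dist≡β k zero    = sym (*-identityʳ (h (k ℕ.+ k)))
    dist≡β k (suc x) = trans (dist-suc n k x) (trans (cong₂ _-_ (dist≡β k x) hτ) (lem (h (k ℕ.+ k)) (β x k k) (τ n x k k)))
      where
      lem : ∀ h b t → h * b - h * t ≡ h * (b - t)
      lem = solve-∀ ℚ-ring
      hτ : J n x k * J n x k * inv (norm n x) ≡ h (k ℕ.+ k) * τ n x k k
      hτ = cancel (norm n x) (>0⇒≢0 (norm-pos n x)) (trans (l1 (norm n x) (J n x k * J n x k) (inv (norm n x)))
        (trans (cong (J n x k * J n x k *_) (inv-ʳ (>0⇒≢0 (norm-pos n x)))) (trans (*-identityʳ (J n x k * J n x k))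
          (trans (sym (τ-unfold n x k k)) (*-assoc (norm n x) (h (k ℕ.+ k)) (τ n x k k))))))
        where
        l1 : ∀ a b c → a * (b * c) ≡ b * (a * c)
        l1 = solve-∀ ℚ-ring

    denom>0 : ∀ x k l → 0ℚ < denom (ν n) (ν x) (ν k) (ν l)
    denom>0 x k l = denom-pos (0≤ν n) (0≤ν x) (0≤ν k) (0≤ν l)

    opaque

      drop : ℕ → ℕ → ℕ → ℚ
      drop x k l = τ n x k l * numer (ν n) (ν x) (ν k) (ν l) * inv (denom (ν n) (ν x) (ν k) (ν l))

      drop-unfold : ∀ x k l → denom (ν n) (ν x) (ν k) (ν l) * drop x k l ≡ τ n x k l * numer (ν n) (ν x) (ν k) (ν l)
      drop-unfold x k l = trans (lem (denom (ν n) (ν x) (ν k) (ν l)) (τ n x k l * numer (ν n) (ν x) (ν k) (ν l)) (inv (denom (ν n) (ν x) (ν k) (ν l))))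
        (trans (cong (τ n x k l * numer (ν n) (ν x) (ν k) (ν l) *_) (inv-ʳ (>0⇒≢0 (denom>0 x k l)))) (*-identityʳ (τ n x k l * numer (ν n) (ν x) (ν k) (ν l))))
        where
        lem : ∀ a b c → a * (b * c) ≡ b * (a * c)
        lem = solve-∀ ℚ-ring

    ν-split : ∀ l e → n ≡ suc (l ℕ.+ e) → ν n ≡ 1ℚ + ν l + ν e
    ν-split l e refl = trans (ν-suc (l ℕ.+ e)) (trans (cong (1ℚ +_) (ν-+ l e)) (sym (+-assoc 1ℚ (ν l) (ν e))))

    -- Induction on `x`: a new term adds `τ` at `l + 1` minus `τ` at `l`, and this is the increment
    -- of `drop`. The condition `l < n` makes the divisor `e + x` of the induction step positive,
    -- `x` being the index of the new term.
    β-drop : ∀ x k l e → n ≡ suc (l ℕ.+ e) → β (suc x) k l - β (suc x) k (suc l) ≡ drop x k l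
    β-drop zero k l e n≡ = trans (lem 1ℚ (τ n 0 k l) (τ n 0 k (suc l)))
      (base-algebra {ν n} {ν k} {ν l} {τ n 0 k l} {τ n 0 k (suc l)} {drop 0 k l} (0≤ν n) (0≤ν k) (0≤ν l) (τ-shift₀ n k l) (drop-unfold 0 k l))
      where
      lem : ∀ a t t′ → a - t - (a - t′) ≡ t′ - t
      lem = solve-∀ ℚ-ring
    β-drop (suc x) k l e n≡ = begin
      (β (suc x) k l - τ n (suc x) k l) - (β (suc x) k (suc l) - τ n (suc x) k (suc l))
        ≡⟨ lem (β (suc x) k l) (τ n (suc x) k l) (β (suc x) k (suc l)) (τ n (suc x) k (suc l)) ⟩
      (β (suc x) k l - β (suc x) k (suc l)) + (τ n (suc x) k (suc l) - τ n (suc x) k l)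
        ≡⟨ cong (_+ (τ n (suc x) k (suc l) - τ n (suc x) k l)) (β-drop x k l e n≡) ⟩
      drop x k l + (τ n (suc x) k (suc l) - τ n (suc x) k l)
        ≡⟨ step-algebra {ν n} {ν k} {ν l} {ν e} {ν (suc x)} {ν x} {τ n (suc x) k l} {τ n (suc x) k (suc l)} {τ n x k l} {drop x k l} {drop (suc x) k l} (ν-split l e n≡) (ν-suc x) (0≤ν k) (0≤ν l) (0≤ν e) (0≤ν x) (τ-shift n (suc x) k l) (τ-suc n x k l) (drop-unfold x k l) (drop-unfold (suc x) k l) ⟩
      drop (suc x) k l ∎
      where
      lem : ∀ b t b′ t′ → (b - t) - (b′ - t′) ≡ (b - b′) + (t′ - t)
      lem = solve-∀ ℚ-ring

    -- For `k = n` the power y^n belongs to the span: it is the zeroth orthogonal polynomial, which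
    -- gives `τ = 1`, and it is orthogonal to all later ones.
    β-end : ∀ x → β (suc x) n n ≡ 0ℚ
    β-end zero    = trans (cong (λ u → 1ℚ - u) (cancel (norm n 0 * h (n ℕ.+ n)) (norm*h≢0 n 0 n n) (trans (τ-unfold n 0 n n) eq))) (+-inverseʳ 1ℚ)
      where
      eq : h (n ℕ.+ n) * h (n ℕ.+ n) ≡ norm n 0 * h (n ℕ.+ n) * 1ℚ
      eq = trans (lem (h (n ℕ.+ n))) (cong (λ m → 1ℚ * h (m ℕ.+ n) * h (n ℕ.+ n) * 1ℚ) (sym (ℕ.+-identityʳ n)))
        where
        lem : ∀ a → a * a ≡ 1ℚ * a * a * 1ℚ
        lem = solve-∀ ℚ-ring
    β-end (suc x) = trans (cong₂ _-_ (β-end x) τ0) refl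
      where
      τ0 : τ n (suc x) n n ≡ 0ℚ
      τ0 = τ-zero n (suc x) n n (trans (cong (J n (suc x)) (sym (ℕ.+-identityʳ n))) (J-zero n (suc x) 0 (s≤s z≤n)))

-- The staircase of index pairs.

module Halves where

  open import Data.Nat using (ℕ; zero; suc; _+_; _≤_; s≤s; z≤n)
  open import Data.Nat.Properties
  open import Data.Product using (_×_; _,_; proj₁; proj₂)
  open import Relation.Binary.PropositionalEquality

  -- hi j = ⌈j/2⌉ and lo j = ⌊j/2⌋.
  hi lo : ℕ → ℕ
  hi zero    = 0
  hi (suc j) = suc (lo j)
  lo zero    = 0
  lo (suc j) = hi j

  hi+lo : ∀ j → hi j + lo j ≡ j
  hi+lo zero    = refl
  hi+lo (suc j) = cong suc (trans (+-comm (lo j) (hi j)) (hi+lo j))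

  lo≤hi : ∀ j → lo j ≤ hi j × hi j ≤ suc (lo j)
  lo≤hi zero    = z≤n , z≤n
  lo≤hi (suc j) = proj₂ (lo≤hi j) , s≤s (proj₁ (lo≤hi j))

  halves-double : ∀ k → hi (k + k) ≡ k × lo (k + k) ≡ k
  halves-double zero    = refl , refl
  halves-double (suc k) rewrite +-suc k k = cong suc (proj₁ (halves-double k)) , cong suc (proj₂ (halves-double k))

  halve-≤ : ∀ l m → l + l ≤ suc (m + m) → l ≤ m
  halve-≤ zero    m       h = z≤n
  halve-≤ (suc l) zero    (s≤s h) rewrite +-suc l l with h
  ... | ()
  halve-≤ (suc l) (suc m) (s≤s h) rewrite +-suc l l | +-suc m m with h
  ... | s≤s h′ = s≤s (halve-≤ l m h′)

  lo-bound : ∀ m j → suc j ≤ suc m + suc m → lo j ≤ m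
  lo-bound m j h = halve-≤ (lo j) m (≤-trans (+-monoˡ-≤ (lo j) (proj₁ (lo≤hi j)))
    (≤-trans (≤-reflexive (hi+lo j)) (≤-pred (≤-trans h (≤-reflexive (cong suc (+-suc m m)))))))

-- The terms of the telescoped sum: their ratios in `j`, and the first of them in closed form.

module Gamma where

  open Rat
  open Moments using (h; h-suc; h-pos; h-zero)
  open Orthogonal
  open Gram
  open Telescope
  open Series
  open Halves
  open Algebra
  open import Data.Nat as ℕ using (ℕ; zero; suc)
  import Data.Nat.Properties as ℕ
  open import Data.Product using (proj₁; proj₂)
  open import Data.Rational
  open import Data.Rational.Properties
  open import Relation.Binary.PropositionalEquality hiding (J)
  open import Tactic.RingSolver using (solve-∀)
  open ≡-Reasoning

  ratio-algebra : ∀ {N X K L L′ E τ₀ τ₁ d₀ d₁} → N ≡ 1ℚ + X → X ≡ L + E → L′ ≡ 1ℚ + L → 0ℚ ≤ X → 0ℚ ≤ K → 0ℚ ≤ L →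
    τ₁ * ((ν 2 + (L + N) + X) * (1ℚ + L - N - X) * (ν 6 + ν 4 * (K + L))) ≡ τ₀ * ((ν 6 + ν 4 * (L + N)) * (1ℚ + L - N) * (ν 2 + (K + L))) →
    denom N X K L * d₀ ≡ τ₀ * numer N X K L → denom N X L′ K * d₁ ≡ τ₁ * numer N X L′ K →
    d₁ * ((ν 5 + ν 2 * (K + L)) * (1ℚ + (1ℚ + X) + (K + (1ℚ + X))) * ((1ℚ + X) - K + X)) ≡ d₀ * ((ν 3 + ν 2 * (L + (1ℚ + X))) * (X - L) * (ν 2 + (K + L)))
  ratio-algebra {_} {_} {K} {L} {_} {E} {τ₀} {τ₁} {d₀} {d₁} refl refl refl X≥0 K≥0 L≥0 h₁ h₂ h₃ =
    trans (ratio-atoms {τ₀} {τ₁} {d₀} {d₁} {a = a} {b = b} {s = s} {s₁ = ν 5 + ν 2 * (K + L)} {a₁ = 1ℚ + N + (K + N)} {f = E + X}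
        {t = ν 3 + ν 2 * (L + N)} {E = E} {w = ν 2 + (K + L)} {g = 1ℚ + ν 2 * X} {n₀ = N - K + X} {m = 1ℚ + (N + N + X)}
        (>0⇒≢0 (0≤⇒pos (0≤⇒pos (ν-pos 1) (+-nonneg L≥0 N≥0)) X≥0))
        (>0⇒≢0 (0≤⇒pos (0≤⇒pos 0<1 (+-nonneg (+-nonneg N≥0 N≥0) X≥0)) X≥0))
        (>0⇒≢0 (0≤⇒pos (ν-pos 2) (*-nonneg (0≤ν 2) (+-nonneg K≥0 L≥0))))
        (trans (cong (τ₁ *_) (r₁ K L E)) (trans h₁ (cong (τ₀ *_) (r₂ K L E)))) h₂
        (trans (cong (_* d₁) (r₃ K L E)) (trans h₃ (cong (τ₁ *_) (r₄ K L E)))))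
      (cong (λ e → d₀ * ((ν 3 + ν 2 * (L + N)) * e * (ν 2 + (K + L)))) (r₅ L E))
    where
    X = L + E
    N = 1ℚ + X
    N≥0 : 0ℚ ≤ N
    N≥0 = +-nonneg (<⇒≤ 0<1) X≥0
    a = ν 2 + (L + N) + X
    b = 1ℚ + (N + N + X) + X
    s = ν 3 + ν 2 * (K + L)
    r₁ : ∀ K L E → let X = L + E; N = 1ℚ + X in (ν 2 + (L + N) + X) * (- (E + X)) * (ν 2 * (ν 3 + ν 2 * (K + L))) ≡
                   (ν 2 + (L + N) + X) * (1ℚ + L - N - X) * (ν 6 + ν 4 * (K + L))
    r₁ = solve-∀ ℚ-ring
    r₂ : ∀ K L E → let X = L + E; N = 1ℚ + X in (ν 6 + ν 4 * (L + N)) * (1ℚ + L - N) * (ν 2 + (K + L)) ≡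
                   ν 2 * (ν 3 + ν 2 * (L + N)) * (- E) * (ν 2 + (K + L))
    r₂ = solve-∀ ℚ-ring
    r₃ : ∀ K L E → let X = L + E; N = 1ℚ + X in (ν 5 + ν 2 * (K + L)) * (1ℚ + N + (K + N)) * (1ℚ + (N + N + X) + X) ≡
                   (ν 3 + ν 2 * ((1ℚ + L) + K)) * (ν 2 + (K + N) + X) * (1ℚ + (N + N + X) + X)
    r₃ = solve-∀ ℚ-ring
    r₄ : ∀ K L E → let X = L + E; N = 1ℚ + X in (1ℚ + ν 2 * X) * (N - (1ℚ + L) + X) * (1ℚ + (N + N + X)) ≡ (1ℚ + ν 2 * X) * (E + X) * (1ℚ + (N + N + X))
    r₄ = solve-∀ ℚ-ring
    r₅ : ∀ L E → E ≡ L + E - L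
    r₅ = solve-∀ ℚ-ring

  -- Here n = x = m + 1.
  gap : ℕ → ℕ → ℚ
  gap m j = β (suc m) (suc m) (hi j) (lo j)

  γ : ℕ → ℕ → ℚ
  γ m j = drop (suc m) m (hi j) (lo j)

  -- `β-drop` raises the index `lo j` by one, and `β-sym` exchanges the result into the pair that
  -- belongs to `suc j`.
  gap-step : ∀ m j e → m ≡ lo j ℕ.+ e → gap m j ≡ γ m j + gap m (suc j)
  gap-step m j e m≡ = trans (lem (gap m j) (β (suc m) (suc m) k (suc l)))
      (cong₂ _+_ (β-drop (suc m) m k l e (cong suc m≡)) (β-sym (suc m) (suc m) k (suc l)))
    where
    k l : ℕ
    k = hi j
    l = lo j
    lem : ∀ a b → a ≡ (a - b) + b
    lem = solve-∀ ℚ-ring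

  gap-end : ∀ m → gap m (suc m ℕ.+ suc m) ≡ 0ℚ
  gap-end m = trans (cong₂ (β (suc m) (suc m)) (proj₁ (halves-double (suc m))) (proj₂ (halves-double (suc m)))) (β-end (suc m) m)

  dist≡gap : ∀ m k → dist (suc m) k (suc m) ≡ h (k ℕ.+ k) * gap m (k ℕ.+ k)
  dist≡gap m k = trans (dist≡β (suc m) k (suc m)) (cong₂ (λ a b → h (k ℕ.+ k) * β (suc m) (suc m) a b)
    (sym (proj₁ (halves-double k))) (sym (proj₂ (halves-double k))))

  γ-ratio : ∀ m j e → m ≡ lo j ℕ.+ e → let N = 1ℚ + ν m; K = ν (hi j); L = ν (lo j) in
    γ m (suc j) * ((ν 5 + ν 2 * (K + L)) * (1ℚ + N + (K + N)) * (N - K + ν m)) ≡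
    γ m j * ((ν 3 + ν 2 * (L + N)) * (ν m - L) * (ν 2 + (K + L)))
  γ-ratio m j e m≡ = ratio-algebra {ν (suc m)} {ν m} {ν (hi j)} {ν (lo j)} {ν (suc (lo j))} {ν e}
      {τ (suc m) m (hi j) (lo j)} {τ (suc m) m (hi j) (suc (lo j))} {γ m j} {γ m (suc j)}
      (ν-suc m) (trans (cong ν m≡) (ν-+ (lo j) e)) (ν-suc (lo j)) (0≤ν m) (0≤ν (hi j)) (0≤ν (lo j))
      (τ-shift (suc m) m (hi j) (lo j)) (drop-unfold (suc m) m (hi j) (lo j))
      (trans (drop-unfold (suc m) m (suc (lo j)) (hi j)) (cong (_* numer (ν (suc m)) (ν m) (ν (suc (lo j))) (ν (hi j))) (τ-sym (suc m) m (suc (lo j)) (hi j))))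

  fact : ℕ → ℚ
  fact zero    = 1ℚ
  fact (suc x) = (1ℚ + ν x) * fact x

  fact-pos : ∀ x → 0ℚ < fact x
  fact-pos zero    = 0<1
  fact-pos (suc x) = *-pos (0≤⇒pos 0<1 (0≤ν x)) (fact-pos x)

  falling≡fact : ∀ n x → falling n (n ℕ.+ x) x ≡ fact x
  falling≡fact n zero    = refl
  falling≡fact n (suc x) = trans (falling-diag n x) (cong ((1ℚ + ν x) *_) (falling≡fact n x))

  double-odds : ℕ → ℚ
  double-odds x = D 0 x

  D≡ : ∀ n x → D n x ≡ double-odds x
  D≡ n zero    = refl
  D≡ n (suc x) = cong (_* (ν 2 + ν 4 * ν x)) (D≡ n x)

  sign : ℕ → ℚ
  sign zero    = 1ℚ
  sign (suc x) = - sign x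

  sign² : ∀ x → sign x * sign x ≡ 1ℚ
  sign² zero    = refl
  sign² (suc x) = trans (lem (sign x)) (sign² x)
    where
    lem : ∀ s → (- s) * (- s) ≡ s * s
    lem = solve-∀ ℚ-ring

  falling-at-0 : ∀ n x → falling n 0 x ≡ sign x * rising n x
  falling-at-0 n zero    = refl
  falling-at-0 n (suc x) = trans (cong (_* (0ℚ - ν n - ν x)) (falling-at-0 n x))
    (trans (lem (sign x) (rising n x) (ν n) (ν x)) (cong (λ u → (- sign x) * u) (trans (cong (rising n x *_) (sym (ν-+ n x))) (sym (rising-last n x)))))
    where
    lem : ∀ s r n x → s * r * (0ℚ - n - x) ≡ (- s) * (r * (n + x))
    lem = solve-∀ ℚ-ring

  J-at-0 : ∀ n x → J n x 0 * (ν (n ℕ.+ x) * ν (suc (n ℕ.+ x))) ≡ sign x * D n x * h n * (ν n * ν (suc n))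
  J-at-0 n x = cancel r (rising≢0 n (suc n) x) (begin
    r * (J n x 0 * (ν (n ℕ.+ x) * ν (suc (n ℕ.+ x))))      ≡⟨ l1 r (J n x 0) (ν (n ℕ.+ x)) (ν (suc (n ℕ.+ x))) ⟩
    J n x 0 * r * (ν (n ℕ.+ x) * ν (suc (n ℕ.+ x)))        ≡⟨ cong (_* (ν (n ℕ.+ x) * ν (suc (n ℕ.+ x)))) (jacobi-moment n x n 0) ⟩
    D n x * h n * falling n 0 x * (ν (n ℕ.+ x) * ν (suc (n ℕ.+ x))) ≡⟨ cong (λ u → D n x * h n * u * (ν (n ℕ.+ x) * ν (suc (n ℕ.+ x)))) (falling-at-0 n x) ⟩
    D n x * h n * (sign x * rising n x) * (ν (n ℕ.+ x) * ν (suc (n ℕ.+ x))) ≡⟨ l2 (D n x) (h n) (sign x) (rising n x) (ν (n ℕ.+ x)) (ν (suc (n ℕ.+ x))) ⟩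
    sign x * D n x * h n * (rising n x * ν (n ℕ.+ x) * ν (suc (n ℕ.+ x))) ≡⟨ cong (sign x * D n x * h n *_) two ⟩
    sign x * D n x * h n * (ν n * (ν (suc n) * r))         ≡⟨ l3 (sign x * D n x * h n) (ν n) (ν (suc n)) r ⟩
    r * (sign x * D n x * h n * (ν n * ν (suc n)))         ∎)
    where
    r = rising (2 ℕ.+ n) x
    two : rising n x * ν (n ℕ.+ x) * ν (suc (n ℕ.+ x)) ≡ ν n * (ν (suc n) * r)
    two = trans (cong₂ _*_ (sym (rising-last n x)) (cong ν (sym (ℕ.+-suc n x)))) (sym (rising-last n (suc x)))
    l1 : ∀ r j a b → r * (j * (a * b)) ≡ j * r * (a * b)
    l1 = solve-∀ ℚ-ring
    l2 : ∀ d h s r a b → d * h * (s * r) * (a * b) ≡ s * d * h * (r * a * b)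
    l2 = solve-∀ ℚ-ring
    l3 : ∀ c a b r → c * (a * (b * r)) ≡ r * (c * (a * b))
    l3 = solve-∀ ℚ-ring

  -- The ratios in `j` say nothing about the size of the terms as `m` grows, so one term is needed
  -- explicitly. At `j = 0` the moment is given by `J-at-0` and the norm by `norm-closed`.
  γ₀-closed : ∀ m → γ m 0 * (ν 12 * (ν 3 + ν 2 * ν m) * h (suc m ℕ.+ suc m ℕ.+ m) * fact m) ≡
                    double-odds m * h (suc m) * h (suc m) * ((ν 2 + ν m) * (ν 2 + ν m))
  γ₀-closed m = cancel Q Q≢0 (begin
      Q * (G * (ν 12 * (ν 3 + ν 2 * X) * H * F))
        ≡⟨ e₁ X d G H F ⟩
      G * (ν 3 * (ν 3 + ν 2 * X)) * (c * (d * H * F)) * (P * P)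
        ≡⟨ cong (λ u → G * (ν 3 * (ν 3 + ν 2 * X)) * u * (P * P)) (sym norm≡) ⟩
      G * (ν 3 * (ν 3 + ν 2 * X)) * (norm n m * b) * (P * P)
        ≡⟨ e₂ X G (norm n m) ⟩
      denom N X 0ℚ 0ℚ * G * norm n m * (P * P)
        ≡⟨ cong (λ u → u * norm n m * (P * P)) drop≡ ⟩
      τ n m 0 0 * numer N X 0ℚ 0ℚ * norm n m * (P * P)
        ≡⟨ e₃ (τ n m 0 0) (numer N X 0ℚ 0ℚ) (norm n m) P ⟩
      norm n m * 1ℚ * τ n m 0 0 * (P * P) * numer N X 0ℚ 0ℚ
        ≡⟨ cong (λ u → u * (P * P) * numer N X 0ℚ 0ℚ) (trans (cong (λ z → norm n m * z * τ n m 0 0) (sym h-zero)) (τ-unfold n m 0 0)) ⟩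
      j * j * (P * P) * numer N X 0ℚ 0ℚ
        ≡⟨ e₄ j P (numer N X 0ℚ 0ℚ) ⟩
      (j * P) * (j * P) * numer N X 0ℚ 0ℚ
        ≡⟨ cong (λ u → u * u * numer N X 0ℚ 0ℚ) j≡ ⟩
      (sign m * d * hn * (N * N₁)) * (sign m * d * hn * (N * N₁)) * numer N X 0ℚ 0ℚ
        ≡⟨ e₅ X (sign m) d hn ⟩
      sign m * sign m * (Q * (d * hn * hn * (N₁ * N₁)))
        ≡⟨ trans (cong (_* (Q * (d * hn * hn * (N₁ * N₁)))) (sign² m)) (*-identityˡ (Q * (d * hn * hn * (N₁ * N₁)))) ⟩
      Q * (d * hn * hn * (N₁ * N₁)) ∎)
    where
    n = suc m
    X = ν m
    N = 1ℚ + X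
    N₁ = ν 2 + X
    G = γ m 0
    d = double-odds m
    H = h (n ℕ.+ n ℕ.+ m)
    F = fact m
    hn = h n
    j = J n m 0
    A = 1ℚ + ν 2 * X
    P = A * (ν 2 * N)
    b = 1ℚ + (N + N + X) + X
    c = 1ℚ + (N + N + X)
    Q = c * d * ((A * A) * (N * N))
    N>0 : 0ℚ < N
    N>0 = 0≤⇒pos 0<1 (0≤ν m)
    A>0 : 0ℚ < A
    A>0 = 0≤⇒pos 0<1 (*-nonneg (0≤ν 2) (0≤ν m))
    Q≢0 : Q ≢ 0ℚ
    Q≢0 = >0⇒≢0 (*-pos (*-pos (0≤⇒pos 0<1 (+-nonneg (+-nonneg (<⇒≤ N>0) (<⇒≤ N>0)) (0≤ν m))) (subst (0ℚ <_) (D≡ 0 m) (D-pos 0 m))) (*-pos (*-pos A>0 A>0) (*-pos N>0 N>0)))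
    norm≡ : norm n m * b ≡ c * (d * H * F)
    norm≡ = trans (subst (λ N → norm n m * (1ℚ + (N + N + X) + X) ≡ (1ℚ + (N + N + X)) * (D n m * H * falling n (n ℕ.+ m) m)) (ν-suc m) (norm-closed n m))
      (cong₂ (λ u v → c * (u * H * v)) (D≡ n m) (falling≡fact n m))
    drop≡ : denom N X 0ℚ 0ℚ * G ≡ τ n m 0 0 * numer N X 0ℚ 0ℚ
    drop≡ = subst (λ N → denom N X 0ℚ 0ℚ * G ≡ τ n m 0 0 * numer N X 0ℚ 0ℚ) (ν-suc m) (drop-unfold n m 0 0)
    νA : ν (n ℕ.+ m) ≡ A
    νA = trans (ν-+ n m) (trans (cong (_+ X) (ν-suc m)) (lem X))
      where
      lem : ∀ x → 1ℚ + x + x ≡ 1ℚ + ν 2 * x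
      lem = solve-∀ ℚ-ring
    νB : ν (suc (n ℕ.+ m)) ≡ ν 2 * N
    νB = trans (ν-suc (n ℕ.+ m)) (trans (cong (1ℚ +_) νA) (lem X))
      where
      lem : ∀ x → 1ℚ + (1ℚ + ν 2 * x) ≡ ν 2 * (1ℚ + x)
      lem = solve-∀ ℚ-ring
    j≡ : j * P ≡ sign m * d * hn * (N * N₁)
    j≡ = trans (cong (j *_) (sym (cong₂ _*_ νA νB))) (trans (J-at-0 n m)
      (cong₂ (λ u v → sign m * u * hn * v) (D≡ n m) (cong₂ _*_ (ν-suc m) (ν-+ 2 m))))
    e₁ : ∀ X d G H F → (1ℚ + ((1ℚ + X) + (1ℚ + X) + X)) * d * (((1ℚ + ν 2 * X) * (1ℚ + ν 2 * X)) * ((1ℚ + X) * (1ℚ + X))) * (G * (ν 12 * (ν 3 + ν 2 * X) * H * F)) ≡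
      G * (ν 3 * (ν 3 + ν 2 * X)) * ((1ℚ + ((1ℚ + X) + (1ℚ + X) + X)) * (d * H * F)) * (((1ℚ + ν 2 * X) * (ν 2 * (1ℚ + X))) * ((1ℚ + ν 2 * X) * (ν 2 * (1ℚ + X))))
    e₁ = solve-∀ ℚ-ring
    e₂ : ∀ X G v → let N = 1ℚ + X; P = (1ℚ + ν 2 * X) * (ν 2 * N) in
      G * (ν 3 * (ν 3 + ν 2 * X)) * (v * (1ℚ + (N + N + X) + X)) * (P * P) ≡
      (ν 3 + ν 2 * (0ℚ + 0ℚ)) * (ν 2 + (0ℚ + N) + X) * (1ℚ + (N + N + X) + X) * G * v * (P * P)
    e₂ = solve-∀ ℚ-ring
    e₃ : ∀ t u v P → t * u * v * (P * P) ≡ v * 1ℚ * t * (P * P) * u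
    e₃ = solve-∀ ℚ-ring
    e₄ : ∀ j P u → j * j * (P * P) * u ≡ (j * P) * (j * P) * u
    e₄ = solve-∀ ℚ-ring
    e₅ : ∀ X s d h → let N = 1ℚ + X; M = ν 2 + X; A = 1ℚ + ν 2 * X; c = 1ℚ + (N + N + X) in
      (s * d * h * (N * M)) * (s * d * h * (N * M)) * ((1ℚ + ν 2 * X) * (N - 0ℚ + X) * (1ℚ + (N + N + X))) ≡
      s * s * (c * d * ((A * A) * (N * N)) * (d * h * h * (M * M)))
    e₅ = solve-∀ ℚ-ring

  γ₀-pos : ∀ m → 0ℚ < γ m 0
  γ₀-pos m = subst (0ℚ <_) (cancel Y (>0⇒≢0 Y>0) (trans (lem Y Z (inv Y)) (trans (cong (Z *_) (inv-ʳ (>0⇒≢0 Y>0)))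
      (trans (*-identityʳ Z) (trans (sym (γ₀-closed m)) (*-comm (γ m 0) Y)))))) (*-pos Z>0 (inv-pos Y>0))
    where
    Y = ν 12 * (ν 3 + ν 2 * ν m) * h (suc m ℕ.+ suc m ℕ.+ m) * fact m
    Z = double-odds m * h (suc m) * h (suc m) * ((ν 2 + ν m) * (ν 2 + ν m))
    2+m>0 : 0ℚ < ν 2 + ν m
    2+m>0 = 0≤⇒pos (ν-pos 1) (0≤ν m)
    Y>0 : 0ℚ < Y
    Y>0 = *-pos (*-pos (*-pos (ν-pos 11) (0≤⇒pos (ν-pos 2) (*-nonneg (0≤ν 2) (0≤ν m)))) (h-pos (suc m ℕ.+ suc m ℕ.+ m))) (fact-pos m)
    Z>0 : 0ℚ < Z
    Z>0 = *-pos (*-pos (*-pos (D-pos 0 m) (h-pos (suc m))) (h-pos (suc m))) (*-pos 2+m>0 2+m>0)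
    lem : ∀ y z i → y * (z * i) ≡ z * (y * i)
    lem = solve-∀ ℚ-ring

  γ₀-ratio : ∀ m → let X = ν m in
    γ (suc m) 0 * ((1ℚ + X) * (ν 2 + X) * (ν 7 + ν 6 * X) * (ν 11 + ν 6 * X)) ≡
    γ m 0 * ((1ℚ + ν 2 * X) * (ν 5 + ν 2 * X) * (ν 4 + ν 3 * X) * (ν 5 + ν 3 * X))
  γ₀-ratio m = cancel Q Q≢0 (begin
      Q * (G′ * ((1ℚ + X) * (ν 2 + X) * (ν 7 + ν 6 * X) * (ν 11 + ν 6 * X)))
        ≡⟨ e₁ X G′ H₀ F ⟩
      G′ * (ν 12 * (ν 3 + ν 2 * (1ℚ + X)) * ((1ℚ + X) * F)) * ((ν 2 + X) * (ν 2 + X)) * (((ν 22 + ν 12 * X) * (ν 18 + ν 12 * X)) * ((ν 14 + ν 12 * X) * H₀))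
        ≡⟨ cong (λ u → G′ * (ν 12 * (ν 3 + ν 2 * (1ℚ + X)) * ((1ℚ + X) * F)) * ((ν 2 + X) * (ν 2 + X)) * u) hhh ⟩
      G′ * (ν 12 * (ν 3 + ν 2 * (1ℚ + X)) * ((1ℚ + X) * F)) * ((ν 2 + X) * (ν 2 + X)) * (p * H₃)
        ≡⟨ e₂ (ν 3 + ν 2 * (1ℚ + X)) G′ H₃ ((1ℚ + X) * F) (ν 2 + X) p ⟩
      G′ * (ν 12 * (ν 3 + ν 2 * (1ℚ + X)) * H₃ * ((1ℚ + X) * F)) * ((ν 2 + X) * (ν 2 + X)) * p
        ≡⟨ cong (λ u → u * ((ν 2 + X) * (ν 2 + X)) * p) closed′ ⟩
      d * (ν 2 + ν 4 * X) * hn′ * hn′ * ((ν 2 + (1ℚ + X)) * (ν 2 + (1ℚ + X))) * ((ν 2 + X) * (ν 2 + X)) * p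
        ≡⟨ e₃ X d hn′ p ⟩
      d * (ν 2 + ν 4 * X) * (((ν 3 + X) * hn′) * ((ν 3 + X) * hn′)) * ((ν 2 + X) * (ν 2 + X)) * p
        ≡⟨ cong (λ u → d * (ν 2 + ν 4 * X) * (u * u) * ((ν 2 + X) * (ν 2 + X)) * p) hn≡ ⟩
      d * (ν 2 + ν 4 * X) * (((ν 10 + ν 4 * X) * hn) * ((ν 10 + ν 4 * X) * hn)) * ((ν 2 + X) * (ν 2 + X)) * p
        ≡⟨ e₄ d (ν 2 + ν 4 * X) (ν 10 + ν 4 * X) hn (ν 2 + X) p ⟩
      d * hn * hn * ((ν 2 + X) * (ν 2 + X)) * ((ν 2 + ν 4 * X) * ((ν 10 + ν 4 * X) * (ν 10 + ν 4 * X)) * p)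
        ≡⟨ cong (_* ((ν 2 + ν 4 * X) * ((ν 10 + ν 4 * X) * (ν 10 + ν 4 * X)) * p)) (sym (γ₀-closed m)) ⟩
      G * (ν 12 * (ν 3 + ν 2 * X) * H₀ * F) * ((ν 2 + ν 4 * X) * ((ν 10 + ν 4 * X) * (ν 10 + ν 4 * X)) * p)
        ≡⟨ e₅ X G H₀ F ⟩
      Q * (G * ((1ℚ + ν 2 * X) * (ν 5 + ν 2 * X) * (ν 4 + ν 3 * X) * (ν 5 + ν 3 * X))) ∎)
    where
    X = ν m
    a = suc m ℕ.+ suc m ℕ.+ m
    G = γ m 0
    G′ = γ (suc m) 0
    d = double-odds m
    F = fact m
    H₀ = h a
    H₁ = h (suc a)
    H₂ = h (suc (suc a))
    H₃ = h (suc (suc (suc a)))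
    hn = h (suc m)
    hn′ = h (suc (suc m))
    p = (ν 6 + ν 3 * X) * (ν 5 + ν 3 * X) * (ν 4 + ν 3 * X)
    Q = ν 288 * (ν 5 + ν 2 * X) * (ν 3 + ν 2 * X) * (ν 2 + X) * H₀ * F
    Q≢0 : Q ≢ 0ℚ
    Q≢0 = >0⇒≢0 (*-pos (*-pos (*-pos (*-pos (*-pos (ν-pos 287) (0≤⇒pos (ν-pos 4) (*-nonneg (0≤ν 2) (0≤ν m)))) (0≤⇒pos (ν-pos 2) (*-nonneg (0≤ν 2) (0≤ν m))))
      (0≤⇒pos (ν-pos 1) (0≤ν m))) (h-pos a)) (fact-pos m))
    νa : ν a ≡ ν 2 + ν 3 * X
    νa = trans (trans (ν-+ (suc m ℕ.+ suc m) m) (cong (_+ X) (trans (ν-+ (suc m) (suc m)) (cong₂ _+_ (ν-suc m) (ν-suc m))))) (lem X)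
      where
      lem : ∀ x → (1ℚ + x) + (1ℚ + x) + x ≡ ν 2 + ν 3 * x
      lem = solve-∀ ℚ-ring
    step : ∀ b y → ν b ≡ y → (ν 2 + y) * h (suc b) ≡ (ν 6 + ν 4 * y) * h b
    step b y e = subst (λ y → (ν 2 + y) * h (suc b) ≡ (ν 6 + ν 4 * y) * h b) e (h-suc b)
    s₁ = step a (ν 2 + ν 3 * X) νa
    s₂ = step (suc a) (1ℚ + (ν 2 + ν 3 * X)) (trans (ν-suc a) (cong (1ℚ +_) νa))
    s₃ = step (suc (suc a)) (1ℚ + (1ℚ + (ν 2 + ν 3 * X))) (trans (ν-suc (suc a)) (cong (1ℚ +_) (trans (ν-suc a) (cong (1ℚ +_) νa))))
    -- From `m` to `m + 1` the argument `n + n + m` grows by 3, so three instances of `h-suc` are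
    -- chained.
    hhh : ((ν 22 + ν 12 * X) * (ν 18 + ν 12 * X)) * ((ν 14 + ν 12 * X) * H₀) ≡ p * H₃
    hhh = begin
      ((ν 22 + ν 12 * X) * (ν 18 + ν 12 * X)) * ((ν 14 + ν 12 * X) * H₀) ≡⟨ f₁ X H₀ ⟩
      (ν 22 + ν 12 * X) * (ν 18 + ν 12 * X) * ((ν 6 + ν 4 * (ν 2 + ν 3 * X)) * H₀) ≡⟨ cong ((ν 22 + ν 12 * X) * (ν 18 + ν 12 * X) *_) (sym s₁) ⟩
      (ν 22 + ν 12 * X) * (ν 18 + ν 12 * X) * ((ν 2 + (ν 2 + ν 3 * X)) * H₁) ≡⟨ f₂ X H₁ ⟩
      (ν 22 + ν 12 * X) * (ν 4 + ν 3 * X) * ((ν 6 + ν 4 * (1ℚ + (ν 2 + ν 3 * X))) * H₁) ≡⟨ cong ((ν 22 + ν 12 * X) * (ν 4 + ν 3 * X) *_) (sym s₂) ⟩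
      (ν 22 + ν 12 * X) * (ν 4 + ν 3 * X) * ((ν 2 + (1ℚ + (ν 2 + ν 3 * X))) * H₂) ≡⟨ f₃ X H₂ ⟩
      (ν 4 + ν 3 * X) * (ν 5 + ν 3 * X) * ((ν 6 + ν 4 * (1ℚ + (1ℚ + (ν 2 + ν 3 * X)))) * H₂) ≡⟨ cong ((ν 4 + ν 3 * X) * (ν 5 + ν 3 * X) *_) (sym s₃) ⟩
      (ν 4 + ν 3 * X) * (ν 5 + ν 3 * X) * ((ν 2 + (1ℚ + (1ℚ + (ν 2 + ν 3 * X)))) * H₃) ≡⟨ f₄ X H₃ ⟩
      p * H₃ ∎
      where
      f₁ : ∀ X H → ((ν 22 + ν 12 * X) * (ν 18 + ν 12 * X)) * ((ν 14 + ν 12 * X) * H) ≡ (ν 22 + ν 12 * X) * (ν 18 + ν 12 * X) * ((ν 6 + ν 4 * (ν 2 + ν 3 * X)) * H)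
      f₁ = solve-∀ ℚ-ring
      f₂ : ∀ X H → (ν 22 + ν 12 * X) * (ν 18 + ν 12 * X) * ((ν 2 + (ν 2 + ν 3 * X)) * H) ≡ (ν 22 + ν 12 * X) * (ν 4 + ν 3 * X) * ((ν 6 + ν 4 * (1ℚ + (ν 2 + ν 3 * X))) * H)
      f₂ = solve-∀ ℚ-ring
      f₃ : ∀ X H → (ν 22 + ν 12 * X) * (ν 4 + ν 3 * X) * ((ν 2 + (1ℚ + (ν 2 + ν 3 * X))) * H) ≡ (ν 4 + ν 3 * X) * (ν 5 + ν 3 * X) * ((ν 6 + ν 4 * (1ℚ + (1ℚ + (ν 2 + ν 3 * X)))) * H)
      f₃ = solve-∀ ℚ-ring
      f₄ : ∀ X H → (ν 4 + ν 3 * X) * (ν 5 + ν 3 * X) * ((ν 2 + (1ℚ + (1ℚ + (ν 2 + ν 3 * X)))) * H) ≡ (ν 6 + ν 3 * X) * (ν 5 + ν 3 * X) * (ν 4 + ν 3 * X) * H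
      f₄ = solve-∀ ℚ-ring
    hn≡ : (ν 3 + X) * hn′ ≡ (ν 10 + ν 4 * X) * hn
    hn≡ = trans (g₁ X hn′) (trans (step (suc m) (1ℚ + X) (ν-suc m)) (g₂ X hn))
      where
      g₁ : ∀ X y → (ν 3 + X) * y ≡ (ν 2 + (1ℚ + X)) * y
      g₁ = solve-∀ ℚ-ring
      g₂ : ∀ X y → (ν 6 + ν 4 * (1ℚ + X)) * y ≡ (ν 10 + ν 4 * X) * y
      g₂ = solve-∀ ℚ-ring
    closed′ : G′ * (ν 12 * (ν 3 + ν 2 * (1ℚ + X)) * H₃ * ((1ℚ + X) * F)) ≡ d * (ν 2 + ν 4 * X) * hn′ * hn′ * ((ν 2 + (1ℚ + X)) * (ν 2 + (1ℚ + X)))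
    closed′ = subst₂ (λ Y b → G′ * (ν 12 * (ν 3 + ν 2 * Y) * h b * ((1ℚ + X) * F)) ≡ d * (ν 2 + ν 4 * X) * hn′ * hn′ * ((ν 2 + Y) * (ν 2 + Y)))
      (ν-suc m) shape (γ₀-closed (suc m))
      where
      shape : suc (suc m) ℕ.+ suc (suc m) ℕ.+ suc m ≡ suc (suc (suc a))
      shape = trans (ℕ.+-suc (suc (suc m) ℕ.+ suc (suc m)) m) (cong (λ b → suc (suc (suc b) ℕ.+ m)) (ℕ.+-suc m (suc m)))
    e₁ : ∀ X G H F → ν 288 * (ν 5 + ν 2 * X) * (ν 3 + ν 2 * X) * (ν 2 + X) * H * F * (G * ((1ℚ + X) * (ν 2 + X) * (ν 7 + ν 6 * X) * (ν 11 + ν 6 * X))) ≡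
      G * (ν 12 * (ν 3 + ν 2 * (1ℚ + X)) * ((1ℚ + X) * F)) * ((ν 2 + X) * (ν 2 + X)) * (((ν 22 + ν 12 * X) * (ν 18 + ν 12 * X)) * ((ν 14 + ν 12 * X) * H))
    e₁ = solve-∀ ℚ-ring
    e₂ : ∀ c G H F y p → G * (ν 12 * c * F) * (y * y) * (p * H) ≡ G * (ν 12 * c * H * F) * (y * y) * p
    e₂ = solve-∀ ℚ-ring
    e₃ : ∀ X d h p → d * (ν 2 + ν 4 * X) * h * h * ((ν 2 + (1ℚ + X)) * (ν 2 + (1ℚ + X))) * ((ν 2 + X) * (ν 2 + X)) * p ≡
      d * (ν 2 + ν 4 * X) * (((ν 3 + X) * h) * ((ν 3 + X) * h)) * ((ν 2 + X) * (ν 2 + X)) * p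
    e₃ = solve-∀ ℚ-ring
    e₄ : ∀ d c u h y p → d * c * ((u * h) * (u * h)) * (y * y) * p ≡ d * h * h * (y * y) * (c * (u * u) * p)
    e₄ = solve-∀ ℚ-ring
    e₅ : ∀ X G H F → G * (ν 12 * (ν 3 + ν 2 * X) * H * F) * ((ν 2 + ν 4 * X) * ((ν 10 + ν 4 * X) * (ν 10 + ν 4 * X)) * ((ν 6 + ν 3 * X) * (ν 5 + ν 3 * X) * (ν 4 + ν 3 * X))) ≡
      ν 288 * (ν 5 + ν 2 * X) * (ν 3 + ν 2 * X) * (ν 2 + X) * H * F * (G * ((1ℚ + ν 2 * X) * (ν 5 + ν 2 * X) * (ν 4 + ν 3 * X) * (ν 5 + ν 3 * X)))
    e₅ = solve-∀ ℚ-ring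

-- Bounds and limits for the ratios of consecutive terms.

module Ratio where

  open Rat
  open import Data.Integer using (+_)
  open import Data.Rational
  open import Data.Rational.Properties
  open import Relation.Binary.PropositionalEquality hiding (J)
  open import Tactic.RingSolver using (solve-∀)

  cancel-≤ : ∀ {a b} d → 0ℚ < d → d * a ≤ d * b → a ≤ b
  cancel-≤ d p = *-cancelˡ-≤-pos d {{positive p}}

  mul-≤ : ∀ {a b} d → 0ℚ ≤ d → a ≤ b → d * a ≤ d * b
  mul-≤ d p = *-monoˡ-≤-nonNeg d {{nonNegative p}}

  0≤1 : 0ℚ ≤ 1ℚ
  0≤1 = <⇒≤ 0<1

  0≤½ : 0ℚ ≤ ½
  0≤½ = nonNegative⁻¹ ½

  -- The limits of the ratios lie below 1/4. The bound ⅜ leaves room for finite `m` and is small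
  -- enough for the error recursions of the tails to close.
  ⅜ ⅛ : ℚ
  ⅜ = + 3 / 8
  ⅛ = + 1 / 8

  -- q is the ratio of two consecutive terms γ m j, in the variables L = ⌊j/2⌋, E = m - L and
  -- κ = ⌈j/2⌉ - ⌊j/2⌋; as n = m + 1 grows it tends to (2 + j) / (2 (5 + 2 j)).
  module _ (L E κ : ℚ) where

    private
      K M N J D : ℚ
      K = L + κ
      M = L + E
      N = 1ℚ + M
      J = K + L
      D = (1ℚ + N + (K + N)) * (N - K + M)

    module _ (q : ℚ) (L≥0 : 0ℚ ≤ L) (E≥0 : 0ℚ ≤ E) (κ≥0 : 0ℚ ≤ κ) (κ≤1 : 0ℚ ≤ 1ℚ - κ) (M≥1 : 0ℚ ≤ M - 1ℚ)
      (def : q * ((ν 5 + ν 2 * J) * (1ℚ + N + (K + N)) * (N - K + M)) ≡ (ν 3 + ν 2 * (L + N)) * E * (ν 2 + J)) where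

      private
        K≥0 : 0ℚ ≤ K
        K≥0 = +-nonneg L≥0 κ≥0
        M≥0 : 0ℚ ≤ M
        M≥0 = +-nonneg L≥0 E≥0
        N>0 : 0ℚ < N
        N>0 = subst (0ℚ <_) (+-comm M 1ℚ) (+-pos M≥0 0<1)
        N≥0 : 0ℚ ≤ N
        N≥0 = <⇒≤ N>0
        J≥0 : 0ℚ ≤ J
        J≥0 = +-nonneg K≥0 L≥0
        5+2J>0 : 0ℚ < ν 5 + ν 2 * J
        5+2J>0 = subst (0ℚ <_) (+-comm (ν 2 * J) (ν 5)) (+-pos (*-nonneg (0≤ν 2) J≥0) (ν-pos 4))
        t = ν 3 + ν 2 * (L + N)
        t≥0 : 0ℚ ≤ t
        t≥0 = +-nonneg (0≤ν 3) (*-nonneg (0≤ν 2) (+-nonneg L≥0 N≥0))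
        2+J≥0 : 0ℚ ≤ ν 2 + J
        2+J≥0 = +-nonneg (0≤ν 2) J≥0
        excess = (1ℚ + K) * (E + (1ℚ - κ) + M) + ν 2 * N * (E + (1ℚ - κ)) + N * (M - 1ℚ)
        excess≥0 : 0ℚ ≤ excess
        excess≥0 = +-nonneg (+-nonneg (*-nonneg (+-nonneg 0≤1 K≥0) (+-nonneg (+-nonneg E≥0 κ≤1) M≥0))
          (*-nonneg (*-nonneg (0≤ν 2) N≥0) (+-nonneg E≥0 κ≤1))) (*-nonneg N≥0 M≥1)
        D≡ : D ≡ N * N + excess
        D≡ = lem L E κ
          where
          lem : ∀ L E κ → (1ℚ + (1ℚ + (L + E)) + ((L + κ) + (1ℚ + (L + E)))) * ((1ℚ + (L + E)) - (L + κ) + (L + E)) ≡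
            (1ℚ + (L + E)) * (1ℚ + (L + E)) + ((1ℚ + (L + κ)) * (E + (1ℚ - κ) + (L + E)) + ν 2 * (1ℚ + (L + E)) * (E + (1ℚ - κ)) + (1ℚ + (L + E)) * ((L + E) - 1ℚ))
          lem = solve-∀ ℚ-ring
        D>0 : 0ℚ < D
        D>0 = subst (0ℚ <_) (trans (+-comm excess (N * N)) (sym D≡)) (+-pos excess≥0 (*-pos N>0 N>0))
        Den = (ν 5 + ν 2 * J) * D
        Den>0 : 0ℚ < Den
        Den>0 = *-pos 5+2J>0 D>0
        def′ : Den * q ≡ t * E * (ν 2 + J)
        def′ = trans (lem (ν 5 + ν 2 * J) (1ℚ + N + (K + N)) (N - K + M) q) def
          where
          lem : ∀ a b c q → a * (b * c) * q ≡ q * (a * b * c)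
          lem = solve-∀ ℚ-ring

      ratio-nonneg : 0ℚ ≤ q
      ratio-nonneg = cancel-≤ Den Den>0 (subst₂ _≤_ (sym (*-zeroʳ Den)) (sym def′) (*-nonneg (*-nonneg t≥0 E≥0) 2+J≥0))

      ratio≤⅜ : q ≤ ⅜
      ratio≤⅜ = cancel-≤ Den Den>0 (≤-by p p≥0 (trans (cong (_+ p) def′) (lem L E κ)))
        where
        p = ⅛ * (ν 5 + ν 2 * J) * (ν 4 * N * M + (ν 8 * L + ν 5 * (L * L)) + ν 3 * (1ℚ - κ) * (ν 3 + L + K)) + ½ * (t * E)
        p≥0 : 0ℚ ≤ p
        p≥0 = +-nonneg (*-nonneg (*-nonneg (nonNegative⁻¹ ⅛) (<⇒≤ 5+2J>0)) (+-nonneg (+-nonneg (*-nonneg (*-nonneg (0≤ν 4) N≥0) M≥0)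
          (+-nonneg (*-nonneg (0≤ν 8) L≥0) (*-nonneg (0≤ν 5) (*-nonneg L≥0 L≥0)))) (*-nonneg (*-nonneg (0≤ν 3) κ≤1) (+-nonneg (+-nonneg (0≤ν 3) L≥0) K≥0))))
          (*-nonneg 0≤½ (*-nonneg t≥0 E≥0))
        lem : ∀ L E κ → let K = L + κ; M = L + E; N = 1ℚ + M; J = K + L; t = ν 3 + ν 2 * (L + N) in
          t * E * (ν 2 + J) + (⅛ * (ν 5 + ν 2 * J) * (ν 4 * N * M + (ν 8 * L + ν 5 * (L * L)) + ν 3 * (1ℚ - κ) * (ν 3 + L + K)) + ½ * (t * E))
          ≡ (ν 5 + ν 2 * J) * ((1ℚ + N + (K + N)) * (N - K + M)) * ⅜
        lem = solve-∀ ℚ-ring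

      -- Multiplied by `W`, the difference becomes `(2 + J) num`. In `num` the terms of order N²
      -- cancel, so it is at most `9 N (1 + J)²` in absolute value, while `D` is at least N².
      ratio-limit : ∀ Q u → 0ℚ ≤ u → N * u ≡ 1ℚ → Q * (ν 2 * (ν 5 + ν 2 * J)) ≡ ν 2 + J →
                    ∣ q - Q ∣ ≤ ν 3 * ((1ℚ + J) * (1ℚ + J)) * u
      ratio-limit Q u u≥0 Nu Q≡ = ∣∣≤ (cancel-≤ W W>0 (upper p₁ p₁≥0 (l₁ L E κ))) (cancel-≤ W W>0 (lower p₂ p₂≥0 (l₂ L E κ)))
        where
        W = ν 2 * (ν 5 + ν 2 * J) * D
        W>0 : 0ℚ < W
        W>0 = *-pos (*-pos (ν-pos 1) 5+2J>0) D>0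
        B = ν 3 * ((1ℚ + J) * (1ℚ + J)) * u
        num = ν 2 * (t * E) - D
        J² = (1ℚ + J) * (1ℚ + J)
        W[q-Q] : W * (q - Q) ≡ (ν 2 + J) * num
        W[q-Q] = trans (a₁ (ν 5 + ν 2 * J) D q Q) (trans (cong₂ (λ y z → ν 2 * y - z * D) def′ Q≡) (a₂ t E (ν 2 + J) D))
          where
          a₁ : ∀ c d q Q → ν 2 * c * d * (q - Q) ≡ ν 2 * (c * d * q) - Q * (ν 2 * c) * d
          a₁ = solve-∀ ℚ-ring
          a₂ : ∀ t E c D → ν 2 * (t * E * c) - c * D ≡ c * (ν 2 * (t * E) - D)
          a₂ = solve-∀ ℚ-ring
        -- This is where the constant 3 suffices: `6 (5 + 2J)` exceeds `9 (2 + J)` by `12 + 3J`. The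
        -- part of `D` beyond N² only adds to the right-hand side.
        WB : (ν 2 + J) * (ν 9 * N * J²) + (J² * N * (ν 12 + ν 3 * J) + ν 6 * (ν 5 + ν 2 * J) * J² * (u * excess)) ≡ W * B
        WB = trans (b₁ (ν 2 + J) J N J² u excess (ν 5 + ν 2 * J) refl refl) (trans (cong (λ y → ν 6 * (ν 5 + ν 2 * J) * J² * (N * y + u * excess)) (sym Nu))
          (trans (b₂ (ν 5 + ν 2 * J) J² N u excess) (cong (λ d → ν 2 * (ν 5 + ν 2 * J) * d * B) (sym D≡))))
          where
          b₀ : ∀ J N j u x → (ν 2 + J) * (ν 9 * N * j) + (j * N * (ν 12 + ν 3 * J) + ν 6 * (ν 5 + ν 2 * J) * j * (u * x)) ≡ ν 6 * (ν 5 + ν 2 * J) * j * (N * 1ℚ + u * x)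
          b₀ = solve-∀ ℚ-ring
          b₁ : ∀ c J N j u x d → c ≡ ν 2 + J → d ≡ ν 5 + ν 2 * J → c * (ν 9 * N * j) + (j * N * (ν 12 + ν 3 * J) + ν 6 * d * j * (u * x)) ≡ ν 6 * d * j * (N * 1ℚ + u * x)
          b₁ _ J N j u x _ refl refl = b₀ J N j u x
          b₂ : ∀ d j N u x → ν 6 * d * j * (N * (N * u) + u * x) ≡ ν 2 * d * (N * N + x) * (ν 3 * j * u)
          b₂ = solve-∀ ℚ-ring
        rest≥0 : 0ℚ ≤ J² * N * (ν 12 + ν 3 * J) + ν 6 * (ν 5 + ν 2 * J) * J² * (u * excess)
        rest≥0 = +-nonneg (*-nonneg (*-nonneg J²≥0 N≥0) (+-nonneg (0≤ν 12) (*-nonneg (0≤ν 3) J≥0)))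
          (*-nonneg (*-nonneg (*-nonneg (0≤ν 6) (<⇒≤ 5+2J>0)) J²≥0) (*-nonneg u≥0 excess≥0))
          where
          J²≥0 : 0ℚ ≤ J²
          J²≥0 = *-nonneg (+-nonneg 0≤1 J≥0) (+-nonneg 0≤1 J≥0)
        bound : ∀ {y} p → 0ℚ ≤ p → y + p ≡ ν 9 * N * J² → (ν 2 + J) * y ≤ W * B
        bound {y} p p≥0 e = ≤-trans (mul-≤ (ν 2 + J) 2+J≥0 (≤-by p p≥0 e)) (≤-by _ rest≥0 WB)
        upper : ∀ p → 0ℚ ≤ p → num + p ≡ ν 9 * N * J² → W * (q - Q) ≤ W * B
        upper p p≥0 e = subst (_≤ W * B) (sym W[q-Q]) (bound p p≥0 e)
        lower : ∀ p → 0ℚ ≤ p → - num + p ≡ ν 9 * N * J² → W * - (q - Q) ≤ W * B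
        lower p p≥0 e = subst (_≤ W * B) (trans (c₁ (ν 2 + J) num) (trans (cong -_ (sym W[q-Q])) (c₂ W (q - Q)))) (bound p p≥0 e)
          where
          c₁ : ∀ a b → a * - b ≡ - (a * b)
          c₁ = solve-∀ ℚ-ring
          c₂ : ∀ a b → - (a * b) ≡ a * - b
          c₂ = solve-∀ ℚ-ring
        p₁ = M * (ν 7 + ν 18 * J + ν 9 * (J * J)) + (ν 6 + ν 16 * K + ν 18 * L + ν 8 * (K * K) + ν 18 * (K * L) + ν 9 * (L * L)) + ν 2 * ((ν 3 + ν 2 * L) * (1ℚ + L))
        p₁≥0 : 0ℚ ≤ p₁
        p₁≥0 = +-nonneg (+-nonneg (*-nonneg M≥0 (+-nonneg (+-nonneg (0≤ν 7) (*-nonneg (0≤ν 18) J≥0)) (*-nonneg (0≤ν 9) (*-nonneg J≥0 J≥0))))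
          (+-nonneg (+-nonneg (+-nonneg (+-nonneg (+-nonneg (0≤ν 6) (*-nonneg (0≤ν 16) K≥0)) (*-nonneg (0≤ν 18) L≥0)) (*-nonneg (0≤ν 8) (*-nonneg K≥0 K≥0)))
            (*-nonneg (0≤ν 18) (*-nonneg K≥0 L≥0))) (*-nonneg (0≤ν 9) (*-nonneg L≥0 L≥0))))
          (*-nonneg (0≤ν 2) (*-nonneg (+-nonneg (0≤ν 3) (*-nonneg (0≤ν 2) L≥0)) (+-nonneg 0≤1 L≥0)))
        p₂ = M * (ν 9 * ((1ℚ + J) * (1ℚ + J)) + ν 2) + (ν 2 + (1ℚ + K) * (1ℚ + K)) + (ν 3 + ν 18 * K + ν 8 * L + ν 9 * (K * K) + ν 18 * (K * L) + ν 5 * (L * L))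
        p₂≥0 : 0ℚ ≤ p₂
        p₂≥0 = +-nonneg (+-nonneg (*-nonneg M≥0 (+-nonneg (*-nonneg (0≤ν 9) (*-nonneg (+-nonneg 0≤1 J≥0) (+-nonneg 0≤1 J≥0))) (0≤ν 2)))
          (+-nonneg (0≤ν 2) (*-nonneg (+-nonneg 0≤1 K≥0) (+-nonneg 0≤1 K≥0))))
          (+-nonneg (+-nonneg (+-nonneg (+-nonneg (+-nonneg (0≤ν 3) (*-nonneg (0≤ν 18) K≥0)) (*-nonneg (0≤ν 8) L≥0)) (*-nonneg (0≤ν 9) (*-nonneg K≥0 K≥0)))
            (*-nonneg (0≤ν 18) (*-nonneg K≥0 L≥0))) (*-nonneg (0≤ν 5) (*-nonneg L≥0 L≥0)))
        l₁ : ∀ L E κ → let K = L + κ; M = L + E; N = 1ℚ + M; J = K + L; D = (1ℚ + N + (K + N)) * (N - K + M) in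
          (ν 2 * ((ν 3 + ν 2 * (L + N)) * E) - D) + (M * (ν 7 + ν 18 * J + ν 9 * (J * J)) + (ν 6 + ν 16 * K + ν 18 * L + ν 8 * (K * K) + ν 18 * (K * L) + ν 9 * (L * L)) + ν 2 * ((ν 3 + ν 2 * L) * (1ℚ + L)))
          ≡ ν 9 * N * ((1ℚ + J) * (1ℚ + J))
        l₁ = solve-∀ ℚ-ring
        l₂ : ∀ L E κ → let K = L + κ; M = L + E; N = 1ℚ + M; J = K + L; D = (1ℚ + N + (K + N)) * (N - K + M) in
          - (ν 2 * ((ν 3 + ν 2 * (L + N)) * E) - D) + (M * (ν 9 * ((1ℚ + J) * (1ℚ + J)) + ν 2) + (ν 2 + (1ℚ + K) * (1ℚ + K)) + (ν 3 + ν 18 * K + ν 8 * L + ν 9 * (K * K) + ν 18 * (K * L) + ν 5 * (L * L)))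
          ≡ ν 9 * N * ((1ℚ + J) * (1ℚ + J))
        l₂ = solve-∀ ℚ-ring

-- The ratios as functions of `m` and `j`.

module Sums where

  open Rat
  open Ratio
  open Halves
  open import Data.Nat as ℕ using (ℕ; suc; s≤s; z≤n)
  import Data.Nat.Properties as ℕ
  open import Data.Product using (_,_; proj₁; proj₂)
  open import Data.Rational
  open import Data.Rational.Properties
  open import Relation.Binary.PropositionalEquality
  open import Tactic.RingSolver using (solve-∀)

  denQ numQ : ℕ → ℕ → ℚ
  denQ m j = let N = 1ℚ + ν m; K = ν (hi j); L = ν (lo j) in (ν 5 + ν 2 * (K + L)) * (1ℚ + N + (K + N)) * (N - K + ν m)
  numQ m j = let N = 1ℚ + ν m; K = ν (hi j); L = ν (lo j) in (ν 3 + ν 2 * (L + N)) * (ν m - L) * (ν 2 + (K + L))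

  u : ℕ → ℚ
  u m = inv (ν (suc m))

  u≥0 : ∀ m → 0ℚ ≤ u m
  u≥0 m = <⇒≤ (inv-pos (ν-pos m))

  Nu≡1 : ∀ m → (1ℚ + ν m) * u m ≡ 1ℚ
  Nu≡1 m = trans (cong (_* u m) (sym (ν-suc m))) (inv-ν m)

  u-anti : ∀ {m m′} → m ℕ.≤ m′ → u m′ ≤ u m
  u-anti {m} {m′} h with ℕ.m≤n⇒∃[o]m+o≡n h
  ... | o , refl = cancel-≤ (ν (suc m)) (ν-pos m) (cancel-≤ (ν (suc (m ℕ.+ o))) (ν-pos (m ℕ.+ o))
    (≤-by (ν o) (0≤ν o) (trans (cong (_+ ν o) (trans (l1 (ν (suc (m ℕ.+ o))) (ν (suc m)) (u (m ℕ.+ o))) (trans (cong (ν (suc m) *_) (inv-ν (m ℕ.+ o))) (*-identityʳ (ν (suc m))))))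
      (trans (sym (ν-+ (suc m) o)) (sym (trans (cong (ν (suc (m ℕ.+ o)) *_) (inv-ν m)) (*-identityʳ (ν (suc (m ℕ.+ o))))))))))
    where
    l1 : ∀ a b c → a * (b * c) ≡ b * (a * c)
    l1 = solve-∀ ℚ-ring

  limQ : ℕ → ℚ
  limQ j = (ν 2 + ν j) * inv (ν 2 * (ν 5 + ν 2 * ν j))

  limDen>0 : ∀ j → 0ℚ < ν 2 * (ν 5 + ν 2 * ν j)
  limDen>0 j = *-pos (ν-pos 1) (subst (0ℚ <_) (+-comm (ν 2 * ν j) (ν 5)) (+-pos (*-nonneg (0≤ν 2) (0≤ν j)) (ν-pos 4)))

  limQ-def : ∀ j → limQ j * (ν 2 * (ν 5 + ν 2 * ν j)) ≡ ν 2 + ν j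
  limQ-def j = trans (lem (ν 2 + ν j) (inv (ν 2 * (ν 5 + ν 2 * ν j))) (ν 2 * (ν 5 + ν 2 * ν j)))
    (trans (cong ((ν 2 + ν j) *_) (inv-ʳ (>0⇒≢0 (limDen>0 j)))) (*-identityʳ (ν 2 + ν j)))
    where
    lem : ∀ a b c → a * b * c ≡ a * (c * b)
    lem = solve-∀ ℚ-ring

  opaque
    q : ℕ → ℕ → ℚ
    q m j = numQ m j * inv (denQ m j)

    q-unfold : ∀ m j → denQ m j ≢ 0ℚ → q m j * denQ m j ≡ numQ m j
    q-unfold m j h = trans (lem (numQ m j) (inv (denQ m j)) (denQ m j)) (trans (cong (numQ m j *_) (inv-ʳ h)) (*-identityʳ (numQ m j)))
      where
      lem : ∀ a b c → a * b * c ≡ a * (c * b)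
      lem = solve-∀ ℚ-ring

  -- The index is `suc m′` because the estimates of the ratio ask for `M - 1` to be non-negative.
  -- This is why later sequences run over `suc m`, that is `n = m + 2`.
  module Facts (m′ j : ℕ) (lo≤m : lo j ℕ.≤ suc m′) where

    private
      m = suc m′
      X = ν m
      L = ν (lo j)
      K = ν (hi j)
      e = proj₁ (ℕ.m≤n⇒∃[o]m+o≡n lo≤m)
      E = ν e
      c = proj₁ (ℕ.m≤n⇒∃[o]m+o≡n (proj₁ (lo≤hi j)))
      κ = ν c
      c≤1 : c ℕ.≤ 1
      c≤1 = ℕ.+-cancelˡ-≤ (lo j) _ _ (ℕ.≤-trans (ℕ.≤-reflexive (proj₂ (ℕ.m≤n⇒∃[o]m+o≡n (proj₁ (lo≤hi j)))))
              (ℕ.≤-trans (proj₂ (lo≤hi j)) (ℕ.≤-reflexive (ℕ.+-comm 1 (lo j)))))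
      κ≤1 : 0ℚ ≤ 1ℚ - κ
      κ≤1 = go c≤1
        where
        go : ∀ {c} → c ℕ.≤ 1 → 0ℚ ≤ 1ℚ - ν c
        go z≤n       = 0≤1
        go (s≤s z≤n) = ≤-refl
      L+E : L + E ≡ X
      L+E = trans (sym (ν-+ (lo j) e)) (cong ν (proj₂ (ℕ.m≤n⇒∃[o]m+o≡n lo≤m)))
      L+κ : L + κ ≡ K
      L+κ = trans (sym (ν-+ (lo j) c)) (cong ν (proj₂ (ℕ.m≤n⇒∃[o]m+o≡n (proj₁ (lo≤hi j)))))
      J≡ : K + L ≡ ν j
      J≡ = trans (sym (ν-+ (hi j) (lo j))) (cong ν (hi+lo j))
      M≥1 : 0ℚ ≤ (L + E) - 1ℚ
      M≥1 = subst (0ℚ ≤_) (sym (trans (cong (_- 1ℚ) (trans L+E (ν-suc m′))) (lem (ν m′)))) (0≤ν m′)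
        where
        lem : ∀ x → 1ℚ + x - 1ℚ ≡ x
        lem = solve-∀ ℚ-ring

    denQ>0 : 0ℚ < denQ m j
    denQ>0 = *-pos (*-pos (subst (0ℚ <_) (+-comm (ν 2 * (K + L)) (ν 5)) (+-pos (*-nonneg (0≤ν 2) (+-nonneg (0≤ν (hi j)) (0≤ν (lo j)))) (ν-pos 4)))
        (subst (0ℚ <_) (lem₁ X K) (+-pos (+-nonneg (+-nonneg (0≤ν m) (+-nonneg (0≤ν (hi j)) (0≤ν m))) (0≤ν 2)) 0<1)))
      (subst (0ℚ <_) eq (+-pos (+-nonneg (0≤ν e) κ≤1) (ν-pos m′)))
      where
      lem₁ : ∀ X K → X + (K + X) + ν 2 + 1ℚ ≡ 1ℚ + (1ℚ + X) + (K + (1ℚ + X))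
      lem₁ = solve-∀ ℚ-ring
      lem₂ : ∀ L E κ → E + (1ℚ - κ) + (L + E) ≡ (1ℚ + (L + E)) - (L + κ) + (L + E)
      lem₂ = solve-∀ ℚ-ring
      eq : E + (1ℚ - κ) + X ≡ (1ℚ + X) - K + X
      eq = trans (cong (E + (1ℚ - κ) +_) (sym L+E)) (trans (lem₂ L E κ) (cong₂ (λ M K → (1ℚ + M) - K + M) L+E L+κ))

    q-def : q m j * denQ m j ≡ numQ m j
    q-def = q-unfold m j (>0⇒≢0 denQ>0)

    private
      def : let K = L + κ; M = L + E; N = 1ℚ + M; J = K + L in
            q m j * ((ν 5 + ν 2 * J) * (1ℚ + N + (K + N)) * (N - K + M)) ≡ (ν 3 + ν 2 * (L + N)) * E * (ν 2 + J)
      def = subst₂ (λ K M → let N = 1ℚ + M; J = K + L in q m j * ((ν 5 + ν 2 * J) * (1ℚ + N + (K + N)) * (N - K + M)) ≡ (ν 3 + ν 2 * (L + N)) * E * (ν 2 + J))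
        (sym L+κ) (sym L+E) (trans q-def (cong (λ E → (ν 3 + ν 2 * (L + (1ℚ + X))) * E * (ν 2 + (K + L))) (trans (cong (_- L) (sym L+E)) (lem L E))))
        where
        lem : ∀ L E → L + E - L ≡ E
        lem = solve-∀ ℚ-ring

    q≥0 : 0ℚ ≤ q m j
    q≥0 = ratio-nonneg L E κ (q m j) (0≤ν (lo j)) (0≤ν e) (0≤ν c) κ≤1 M≥1 def

    q≤⅜ : q m j ≤ ⅜
    q≤⅜ = ratio≤⅜ L E κ (q m j) (0≤ν (lo j)) (0≤ν e) (0≤ν c) κ≤1 M≥1 def

    q-limit : ∣ q m j - limQ j ∣ ≤ ν 3 * ((1ℚ + ν j) * (1ℚ + ν j)) * u m
    q-limit = subst (λ J → ∣ q m j - limQ j ∣ ≤ ν 3 * ((1ℚ + J) * (1ℚ + J)) * u m) (trans (cong (_+ L) L+κ) J≡)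
      (ratio-limit L E κ (q m j) (0≤ν (lo j)) (0≤ν e) (0≤ν c) κ≤1 M≥1 def (limQ j) (u m) (u≥0 m)
        (trans (cong (λ M → (1ℚ + M) * u m) L+E) (Nu≡1 m))
        (trans (cong (λ J → limQ j * (ν 2 * (ν 5 + ν 2 * J))) (trans (cong (_+ L) L+κ) J≡)) (trans (limQ-def j) (cong (ν 2 +_) (sym (trans (cong (_+ L) L+κ) J≡))))))

-- Sums of terms measured by their first term.

module Tails where

  open Rat
  open Ratio
  open Halves
  open Sums
  open import Data.Nat as ℕ using (ℕ; zero; suc; s≤s)
  import Data.Nat.Properties as ℕ
  open import Data.Rational
  open import Data.Rational.Properties
  open import Relation.Binary.PropositionalEquality
  open import Tactic.RingSolver using (solve-∀)

  -- S m f j = 1 + q_j + q_j q_{j+1} + ⋯ with f terms.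
  S : ℕ → ℕ → ℕ → ℚ
  S m zero    j = 0ℚ
  S m (suc f) j = 1ℚ + q m j * S m f (suc j)

  Full : ℕ → ℕ → ℕ → Set
  Full m f j = j ℕ.+ f ≡ suc m ℕ.+ suc m

  Full-suc : ∀ {m f j} → Full m (suc f) j → Full m f (suc j)
  Full-suc {m} {f} {j} e = trans (sym (ℕ.+-suc j f)) e

  Full-lo : ∀ {m f j} → Full m (suc f) j → lo j ℕ.≤ m
  Full-lo {m} {f} {j} e = lo-bound m j (ℕ.≤-trans (ℕ.m≤m+n (suc j) f) (ℕ.≤-reflexive (Full-suc {m} e)))

  mul-mono-≤ : ∀ {a b c d} → 0ℚ ≤ a → 0ℚ ≤ d → a ≤ b → c ≤ d → a * c ≤ b * d
  mul-mono-≤ {a} {b} {c} {d} a≥0 d≥0 h h′ = ≤-trans (mul-≤ a a≥0 h′) (*-monoʳ-≤-nonNeg d {{nonNegative d≥0}} h)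

  ∣a-b∣≡∣b-a∣ : ∀ a b → ∣ a - b ∣ ≡ ∣ b - a ∣
  ∣a-b∣≡∣b-a∣ a b = trans (cong ∣_∣ (lem a b)) (∣-p∣≡∣p∣ (b - a))
    where
    lem : ∀ a b → a - b ≡ - (b - a)
    lem = solve-∀ ℚ-ring

  triangle : ∀ a b c → ∣ a - c ∣ ≤ ∣ a - b ∣ + ∣ b - c ∣
  triangle a b c = ≤-trans (≤-reflexive (cong ∣_∣ (lem a b c))) (∣p+q∣≤∣p∣+∣q∣ (a - b) (b - c))
    where
    lem : ∀ a b c → a - c ≡ (a - b) + (b - c)
    lem = solve-∀ ℚ-ring

  -- |a b - c d| through a (b - d) + (a - c) d.
  product-gap : ∀ {a b c d A D x y} → 0ℚ ≤ a → 0ℚ ≤ d → a ≤ A → d ≤ D → ∣ b - d ∣ ≤ x → ∣ a - c ∣ ≤ y → ∣ a * b - c * d ∣ ≤ A * x + y * D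
  product-gap {a} {b} {c} {d} {A} {D} {x} {y} a≥0 d≥0 hA hD hx hy =
    ≤-trans (≤-reflexive (cong ∣_∣ (lem a b c d))) (≤-trans (∣p+q∣≤∣p∣+∣q∣ (a * (b - d)) ((a - c) * d)) (+-mono-≤
      (≤-trans (≤-reflexive (trans (∣p*q∣≡∣p∣*∣q∣ a (b - d)) (cong (_* ∣ b - d ∣) (0≤p⇒∣p∣≡p a≥0)))) (mul-mono-≤ a≥0 (≤-trans (0≤∣p∣ (b - d)) hx) hA hx))
      (≤-trans (≤-reflexive (trans (∣p*q∣≡∣p∣*∣q∣ (a - c) d) (cong (∣ a - c ∣ *_) (0≤p⇒∣p∣≡p d≥0)))) (mul-mono-≤ (0≤∣p∣ (a - c)) (≤-trans d≥0 hD) hy hD))))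
    where
    lem : ∀ a b c d → a * b - c * d ≡ a * (b - d) + (a - c) * d
    lem = solve-∀ ℚ-ring

  0≤⅜ : 0ℚ ≤ ⅜
  0≤⅜ = nonNegative⁻¹ ⅜

  S≥0 : ∀ m′ f j → Full (suc m′) f j → 0ℚ ≤ S (suc m′) f j
  S≥0 m′ zero    j e = ≤-refl
  S≥0 m′ (suc f) j e = +-nonneg 0≤1 (*-nonneg (Facts.q≥0 m′ j (Full-lo {suc m′} e)) (S≥0 m′ f (suc j) (Full-suc {suc m′} e)))

  1≤S : ∀ m′ f j → Full (suc m′) (suc f) j → 1ℚ ≤ S (suc m′) (suc f) j
  1≤S m′ f j e = ≤-by _ (*-nonneg (Facts.q≥0 m′ j (Full-lo {suc m′} e)) (S≥0 m′ f (suc j) (Full-suc {suc m′} e))) refl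

  -- The bound reproduces itself, because `1 + ⅜ · 2` is 2 less ¼.
  S≤2 : ∀ m′ f j → Full (suc m′) f j → S (suc m′) f j ≤ ν 2
  S≤2 m′ zero    j e = 0≤ν 2
  S≤2 m′ (suc f) j e = ≤-trans (+-monoʳ-≤ 1ℚ (mul-mono-≤ (Facts.q≥0 m′ j (Full-lo {suc m′} e)) (0≤ν 2) (Facts.q≤⅜ m′ j (Full-lo {suc m′} e)) (S≤2 m′ f (suc j) (Full-suc {suc m′} e))))
    (≤-by (½ * ½) (*-nonneg 0≤½ 0≤½) refl)

  sq : ℚ → ℚ
  sq x = x * x

  sq≥0 : ∀ {x} → 0ℚ ≤ x → 0ℚ ≤ sq x
  sq≥0 h = *-nonneg h h

  -- At the end of the sum, where j is about 2n, the error terms below exceed the trivial bound 2.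
  end-large : ∀ m y c → 0ℚ ≤ c → y ≡ ν (suc m ℕ.+ suc m) → ν 2 ≤ ν 20 * sq (c + y) * u m
  end-large m y c c≥0 refl = ≤-by (ν 2 * ν 39 + ν 80 * ν m + ν 20 * (c * c + ν 2 * c * Y) * u m)
      (+-nonneg (+-nonneg (*-nonneg (0≤ν 2) (0≤ν 39)) (*-nonneg (0≤ν 80) (0≤ν m))) (*-nonneg (*-nonneg (0≤ν 20) (+-nonneg (*-nonneg c≥0 c≥0) (*-nonneg (*-nonneg (0≤ν 2) c≥0) (0≤ν (suc m ℕ.+ suc m))))) (u≥0 m)))
      (trans (lem₁ (ν m) c (u m) Y) (trans (cong (λ z → ν 80 * (1ℚ + ν m) * z + ν 20 * (c * c + ν 2 * c * Y) * u m) (sym (Nu≡1 m)))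
        (trans (lem₂ (ν m) c (u m) Y) (trans (cong (λ z → ν 20 * (z * z) * u m + ν 20 * (c * c + ν 2 * c * Y) * u m) (sym Y≡)) (lem₃ c (u m) Y)))))
    where
    Y = ν (suc m ℕ.+ suc m)
    Y≡ : Y ≡ ν 2 * (1ℚ + ν m)
    Y≡ = trans (ν-+ (suc m) (suc m)) (trans (cong₂ _+_ (ν-suc m) (ν-suc m)) (lem (ν m)))
      where
      lem : ∀ x → (1ℚ + x) + (1ℚ + x) ≡ ν 2 * (1ℚ + x)
      lem = solve-∀ ℚ-ring
    lem₁ : ∀ X c u Y → ν 2 + (ν 2 * ν 39 + ν 80 * X + ν 20 * (c * c + ν 2 * c * Y) * u) ≡ ν 80 * (1ℚ + X) * 1ℚ + ν 20 * (c * c + ν 2 * c * Y) * u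
    lem₁ = solve-∀ ℚ-ring
    lem₂ : ∀ X c u Y → ν 80 * (1ℚ + X) * ((1ℚ + X) * u) + ν 20 * (c * c + ν 2 * c * Y) * u ≡
                       ν 20 * ((ν 2 * (1ℚ + X)) * (ν 2 * (1ℚ + X))) * u + ν 20 * (c * c + ν 2 * c * Y) * u
    lem₂ = solve-∀ ℚ-ring
    lem₃ : ∀ c u Y → ν 20 * (Y * Y) * u + ν 20 * (c * c + ν 2 * c * Y) * u ≡ ν 20 * ((c + Y) * (c + Y)) * u
    lem₃ = solve-∀ ℚ-ring

  ∣a∣≤2 : ∀ {a b} → 0ℚ ≤ a → a ≤ ν 2 → 0ℚ ≤ b → b ≤ ν 2 → ∣ a - b ∣ ≤ ν 2
  ∣a∣≤2 {a} {b} a≥0 a≤2 b≥0 b≤2 = ∣∣≤ (≤-trans (≤-by b b≥0 (l a b)) a≤2) (≤-trans (≤-by a a≥0 (l′ a b)) b≤2)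
    where
    l : ∀ a b → a - b + b ≡ a
    l = solve-∀ ℚ-ring
    l′ : ∀ a b → - (a - b) + a ≡ b
    l′ = solve-∀ ℚ-ring

  q-near : ∀ m′ k′ j → m′ ℕ.≤ k′ → lo j ℕ.≤ suc m′ → ∣ q (suc m′) j - q (suc k′) j ∣ ≤ ν 6 * sq (1ℚ + ν j) * u (suc m′)
  q-near m′ k′ j m≤k l = ≤-trans (triangle (q (suc m′) j) (limQ j) (q (suc k′) j)) (≤-trans (+-mono-≤ (Facts.q-limit m′ j l)
      (≤-trans (≤-reflexive (∣a-b∣≡∣b-a∣ (limQ j) (q (suc k′) j))) (≤-trans (Facts.q-limit k′ j (ℕ.≤-trans l (s≤s m≤k)))
        (mul-≤ (ν 3 * sq (1ℚ + ν j)) (*-nonneg (0≤ν 3) (sq≥0 (+-nonneg 0≤1 (0≤ν j)))) (u-anti (s≤s m≤k))))))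
    (≤-reflexive (lem (sq (1ℚ + ν j)) (u (suc m′)))))
    where
    lem : ∀ s u → ν 3 * s * u + ν 3 * s * u ≡ ν 6 * s * u
    lem = solve-∀ ℚ-ring

  -- Each step damps the earlier errors by ⅜. The constant closes since `⅜ · 20 + 6 · 2` is below
  -- 20, with 6 from `q-near` and 2 from `S≤2`; the shift 4 absorbs the passage from `j` to `j + 1`.
  -- Where one of the sums ends, `end-large` takes over.
  S-near : ∀ m′ k′ → m′ ℕ.≤ k′ → ∀ f f′ j → Full (suc m′) f j → Full (suc k′) f′ j →
           ∣ S (suc m′) f j - S (suc k′) f′ j ∣ ≤ ν 20 * sq (ν 4 + ν j) * u (suc m′)
  S-near m′ k′ m≤k zero f′ j e e′ = ≤-trans (∣a∣≤2 ≤-refl (0≤ν 2) (S≥0 k′ f′ j e′) (S≤2 k′ f′ j e′))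
    (end-large (suc m′) (ν j) (ν 4) (0≤ν 4) (cong ν (trans (sym (ℕ.+-identityʳ j)) e)))
  S-near m′ k′ m≤k (suc f) zero j e e′ = ≤-trans (∣a∣≤2 (S≥0 m′ (suc f) j e) (S≤2 m′ (suc f) j e) ≤-refl (0≤ν 2))
    (≤-trans (end-large (suc k′) (ν j) (ν 4) (0≤ν 4) (cong ν (trans (sym (ℕ.+-identityʳ j)) e′)))
      (mul-≤ (ν 20 * sq (ν 4 + ν j)) (*-nonneg (0≤ν 20) (sq≥0 (+-nonneg (0≤ν 4) (0≤ν j)))) (u-anti (s≤s m≤k))))
  S-near m′ k′ m≤k (suc f) (suc f′) j e e′ = ≤-trans (≤-reflexive (cong ∣_∣ (l₁ (q (suc m′) j * S (suc m′) f (suc j)) (q (suc k′) j * S (suc k′) f′ (suc j)))))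
      (≤-trans (product-gap (Facts.q≥0 m′ j lo≤) (S≥0 k′ f′ (suc j) e₁′) (Facts.q≤⅜ m′ j lo≤) (S≤2 k′ f′ (suc j) e₁′)
          (S-near m′ k′ m≤k f f′ (suc j) e₁ e₁′) (q-near m′ k′ j m≤k lo≤))
        (≤-by (u (suc m′) * (½ * (Y * Y) + ν 61 * Y + ν 120 + ½))
          (*-nonneg (u≥0 (suc m′)) (+-nonneg (+-nonneg (+-nonneg (*-nonneg 0≤½ (sq≥0 (0≤ν j))) (*-nonneg (0≤ν 61) (0≤ν j))) (0≤ν 120)) 0≤½))
          (trans (cong (λ z → ⅜ * (ν 20 * sq (ν 4 + z) * u (suc m′)) + ν 6 * sq (1ℚ + Y) * u (suc m′) * ν 2 + u (suc m′) * (½ * (Y * Y) + ν 61 * Y + ν 120 + ½)) (ν-suc j)) (l₂ Y (u (suc m′))))))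
    where
    Y = ν j
    lo≤ = Full-lo {suc m′} e
    e₁ = Full-suc {suc m′} e
    e₁′ = Full-suc {suc k′} e′
    l₁ : ∀ a b → (1ℚ + a) - (1ℚ + b) ≡ a - b
    l₁ = solve-∀ ℚ-ring
    l₂ : ∀ Y u → ⅜ * (ν 20 * ((ν 4 + (1ℚ + Y)) * (ν 4 + (1ℚ + Y))) * u) + ν 6 * ((1ℚ + Y) * (1ℚ + Y)) * u * ν 2 + u * (½ * (Y * Y) + ν 61 * Y + ν 120 + ½) ≡ ν 20 * ((ν 4 + Y) * (ν 4 + Y)) * u
    l₂ = solve-∀ ℚ-ring

  -- The difference is exactly `4 / W`, and `W` grows like `16 j²`.
  limQ-near : ∀ j → ∣ limQ (suc (suc j)) - limQ j ∣ ≤ ½ * sq (u j)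
  limQ-near j = ∣∣≤ (cancel-≤ W W>0 (≤-trans (≤-reflexive W*d) (≤-trans (≤-by _ p≥0 refl) (≤-reflexive W*b))))
                    (cancel-≤ W W>0 (≤-trans (≤-reflexive (trans (neg₁ W d) (cong -_ W*d))) (≤-trans (neg-≤0 (ν 4) (0≤ν 4)) (*-nonneg (<⇒≤ W>0) (*-nonneg 0≤½ (sq≥0 (u≥0 j)))))))
    where
    Y = ν j
    a = ν 5 + ν 2 * Y
    b = ν 9 + ν 2 * Y
    W = (ν 2 * a) * (ν 2 * b)
    d = limQ (suc (suc j)) - limQ j
    b>0 : 0ℚ < b
    b>0 = subst (0ℚ <_) (+-comm (ν 2 * Y) (ν 9)) (+-pos (*-nonneg (0≤ν 2) (0≤ν j)) (ν-pos 8))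
    W>0 : 0ℚ < W
    W>0 = *-pos (limDen>0 j) (*-pos (ν-pos 1) b>0)
    νj+2 : ν (suc (suc j)) ≡ ν 2 + Y
    νj+2 = ν-+ 2 j
    def₂ : limQ (suc (suc j)) * (ν 2 * b) ≡ ν 4 + Y
    def₂ = trans (cong (λ z → limQ (suc (suc j)) * (ν 2 * z)) (trans (l₁ Y) (cong (λ z → ν 5 + ν 2 * z) (sym νj+2)))) (trans (limQ-def (suc (suc j))) (trans (cong (ν 2 +_) νj+2) (l₂ Y)))
      where
      l₁ : ∀ y → ν 9 + ν 2 * y ≡ ν 5 + ν 2 * (ν 2 + y)
      l₁ = solve-∀ ℚ-ring
      l₂ : ∀ y → ν 2 + (ν 2 + y) ≡ ν 4 + y
      l₂ = solve-∀ ℚ-ring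
    W*d : W * d ≡ ν 4
    W*d = trans (l₁ a b (limQ (suc (suc j))) (limQ j)) (trans (cong₂ (λ y z → ν 2 * a * y - ν 2 * b * z) def₂ (limQ-def j)) (l₂ Y))
      where
      l₁ : ∀ a b p q → (ν 2 * a) * (ν 2 * b) * (p - q) ≡ ν 2 * a * (p * (ν 2 * b)) - ν 2 * b * (q * (ν 2 * a))
      l₁ = solve-∀ ℚ-ring
      l₂ : ∀ Y → ν 2 * (ν 5 + ν 2 * Y) * (ν 4 + Y) - ν 2 * (ν 9 + ν 2 * Y) * (ν 2 + Y) ≡ ν 4
      l₂ = solve-∀ ℚ-ring
    p = ν 4 + (ν 40 * Y + ν 82) * sq (u j)
    p≥0 : 0ℚ ≤ p
    p≥0 = +-nonneg (0≤ν 4) (*-nonneg (+-nonneg (*-nonneg (0≤ν 40) (0≤ν j)) (0≤ν 82)) (sq≥0 (u≥0 j)))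
    W*b : ν 4 + p ≡ W * (½ * sq (u j))
    W*b = trans (l₁ Y (u j)) (trans (cong (λ z → ν 8 * (z * z) + (ν 40 * Y + ν 82) * sq (u j)) (sym (Nu≡1 j))) (l₂ Y (u j)))
      where
      l₁ : ∀ Y u → ν 4 + (ν 4 + (ν 40 * Y + ν 82) * (u * u)) ≡ ν 8 * (1ℚ * 1ℚ) + (ν 40 * Y + ν 82) * (u * u)
      l₁ = solve-∀ ℚ-ring
      l₂ : ∀ Y u → ν 8 * (((1ℚ + Y) * u) * ((1ℚ + Y) * u)) + (ν 40 * Y + ν 82) * (u * u) ≡ (ν 2 * (ν 5 + ν 2 * Y)) * (ν 2 * (ν 9 + ν 2 * Y)) * (½ * (u * u))
      l₂ = solve-∀ ℚ-ring
    neg₁ : ∀ W d → W * - d ≡ - (W * d)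
    neg₁ = solve-∀ ℚ-ring
    neg-≤0 : ∀ x → 0ℚ ≤ x → - x ≤ 0ℚ
    neg-≤0 x h = neg-antimono-≤ h

  -- Starting two places later replaces each ratio by the one two places on. By `limQ-near` their
  -- limits differ by O(j⁻²), and the distance from the limits adds an error that disappears as `m`
  -- grows. Both constants close: `⅜ · 4 + ½ · 2` is below 4 and `⅜ · 20 + 6 · 2` is below 20.
  S-drift : ∀ m′ f j → Full (suc m′) (suc (suc f)) j →
            ∣ S (suc m′) f (suc (suc j)) - S (suc m′) (suc (suc f)) j ∣ ≤ ν 4 * sq (u j) + ν 20 * sq (ν 6 + ν j) * u (suc m′)
  S-drift m′ zero j e = ≤-trans (∣a∣≤2 ≤-refl (0≤ν 2) (S≥0 m′ 2 j e) (S≤2 m′ 2 j e))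
    (≤-trans (end-large (suc m′) (ν (suc (suc j))) (ν 4) (0≤ν 4) (cong ν (trans (sym (ℕ.+-comm j 2)) e)))
      (≤-trans (≤-reflexive (cong (λ z → ν 20 * sq z * u (suc m′)) (trans (cong (ν 4 +_) (ν-+ 2 j)) (lem (ν j)))))
        (≤-by (ν 4 * sq (u j)) (*-nonneg (0≤ν 4) (sq≥0 (u≥0 j))) (+-comm _ (ν 4 * sq (u j))))))
    where
    lem : ∀ y → ν 4 + (ν 2 + y) ≡ ν 6 + y
    lem = solve-∀ ℚ-ring
  S-drift m′ (suc f) j e = ≤-trans (≤-reflexive (cong ∣_∣ (l₁ (q m (suc (suc j)) * S m f (suc (suc (suc j)))) (q m j * S m (suc (suc f)) (suc j)))))
      (≤-trans (product-gap (Facts.q≥0 m′ (suc (suc j)) lo₂) (S≥0 m′ (suc (suc f)) (suc j) e₁) (Facts.q≤⅜ m′ (suc (suc j)) lo₂) (S≤2 m′ (suc (suc f)) (suc j) e₁)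
          (S-drift m′ f (suc j) e₁) q-diff)
        (≤-by p p≥0 fin))
    where
    m = suc m′
    Y = ν j
    U = u m
    e₁ = Full-suc {m} {suc (suc f)} {j} e
    lo₀ = Full-lo {m} {suc (suc f)} {j} e
    lo₂ : lo (suc (suc j)) ℕ.≤ m
    lo₂ = Full-lo {m} {f} {suc (suc j)} (Full-suc {m} {suc f} {suc j} e₁)
    q-diff : ∣ q m (suc (suc j)) - q m j ∣ ≤ (ν 3 * sq (ν 3 + Y) * U + ½ * sq (u j)) + ν 3 * sq (1ℚ + Y) * U
    q-diff = ≤-trans (triangle (q m (suc (suc j))) (limQ j) (q m j)) (+-mono-≤
      (≤-trans (triangle (q m (suc (suc j))) (limQ (suc (suc j))) (limQ j)) (+-mono-≤
        (≤-trans (Facts.q-limit m′ (suc (suc j)) lo₂) (≤-reflexive (cong (λ z → ν 3 * sq z * U) (trans (cong (1ℚ +_) (ν-+ 2 j)) (l₀ Y))))) (limQ-near j)))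
      (≤-trans (≤-reflexive (∣a-b∣≡∣b-a∣ (limQ j) (q m j))) (Facts.q-limit m′ j lo₀)))
      where
      l₀ : ∀ y → 1ℚ + (ν 2 + y) ≡ ν 3 + y
      l₀ = solve-∀ ℚ-ring
    l₁ : ∀ a b → (1ℚ + a) - (1ℚ + b) ≡ a - b
    l₁ = solve-∀ ℚ-ring
    r = sq (u j) - sq (u (suc j))
    r≥0 : 0ℚ ≤ r
    r≥0 = ≤-trans (≤-reflexive (sym (+-inverseʳ (sq (u (suc j)))))) (+-monoˡ-≤ (- sq (u (suc j)))
      (mul-mono-≤ (u≥0 (suc j)) (u≥0 j) (u-anti (ℕ.n≤1+n j)) (u-anti (ℕ.n≤1+n j))))
    p = (⅜ * ν 4) * r + (1ℚ + ½) * sq (u j) + U * (½ * (Y * Y) + ν 87 * Y + ν 292 + ½)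
    p≥0 : 0ℚ ≤ p
    p≥0 = +-nonneg (+-nonneg (*-nonneg (*-nonneg 0≤⅜ (0≤ν 4)) r≥0) (*-nonneg (+-nonneg 0≤1 0≤½) (sq≥0 (u≥0 j))))
      (*-nonneg (u≥0 m) (+-nonneg (+-nonneg (+-nonneg (*-nonneg 0≤½ (sq≥0 (0≤ν j))) (*-nonneg (0≤ν 87) (0≤ν j))) (0≤ν 292)) 0≤½))
    fin : ⅜ * (ν 4 * sq (u (suc j)) + ν 20 * sq (ν 6 + ν (suc j)) * U) + ((ν 3 * sq (ν 3 + Y) * U + ½ * sq (u j)) + ν 3 * sq (1ℚ + Y) * U) * ν 2 + p
          ≡ ν 4 * sq (u j) + ν 20 * sq (ν 6 + Y) * U
    fin = trans (cong (λ z → ⅜ * (ν 4 * sq (u (suc j)) + ν 20 * sq (ν 6 + z) * U) + ((ν 3 * sq (ν 3 + Y) * U + ½ * sq (u j)) + ν 3 * sq (1ℚ + Y) * U) * ν 2 + p) (ν-suc j))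
      (lem Y U (sq (u j)) (sq (u (suc j))))
      where
      lem : ∀ Y U s s′ → ⅜ * (ν 4 * s′ + ν 20 * ((ν 6 + (1ℚ + Y)) * (ν 6 + (1ℚ + Y))) * U) + ((ν 3 * ((ν 3 + Y) * (ν 3 + Y)) * U + ½ * s) + ν 3 * ((1ℚ + Y) * (1ℚ + Y)) * U) * ν 2
        + ((⅜ * ν 4) * (s - s′) + (1ℚ + ½) * s + U * (½ * (Y * Y) + ν 87 * Y + ν 292 + ½)) ≡ ν 4 * s + ν 20 * ((ν 6 + Y) * (ν 6 + Y)) * U
      lem = solve-∀ ℚ-ring

-- The quotient of tiling counts as first term times sum.

module Bridge where

  open import Defs
  open Rat
  open Strip using (1≤pf; pf)
  open Regions using (MF≡pf; starts; trues-replicate)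
  open Hole using (MFhole≡pf; lowerPt; upperPt)
  open Orthogonal using (insert-pair)
  open Gram using (dist; residual; residual-correct)
  open Moments using (h)
  open Gamma
  open Halves
  open Sums
  open Tails
  open import Data.Empty using (⊥-elim)
  import Data.Integer as ℤ
  import Data.Integer.Properties as ℤ
  open import Data.List using (_∷_; replicate)
  open import Data.Bool using (true)
  open import Data.Nat as ℕ using (ℕ; zero; suc)
  import Data.Nat.Properties as ℕ
  open import Data.Product using (_,_; proj₁; proj₂)
  open import Data.Rational
  open import Data.Rational.Properties
  import Data.Rational.Unnormalised as ℚᵘ
  import Data.Rational.Unnormalised.Properties as ℚᵘ
  open import Relation.Binary.PropositionalEquality
  open import Tactic.RingSolver using (solve-∀)
  open ≡-Reasoning

  frac-* : ∀ a b → fracℕ a (suc b) * ν (suc b) ≡ ν a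
  frac-* a b = toℚᵘ-injective (ℚᵘ.≃-trans (toℚᵘ-homo-* (fracℕ a (suc b)) (ν (suc b)))
    (ℚᵘ.≃-trans (ℚᵘ.*-cong (toℚᵘ-fromℚᵘ (ℤ.+ a ℚᵘ./ suc b)) (ι-toℚᵘ (ℤ.+ suc b)))
    (ℚᵘ.≃-trans (ℚᵘ.*≡* lem) (ℚᵘ.≃-sym (ι-toℚᵘ (ℤ.+ a))))))
    where
    lem : (ℤ.+ a ℤ.* ℤ.+ suc b) ℤ.* ℤ.+ 1 ≡ ℤ.+ a ℤ.* ℤ.+ (suc b ℕ.* 1)
    lem = trans (ℤ.*-identityʳ (ℤ.+ a ℤ.* ℤ.+ suc b)) (cong (λ z → ℤ.+ a ℤ.* ℤ.+ z) (sym (ℕ.*-identityʳ (suc b))))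

  frac-unique : ∀ a b r → ι (ℤ.+ b) ≢ 0ℚ → ι (ℤ.+ a) ≡ r * ι (ℤ.+ b) → fracℕ a b ≡ r
  frac-unique a zero    r h e = ⊥-elim (h refl)
  frac-unique a (suc b) r h e = cancel (ν (suc b)) h (trans (*-comm (ν (suc b)) (fracℕ a (suc b))) (trans (frac-* a b) (trans e (*-comm r (ν (suc b))))))

  -- The value of the quotient of tiling counts for `n = x = m + 1`; the analysis works with it in
  -- place of the counts.
  correlation : ℕ → ℕ → ℚ
  correlation m k = h (k ℕ.+ k) * gap m (k ℕ.+ k)

  MF-pos : ∀ n x → 0ℚ < ι (ℤ.+ MF n x)
  MF-pos n x = <-≤-trans 0<1 (subst (1ℚ ≤_) (sym (MF≡pf n x)) (1≤pf x _ _ (replicate (2 ℕ.* x) true)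
    (trans (trues-replicate (2 ℕ.* x)) (cong (x ℕ.+_) (ℕ.+-identityʳ x)))))

  hole-count : ∀ n m k → n ≡ suc m → k ℕ.≤ m → ι (ℤ.+ MFhole n n k) ≡ correlation m k * ι (ℤ.+ MF n n)
  hole-count n m k n≡ k≤m = begin
    ι (ℤ.+ MFhole n n k)                                           ≡⟨ MFhole≡pf d k n n (trans n≡ (cong suc (trans (sym (proj₂ (ℕ.m≤n⇒∃[o]m+o≡n k≤m))) (ℕ.+-comm k d)))) ⟩
    pf (suc n) (lowerPt k ∷ upperPt k ∷ starts n n)            ≡⟨ insert-pair n n k (residual n k n) (residual-correct n k n) ⟩
    dist n k n * pf n (starts n n)                             ≡⟨ cong₂ _*_ (trans (cong (λ z → dist z k z) n≡) (dist≡gap m k)) (sym (MF≡pf n n)) ⟩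
    correlation m k * ι (ℤ.+ MF n n)                               ∎
    where
    d = proj₁ (ℕ.m≤n⇒∃[o]m+o≡n k≤m)


  ratio≡correlation : ∀ n m k → n ≡ suc m → k ℕ.≤ m → fracℕ (MFhole n n k) (MF n n) ≡ correlation m k
  ratio≡correlation n m k n≡ h = frac-unique (MFhole n n k) (MF n n) (correlation m k) (>0⇒≢0 (MF-pos n n)) (hole-count n m k n≡ h)

  γ-suc : ∀ m′ j → lo j ℕ.≤ suc m′ → γ (suc m′) (suc j) ≡ γ (suc m′) j * q (suc m′) j
  γ-suc m′ j l with ℕ.m≤n⇒∃[o]m+o≡n l
  ... | e , e≡ = cancel (denQ m j) (>0⇒≢0 (Facts.denQ>0 m′ j l)) (begin
    denQ m j * γ m (suc j)           ≡⟨ *-comm (denQ m j) (γ m (suc j)) ⟩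
    γ m (suc j) * denQ m j           ≡⟨ γ-ratio m j e (sym e≡) ⟩
    γ m j * numQ m j                 ≡⟨ cong (γ m j *_) (sym (Facts.q-def m′ j l)) ⟩
    γ m j * (q m j * denQ m j)       ≡⟨ lem (γ m j) (q m j) (denQ m j) ⟩
    denQ m j * (γ m j * q m j)       ∎)
    where
    m = suc m′
    lem : ∀ a b c → a * (b * c) ≡ c * (a * b)
    lem = solve-∀ ℚ-ring

  gap≡γS : ∀ m′ f j → Full (suc m′) f j → gap (suc m′) j ≡ γ (suc m′) j * S (suc m′) f j
  gap≡γS m′ zero    j e = trans (trans (cong (gap (suc m′)) (trans (sym (ℕ.+-identityʳ j)) e)) (gap-end (suc m′))) (sym (*-zeroʳ (γ (suc m′) j)))
  gap≡γS m′ (suc f) j e with ℕ.m≤n⇒∃[o]m+o≡n (Full-lo {suc m′} {f} {j} e)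
  ... | r , r≡ = begin
    gap m j                                             ≡⟨ gap-step m j r (sym r≡) ⟩
    γ m j + gap m (suc j)                               ≡⟨ cong (λ z → γ m j + z) (gap≡γS m′ f (suc j) (Full-suc {m} {f} {j} e)) ⟩
    γ m j + γ m (suc j) * S m f (suc j)                 ≡⟨ cong (λ g → γ m j + g * S m f (suc j)) (γ-suc m′ j (Full-lo {m} {f} {j} e)) ⟩
    γ m j + γ m j * q m j * S m f (suc j)               ≡⟨ lem (γ m j) (q m j) (S m f (suc j)) ⟩
    γ m j * (1ℚ + q m j * S m f (suc j))                ∎
    where
    m = suc m′
    lem : ∀ g q s → g + g * q * s ≡ g * (1ℚ + q * s)
    lem = solve-∀ ℚ-ring

-- Convergence in `m` at the rate 1/m.

module Rates where

  open Rat
  open Ratio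
  open Halves
  open Sums
  open Tails
  open Moments using (h; h-pos)
  open Gamma
  open Bridge using (correlation; γ-suc; gap≡γS)
  import Data.Integer as ℤ
  import Data.Integer.Properties as ℤ
  open import Data.Nat as ℕ using (ℕ; zero; suc; s≤s; z≤n)
  import Data.Nat.Properties as ℕ
  open import Data.Product using (_,_; proj₁; proj₂; ∃)
  open import Data.Rational
  open import Data.Rational.Properties
  import Data.Rational.Unnormalised as ℚᵘ
  import Data.Rational.Unnormalised.Properties as ℚᵘ
  open import Data.Sum using (inj₁; inj₂)
  open import Relation.Binary.PropositionalEquality
  open import Tactic.RingSolver using (solve-∀)

  ν-mono : ∀ {a b} → a ℕ.≤ b → ν a ≤ ν b
  ν-mono {a} h with ℕ.m≤n⇒∃[o]m+o≡n h
  ... | o , refl = ≤-by (ν o) (0≤ν o) (sym (ν-+ a o))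

  -- The Archimedean property with an explicit witness: the denominator is at least 1, so the
  -- numerator bounds the fraction.
  below-ν : ∀ p → p ≤ ν ℤ.∣ ↥ p ∣
  below-ν p = toℚᵘ-cancel-≤ (ℚᵘ.≤-respʳ-≃ (ℚᵘ.≃-sym (ι-toℚᵘ (ℤ.+ ℤ.∣ ↥ p ∣))) (ℚᵘ.*≤* (lem p)))
    where
    lem : ∀ p → ℚᵘ.↥ (toℚᵘ p) ℤ.* ℤ.+ 1 ℤ.≤ ℤ.+ ℤ.∣ ↥ p ∣ ℤ.* ℚᵘ.↧ (toℚᵘ p)
    lem (mkℚ (ℤ.+ a) d _)    = ℤ.*-monoˡ-≤-nonNeg (ℤ.+ a) (ℤ.+≤+ (s≤s z≤n))
    lem (mkℚ ℤ.-[1+ a ] d _) = ℤ.-≤+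

  u-small : ∀ C {ε} → 0ℚ < ε → ∃ λ K → ∀ m → K ℕ.≤ m → C * u m < ε
  u-small C {ε} ε>0 = K , λ m le → *-cancelˡ-<-nonNeg (ν (suc m)) {{nonNegative (0≤ν (suc m))}}
      (subst₂ _<_ (sym (trans (l₁ (ν (suc m)) C (u m)) (trans (cong (C *_) (inv-ν m)) (*-identityʳ C)))) (*-comm ε (ν (suc m))) (big m le))
    where
    K = ℤ.∣ ↥ (C * inv ε) ∣
    l₁ : ∀ a b c → a * (b * c) ≡ b * (a * c)
    l₁ = solve-∀ ℚ-ring
    l₂ : ∀ e c i → e * (c * i) ≡ c * (e * i)
    l₂ = solve-∀ ℚ-ring
    big : ∀ m → K ℕ.≤ m → C < ε * ν (suc m)
    big m le = subst (_< ε * ν (suc m)) (trans (l₂ ε C (inv ε)) (trans (cong (C *_) (inv-ʳ (>0⇒≢0 ε>0))) (*-identityʳ C)))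
      (*-monoʳ-<-pos ε {{positive ε>0}} (≤-<-trans (below-ν (C * inv ε)) (≤-<-trans (ν-mono le)
        (subst (ν m <_) (sym (ν-suc m)) (subst (_< 1ℚ + ν m) (+-identityˡ (ν m)) (+-monoˡ-< (ν m) 0<1))))))

  -- A Cauchy condition with an explicit rate. Non-negativity and the bound are carried along
  -- because `product-gap` needs them, and with them the condition is closed under products.
  record Rate (f : ℕ → ℚ) : Set where
    field
      M₀      : ℕ
      B C     : ℚ
      nonneg  : ∀ m → M₀ ℕ.≤ m → 0ℚ ≤ f m
      bounded : ∀ m → M₀ ℕ.≤ m → f m ≤ B
      close   : ∀ m m′ → M₀ ℕ.≤ m → m ℕ.≤ m′ → ∣ f m - f m′ ∣ ≤ C * u m

  Rate-* : ∀ {f g} → Rate f → Rate g → Rate (λ m → f m * g m)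
  Rate-* {f} {g} F G = record
    { M₀ = F.M₀ ℕ.⊔ G.M₀
    ; B = F.B * G.B
    ; C = F.B * G.C + F.C * G.B
    ; nonneg = λ m h → *-nonneg (F.nonneg m (l h)) (G.nonneg m (r h))
    ; bounded = λ m h → mul-mono-≤ (F.nonneg m (l h)) (≤-trans (G.nonneg m (r h)) (G.bounded m (r h))) (F.bounded m (l h)) (G.bounded m (r h))
    ; close = λ m m′ h h′ → ≤-trans (product-gap (F.nonneg m (l h)) (G.nonneg m′ (ℕ.≤-trans (r h) h′)) (F.bounded m (l h)) (G.bounded m′ (ℕ.≤-trans (r h) h′))
        (G.close m m′ (r h) h′) (F.close m m′ (l h) h′)) (≤-reflexive (lem F.B G.C F.C G.B (u m)))
    }
    where
    module F = Rate F
    module G = Rate G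
    l : ∀ {m} → F.M₀ ℕ.⊔ G.M₀ ℕ.≤ m → F.M₀ ℕ.≤ m
    l h = ℕ.≤-trans (ℕ.m≤m⊔n F.M₀ G.M₀) h
    r : ∀ {m} → F.M₀ ℕ.⊔ G.M₀ ℕ.≤ m → G.M₀ ℕ.≤ m
    r h = ℕ.≤-trans (ℕ.m≤n⊔m F.M₀ G.M₀) h
    lem : ∀ b c c′ b′ u → b * (c * u) + (c′ * u) * b′ ≡ (b * c + c′ * b′) * u
    lem = solve-∀ ℚ-ring

  Rate-≗ : ∀ {f g} M → (∀ m → M ℕ.≤ m → g m ≡ f m) → Rate f → Rate g
  Rate-≗ {f} {g} M e F = record
    { M₀ = F.M₀ ℕ.⊔ M ; B = F.B ; C = F.C
    ; nonneg = λ m h → subst (0ℚ ≤_) (sym (e m (r h))) (F.nonneg m (l h))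
    ; bounded = λ m h → subst (_≤ F.B) (sym (e m (r h))) (F.bounded m (l h))
    ; close = λ m m′ h h′ → subst₂ (λ a b → ∣ a - b ∣ ≤ F.C * u m) (sym (e m (r h))) (sym (e m′ (ℕ.≤-trans (r h) h′))) (F.close m m′ (l h) h′) }
    where
    module F = Rate F
    l : ∀ {m} → F.M₀ ℕ.⊔ M ℕ.≤ m → F.M₀ ℕ.≤ m
    l h = ℕ.≤-trans (ℕ.m≤m⊔n F.M₀ M) h
    r : ∀ {m} → F.M₀ ℕ.⊔ M ℕ.≤ m → M ℕ.≤ m
    r h = ℕ.≤-trans (ℕ.m≤n⊔m F.M₀ M) h

  Rate-const : ∀ {c} → 0ℚ ≤ c → Rate (λ _ → c)
  Rate-const {c} h = record
    { M₀ = 0 ; B = c ; C = 0ℚ ; nonneg = λ _ _ → h ; bounded = λ _ _ → ≤-refl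
    ; close = λ m _ _ _ → ≤-reflexive (trans (cong ∣_∣ (+-inverseʳ c)) (sym (*-zeroˡ (u m)))) }

  Rate⇒Cauchy : ∀ {f} (F : Rate f) {ε} → 0ℚ < ε → ∃ λ K → ∀ m m′ → K ℕ.≤ m → K ℕ.≤ m′ → ∣ f m - f m′ ∣ < ε
  Rate⇒Cauchy {f} F {ε} ε>0 = F.M₀ ℕ.⊔ K₀ , go
    where
    module F = Rate F
    K₀ = proj₁ (u-small F.C ε>0)
    ordered : ∀ m m′ → F.M₀ ℕ.⊔ K₀ ℕ.≤ m → m ℕ.≤ m′ → ∣ f m - f m′ ∣ < ε
    ordered m m′ h h′ = ≤-<-trans (F.close m m′ (ℕ.≤-trans (ℕ.m≤m⊔n F.M₀ K₀) h) h′) (proj₂ (u-small F.C ε>0) m (ℕ.≤-trans (ℕ.m≤n⊔m F.M₀ K₀) h))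
    go : ∀ m m′ → F.M₀ ℕ.⊔ K₀ ℕ.≤ m → F.M₀ ℕ.⊔ K₀ ℕ.≤ m′ → ∣ f m - f m′ ∣ < ε
    go m m′ h h′ with ℕ.≤-total m m′
    ... | inj₁ le = ordered m m′ h le
    ... | inj₂ le = subst (_< ε) (∣a-b∣≡∣b-a∣ (f m′) (f m)) (ordered m′ m h′ le)

  lo≤ : ∀ {m} j → j ℕ.≤ m → lo j ℕ.≤ suc m
  lo≤ {m} j h = ℕ.≤-trans (ℕ.≤-trans (ℕ.m≤n+m (lo j) (hi j)) (ℕ.≤-reflexive (hi+lo j))) (ℕ.m≤n⇒m≤1+n h)

  q-Rate : ∀ j → Rate (λ m → q (suc m) j)
  q-Rate j = record
    { M₀ = j ; B = ⅜ ; C = ν 6 * sq (1ℚ + ν j)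
    ; nonneg = λ m h → Facts.q≥0 m j (lo≤ j h) ; bounded = λ m h → Facts.q≤⅜ m j (lo≤ j h)
    ; close = λ m m′ h h′ → ≤-trans (q-near m m′ j h′ (lo≤ j h))
        (mul-≤ (ν 6 * sq (1ℚ + ν j)) (*-nonneg (0≤ν 6) (sq≥0 (+-nonneg 0≤1 (0≤ν j)))) (u-anti (ℕ.n≤1+n m))) }

  fuel : ℕ → ℕ → ℕ
  fuel m j = (suc (suc m) ℕ.+ suc (suc m)) ℕ.∸ j

  fuel-Full : ∀ {m} j → j ℕ.≤ m → Full (suc m) (fuel m j) j
  fuel-Full {m} j h = ℕ.m+[n∸m]≡n (ℕ.≤-trans (ℕ.≤-trans h (ℕ.≤-trans (ℕ.n≤1+n m) (ℕ.n≤1+n (suc m)))) (ℕ.m≤m+n (suc (suc m)) (suc (suc m))))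

  S-Rate : ∀ j → Rate (λ m → S (suc m) (fuel m j) j)
  S-Rate j = record
    { M₀ = j ; B = ν 2 ; C = ν 20 * sq (ν 4 + ν j)
    ; nonneg = λ m h → S≥0 m (fuel m j) j (fuel-Full j h) ; bounded = λ m h → S≤2 m (fuel m j) j (fuel-Full j h)
    ; close = λ m m′ h h′ → ≤-trans (S-near m m′ h′ (fuel m j) (fuel m′ j) j (fuel-Full j h) (fuel-Full j (ℕ.≤-trans h h′)))
        (mul-≤ (ν 20 * sq (ν 4 + ν j)) (*-nonneg (0≤ν 20) (sq≥0 (+-nonneg (0≤ν 4) (0≤ν j)))) (u-anti (ℕ.n≤1+n m))) }

  -- One step of γ₀ loses at most the proportion 1/((m+1)(m+2)) = u m - u (m+1), which telescopes.
  module First where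

    module _ (m : ℕ) where
      X = ν m
      A = (1ℚ + X) * (ν 2 + X) * (ν 7 + ν 6 * X) * (ν 11 + ν 6 * X)
      N = (1ℚ + X) * (ν 2 + X)
      A>0 : 0ℚ < A
      A>0 = *-pos (*-pos (*-pos (p 0) (p 1)) (p′ 6)) (p′ 10)
        where
        p : ∀ a → 0ℚ < ν (suc a) + X
        p a = subst (0ℚ <_) (+-comm X (ν (suc a))) (+-pos (0≤ν m) (ν-pos a))
        p′ : ∀ a → 0ℚ < ν (suc a) + ν 6 * X
        p′ a = subst (0ℚ <_) (+-comm (ν 6 * X) (ν (suc a))) (+-pos (*-nonneg (0≤ν 6) (0≤ν m)) (ν-pos a))
      A*drop : A * (γ m 0 - γ (suc m) 0) ≡ γ m 0 * (ν 24 * N + ν 6)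
      A*drop = trans (l₁ A (γ m 0) (γ (suc m) 0)) (trans (cong (λ z → A * γ m 0 - z) (γ₀-ratio m)) (l₂ X (γ m 0)))
        where
        l₁ : ∀ a g g′ → a * (g - g′) ≡ a * g - g′ * a
        l₁ = solve-∀ ℚ-ring
        l₂ : ∀ X g → (1ℚ + X) * (ν 2 + X) * (ν 7 + ν 6 * X) * (ν 11 + ν 6 * X) * g - g * ((1ℚ + ν 2 * X) * (ν 5 + ν 2 * X) * (ν 4 + ν 3 * X) * (ν 5 + ν 3 * X))
             ≡ g * (ν 24 * ((1ℚ + X) * (ν 2 + X)) + ν 6)
        l₂ = solve-∀ ℚ-ring

      decreasing : γ (suc m) 0 ≤ γ m 0
      decreasing = ≤-by (γ m 0 - γ (suc m) 0) (cancel-≤ A A>0 (subst₂ _≤_ (sym (*-zeroʳ A)) (sym A*drop)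
          (*-nonneg (<⇒≤ (γ₀-pos m)) (+-nonneg (*-nonneg (0≤ν 24) (*-nonneg (+-nonneg 0≤1 (0≤ν m)) (+-nonneg (0≤ν 2) (0≤ν m)))) (0≤ν 6)))))
        (lem (γ (suc m) 0) (γ m 0))
        where
        lem : ∀ a b → a + (b - a) ≡ b
        lem = solve-∀ ℚ-ring

      -- After multiplication by `A` the claim is that `24 (m+1)(m+2) + 6` is at most
      -- `(6m+7)(6m+11)`.
      small-drop : γ m 0 - γ (suc m) 0 ≤ γ m 0 * (u m - u (suc m))
      small-drop = cancel-≤ A A>0 (≤-trans (≤-reflexive A*drop) (≤-by (γ m 0 * (ν 23 + ν 36 * X + ν 12 * (X * X)))
          (*-nonneg (<⇒≤ (γ₀-pos m)) (+-nonneg (+-nonneg (0≤ν 23) (*-nonneg (0≤ν 36) (0≤ν m))) (*-nonneg (0≤ν 12) (sq≥0 (0≤ν m)))))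
          (trans (l₁ X (γ m 0)) (trans (cong (λ z → γ m 0 * (ν 7 + ν 6 * X) * (ν 11 + ν 6 * X) * z) one) (l₂ X (γ m 0) (u m) (u (suc m)))))))
        where
        one : (ν 2 + X) * 1ℚ - (1ℚ + X) * 1ℚ ≡ (ν 2 + X) * ((1ℚ + X) * u m) - (1ℚ + X) * ((ν 2 + X) * u (suc m))
        one = cong₂ (λ a b → (ν 2 + X) * a - (1ℚ + X) * b) (sym (Nu≡1 m)) (sym (trans (cong (_* u (suc m)) (trans (l X) (cong (1ℚ +_) (sym (ν-suc m))))) (Nu≡1 (suc m))))
          where
          l : ∀ x → ν 2 + x ≡ 1ℚ + (1ℚ + x)
          l = solve-∀ ℚ-ring
        l₁ : ∀ X g → g * (ν 24 * ((1ℚ + X) * (ν 2 + X)) + ν 6) + g * (ν 23 + ν 36 * X + ν 12 * (X * X)) ≡ g * (ν 7 + ν 6 * X) * (ν 11 + ν 6 * X) * ((ν 2 + X) * 1ℚ - (1ℚ + X) * 1ℚ)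
        l₁ = solve-∀ ℚ-ring
        l₂ : ∀ X g a b → g * (ν 7 + ν 6 * X) * (ν 11 + ν 6 * X) * ((ν 2 + X) * ((1ℚ + X) * a) - (1ℚ + X) * ((ν 2 + X) * b)) ≡ (1ℚ + X) * (ν 2 + X) * (ν 7 + ν 6 * X) * (ν 11 + ν 6 * X) * (g * (a - b))
        l₂ = solve-∀ ℚ-ring

    antitone : ∀ m o → γ (m ℕ.+ o) 0 ≤ γ m 0
    antitone m zero    = ≤-reflexive (cong (λ k → γ k 0) (ℕ.+-identityʳ m))
    antitone m (suc o) = ≤-trans (≤-reflexive (cong (λ k → γ k 0) (ℕ.+-suc m o))) (≤-trans (decreasing (m ℕ.+ o)) (antitone m o))

    total-drop : ∀ m o → γ m 0 - γ (m ℕ.+ o) 0 ≤ γ m 0 * (u m - u (m ℕ.+ o))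
    total-drop m zero    rewrite ℕ.+-identityʳ m = ≤-reflexive (trans (+-inverseʳ (γ m 0)) (sym (trans (cong (γ m 0 *_) (+-inverseʳ (u m))) (*-zeroʳ (γ m 0)))))
    total-drop m (suc o) rewrite ℕ.+-suc m o = ≤-trans (≤-reflexive (l₁ (γ m 0) (γ (m ℕ.+ o) 0) (γ (suc (m ℕ.+ o)) 0)))
      (≤-trans (+-mono-≤ (total-drop m o) (≤-trans (small-drop (m ℕ.+ o))
         (*-monoʳ-≤-nonNeg (u (m ℕ.+ o) - u (suc (m ℕ.+ o))) {{nonNegative du≥0}} (antitone m o))))
       (≤-reflexive (l₂ (γ m 0) (u m) (u (m ℕ.+ o)) (u (suc (m ℕ.+ o))))))
      where
      du≥0 : 0ℚ ≤ u (m ℕ.+ o) - u (suc (m ℕ.+ o))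
      du≥0 = ≤-trans (≤-reflexive (sym (+-inverseʳ (u (suc (m ℕ.+ o)))))) (+-monoˡ-≤ (- u (suc (m ℕ.+ o))) (u-anti (ℕ.n≤1+n (m ℕ.+ o))))
      l₁ : ∀ a b c → a - c ≡ (a - b) + (b - c)
      l₁ = solve-∀ ℚ-ring
      l₂ : ∀ g a b c → g * (a - b) + g * (b - c) ≡ g * (a - c)
      l₂ = solve-∀ ℚ-ring

    near : ∀ m k → m ℕ.≤ k → γ m 0 - γ k 0 ≤ γ m 0 * u m
    near m k h with ℕ.m≤n⇒∃[o]m+o≡n h
    ... | o , refl = ≤-trans (total-drop m o) (≤-by (γ m 0 * u (m ℕ.+ o)) (*-nonneg (<⇒≤ (γ₀-pos m)) (u≥0 (m ℕ.+ o))) (lem (γ m 0) (u m) (u (m ℕ.+ o))))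
      where
      lem : ∀ g a b → g * (a - b) + g * b ≡ g * a
      lem = solve-∀ ℚ-ring

    antitone-≤ : ∀ {m k} → m ℕ.≤ k → γ k 0 ≤ γ m 0
    antitone-≤ {m} h with ℕ.m≤n⇒∃[o]m+o≡n h
    ... | o , refl = antitone m o

    rate : Rate (λ m → γ (suc m) 0)
    rate = record
      { M₀ = 0 ; B = γ 0 0 ; C = γ 0 0
      ; nonneg = λ m _ → <⇒≤ (γ₀-pos (suc m)) ; bounded = λ m _ → antitone-≤ z≤n
      ; close = λ m m′ _ h → ∣∣≤ (≤-trans (near (suc m) (suc m′) (s≤s h)) (mul-mono-≤ (<⇒≤ (γ₀-pos (suc m))) (u≥0 m) (antitone-≤ z≤n) (u-anti (ℕ.n≤1+n m))))
          (≤-trans (≤-by (γ (suc m) 0 - γ (suc m′) 0) (≤-trans (≤-reflexive (sym (+-inverseʳ (γ (suc m′) 0)))) (+-monoˡ-≤ (- γ (suc m′) 0) (antitone-≤ (s≤s h))))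
             (lem (γ (suc m) 0) (γ (suc m′) 0))) (*-nonneg (<⇒≤ (γ₀-pos 0)) (u≥0 m))) }
      where
      lem : ∀ a b → - (a - b) + (a - b) ≡ 0ℚ
      lem = solve-∀ ℚ-ring

  γ-Rate : ∀ j → Rate (λ m → γ (suc m) j)
  γ-Rate zero    = First.rate
  γ-Rate (suc j) = Rate-≗ j (λ m h → γ-suc m j (lo≤ j h)) (Rate-* (γ-Rate j) (q-Rate j))

  correlation-Rate : ∀ k → Rate (λ m → correlation (suc m) k)
  correlation-Rate k = Rate-≗ (k ℕ.+ k) (λ m l → cong (h (k ℕ.+ k) *_) (gap≡γS m (fuel m (k ℕ.+ k)) (k ℕ.+ k) (fuel-Full (k ℕ.+ k) l)))
    (Rate-* (Rate-const (<⇒≤ (h-pos (k ℕ.+ k)))) (Rate-* (γ-Rate (k ℕ.+ k)) (S-Rate (k ℕ.+ k))))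

-- Positivity of the limits and the quotient of consecutive correlations.

module Asymptotics where

  open Rat
  open Ratio
  open Sums
  open Tails
  open Rates
  open Moments using (h; h-pos; h-suc)
  open Gamma
  open Bridge using (correlation; γ-suc; gap≡γS)
  open import Data.Empty using (⊥-elim)
  open import Data.Nat as ℕ using (ℕ; zero; suc; s≤s; z≤n)
  import Data.Nat.Properties as ℕ
  open import Data.Product using (_×_; _,_; proj₁; proj₂)
  open import Data.Rational
  open import Data.Rational.Properties
  open import Data.Sum using (inj₁; inj₂)
  open import Relation.Binary.PropositionalEquality hiding (J)
  open import Tactic.RingSolver using (solve-∀)
  open ≡-Reasoning

  record Positive∞ (f : ℕ → ℚ) : Set where
    field
      M₀    : ℕ
      δ     : ℚ
      δ>0   : 0ℚ < δ
      above : ∀ m → M₀ ℕ.≤ m → δ ≤ f m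

  Positive∞-* : ∀ {f g} → Positive∞ f → Positive∞ g → Positive∞ (λ m → f m * g m)
  Positive∞-* {f} {g} F G = record
    { M₀ = F.M₀ ℕ.⊔ G.M₀ ; δ = F.δ * G.δ ; δ>0 = *-pos F.δ>0 G.δ>0
    ; above = λ m l → let g≥ = G.above m (ℕ.≤-trans (ℕ.m≤n⊔m F.M₀ G.M₀) l) in
        mul-mono-≤ (<⇒≤ F.δ>0) (≤-trans (<⇒≤ G.δ>0) g≥) (F.above m (ℕ.≤-trans (ℕ.m≤m⊔n F.M₀ G.M₀) l)) g≥ }
    where
    module F = Positive∞ F
    module G = Positive∞ G

  Positive∞-≗ : ∀ {f g} M → (∀ m → M ℕ.≤ m → g m ≡ f m) → Positive∞ f → Positive∞ g
  Positive∞-≗ M e F = record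
    { M₀ = F.M₀ ℕ.⊔ M ; δ = F.δ ; δ>0 = F.δ>0
    ; above = λ m l → subst (F.δ ≤_) (sym (e m (ℕ.≤-trans (ℕ.m≤n⊔m F.M₀ M) l))) (F.above m (ℕ.≤-trans (ℕ.m≤m⊔n F.M₀ M) l)) }
    where
    module F = Positive∞ F

  ⅒ : ℚ
  ⅒ = inv (ν 10)

  q-Positive∞ : ∀ j → Positive∞ (λ m → q (suc m) j)
  q-Positive∞ j = record { M₀ = K ℕ.⊔ j ; δ = ⅒ ; δ>0 = inv-pos (ν-pos 9) ; above = above }
    where
    C = ν 3 * sq (1ℚ + ν j)
    small = u-small C (inv-pos (ν-pos 9))
    K = proj₁ small
    -- The limits are at least 1/5, the value at `j = 0`. Half of this survives for the ratios
    -- themselves once `m` is large.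
    lim≥ : ⅒ + ⅒ ≤ limQ j
    lim≥ = cancel-≤ (ν 2 * (ν 5 + ν 2 * Y)) (limDen>0 j) (≤-by ((ν 2 * ⅒) * Y) (*-nonneg (*-nonneg (0≤ν 2) (<⇒≤ (inv-pos (ν-pos 9)))) (0≤ν j))
        (trans (l₁ Y ⅒) (trans (cong (λ t → t * (ν 2 + Y)) (inv-ʳ (>0⇒≢0 (ν-pos 9))))
          (trans (*-identityˡ (ν 2 + Y)) (trans (sym (limQ-def j)) (*-comm (limQ j) (ν 2 * (ν 5 + ν 2 * Y))))))))
      where
      Y = ν j
      l₁ : ∀ y t → ν 2 * (ν 5 + ν 2 * y) * (t + t) + (ν 2 * t) * y ≡ (ν 10 * t) * (ν 2 + y)
      l₁ = solve-∀ ℚ-ring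
    above : ∀ m → K ℕ.⊔ j ℕ.≤ m → ⅒ ≤ q (suc m) j
    above m l = ≤-trans (≤-by {⅒} {limQ j + - ⅒} (limQ j + - ⅒ - ⅒)
        (≤-trans (≤-reflexive (sym (+-inverseʳ (⅒ + ⅒)))) (≤-trans (+-monoˡ-≤ (- (⅒ + ⅒)) lim≥) (≤-reflexive (l₁ (limQ j) ⅒)))) (l₂ (limQ j) ⅒))
      (≤-trans (+-monoʳ-≤ (limQ j) (neg-antimono-≤ dist≤)) (≤-trans (+-monoʳ-≤ (limQ j) (neg-antimono-≤ (p≤∣p∣′ (limQ j - q (suc m) j)))) (≤-reflexive (l₃ (limQ j) (q (suc m) j)))))
      where
      p≤∣p∣′ : ∀ p → p ≤ ∣ p ∣
      p≤∣p∣′ p with ≤-total 0ℚ p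
      ... | inj₁ p≥0 = ≤-reflexive (sym (0≤p⇒∣p∣≡p p≥0))
      ... | inj₂ p≤0 = ≤-trans p≤0 (0≤∣p∣ p)
      dist≤ : ∣ limQ j - q (suc m) j ∣ ≤ ⅒
      dist≤ = ≤-trans (≤-reflexive (∣a-b∣≡∣b-a∣ (limQ j) (q (suc m) j)))
        (≤-trans (Facts.q-limit m j (lo≤ j (ℕ.≤-trans (ℕ.m≤n⊔m K j) l)))
          (<⇒≤ (proj₂ small (suc m) (ℕ.m≤n⇒m≤1+n (ℕ.≤-trans (ℕ.m≤m⊔n K j) l)))))
      l₁ : ∀ a t → a + - (t + t) ≡ a + - t - t
      l₁ = solve-∀ ℚ-ring
      l₂ : ∀ a t → t + (a + - t - t) ≡ a + - t
      l₂ = solve-∀ ℚ-ring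
      l₃ : ∀ a b → a + - (a - b) ≡ b
      l₃ = solve-∀ ℚ-ring

  γ₀-Positive∞ : Positive∞ (λ m → γ (suc m) 0)
  γ₀-Positive∞ = record
    -- From `m = 1` on at most the share `u 1 = ½` of the first term is lost. Starting from 0, the
    -- share `u 0 = 1` would leave nothing.
    { M₀ = 0 ; δ = ½ * γ 1 0 ; δ>0 = *-pos (positive⁻¹ ½) (γ₀-pos 1)
    ; above = λ m _ → ≤-by (½ * γ 1 0 - (γ 1 0 - γ (suc m) 0))
        (≤-trans (≤-reflexive (sym (+-inverseʳ (γ 1 0 - γ (suc m) 0)))) (+-monoˡ-≤ (- (γ 1 0 - γ (suc m) 0))
          (≤-trans (First.near 1 (suc m) (s≤s z≤n)) (≤-reflexive (trans (cong (γ 1 0 *_) u1) (*-comm (γ 1 0) ½))))))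
        (lem (γ 1 0) (γ (suc m) 0)) }
    where
    u1 : u 1 ≡ ½
    u1 = cancel (ν 2) (>0⇒≢0 (ν-pos 1)) (trans (inv-ν 1) refl)
    lem : ∀ g g′ → ½ * g + (½ * g - (g - g′)) ≡ g′
    lem = solve-∀ ℚ-ring

  γ-Positive∞ : ∀ j → Positive∞ (λ m → γ (suc m) j)
  γ-Positive∞ zero    = γ₀-Positive∞
  γ-Positive∞ (suc j) = Positive∞-≗ j (λ m l → γ-suc m j (lo≤ j l)) (Positive∞-* (γ-Positive∞ j) (q-Positive∞ j))

  S-Positive∞ : ∀ j → Positive∞ (λ m → S (suc m) (fuel m j) j)
  S-Positive∞ j = record { M₀ = j ; δ = 1ℚ ; δ>0 = 0<1 ; above = λ m l → go m (fuel m j) l (fuel-Full j l) }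
    where
    go : ∀ m f → j ℕ.≤ m → Full (suc m) f j → 1ℚ ≤ S (suc m) f j
    go m (suc f) l e = 1≤S m f j e
    go m zero    l e = ⊥-elim (ℕ.<⇒≱ (ℕ.≤-trans (ℕ.n<1+n m) (ℕ.n≤1+n (suc m))) (ℕ.≤-trans (ℕ.≤-trans (ℕ.m≤m+n (suc (suc m)) (suc (suc m))) (ℕ.≤-reflexive (trans (sym e) (ℕ.+-identityʳ j)))) l))

  correlation-Positive∞ : ∀ k → Positive∞ (λ m → correlation (suc m) k)
  correlation-Positive∞ k = Positive∞-≗ (k ℕ.+ k) (λ m l → cong (h (k ℕ.+ k) *_) (gap≡γS m (fuel m (k ℕ.+ k)) (k ℕ.+ k) (fuel-Full (k ℕ.+ k) l)))
    (Positive∞-* (record { M₀ = 0 ; δ = h (k ℕ.+ k) ; δ>0 = h-pos (k ℕ.+ k) ; above = λ _ _ → ≤-refl }) (Positive∞-* (γ-Positive∞ (k ℕ.+ k)) (S-Positive∞ (k ℕ.+ k))))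

  -- The limit of `h (j+2) / h j` times two consecutive ratios, that is, of the quotient of
  -- consecutive correlations with the factor from the two sums left out. For `j = 2k` it is
  -- `(4k+3) / (4k+7)`.
  lim-slope : ℕ → ℚ
  lim-slope j = (ν 3 + ν 2 * ν j) * inv (ν 7 + ν 2 * ν j)

  7+2j>0 : ∀ j → 0ℚ < ν 7 + ν 2 * ν j
  7+2j>0 j = subst (0ℚ <_) (+-comm (ν 2 * ν j) (ν 7)) (+-pos (*-nonneg (0≤ν 2) (0≤ν j)) (ν-pos 6))

  lim-slope-def : ∀ j → lim-slope j * (ν 7 + ν 2 * ν j) ≡ ν 3 + ν 2 * ν j
  lim-slope-def j = trans (lem (ν 3 + ν 2 * ν j) (inv (ν 7 + ν 2 * ν j)) (ν 7 + ν 2 * ν j)) (trans (cong ((ν 3 + ν 2 * ν j) *_) (inv-ʳ (>0⇒≢0 (7+2j>0 j)))) (*-identityʳ (ν 3 + ν 2 * ν j)))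
    where
    lem : ∀ a b c → a * b * c ≡ a * (c * b)
    lem = solve-∀ ℚ-ring

  limQ-bounds : ∀ j → 0ℚ ≤ limQ j × limQ j ≤ 1ℚ
  limQ-bounds j = *-nonneg (+-nonneg (0≤ν 2) (0≤ν j)) (<⇒≤ (inv-pos (limDen>0 j))) ,
    cancel-≤ (ν 2 * (ν 5 + ν 2 * ν j)) (limDen>0 j) (≤-trans (≤-reflexive (trans (*-comm (ν 2 * (ν 5 + ν 2 * ν j)) (limQ j)) (limQ-def j)))
      (≤-by (ν 8 + ν 3 * ν j) (+-nonneg (0≤ν 8) (*-nonneg (0≤ν 3) (0≤ν j))) (lem (ν j))))
    where
    lem : ∀ y → ν 2 + y + (ν 8 + ν 3 * y) ≡ ν 2 * (ν 5 + ν 2 * y) * 1ℚ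
    lem = solve-∀ ℚ-ring

  ⅜≤1 : ⅜ ≤ 1ℚ
  ⅜≤1 = ≤-by (½ + ⅛) (+-nonneg 0≤½ (nonNegative⁻¹ ⅛)) refl

  -- The moments contribute the factor h (j+2) / h j, which tends to 16.
  module Quotient (m′ j f : ℕ) (full : Full (suc m′) (suc (suc f)) j) (j≥ : suc (suc j) ℕ.≤ m′) (F : ℚ)
    (γj>0 : 0ℚ < γ (suc m′) j)
    (F-def : F * (h j * gap (suc m′) j) ≡ h (suc (suc j)) * gap (suc m′) (suc (suc j))) where

    private
      m = suc m′
      Y = ν j
      U = u m
      σ = S m (suc (suc f)) j
      σ″ = S m f (suc (suc j))
      q₀ = q m j
      q₁ = q m (suc j)
      Q₀ = limQ j
      Q₁ = limQ (suc j)
      c = lim-slope j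
      T = (ν 2 + Y) * (ν 3 + Y)
      W = (ν 6 + ν 4 * Y) * (ν 10 + ν 4 * Y)
      lo₀ = lo≤ j (ℕ.≤-trans (ℕ.n≤1+n j) (ℕ.≤-trans (ℕ.n≤1+n (suc j)) j≥))
      lo₁ = lo≤ (suc j) (ℕ.≤-trans (ℕ.n≤1+n (suc j)) j≥)
      full₂ : Full m f (suc (suc j))
      full₂ = Full-suc {m} {f} {suc j} (Full-suc {m} {suc f} {j} full)
      2+Y>0 : 0ℚ < ν 2 + Y
      2+Y>0 = subst (0ℚ <_) (+-comm Y (ν 2)) (+-pos (0≤ν j) (ν-pos 1))
      3+Y>0 : 0ℚ < ν 3 + Y
      3+Y>0 = subst (0ℚ <_) (+-comm Y (ν 3)) (+-pos (0≤ν j) (ν-pos 2))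
      T>0 : 0ℚ < T
      T>0 = *-pos 2+Y>0 3+Y>0
      W≥0 : 0ℚ ≤ W
      W≥0 = *-nonneg (+-nonneg (0≤ν 6) (*-nonneg (0≤ν 4) (0≤ν j))) (+-nonneg (0≤ν 10) (*-nonneg (0≤ν 4) (0≤ν j)))
      σ≥1 : 1ℚ ≤ σ
      σ≥1 = 1≤S m′ (suc f) j full
      W≤ : W ≤ ν 16 * T
      W≤ = ≤-by (ν 16 * Y + ν 36) (+-nonneg (*-nonneg (0≤ν 16) (0≤ν j)) (0≤ν 36)) (lem Y)
        where
        lem : ∀ y → (ν 6 + ν 4 * y) * (ν 10 + ν 4 * y) + (ν 16 * y + ν 36) ≡ ν 16 * ((ν 2 + y) * (ν 3 + y))
        lem = solve-∀ ℚ-ring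

      hh : T * h (suc (suc j)) ≡ W * h j
      hh = begin
        T * h (suc (suc j))                              ≡⟨ l₁ (ν 2 + Y) (ν 3 + Y) (h (suc (suc j))) ⟩
        (ν 2 + Y) * ((ν 3 + Y) * h (suc (suc j)))        ≡⟨ cong ((ν 2 + Y) *_) s₁ ⟩
        (ν 2 + Y) * ((ν 10 + ν 4 * Y) * h (suc j))       ≡⟨ l₂ (ν 2 + Y) (ν 10 + ν 4 * Y) (h (suc j)) ⟩
        (ν 10 + ν 4 * Y) * ((ν 2 + Y) * h (suc j))       ≡⟨ cong ((ν 10 + ν 4 * Y) *_) (h-suc j) ⟩
        (ν 10 + ν 4 * Y) * ((ν 6 + ν 4 * Y) * h j)       ≡⟨ l₃ (ν 10 + ν 4 * Y) (ν 6 + ν 4 * Y) (h j) ⟩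
        W * h j                                          ∎
        where
        l₁ : ∀ a b c → a * b * c ≡ a * (b * c)
        l₁ = solve-∀ ℚ-ring
        l₂ : ∀ a b c → a * (b * c) ≡ b * (a * c)
        l₂ = solve-∀ ℚ-ring
        l₃ : ∀ a b c → a * (b * c) ≡ b * a * c
        l₃ = solve-∀ ℚ-ring
        e₁ : ∀ y → ν 3 + y ≡ ν 2 + (1ℚ + y)
        e₁ = solve-∀ ℚ-ring
        e₂ : ∀ y → ν 6 + ν 4 * (1ℚ + y) ≡ ν 10 + ν 4 * y
        e₂ = solve-∀ ℚ-ring
        s₁ : (ν 3 + Y) * h (suc (suc j)) ≡ (ν 10 + ν 4 * Y) * h (suc j)
        s₁ = trans (cong (_* h (suc (suc j))) (trans (e₁ Y) (cong (ν 2 +_) (sym (ν-suc j))))) (trans (h-suc (suc j))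
          (cong (_* h (suc j)) (trans (cong (λ z → ν 6 + ν 4 * z) (ν-suc j)) (e₂ Y))))

      γ₂ : γ m (suc (suc j)) ≡ γ m j * q₀ * q₁
      γ₂ = trans (γ-suc m′ (suc j) lo₁) (cong (_* q₁) (γ-suc m′ j lo₀))

      F-main : T * (F * σ) ≡ W * (q₀ * q₁ * σ″)
      F-main = cancel (h j * γ m j) (>0⇒≢0 (*-pos (h-pos j) γj>0)) (begin
        h j * γ m j * (T * (F * σ))                 ≡⟨ l₁ (h j) (γ m j) T F σ ⟩
        T * (F * (h j * (γ m j * σ)))               ≡⟨ cong (λ z → T * (F * (h j * z))) (sym (gap≡γS m′ (suc (suc f)) j full)) ⟩
        T * (F * (h j * gap m j))                   ≡⟨ cong (T *_) F-def ⟩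
        T * (h (suc (suc j)) * gap m (suc (suc j))) ≡⟨ sym (*-assoc T (h (suc (suc j))) (gap m (suc (suc j)))) ⟩
        T * h (suc (suc j)) * gap m (suc (suc j))   ≡⟨ cong₂ _*_ hh (trans (gap≡γS m′ f (suc (suc j)) full₂) (cong (_* σ″) γ₂)) ⟩
        W * h j * (γ m j * q₀ * q₁ * σ″)            ≡⟨ l₂ W (h j) (γ m j) q₀ q₁ σ″ ⟩
        h j * γ m j * (W * (q₀ * q₁ * σ″))          ∎)
        where
        l₁ : ∀ h g T F s → h * g * (T * (F * s)) ≡ T * (F * (h * (g * s)))
        l₁ = solve-∀ ℚ-ring
        l₂ : ∀ W h g a b s → W * h * (g * a * b * s) ≡ h * g * (W * (a * b * s))
        l₂ = solve-∀ ℚ-ring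

      Q₁-def : Q₁ * (ν 2 * (ν 7 + ν 2 * Y)) ≡ ν 3 + Y
      Q₁-def = trans (cong (λ z → Q₁ * (ν 2 * z)) (trans (l₁ Y) (cong (λ z → ν 5 + ν 2 * z) (sym (ν-suc j))))) (trans (limQ-def (suc j)) (trans (cong (ν 2 +_) (ν-suc j)) (l₂ Y)))
        where
        l₁ : ∀ y → ν 7 + ν 2 * y ≡ ν 5 + ν 2 * (1ℚ + y)
        l₁ = solve-∀ ℚ-ring
        l₂ : ∀ y → ν 2 + (1ℚ + y) ≡ ν 3 + y
        l₂ = solve-∀ ℚ-ring

      limit-product : W * (Q₀ * Q₁) ≡ c * T
      limit-product = cancel (ν 2 * (ν 5 + ν 2 * Y) * (ν 2 * (ν 7 + ν 2 * Y))) (≢0-* (>0⇒≢0 (limDen>0 j)) (≢0-* (>0⇒≢0 (ν-pos 1)) (>0⇒≢0 (7+2j>0 j)))) (begin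
        ν 2 * (ν 5 + ν 2 * Y) * (ν 2 * (ν 7 + ν 2 * Y)) * (W * (Q₀ * Q₁))
          ≡⟨ l₁ (ν 2 * (ν 5 + ν 2 * Y)) (ν 2 * (ν 7 + ν 2 * Y)) W Q₀ Q₁ ⟩
        W * ((Q₀ * (ν 2 * (ν 5 + ν 2 * Y))) * (Q₁ * (ν 2 * (ν 7 + ν 2 * Y))))
          ≡⟨ cong₂ (λ a b → W * (a * b)) (limQ-def j) Q₁-def ⟩
        W * T
          ≡⟨ l₂ Y T ⟩
        ν 2 * (ν 5 + ν 2 * Y) * ν 2 * T * (ν 3 + ν 2 * Y)
          ≡⟨ cong (ν 2 * (ν 5 + ν 2 * Y) * ν 2 * T *_) (sym (lim-slope-def j)) ⟩
        ν 2 * (ν 5 + ν 2 * Y) * ν 2 * T * (c * (ν 7 + ν 2 * Y))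
          ≡⟨ l₃ (ν 2 * (ν 5 + ν 2 * Y)) T c (ν 7 + ν 2 * Y) ⟩
        ν 2 * (ν 5 + ν 2 * Y) * (ν 2 * (ν 7 + ν 2 * Y)) * (c * T) ∎)
        where
        l₁ : ∀ a b W p q → a * b * (W * (p * q)) ≡ W * ((p * a) * (q * b))
        l₁ = solve-∀ ℚ-ring
        l₂ : ∀ y T → (ν 6 + ν 4 * y) * (ν 10 + ν 4 * y) * T ≡ ν 2 * (ν 5 + ν 2 * y) * ν 2 * T * (ν 3 + ν 2 * y)
        l₂ = solve-∀ ℚ-ring
        l₃ : ∀ a T c b → a * ν 2 * T * (c * b) ≡ a * (ν 2 * b) * (c * T)
        l₃ = solve-∀ ℚ-ring

      E : ℚ
      E = ν 4 * sq (u j) + ν 32 * sq (ν 6 + Y) * U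

      q-error : ∣ Q₀ * Q₁ - q₀ * q₁ ∣ ≤ ν 6 * sq (ν 6 + Y) * U
      q-error = ≤-trans (≤-reflexive (∣a-b∣≡∣b-a∣ (Q₀ * Q₁) (q₀ * q₁)))
        (≤-trans (product-gap {q₀} {q₁} {Q₀} {Q₁} (Facts.q≥0 m′ j lo₀) (proj₁ (limQ-bounds (suc j))) (≤-trans (Facts.q≤⅜ m′ j lo₀) ⅜≤1) (proj₂ (limQ-bounds (suc j)))
            (Facts.q-limit m′ (suc j) lo₁) (Facts.q-limit m′ j lo₀))
          (≤-by (U * (ν 54 * Y + ν 201)) (*-nonneg (u≥0 m) (+-nonneg (*-nonneg (0≤ν 54) (0≤ν j)) (0≤ν 201)))
            (trans (cong (λ z → 1ℚ * (ν 3 * ((1ℚ + z) * (1ℚ + z)) * U) + ν 3 * ((1ℚ + Y) * (1ℚ + Y)) * U * 1ℚ + U * (ν 54 * Y + ν 201)) (ν-suc j)) (lem Y U))))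
        where
        lem : ∀ y U → 1ℚ * (ν 3 * ((1ℚ + (1ℚ + y)) * (1ℚ + (1ℚ + y))) * U) + ν 3 * ((1ℚ + y) * (1ℚ + y)) * U * 1ℚ + U * (ν 54 * y + ν 201) ≡ ν 6 * ((ν 6 + y) * (ν 6 + y)) * U
        lem = solve-∀ ℚ-ring

      total-error : ∣ Q₀ * Q₁ * σ - q₀ * q₁ * σ″ ∣ ≤ E
      total-error = ≤-trans (product-gap {Q₀ * Q₁} {σ} {q₀ * q₁} {σ″} (*-nonneg (proj₁ (limQ-bounds j)) (proj₁ (limQ-bounds (suc j)))) (S≥0 m′ f (suc (suc j)) full₂)
          (mul-mono-≤ (proj₁ (limQ-bounds j)) 0≤1 (proj₂ (limQ-bounds j)) (proj₂ (limQ-bounds (suc j)))) (S≤2 m′ f (suc (suc j)) full₂)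
          (≤-trans (≤-reflexive (∣a-b∣≡∣b-a∣ σ σ″)) (S-drift m′ f j full)) q-error)
        (≤-reflexive (lem (sq (u j)) (sq (ν 6 + Y)) U))
        where
        lem : ∀ s y U → 1ℚ * 1ℚ * (ν 4 * s + ν 20 * y * U) + ν 6 * y * U * ν 2 ≡ ν 4 * s + ν 32 * y * U
        lem = solve-∀ ℚ-ring

      ∣W*∣ : ∀ x → ∣ W * x ∣ ≡ W * ∣ x ∣
      ∣W*∣ x = trans (∣p*q∣≡∣p∣*∣q∣ W x) (cong (_* ∣ x ∣) (0≤p⇒∣p∣≡p W≥0))

    quotient-near : ∣ F - lim-slope j ∣ ≤ ν 16 * (ν 4 * sq (u j) + ν 32 * sq (ν 6 + ν j) * u (suc m′))
    quotient-near = cancel-≤ T T>0 (≤-trans step₁ (≤-trans (≤-reflexive step₂) (≤-trans (mul-≤ W W≥0 total-error)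
        (≤-trans (*-monoʳ-≤-nonNeg E {{nonNegative E≥0}} W≤) (≤-reflexive (l₃ T E))))))
      where
      E≥0 : 0ℚ ≤ E
      E≥0 = ≤-trans (0≤∣p∣ (Q₀ * Q₁ * σ - q₀ * q₁ * σ″)) total-error
      step₁ : T * ∣ F - c ∣ ≤ T * (σ * ∣ F - c ∣)
      step₁ = mul-≤ T (<⇒≤ T>0) (≤-trans (≤-reflexive (sym (*-identityˡ ∣ F - c ∣))) (*-monoʳ-≤-nonNeg ∣ F - c ∣ {{∣-∣-nonNeg (F - c)}} σ≥1))
      step₂ : T * (σ * ∣ F - c ∣) ≡ W * ∣ Q₀ * Q₁ * σ - q₀ * q₁ * σ″ ∣
      step₂ = begin
        T * (σ * ∣ F - c ∣)                         ≡⟨ sym (*-assoc T σ ∣ F - c ∣) ⟩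
        T * σ * ∣ F - c ∣                           ≡⟨ cong (_* ∣ F - c ∣) (sym (0≤p⇒∣p∣≡p (*-nonneg (<⇒≤ T>0) (≤-trans 0≤1 σ≥1)))) ⟩
        ∣ T * σ ∣ * ∣ F - c ∣                       ≡⟨ sym (∣p*q∣≡∣p∣*∣q∣ (T * σ) (F - c)) ⟩
        ∣ T * σ * (F - c) ∣                         ≡⟨ cong ∣_∣ (l₁ T σ F c) ⟩
        ∣ T * (F * σ) - c * T * σ ∣                 ≡⟨ cong₂ (λ a b → ∣ a - b * σ ∣) F-main (sym limit-product) ⟩
        ∣ W * (q₀ * q₁ * σ″) - W * (Q₀ * Q₁) * σ ∣  ≡⟨ ∣a-b∣≡∣b-a∣ (W * (q₀ * q₁ * σ″)) (W * (Q₀ * Q₁) * σ) ⟩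
        ∣ W * (Q₀ * Q₁) * σ - W * (q₀ * q₁ * σ″) ∣  ≡⟨ cong ∣_∣ (l₂ W (Q₀ * Q₁) σ (q₀ * q₁ * σ″)) ⟩
        ∣ W * (Q₀ * Q₁ * σ - q₀ * q₁ * σ″) ∣        ≡⟨ ∣W*∣ (Q₀ * Q₁ * σ - q₀ * q₁ * σ″) ⟩
        W * ∣ Q₀ * Q₁ * σ - q₀ * q₁ * σ″ ∣          ∎
        where
        l₁ : ∀ T s F c → T * s * (F - c) ≡ T * (F * s) - c * T * s
        l₁ = solve-∀ ℚ-ring
        l₂ : ∀ W p s r → W * p * s - W * r ≡ W * (p * s - r)
        l₂ = solve-∀ ℚ-ring
      l₃ : ∀ T E → ν 16 * T * E ≡ T * (ν 16 * E)
      l₃ = solve-∀ ℚ-ring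

  record Eventually (P : ℕ → Set) : Set where
    constructor from
    field
      start : ℕ
      holds : ∀ m → start ℕ.≤ m → P m

  -- With `c = (4k+3) / (4k+7)` the main term `k (1 - c) - 1` is `-7 / (4k+7)`. The constant is
  -- `16 · 4 + 16 · 32 + 7`: the two errors of `quotient-near`, which after multiplication by `k`
  -- are still of order 1/k, and the main term.
  slope-estimate : ∀ k → Eventually λ m → 0ℚ < correlation (suc m) k × (∀ F → F * correlation (suc m) k ≡ correlation (suc m) (suc k) →
                   ∣ (F - 1ℚ) * (- ν k) - 1ℚ ∣ ≤ ν 583 * u k)
  slope-estimate k = from (G.M₀ ℕ.⊔ (C.M₀ ℕ.⊔ (suc (suc j) ℕ.⊔ K))) λ m l →
      let l₁ = ℕ.≤-trans (ℕ.m≤m⊔n G.M₀ (C.M₀ ℕ.⊔ (suc (suc j) ℕ.⊔ K))) l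
          l′ = ℕ.≤-trans (ℕ.m≤n⊔m G.M₀ (C.M₀ ℕ.⊔ (suc (suc j) ℕ.⊔ K))) l
          l₂ = ℕ.≤-trans (ℕ.m≤m⊔n C.M₀ (suc (suc j) ℕ.⊔ K)) l′
          l″ = ℕ.≤-trans (ℕ.m≤n⊔m C.M₀ (suc (suc j) ℕ.⊔ K)) l′
      in <-≤-trans C.δ>0 (C.above m l₂) ,
         estimate m (<-≤-trans G.δ>0 (G.above m l₁)) (ℕ.≤-trans (ℕ.m≤m⊔n (suc (suc j)) K) l″) (ℕ.≤-trans (ℕ.m≤n⊔m (suc (suc j)) K) l″)
    where
    j = k ℕ.+ k
    X = ν k
    J = ν j
    module G = Positive∞ (γ-Positive∞ j)
    module C = Positive∞ (correlation-Positive∞ k)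
    -- The error that vanishes in `m` has a coefficient growing with `k`. Once `P u m < 1`, it is at
    -- most `u k` even after multiplication by `k`; the threshold for `m` therefore depends on `k`.
    P = sq (ν 6 + J) * sq (1ℚ + X)
    K = proj₁ (u-small P 0<1)
    J≡ : J ≡ X + X
    J≡ = ν-+ k k
    1+X>0 : 0ℚ < 1ℚ + X
    1+X>0 = subst (0ℚ <_) (+-comm X 1ℚ) (+-pos (0≤ν k) 0<1)
    c = lim-slope j
    ku≤1 : X * u k ≤ 1ℚ
    ku≤1 = ≤-by (u k) (u≥0 k) (trans (lem X (u k)) (Nu≡1 k))
      where
      lem : ∀ x u → x * u + u ≡ (1ℚ + x) * u
      lem = solve-∀ ℚ-ring
    main-term : ∣ X * (1ℚ - c) - 1ℚ ∣ ≤ ν 7 * u k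
    main-term = ∣∣≤ (cancel-≤ w (7+2j>0 j) (≤-trans (≤-reflexive wd) (≤-trans (neg-antimono-≤ (0≤ν 7)) (*-nonneg (<⇒≤ (7+2j>0 j)) (*-nonneg (0≤ν 7) (u≥0 k))))))
                    (cancel-≤ w (7+2j>0 j) (≤-trans (≤-reflexive (trans (l₂ w (X * (1ℚ - c) - 1ℚ)) (trans (cong -_ wd) refl))) bound))
      where
      w = ν 7 + ν 2 * J
      wd : w * (X * (1ℚ - c) - 1ℚ) ≡ - ν 7
      wd = trans (l₁ w X c) (trans (cong (λ z → X * w - X * z - w) (lim-slope-def j)) (trans (cong (λ J → X * (ν 7 + ν 2 * J) - X * (ν 3 + ν 2 * J) - (ν 7 + ν 2 * J)) J≡) (l₃ X)))
        where
        l₁ : ∀ w x c → w * (x * (1ℚ - c) - 1ℚ) ≡ x * w - x * (c * w) - w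
        l₁ = solve-∀ ℚ-ring
        l₃ : ∀ x → x * (ν 7 + ν 2 * (x + x)) - x * (ν 3 + ν 2 * (x + x)) - (ν 7 + ν 2 * (x + x)) ≡ - ν 7
        l₃ = solve-∀ ℚ-ring
      l₂ : ∀ w d → w * - d ≡ - (w * d)
      l₂ = solve-∀ ℚ-ring
      bound : ν 7 ≤ w * (ν 7 * u k)
      bound = ≤-by (ν 7 * ((ν 6 + ν 3 * X) * u k)) (*-nonneg (0≤ν 7) (*-nonneg (+-nonneg (0≤ν 6) (*-nonneg (0≤ν 3) (0≤ν k))) (u≥0 k)))
        (trans (cong (λ z → ν 7 * z + ν 7 * ((ν 6 + ν 3 * X) * u k)) (sym (Nu≡1 k))) (trans (l₄ X (u k)) (cong (λ J → (ν 7 + ν 2 * J) * (ν 7 * u k)) (sym J≡))))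
        where
        l₄ : ∀ x u → ν 7 * ((1ℚ + x) * u) + ν 7 * ((ν 6 + ν 3 * x) * u) ≡ (ν 7 + ν 2 * (x + x)) * (ν 7 * u)
        l₄ = solve-∀ ℚ-ring
    estimate : ∀ m → 0ℚ < γ (suc m) j → suc (suc j) ℕ.≤ m → K ℕ.≤ m → ∀ F → F * correlation (suc m) k ≡ correlation (suc m) (suc k) →
               ∣ (F - 1ℚ) * (- X) - 1ℚ ∣ ≤ ν 583 * u k
    estimate m γ>0 j≤m K≤m F F-def = ≤-trans (≤-reflexive (cong ∣_∣ (l₁ F X c))) (≤-trans (∣p+q∣≤∣p∣+∣q∣ (X * (c - F)) (X * (1ℚ - c) - 1ℚ))
        (≤-trans (+-mono-≤ (≤-trans (≤-reflexive (trans (∣p*q∣≡∣p∣*∣q∣ X (c - F)) (cong₂ _*_ (0≤p⇒∣p∣≡p (0≤ν k)) (∣a-b∣≡∣b-a∣ c F)))) (≤-trans (mul-≤ X (0≤ν k) near) error-small)) main-term)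
          (≤-reflexive (l₂ (u k)))))
      where
      f = fuel m (suc (suc j))
      full : Full (suc m) (suc (suc f)) j
      full = trans (trans (ℕ.+-suc j (suc f)) (cong suc (ℕ.+-suc j f))) (fuel-Full (suc (suc j)) j≤m)
      U = u (suc m)
      j+2 : suc k ℕ.+ suc k ≡ suc (suc j)
      j+2 = cong suc (ℕ.+-suc k k)
      near : ∣ F - c ∣ ≤ ν 16 * (ν 4 * sq (u j) + ν 32 * sq (ν 6 + J) * U)
      near = Quotient.quotient-near m j f full j≤m F γ>0 (trans F-def (cong (λ i → h i * gap (suc m) i) j+2))
      e₁ : X * sq (u j) ≤ u k
      e₁ = ≤-trans (mul-≤ X (0≤ν k) (mul-mono-≤ (u≥0 j) (u≥0 k) (u-anti (ℕ.m≤m+n k k)) (u-anti (ℕ.m≤m+n k k))))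
        (≤-trans (≤-reflexive (sym (*-assoc X (u k) (u k)))) (≤-trans (*-monoʳ-≤-nonNeg (u k) {{nonNegative (u≥0 k)}} ku≤1) (≤-reflexive (*-identityˡ (u k)))))
      e₂ : X * (sq (ν 6 + J) * U) ≤ u k
      e₂ = cancel-≤ (1ℚ + X) 1+X>0 (≤-trans (≤-by ((1ℚ + X) * (sq (ν 6 + J) * U)) (*-nonneg (<⇒≤ 1+X>0) (*-nonneg (sq≥0 (+-nonneg (0≤ν 6) (0≤ν j))) (u≥0 (suc m)))) (l₃ X (sq (ν 6 + J)) U))
        (≤-trans (<⇒≤ (proj₂ (u-small P 0<1) (suc m) (ℕ.m≤n⇒m≤1+n K≤m))) (≤-reflexive (sym (Nu≡1 k)))))
        where
        l₃ : ∀ x s U → (1ℚ + x) * (x * (s * U)) + (1ℚ + x) * (s * U) ≡ s * ((1ℚ + x) * (1ℚ + x)) * U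
        l₃ = solve-∀ ℚ-ring
      error-small : X * (ν 16 * (ν 4 * sq (u j) + ν 32 * sq (ν 6 + J) * U)) ≤ ν 64 * u k + ν 512 * u k
      error-small = ≤-trans (≤-reflexive (l₄ X (sq (u j)) (sq (ν 6 + J)) U)) (+-mono-≤ (mul-≤ (ν 64) (0≤ν 64) e₁) (mul-≤ (ν 512) (0≤ν 512) e₂))
        where
        l₄ : ∀ x a s U → x * (ν 16 * (ν 4 * a + ν 32 * s * U)) ≡ ν 64 * (x * a) + ν 512 * (x * (s * U))
        l₄ = solve-∀ ℚ-ring
      l₁ : ∀ F x c → (F - 1ℚ) * (- x) - 1ℚ ≡ x * (c - F) + (x * (1ℚ - c) - 1ℚ)
      l₁ = solve-∀ ℚ-ring
      l₂ : ∀ u → ν 64 * u + ν 512 * u + ν 7 * u ≡ ν 583 * u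
      l₂ = solve-∀ ℚ-ring

-- Return to the tiling counts.

module Main where

  open import Defs
  open Rat
  open Bridge
  open Rates
  open Asymptotics
  open import Data.Nat as ℕ using (ℕ; suc; s≤s)
  import Data.Nat.Properties as ℕ
  open import Data.Product using (_×_; _,_; proj₁; proj₂; ∃)
  open import Data.Rational
  open import Data.Rational.Properties
  open import Relation.Binary.PropositionalEquality
  open import Tactic.RingSolver using (solve-∀)

  -- The estimates concern `correlation (suc m)`, hence `n = m + 2`; every threshold is raised by
  -- two accordingly.
  shifted : ∀ {K n} → suc (suc K) ℕ.≤ n → ∃ λ m → n ≡ suc (suc m) × K ℕ.≤ m
  shifted {K} {suc (suc m)} (s≤s (s≤s l)) = m , refl , l

  -- f stands for a ratio of tiling counts; it is abstract because Agda would enumerate the tilings otherwise.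
  module _ (k : ℕ) {f g : ℕ → ℚ} (f≡g : ∀ n m → n ≡ suc m → k ℕ.≤ m → f n ≡ g m) where

    reindex-Cauchy : Rate (λ m → g (suc m)) → CauchyQ f
    reindex-Cauchy R ε ε>0 = suc (suc (K ℕ.⊔ k)) , λ n n′ l l′ →
      let m  , e  , h  = shifted l
          m′ , e′ , h′ = shifted l′
      in subst₂ (λ a b → ∣ a - b ∣ < ε)
           (sym (f≡g n (suc m) e (ℕ.m≤n⇒m≤1+n (ℕ.≤-trans (ℕ.m≤n⊔m K k) h))))
           (sym (f≡g n′ (suc m′) e′ (ℕ.m≤n⇒m≤1+n (ℕ.≤-trans (ℕ.m≤n⊔m K k) h′))))
           (close m m′ (ℕ.≤-trans (ℕ.m≤m⊔n K k) h) (ℕ.≤-trans (ℕ.m≤m⊔n K k) h′))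
      where
      K = proj₁ (Rate⇒Cauchy R ε>0)
      close = proj₂ (Rate⇒Cauchy R ε>0)

    reindex-positive : Positive∞ (λ m → g (suc m)) → EventuallyPositive f
    reindex-positive P = ½ * δ , *-pos ½>0 δ>0 , suc (suc (M₀ ℕ.⊔ k)) , λ n l →
      let m , e , h = shifted l
      in subst (½ * δ <_) (sym (f≡g n (suc m) e (ℕ.m≤n⇒m≤1+n (ℕ.≤-trans (ℕ.m≤n⊔m M₀ k) h))))
           (<-≤-trans half (above m (ℕ.≤-trans (ℕ.m≤m⊔n M₀ k) h)))
      where
      open Positive∞ P
      ½>0 : 0ℚ < ½
      ½>0 = positive⁻¹ ½
      half : ½ * δ < δ
      half = subst (½ * δ <_) (lem δ) (subst (_< ½ * δ + ½ * δ) (+-identityʳ (½ * δ)) (+-monoʳ-< (½ * δ) (*-pos ½>0 δ>0)))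
        where
        lem : ∀ d → ½ * d + ½ * d ≡ d
        lem = solve-∀ ℚ-ring

  frac-of-multiples : ∀ a b t {c d} → 0ℚ < ν t → 0ℚ < d → ν a ≡ c * ν t → ν b ≡ d * ν t → fracℕ a b * d ≡ c
  frac-of-multiples a b t {c} {d} t>0 d>0 a≡ b≡ = trans (cong (_* d) (frac-unique a b (c * inv d) b≢0
      (trans a≡ (trans (lem₁ (d * inv d) (inv-ʳ (>0⇒≢0 d>0))) (trans (lem₂ c d (inv d) (ν t)) (cong (λ z → c * inv d * z) (sym b≡)))))))
    (trans (lem₃ c d (inv d)) (trans (cong (c *_) (inv-ʳ (>0⇒≢0 d>0))) (*-identityʳ c)))
    where
    b≢0 : ν b ≢ 0ℚ
    b≢0 = >0⇒≢0 (subst (0ℚ <_) (sym b≡) (*-pos d>0 t>0))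
    lem₁ : ∀ x → x ≡ 1ℚ → c * ν t ≡ c * x * ν t
    lem₁ x e = cong (_* ν t) (sym (trans (cong (c *_) e) (*-identityʳ c)))
    lem₂ : ∀ c d i t → c * (d * i) * t ≡ c * i * (d * t)
    lem₂ = solve-∀ ℚ-ring
    lem₃ : ∀ c d i → c * i * d ≡ c * (d * i)
    lem₃ = solve-∀ ℚ-ring

  ω-Cauchy : ∀ k → CauchyQ (λ n → fracℕ (MFhole n n k) (MF n n))
  ω-Cauchy k = reindex-Cauchy k {λ n → fracℕ (MFhole n n k) (MF n n)} {λ m → correlation m k} (λ n m → ratio≡correlation n m k) (correlation-Rate k)

  ω-positive : ∀ k → EventuallyPositive (λ n → fracℕ (MFhole n n k) (MF n n))
  ω-positive k = reindex-positive k {λ n → fracℕ (MFhole n n k) (MF n n)} {λ m → correlation m k} (λ n m → ratio≡correlation n m k) (correlation-Positive∞ k)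

  -- The count without hole cancels. Positivity of the correlation guarantees that the count in the
  -- denominator is not zero.
  consecutive-holes : ∀ n m k → n ≡ suc m → suc k ℕ.≤ m → 0ℚ < correlation m k →
                      fracℕ (MFhole n n (suc k)) (MFhole n n k) * correlation m k ≡ correlation m (suc k)
  consecutive-holes n m k n≡ k<m c>0 = frac-of-multiples (MFhole n n (suc k)) (MFhole n n k) (MF n n) {correlation m (suc k)} {correlation m k}
    (MF-pos n n) c>0 (hole-count n m (suc k) n≡ k<m) (hole-count n m k n≡ (ℕ.<⇒≤ k<m))

  slope-limit : ∀ {ε} → 0ℚ < ε → ∃ λ K → ∀ k → K ℕ.≤ k → ∃ λ N → ∀ n → N ℕ.≤ n →
                ∣ (fracℕ (MFhole n n (suc k)) (MFhole n n k) - 1ℚ) * (- ν k) - 1ℚ ∣ ≤ ε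
  slope-limit {ε} ε>0 = proj₁ (u-small (ν 583) ε>0) , λ k K≤k →
    let start = Eventually.start (slope-estimate k)
    in suc (suc (start ℕ.⊔ k)) , λ n l →
      let m , e , h = shifted l
          c>0 , bound = Eventually.holds (slope-estimate k) m (ℕ.≤-trans (ℕ.m≤m⊔n start k) h)
      in ≤-trans (bound (fracℕ (MFhole n n (suc k)) (MFhole n n k))
                        (consecutive-holes n (suc m) k e (s≤s (ℕ.≤-trans (ℕ.m≤n⊔m start k) h)) c>0))
                 (<⇒≤ (proj₂ (u-small (ν 583) ε>0) k K≤k))

open import Defs
open import Data.Nat as ℕ using (ℕ; suc; _≤_)
open import Data.Integer as ℤ using (+_)
open import Data.Rational as ℚ using (ℚ; 0ℚ; 1ℚ)
open import Data.Product using (_×_; ∃; _,_)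

-- The limits ω are not formed as real numbers. By the first two parts they exist and are positive,
-- so `ω(k+1) / ω(k)` is the limit in `n` of the quotient of the two counts with holes, and the weak
-- inequality of the third part passes to that limit.
theorem2 : ((k : ℕ) → CauchyQ (λ n → fracℕ (MFhole n n k) (MF n n)))
    × ((k : ℕ) → EventuallyPositive (λ n → fracℕ (MFhole n n k) (MF n n)))
    × ((ε : ℚ) → 0ℚ ℚ.< ε →
    ∃ λ K → (k : ℕ) → K ≤ k →
    ∃ λ N → (n : ℕ) → N ≤ n →
    ℚ.∣ (fracℕ (MFhole n n (suc k)) (MFhole n n k) ℚ.- 1ℚ) ℚ.* (ℚ.- ℕtoℚ k) ℚ.- 1ℚ ∣
    ℚ.≤ ε)
theorem2 = Main.ω-Cauchy , Main.ω-positive , λ ε ε>0 → Main.slope-limit ε>0
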